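{- Let $k$ be a non-negative integer and $p>5$ a prime. The monomial $X^d$ (with $d$ a non-negative integer) is planar over $\mathbb{F}_{p^{2^k}}$ if and only if $d\equiv 2p^i\pmod{p^{2^k}-1}$ for some non-negative integer $i$.
   Context: A polynomial is planar over $\mathbb{F}_q$ if the function $F$ it induces on $\mathbb{F}_q$ satisfies: for every non-zero $\alpha\in\mathbb{F}_q$, the map $x\mapsto F(x+\alpha)-F(x)-F(\alpha)$ is a permutation of $\mathbb{F}_q$. -}

module Defs where

open import Level using (Level; _⊔_) renaming (suc to lsuc)
open import Data.Nat using (ℕ; zero; suc)
open import Data.Fin using (Fin)
open import Data.Product using (∃)
open import Relation.Nullary using (¬_)
open import Algebra.Bundles using (CommutativeRing)
open import Function.Bundles using (Bijection)
open import Function.Definitions using (Bijective)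
import Relation.Binary.PropositionalEquality as ≡

record FiniteField (c ℓ : Level) (q : ℕ) : Set (lsuc (c ⊔ ℓ)) where
  field
    commRing : CommutativeRing c ℓ
  open CommutativeRing commRing public
  field
    0≉1     : ¬ (0# ≈ 1#)
    inverse : ∀ x → ¬ (x ≈ 0#) → ∃ λ y → (x * y) ≈ 1#
    enum    : Bijection setoid (≡.setoid (Fin q))

module _ {c ℓ : Level} {q : ℕ} (F : FiniteField c ℓ q) where
  open FiniteField F

  pow : Carrier → ℕ → Carrier
  pow x zero    = 1#
  pow x (suc n) = x * pow x n

  IsPlanar : (Carrier → Carrier) → Set (c ⊔ ℓ)
  IsPlanar f = ∀ α → ¬ (α ≈ 0#) →
    Bijective _≈_ _≈_ (λ x → (f (x + α) - f x) - f α)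

  monomial : ℕ → Carrier → Carrier
  monomial d x = pow x d

{-# OPTIONS --safe #-}
module Submission where

-- Let f = x^d be planar over the field of p^(2^k) elements. On every subfield the differences
-- f(x + α) − f(x) run through the whole subfield, so their power sums vanish; over the prime field
-- this forces d ≡ 2 (mod p − 1).
--
-- Suppose the claim holds modulo Q − 1, Q = p^(2^i). After a Frobenius twist d = 2 + (μ + 1)(Q − 1).
-- For c with c^Q = −c, the map x ↦ f(x)^Q − f(x) = f(x + c) − f(x) is a bijection from {x^Q = x + c}
-- onto {z^Q = −z}. Hence Σ (f(x)^Q − f(x))^(Q−1−2J) (x^Q − x)^(4J) = 0 over the field of Q² elements,
-- for 0 < 2J < Q − 1. Expanding, this is a relation Σ_t C(4J, 2J + 2t) Λ(t) = 0 in characteristic p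
-- that depends only on e = 1/μ modulo H = (Q + 1)/2, where Λ(t) is the sum of C(l + 2J, 2J) over
-- 0 ≤ l < Q with l + J + 1 ≡ e t (mod H).
--
-- J = 1 gives e ≡ 1 or e ≡ −1/2 (mod p), and replacing d by d Q turns e into H − e, so e = 1 + Y
-- with p | Y. If Y ≠ 0, let A be the power of p exactly dividing Y. Lucas' theorem makes the relations
-- for 2J = s p^b + 1 < A sparse, and they successively bound Y until (A + 3) Y < 6 H; the relations for
-- 2J = A + s with s = 1, 3, and s = 5 when p = 7, are then contradictory. So e = ±1 modulo H, and up to
-- the quadratic twist, excluded by the second power sum, d ≡ 2 or 2Q (mod Q² − 1).

-- The relation for a given J involves J + 1 values of Λ, and for general J it yields nothing
-- usable. J has to be chosen so that almost all its binomial coefficients vanish modulo p. Indexing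
-- the classes by e instead of μ makes the multiples e t with small t the relevant ones. For e = 1 +
-- Y the upper index of a binomial is then t Y plus a quantity free of Y, corrected each time t Y
-- wraps around H, so the number of wraps is the real unknown. The monomial x^(2Q) is planar with e
-- = 1. Its relations hold for free, and subtracting them leaves only the wrapped t as long as 2J <
-- A. The bound (A + 3) Y < 6 H allows at most two wraps for t ≤ (A + 3)/2, the largest index
-- occurring for s = 1 and s = 3. Every pattern of wraps then turns the relation into a linear
-- equation for y = Y/A modulo p. For s = 1 it forces y = 1 or y = 2. For s = 3 it leaves integer
-- constants with prime factors 2, 3, 5 only, except for two patterns where the constant contains a
-- factor 7; this is one source of p > 5 and the reason why p = 7 needs s = 5.

open import Defs
open import Level using (Level; _⊔_)

-- Congruences between natural numbers

module Congruence where
  open import Data.Nat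
  open import Data.Nat.Properties
  open import Data.Nat.DivMod using (_%_; _/_; m≡m%n+[m/n]*n; m<n⇒m%n≡m; [m+kn]%n≡m%n)
  open import Data.Nat.Divisibility
  open import Data.Nat.Primality using (Prime; prime⇒irreducible)
  open import Data.Nat.Solver using (module +-*-Solver)
  open import Data.Product using (∃; _,_)
  open import Data.Sum using (_⊎_; inj₁; inj₂)
  open import Data.Empty using (⊥-elim)
  open import Relation.Binary.PropositionalEquality

  infix 4 _≡_mod_
  -- Multiples of the modulus are added on both sides, which makes the relation visibly symmetric
  -- and avoids truncated subtraction; for modulus 0 it is equality.
  _≡_mod_ : ℕ → ℕ → ℕ → Set
  a ≡ b mod m = ∃ λ i → ∃ λ j → a + i * m ≡ b + j * m

  module _ {m : ℕ} where
    open +-*-Solver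

    mod-reflexive : ∀ {a b} → a ≡ b → a ≡ b mod m
    mod-reflexive refl = 0 , 0 , refl

    mod-sym : ∀ {a b} → a ≡ b mod m → b ≡ a mod m
    mod-sym (i , j , eq) = j , i , sym eq

    mod-+ : ∀ {a b c d} → a ≡ b mod m → c ≡ d mod m → a + c ≡ b + d mod m
    mod-+ {a} {b} {c} {d} (i , j , eq) (k , l , eq′) = i + k , j + l , (begin
      a + c + (i + k) * m        ≡⟨ solve 5 (λ a c i k m → a :+ c :+ (i :+ k) :* m := (a :+ i :* m) :+ (c :+ k :* m)) refl a c i k m ⟩
      (a + i * m) + (c + k * m)  ≡⟨ cong₂ _+_ eq eq′ ⟩
      (b + j * m) + (d + l * m)  ≡⟨ solve 5 (λ a c i k m → (a :+ i :* m) :+ (c :+ k :* m) := a :+ c :+ (i :+ k) :* m) refl b d j l m ⟩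
      b + d + (j + l) * m        ∎)
      where open ≡-Reasoning

    mod-trans : ∀ {a b c} → a ≡ b mod m → b ≡ c mod m → a ≡ c mod m
    mod-trans {a} {b} {c} (i , j , eq) (k , l , eq′) = i + k , l + j , (begin
      a + (i + k) * m            ≡⟨ solve 4 (λ a i k m → a :+ (i :+ k) :* m := (a :+ i :* m) :+ k :* m) refl a i k m ⟩
      (a + i * m) + k * m        ≡⟨ cong (_+ k * m) eq ⟩
      (b + j * m) + k * m        ≡⟨ solve 4 (λ b j k m → (b :+ j :* m) :+ k :* m := (b :+ k :* m) :+ j :* m) refl b j k m ⟩
      (b + k * m) + j * m        ≡⟨ cong (_+ j * m) eq′ ⟩
      (c + l * m) + j * m        ≡⟨ solve 4 (λ c l j m → (c :+ l :* m) :+ j :* m := c :+ (l :+ j) :* m) refl c l j m ⟩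
      c + (l + j) * m            ∎)
      where open ≡-Reasoning

    mod-*ˡ : ∀ c {a b} → a ≡ b mod m → c * a ≡ c * b mod m
    mod-*ˡ c {a} {b} (i , j , eq) = c * i , c * j , (begin
      c * a + c * i * m    ≡⟨ solve 4 (λ c a i m → c :* a :+ c :* i :* m := c :* (a :+ i :* m)) refl c a i m ⟩
      c * (a + i * m)      ≡⟨ cong (c *_) eq ⟩
      c * (b + j * m)      ≡⟨ solve 4 (λ c a i m → c :* (a :+ i :* m) := c :* a :+ c :* i :* m) refl c b j m ⟩
      c * b + c * j * m    ∎)
      where open ≡-Reasoning

    mod-*ʳ : ∀ c {a b} → a ≡ b mod m → a * c ≡ b * c mod m
    mod-*ʳ c {a} {b} eq = subst₂ (_≡_mod m) (*-comm c a) (*-comm c b) (mod-*ˡ c eq)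

    mod-* : ∀ {a b c d} → a ≡ b mod m → c ≡ d mod m → a * c ≡ b * d mod m
    mod-* {a} {b} {c} {d} eq eq′ = mod-trans (mod-*ʳ c eq) (mod-*ˡ b eq′)

    mod-^ : ∀ k {a b} → a ≡ b mod m → a ^ k ≡ b ^ k mod m
    mod-^ zero    eq = mod-reflexive refl
    mod-^ (suc k) eq = mod-* eq (mod-^ k eq)

    mod-+-cancelˡ : ∀ c {a b} → c + a ≡ c + b mod m → a ≡ b mod m
    mod-+-cancelˡ c {a} {b} (i , j , eq) = i , j ,
      +-cancelˡ-≡ c _ _ (trans (sym (+-assoc c a (i * m))) (trans eq (+-assoc c b (j * m))))

    mod-multiple : ∀ a k → a + k * m ≡ a mod m
    mod-multiple a k = 0 , k , +-identityʳ _

    ∣⇒mod : ∀ {a} → m ∣ a → a ≡ 0 mod m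
    ∣⇒mod (divides k eq) = 0 , k , trans (+-identityʳ _) eq

    mod⇒∣ : ∀ {a} → a ≡ 0 mod m → m ∣ a
    mod⇒∣ {a} (i , j , eq) = ∣m+n∣m⇒∣n {m} {i * m} {a}
      (subst (m ∣_) (trans (sym eq) (+-comm a (i * m))) (n∣m*n j)) (n∣m*n i)

    mod-unique : ∀ {a b} → a < m → b < m → a ≡ b mod m → a ≡ b
    mod-unique {a} {b} a<m b<m (i , j , eq) = begin
      a                ≡⟨ m<n⇒m%n≡m a<m ⟨
      a % m            ≡⟨ [m+kn]%n≡m%n a i m ⟨
      (a + i * m) % m  ≡⟨ cong (_% m) eq ⟩
      (b + j * m) % m  ≡⟨ [m+kn]%n≡m%n b j m ⟩
      b % m            ≡⟨ m<n⇒m%n≡m b<m ⟩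
      b                ∎
      where
      open ≡-Reasoning
      instance
        m≢0 : NonZero m
        m≢0 = >-nonZero (≤-<-trans z≤n a<m)

  n%m≡n : ∀ n m .{{_ : NonZero m}} → n ≡ n % m mod m
  n%m≡n n m = 0 , n / m , trans (+-identityʳ n) (m≡m%n+[m/n]*n n m)

  even⊎odd : ∀ n → ∃ λ k → n ≡ 2 * k ⊎ n ≡ suc (2 * k)
  even⊎odd zero    = 0 , inj₁ refl
  even⊎odd (suc n) with even⊎odd n
  ... | k , inj₁ n≡ = k , inj₂ (cong suc n≡)
  ... | k , inj₂ n≡ = suc k , inj₁ (trans (cong suc n≡) (sym (*-suc 2 k)))

  odd-prime : ∀ {p} → Prime p → 2 < p → ∃ λ k → p ≡ suc (2 * k)
  odd-prime {p} pr 2<p with even⊎odd p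
  ... | k , inj₂ eq = k , eq
  ... | k , inj₁ eq with prime⇒irreducible pr (divides k (trans eq (*-comm 2 k)))
  ...   | inj₁ ()
  ...   | inj₂ 2≡p = ⊥-elim (<-irrefl 2≡p 2<p)

  odd-^ : ∀ {p h} → p ≡ suc (2 * h) → ∀ k → ∃ λ g → p ^ k ≡ suc (2 * g)
  odd-^ p≡ zero = 0 , refl
  odd-^ {p} {h} p≡ (suc k) with odd-^ {p} {h} p≡ k
  ... | g , pᵏ≡ = h + g + 2 * h * g , trans (cong₂ _*_ p≡ pᵏ≡)
    (solve 2 (λ h g → (con 1 :+ con 2 :* h) :* (con 1 :+ con 2 :* g) := con 1 :+ con 2 :* (h :+ g :+ con 2 :* h :* g)) refl h g)
    where open +-*-Solver

-- A ring solver with integer coefficients over any commutative ring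

module IntegerSolver where
  open import Algebra.Bundles using (CommutativeRing)
  open import Data.Nat as ℕ using (ℕ; zero; suc)
  open import Data.Integer as ℤ using (ℤ; +_; -[1+_])
  import Data.Integer.Properties as ℤ
  open import Data.Maybe using (Maybe; map)
  open import Relation.Binary.Consequences using (dec⇒weaklyDec)
  import Relation.Binary.PropositionalEquality as ≡
  open ≡ using (_≡_)

  module IntegerCoefficients {c ℓ : Level} (R : CommutativeRing c ℓ) where
    open CommutativeRing R
    open import Algebra.Properties.Semiring.Mult semiring
      using (_×_; ×-homo-+; ×1-homo-*)
    open import Algebra.Properties.Ring ring
    open import Algebra.Properties.AbelianGroup +-abelianGroup using (⁻¹-∙-comm)
    open import Relation.Binary.Reasoning.Setoid setoid

    -- The image of a natural number in the ring. A solver constant evaluates to it definitionally,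
    -- so numerals in identities and reduced binomial coefficients share one notation. Note that
    -- `⟦ 1 ⟧` is `1# + 0#`; for this reason `1#` itself is often handed to the solver as a
    -- variable.
    ⟦_⟧ : ℕ → Carrier
    ⟦ n ⟧ = n × 1#

    ⟦⟧-+ : ∀ m n → ⟦ m ℕ.+ n ⟧ ≈ ⟦ m ⟧ + ⟦ n ⟧
    ⟦⟧-+ = ×-homo-+ 1#

    ⟦⟧-* : ∀ m n → ⟦ m ℕ.* n ⟧ ≈ ⟦ m ⟧ * ⟦ n ⟧
    ⟦⟧-* = ×1-homo-*

    ⟦⟧-cong : ∀ {m n} → m ≡ n → ⟦ m ⟧ ≈ ⟦ n ⟧
    ⟦⟧-cong ≡.refl = refl

    private
      fromℤ : ℤ → Carrier
      fromℤ (+ n)    = ⟦ n ⟧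
      fromℤ -[1+ n ] = - ⟦ suc n ⟧

      fromℤ-⊖ : ∀ m n → fromℤ (m ℤ.⊖ n) ≈ ⟦ m ⟧ - ⟦ n ⟧
      fromℤ-⊖ zero    zero    = sym (-‿inverseʳ 0#)
      fromℤ-⊖ zero    (suc n) = sym (+-identityˡ _)
      fromℤ-⊖ (suc m) zero    =
        trans (sym (+-identityʳ _)) (+-congˡ (sym -0#≈0#))
      fromℤ-⊖ (suc m) (suc n) = begin
        fromℤ (suc m ℤ.⊖ suc n)              ≡⟨ ≡.cong fromℤ (ℤ.[1+m]⊖[1+n]≡m⊖n m n) ⟩
        fromℤ (m ℤ.⊖ n)                      ≈⟨ fromℤ-⊖ m n ⟩
        ⟦ m ⟧ - ⟦ n ⟧                        ≈⟨ +-congˡ (+-identityˡ _) ⟨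
        ⟦ m ⟧ + (0# - ⟦ n ⟧)                 ≈⟨ +-congˡ (+-congʳ (-‿inverseʳ 1#)) ⟨
        ⟦ m ⟧ + ((1# - 1#) - ⟦ n ⟧)          ≈⟨ +-congˡ (+-assoc _ _ _) ⟩
        ⟦ m ⟧ + (1# + (- 1# - ⟦ n ⟧))        ≈⟨ +-assoc _ _ _ ⟨
        (⟦ m ⟧ + 1#) + (- 1# - ⟦ n ⟧)        ≈⟨ +-cong (+-comm _ _) (⁻¹-∙-comm 1# ⟦ n ⟧) ⟩
        (1# + ⟦ m ⟧) - (1# + ⟦ n ⟧)          ∎

      fromℤ-neg : ∀ i → fromℤ (ℤ.- i) ≈ - fromℤ i
      fromℤ-neg (+ zero)  = sym -0#≈0#
      fromℤ-neg (+ suc n) = refl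
      fromℤ-neg -[1+ n ]  = sym (-‿involutive _)

      fromℤ-+ : ∀ i j → fromℤ (i ℤ.+ j) ≈ fromℤ i + fromℤ j
      fromℤ-+ (+ m)    (+ n)    = ⟦⟧-+ m n
      fromℤ-+ (+ m)    -[1+ n ] = fromℤ-⊖ m (suc n)
      fromℤ-+ -[1+ m ] (+ n)    = trans (fromℤ-⊖ n (suc m)) (+-comm _ _)
      fromℤ-+ -[1+ m ] -[1+ n ] = begin
        - ⟦ suc (suc (m ℕ.+ n)) ⟧   ≡⟨ ≡.cong (λ k → - ⟦ suc k ⟧) (≡.sym (ℕₚ.+-suc m n)) ⟩
        - ⟦ suc m ℕ.+ suc n ⟧       ≈⟨ -‿cong (⟦⟧-+ (suc m) (suc n)) ⟩
        - (⟦ suc m ⟧ + ⟦ suc n ⟧)   ≈⟨ ⁻¹-∙-comm _ _ ⟨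
        - ⟦ suc m ⟧ - ⟦ suc n ⟧     ∎
        where import Data.Nat.Properties as ℕₚ

      fromℤ-*⁺ : ∀ m j → fromℤ (+ m ℤ.* j) ≈ ⟦ m ⟧ * fromℤ j
      fromℤ-*⁺ m (+ n)    = trans (reflexive (≡.cong fromℤ (≡.sym (ℤ.pos-* m n)))) (⟦⟧-* m n)
      fromℤ-*⁺ m -[1+ n ] = begin
        fromℤ (+ m ℤ.* (ℤ.- (+ suc n)))  ≡⟨ ≡.cong fromℤ (≡.sym (ℤ.neg-distribʳ-* (+ m) (+ suc n))) ⟩
        fromℤ (ℤ.- (+ m ℤ.* + suc n))    ≈⟨ fromℤ-neg (+ m ℤ.* + suc n) ⟩
        - fromℤ (+ m ℤ.* + suc n)        ≈⟨ -‿cong (fromℤ-*⁺ m (+ suc n)) ⟩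
        - (⟦ m ⟧ * ⟦ suc n ⟧)            ≈⟨ -‿distribʳ-* _ _ ⟩
        ⟦ m ⟧ * - ⟦ suc n ⟧              ∎

      fromℤ-* : ∀ i j → fromℤ (i ℤ.* j) ≈ fromℤ i * fromℤ j
      fromℤ-* (+ m)    j = fromℤ-*⁺ m j
      fromℤ-* -[1+ m ] j = begin
        fromℤ ((ℤ.- (+ suc m)) ℤ.* j)  ≡⟨ ≡.cong fromℤ (≡.sym (ℤ.neg-distribˡ-* (+ suc m) j)) ⟩
        fromℤ (ℤ.- (+ suc m ℤ.* j))    ≈⟨ fromℤ-neg (+ suc m ℤ.* j) ⟩
        - fromℤ (+ suc m ℤ.* j)        ≈⟨ -‿cong (fromℤ-*⁺ (suc m) j) ⟩
        - (⟦ suc m ⟧ * fromℤ j)        ≈⟨ -‿distribˡ-* _ _ ⟩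
        - ⟦ suc m ⟧ * fromℤ j          ∎

    open import Algebra.Solver.Ring.AlmostCommutativeRing
      using (fromCommutativeRing; _-Raw-AlmostCommutative⟶_)

    private
      ℤ⟶R : ℤ.+-*-rawRing -Raw-AlmostCommutative⟶ fromCommutativeRing R
      ℤ⟶R = record
        { ⟦_⟧    = fromℤ
        ; +-homo = fromℤ-+
        ; *-homo = fromℤ-*
        ; -‿homo = fromℤ-neg
        ; 0-homo = refl
        ; 1-homo = +-identityʳ 1#
        }

    private
      _≟ᶻ_ : ∀ i j → Maybe (fromℤ i ≈ fromℤ j)
      i ≟ᶻ j = map (λ { ≡.refl → refl }) (dec⇒weaklyDec ℤ._≟_ i j)

    open import Algebra.Solver.Ring ℤ.+-*-rawRing (fromCommutativeRing R) ℤ⟶R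
      _≟ᶻ_ public
      using (Polynomial; solve; con; _:+_; _:*_; _:-_; :-_; _:=_; _:^_)

-- Binomial coefficients, finite fields and power sums of planar maps

module PlanarPowerSums where
  open Congruence
  open IntegerSolver
  open import Data.Nat as ℕ using (ℕ; zero; suc; z≤n; s≤s; _∸_; NonZero)
  import Data.Nat.Properties as ℕₚ
  import Data.Integer as ℤ
  open import Data.Nat.DivMod using (_%_; _/_; m≡m%n+[m/n]*n; m%n<n)
  open import Data.Nat.Induction using (<-rec)
  open import Data.Nat.Combinatorics using (_C_; nCn≡1; nCk≡nC[n∸k]; nCk+nC[k+1]≡[n+1]C[k+1])
  open import Data.Nat.Coprimality using (Coprime; coprime-Bézout)
  open import Data.Nat.GCD using (module Bézout)
  open import Data.Nat.Divisibility as ∣ using (_∣_; divides; ∣-trans; _∣?_)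
  open import Data.Nat.Primality using (Prime; euclidsLemma; prime⇒nonZero; prime⇒irreducible)
  open import Data.Nat.Solver using (module +-*-Solver)
  open import Data.Fin as Fin using (Fin; toℕ)
  import Data.Fin.Properties as Finₚ
  open import Data.Fin.Permutation using (Permutation; permutation)
  open import Data.List using (List; []; _∷_)
  open import Data.List.Relation.Unary.All as All using (All; []; _∷_)
  open import Data.List.Relation.Unary.AllPairs using (AllPairs; []; _∷_)
  open import Data.Product using (∃; _×_; _,_; proj₁; proj₂)
  open import Data.Sum using (_⊎_; inj₁; inj₂)
  open import Data.Empty using (⊥; ⊥-elim)
  open import Function using (_∘_)
  open import Function.Bundles using (Bijection)
  open import Function.Definitions using (Bijective; Congruent)
  open import Relation.Nullary using (¬_; Dec; yes; no)
  import Relation.Nullary.Decidable as Dec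
  open import Relation.Binary using (tri<; tri≈; tri>)
  import Relation.Binary.PropositionalEquality as ≡
  open ≡ using (_≡_; _≢_)

  pascal : ∀ n k → suc n C suc k ≡ n C k ℕ.+ n C suc k
  pascal n k = ≡.sym (nCk+nC[k+1]≡[n+1]C[k+1] n k)

  k>n⇒nCk≡0 : ∀ n k → n ℕ.< k → n C k ≡ 0
  k>n⇒nCk≡0 zero    (suc k) _ = ≡.refl
  k>n⇒nCk≡0 (suc n) (suc k) (s≤s n<k) = ≡.trans (pascal n k)
    (≡.cong₂ ℕ._+_ (k>n⇒nCk≡0 n k n<k) (k>n⇒nCk≡0 n (suc k) (ℕₚ.m<n⇒m<1+n n<k)))

  absorption : ∀ n k → suc k ℕ.* (suc n C suc k) ≡ suc n ℕ.* (n C k)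
  absorption zero    zero    = ≡.refl
  absorption zero    (suc k) = ≡.trans (≡.cong (suc (suc k) ℕ.*_) (k>n⇒nCk≡0 1 (suc (suc k)) (s≤s (s≤s z≤n))))
    (ℕₚ.*-zeroʳ (suc (suc k)))
  absorption (suc n) zero    = begin
    1 ℕ.* (suc (suc n) C 1)       ≡⟨ ℕₚ.*-identityˡ _ ⟩
    suc (suc n) C 1               ≡⟨ pascal (suc n) 0 ⟩
    1 ℕ.+ suc n C 1               ≡⟨ ≡.cong (1 ℕ.+_) (≡.trans (≡.sym (ℕₚ.*-identityˡ _)) (absorption n 0)) ⟩
    1 ℕ.+ suc n ℕ.* 1             ≡⟨⟩
    suc (suc n) ℕ.* 1             ∎
    where open ≡.≡-Reasoning
  absorption (suc n) (suc k) = begin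
    suc (suc k) ℕ.* (suc (suc n) C suc (suc k))            ≡⟨ ≡.cong (suc (suc k) ℕ.*_) (pascal (suc n) (suc k)) ⟩
    suc (suc k) ℕ.* (u ℕ.+ suc n C suc (suc k))            ≡⟨ ℕₚ.*-distribˡ-+ (suc (suc k)) u _ ⟩
    (u ℕ.+ suc k ℕ.* u) ℕ.+ suc (suc k) ℕ.* (suc n C suc (suc k))
      ≡⟨ ≡.cong₂ (λ a b → (u ℕ.+ a) ℕ.+ b) (absorption n k) (absorption n (suc k)) ⟩
    (u ℕ.+ suc n ℕ.* (n C k)) ℕ.+ suc n ℕ.* (n C suc k)    ≡⟨ ℕₚ.+-assoc u _ _ ⟩
    u ℕ.+ (suc n ℕ.* (n C k) ℕ.+ suc n ℕ.* (n C suc k))    ≡⟨ ≡.cong (u ℕ.+_) (ℕₚ.*-distribˡ-+ (suc n) (n C k) _) ⟨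
    u ℕ.+ suc n ℕ.* (n C k ℕ.+ n C suc k)                  ≡⟨ ≡.cong (λ z → u ℕ.+ suc n ℕ.* z) (pascal n k) ⟨
    suc (suc n) ℕ.* u                                      ∎
    where
    open ≡.≡-Reasoning
    u = suc n C suc k

  prime-power-∣ : ∀ {p} → Prime p → ∀ k m n → ¬ p ∣ n → p ℕ.^ k ∣ m ℕ.* n → p ℕ.^ k ∣ m
  prime-power-∣ pr zero    m n p∤n _ = ∣.1∣ m
  prime-power-∣ {p} pr (suc k) m n p∤n pᵏ⁺¹∣mn
    with euclidsLemma m n pr (∣-trans (∣.m∣m*n (p ℕ.^ k)) pᵏ⁺¹∣mn)
  ... | inj₂ p∣n = ⊥-elim (p∤n p∣n)
  ... | inj₁ (divides m′ ≡.refl) =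
    ≡.subst (_∣ m′ ℕ.* p) (ℕₚ.*-comm (p ℕ.^ k) p)
      (∣.*-monoʳ-∣ p (prime-power-∣ pr k m′ n p∤n
        (∣.*-cancelˡ-∣ p {{prime⇒nonZero pr}} (≡.subst (p ℕ.^ suc k ∣_) (shuffle m′ p n) pᵏ⁺¹∣mn))) ⟨subst⟩)
    where
    shuffle : ∀ a b c → (a ℕ.* b) ℕ.* c ≡ b ℕ.* (a ℕ.* c)
    shuffle a b c = ≡.trans (≡.cong (ℕ._* c) (ℕₚ.*-comm a b)) (ℕₚ.*-assoc b a c)
    _⟨subst⟩ : p ℕ.* p ℕ.^ k ∣ p ℕ.* m′ → p ℕ.^ k ℕ.* p ∣ m′ ℕ.* p
    _⟨subst⟩ = ≡.subst₂ _∣_ (ℕₚ.*-comm p (p ℕ.^ k)) (ℕₚ.*-comm p m′)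

  -- By absorption i C(p^k, i) = p^k C(p^k - 1, i - 1). If p did not divide C(p^k, i), then p^k
  -- would divide i, which is positive and too small.
  p∣pᵏCi : ∀ {p} → Prime p → ∀ k i → 0 ℕ.< i → i ℕ.< p ℕ.^ k → p ∣ (p ℕ.^ k) C i
  p∣pᵏCi {p} pr k (suc i) _ i<pᵏ with p ∣? ((p ℕ.^ k) C suc i)
  ... | yes p∣C = p∣C
  ... | no  p∤C with p ℕ.^ k in eq
  ...   | suc n = ⊥-elim (∣.>⇒∤ i<pᵏ (≡.subst (_∣ suc i) eq
            (prime-power-∣ pr k (suc i) (suc n C suc i) p∤C
              (≡.subst₂ _∣_ (≡.sym eq) (≡.sym (absorption n i)) (∣.m∣m*n (n C i))))))

  -- Applied to the index of 0, this supplies m distinct non-zero field elements.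
  avoid : ∀ {n} (i₀ : Fin n) {m} → m ℕ.< n →
          ∃ λ (ρ : Fin m → Fin n) → (∀ {i j} → ρ i ≡ ρ j → i ≡ j) × (∀ i → ρ i ≢ i₀)
  avoid {suc n} i₀ (s≤s m≤n) =
    (λ i → Fin.punchIn i₀ (Fin.inject≤ i m≤n)) ,
    (λ eq → Finₚ.inject≤-injective _ _ _ _ (Finₚ.punchIn-injective i₀ _ _ eq)) ,
    (λ i → Finₚ.punchInᵢ≢i i₀ _)

  -- Sums, products and polynomial functions over a finite field

  module Field {c ℓ : Level} {q : ℕ} (F : FiniteField c ℓ q) where
    open FiniteField F
    open IntegerCoefficients commRing public
    open import Algebra.Properties.CommutativeSemiring.Exp commutativeSemiring public
      using (_^_; ^-congˡ; ^-congʳ; ^-homo-*; ^-assocʳ; ^-distrib-*)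
    open import Algebra.Properties.Semiring.Sum semiring public
      using (sum; sum-syntax; sum-cong-≋; sum-remove; ∑-distrib-+; ∑-comm; ∑-permute;
             *-distribˡ-sum; *-distribʳ-sum; sum-replicate; sum-replicate-zero; sum-init-last)
    open import Algebra.Properties.Semiring.Mult semiring public using (×-assoc-*)
    open import Algebra.Properties.Ring ring public
      using (-‿distribˡ-*; -‿distribʳ-*; -0#≈0#; -‿involutive; -‿injective; x∙y⁻¹≈ε⇒x≈y; x≈y⇒x∙y⁻¹≈ε)
    import Algebra.Properties.CommutativeMonoid.Sum *-commutativeMonoid as Π
    open import Relation.Binary.Reasoning.Setoid setoid

    infix 4 _≟_
    private
      module E = Bijection enum

    to : Carrier → Fin q
    to = E.to

    from : Fin q → Carrier
    from = E.to⁻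

    to∘from : ∀ i → to (from i) ≡ i
    to∘from i = proj₂ (E.surjective i) refl

    from∘to : ∀ x → from (to x) ≈ x
    from∘to x = E.injective (to∘from (to x))

    _≟_ : ∀ x y → Dec (x ≈ y)
    x ≟ y = Dec.map′ E.injective E.cong (to x Finₚ.≟ to y)

    *-cancel-0 : ∀ {x y} → x ≉ 0# → x * y ≈ 0# → y ≈ 0#
    *-cancel-0 {x} {y} x≉0 xy≈0 with inverse x x≉0
    ... | x⁻¹ , xx⁻¹≈1 = begin
      y              ≈⟨ *-identityˡ y ⟨
      1# * y         ≈⟨ *-congʳ (trans (*-comm x⁻¹ x) xx⁻¹≈1) ⟨
      x⁻¹ * x * y    ≈⟨ *-assoc _ _ _ ⟩
      x⁻¹ * (x * y)  ≈⟨ *-congˡ xy≈0 ⟩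
      x⁻¹ * 0#       ≈⟨ zeroʳ _ ⟩
      0#             ∎

    *-≉0 : ∀ {x y} → x ≉ 0# → y ≉ 0# → x * y ≉ 0#
    *-≉0 x≉0 y≉0 xy≈0 = y≉0 (*-cancel-0 x≉0 xy≈0)

    ^-≉0 : ∀ {x} n → x ≉ 0# → x ^ n ≉ 0#
    ^-≉0 zero    x≉0 = 0≉1 ∘ sym
    ^-≉0 (suc n) x≉0 = *-≉0 x≉0 (^-≉0 n x≉0)

    x-y≈0⇒x≈y : ∀ {x y} → x - y ≈ 0# → x ≈ y
    x-y≈0⇒x≈y {x} {y} = x∙y⁻¹≈ε⇒x≈y x y

    *-cancelˡ : ∀ {x y z} → x ≉ 0# → x * y ≈ x * z → y ≈ z
    *-cancelˡ {x} {y} {z} x≉0 xy≈xz = x-y≈0⇒x≈y (*-cancel-0 x≉0 (begin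
      x * (y - z)        ≈⟨ solve 3 (λ x y z → x :* (y :- z) := x :* y :- x :* z) refl x y z ⟩
      x * y - x * z      ≈⟨ x≈y⇒x∙y⁻¹≈ε xy≈xz ⟩
      0#                 ∎))

    0^[1+n] : ∀ {x} n → x ≈ 0# → x ^ suc n ≈ 0#
    0^[1+n] n x≈0 = trans (*-congʳ x≈0) (zeroˡ _)

    1^ : ∀ n → 1# ^ n ≈ 1#
    1^ zero    = refl
    1^ (suc n) = trans (*-identityˡ _) (1^ n)

    ^-≡ : ∀ x {m n} → m ≡ n → x ^ m ≈ x ^ n
    ^-≡ x ≡.refl = refl

    pow≈^ : ∀ x n → pow F x n ≈ x ^ n
    pow≈^ x zero    = refl
    pow≈^ x (suc n) = *-congˡ (pow≈^ x n)

    Cong : (Carrier → Carrier) → Set (c ⊔ ℓ)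
    Cong h = Congruent _≈_ _≈_ h

    -- Transports a bijection of the field to the index set `Fin q`, where reindexing of finite sums
    -- and products is available.
    bijection-permutation : ∀ {φ} → Cong φ → Bijective _≈_ _≈_ φ →
      ∃ λ (π : Permutation q q) → ∀ i → from (Data.Fin.Permutation._⟨$⟩ʳ_ π i) ≈ φ (from i)
    bijection-permutation {φ} φ-cong (φ-inj , φ-surj) =
      permutation (to ∘ φ ∘ from) (to ∘ φ⁻¹ ∘ from)
        (λ j → ≡.trans (E.cong (trans (φ-cong (from∘to _)) (φφ⁻¹ (from j)))) (to∘from j))
        (λ i → ≡.trans (E.cong (φ-inj (trans (φφ⁻¹ _) (from∘to _)))) (to∘from i)) ,
      (λ i → from∘to _)
      where
      φ⁻¹ : Carrier → Carrier
      φ⁻¹ y = proj₁ (φ-surj y)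
      φφ⁻¹ : ∀ y → φ (φ⁻¹ y) ≈ y
      φφ⁻¹ y = proj₂ (φ-surj y) refl

    private
      sum-single : ∀ {n} (t : Fin n → Carrier) i₀ → (∀ i → i ≢ i₀ → t i ≈ 0#) → sum t ≈ t i₀
      sum-single {suc n} t i₀ t≈0 = begin
        sum t                                     ≈⟨ sum-remove {i = i₀} t ⟩
        t i₀ + sum (λ j → t (Fin.punchIn i₀ j))   ≈⟨ +-congˡ (trans (sum-cong-≋ (λ j → t≈0 _ (Finₚ.punchInᵢ≢i i₀ j))) (sum-replicate-zero n)) ⟩
        t i₀ + 0#                                 ≈⟨ +-identityʳ _ ⟩
        t i₀                                      ∎

      prod-except : ∀ {n} (t : Fin n → Carrier) i₀ a → t i₀ ≈ 1# → (∀ i → i ≢ i₀ → t i ≈ a) →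
                    Π.sum t ≈ a ^ (n ∸ 1)
      prod-except {suc n} t i₀ a t₀ ta = begin
        Π.sum t                                   ≈⟨ Π.sum-remove {i = i₀} t ⟩
        t i₀ * Π.sum (λ j → t (Fin.punchIn i₀ j)) ≈⟨ *-cong t₀ (trans (Π.sum-cong-≋ (λ j → ta _ (Finₚ.punchInᵢ≢i i₀ j))) (Π.sum-replicate n)) ⟩
        1# * a ^ n                                ≈⟨ *-identityˡ _ ⟩
        a ^ n                                     ∎

      prod-≉0 : ∀ {n} (t : Fin n → Carrier) → (∀ i → t i ≉ 0#) → Π.sum t ≉ 0#
      prod-≉0 {zero}  t t≉0 = 0≉1 ∘ sym
      prod-≉0 {suc n} t t≉0 = *-≉0 (t≉0 Fin.zero) (prod-≉0 (t ∘ Fin.suc) (t≉0 ∘ Fin.suc))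

      from≈⇒≡ : ∀ {i x} → from i ≈ x → i ≡ to x
      from≈⇒≡ {i} eq = ≡.trans (≡.sym (to∘from i)) (E.cong eq)

    abstract
      -- Indicator weights stand in for summation over subsets: subfields and fibres become weighted
      -- sums over the whole field, so a single reindexing lemma serves them all.
      δ : Carrier → Carrier → Carrier
      δ x y with x ≟ y
      ... | yes _ = 1#
      ... | no  _ = 0#

      δ-yes : ∀ {x y} → x ≈ y → δ x y ≈ 1#
      δ-yes {x} {y} x≈y with x ≟ y
      ... | yes _   = refl
      ... | no  x≉y = ⊥-elim (x≉y x≈y)

      δ-no : ∀ {x y} → x ≉ y → δ x y ≈ 0#
      δ-no {x} {y} x≉y with x ≟ y
      ... | yes x≈y = ⊥-elim (x≉y x≈y)
      ... | no  _   = refl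

      ∑ᴷ : (Carrier → Carrier) → Carrier
      ∑ᴷ h = ∑[ i < q ] h (from i)

      ∑ᴷ-cong : ∀ {g h} → (∀ x → g x ≈ h x) → ∑ᴷ g ≈ ∑ᴷ h
      ∑ᴷ-cong g≈h = sum-cong-≋ (λ i → g≈h (from i))

      ∑ᴷ-+ : ∀ g h → ∑ᴷ (λ x → g x + h x) ≈ ∑ᴷ g + ∑ᴷ h
      ∑ᴷ-+ g h = ∑-distrib-+ (g ∘ from) (h ∘ from)

      ∑ᴷ-*ˡ : ∀ a h → ∑ᴷ (λ x → a * h x) ≈ a * ∑ᴷ h
      ∑ᴷ-*ˡ a h = sym (*-distribˡ-sum a (h ∘ from))

      ∑ᴷ-0 : ∀ {h} → (∀ x → h x ≈ 0#) → ∑ᴷ h ≈ 0#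
      ∑ᴷ-0 h≈0 = trans (∑ᴷ-cong h≈0) (sum-replicate-zero q)

      ∑ᴷ-swap : ∀ (h : Carrier → Carrier → Carrier) →
                ∑ᴷ (λ x → ∑ᴷ (h x)) ≈ ∑ᴷ (λ y → ∑ᴷ (λ x → h x y))
      ∑ᴷ-swap h = ∑-comm (λ i j → h (from i) (from j))

      ∑ᴷ-∑ : ∀ {m} (h : Carrier → Fin m → Carrier) → ∑ᴷ (λ x → ∑[ i < m ] h x i) ≈ ∑[ i < m ] ∑ᴷ (λ x → h x i)
      ∑ᴷ-∑ h = ∑-comm (λ x i → h (from x) i)

      ∑ᴷ-1 : ∑ᴷ (λ _ → 1#) ≈ ⟦ q ⟧
      ∑ᴷ-1 = sum-replicate q

      ∑ᴷ-reindex : ∀ {φ h} → Cong φ → Bijective _≈_ _≈_ φ → Cong h →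
                   ∑ᴷ (λ x → h (φ x)) ≈ ∑ᴷ h
      ∑ᴷ-reindex {h = h} φ-cong φ-bij h-cong with bijection-permutation φ-cong φ-bij
      ... | π , π≈φ = sym (trans (∑-permute (h ∘ from) π) (sum-cong-≋ (λ i → h-cong (π≈φ i))))

    δ-⇔ : ∀ {x y z w} → (x ≈ y → z ≈ w) → (z ≈ w → x ≈ y) → δ x y ≈ δ z w
    δ-⇔ {x} {y} {z} {w} f g = by-cases (x ≟ y)
      where
      by-cases : Dec (x ≈ y) → δ x y ≈ δ z w
      by-cases (yes x≈y) = trans (δ-yes x≈y) (sym (δ-yes (f x≈y)))
      by-cases (no  x≉y) = trans (δ-no x≉y) (sym (δ-no (x≉y ∘ g)))

    δ-cong : ∀ {x y z w} → x ≈ z → y ≈ w → δ x y ≈ δ z w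
    δ-cong x≈z y≈w = δ-⇔ (λ x≈y → trans (sym x≈z) (trans x≈y y≈w))
                         (λ z≈w → trans x≈z (trans z≈w (sym y≈w)))

    δ-guard : ∀ {x y u v} → (x ≈ y → u ≈ v) → δ x y * u ≈ δ x y * v
    δ-guard {x} {y} {u} {v} f = by-cases (x ≟ y)
      where
      by-cases : Dec (x ≈ y) → δ x y * u ≈ δ x y * v
      by-cases (yes x≈y) = *-congˡ (f x≈y)
      by-cases (no  x≉y) = trans (*-congʳ (δ-no x≉y)) (trans (zeroˡ _) (sym (trans (*-congʳ (δ-no x≉y)) (zeroˡ _))))

    abstract
      ∑ᴷ-δ : ∀ a {h} → Cong h → ∑ᴷ (λ x → δ a x * h x) ≈ h a
      ∑ᴷ-δ a {h} h-cong = begin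
        ∑ᴷ (λ x → δ a x * h x)                    ≈⟨ sum-single _ (to a) (λ i i≢ → trans (*-congʳ (δ-no (λ a≈ → i≢ (from≈⇒≡ (sym a≈))))) (zeroˡ _)) ⟩
        δ a (from (to a)) * h (from (to a))       ≈⟨ *-cong (δ-yes (sym (from∘to a))) (h-cong (from∘to a)) ⟩
        1# * h a                                  ≈⟨ *-identityˡ _ ⟩
        h a                                       ∎

    scale-bijective : ∀ {a} → a ≉ 0# → Bijective _≈_ _≈_ (a *_)
    scale-bijective {a} a≉0 = *-cancelˡ a≉0 , λ y → a⁻¹ * y , λ {z} z≈ → begin
      a * z            ≈⟨ *-congˡ z≈ ⟩
      a * (a⁻¹ * y)    ≈⟨ *-assoc _ _ _ ⟨
      a * a⁻¹ * y      ≈⟨ *-congʳ aa⁻¹≈1 ⟩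
      1# * y           ≈⟨ *-identityˡ y ⟩
      y                ∎
      where
      a⁻¹ = proj₁ (inverse a a≉0)
      aa⁻¹≈1 = proj₂ (inverse a a≉0)

    shift-bijective : ∀ a → Bijective _≈_ _≈_ (_+ a)
    shift-bijective a =
      (λ {x} {y} eq → begin
        x           ≈⟨ solve 2 (λ x a → x := (x :+ a) :- a) refl x a ⟩
        x + a - a   ≈⟨ +-congʳ eq ⟩
        y + a - a   ≈⟨ solve 2 (λ x a → (x :+ a) :- a := x) refl y a ⟩
        y           ∎) ,
      (λ y → y - a , λ z≈ → trans (+-congʳ z≈) (solve 2 (λ y a → (y :- a) :+ a := y) refl y a))

    -- Multiplication by a permutes the factors of the product of all non-zero elements. Since the
    -- product runs over the whole field, `ν` replaces the factor at 0 by 1, and `α x` is the ratio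
    -- of `ν (a * x)` to `ν x`, which is 1 at 0 and a elsewhere.
    fermat′ : ∀ {a} → a ≉ 0# → a ^ (q ∸ 1) ≈ 1#
    fermat′ {a} a≉0 = sym (*-cancelˡ P≉0 (begin
      P * 1#                                         ≈⟨ *-identityʳ P ⟩
      P                                              ≈⟨ Π.∑-permute (ν ∘ from) π ⟩
      Π.sum (λ i → ν (from (π ⟨$⟩ʳ i)))              ≈⟨ Π.sum-cong-≋ (λ i → trans (ν-cong (π≈ i)) (ν-scale (from i))) ⟩
      Π.sum (λ i → α (from i) * ν (from i))          ≈⟨ Π.∑-distrib-+ (α ∘ from) (ν ∘ from) ⟩
      Π.sum (α ∘ from) * P                           ≈⟨ *-congʳ (prod-except (α ∘ from) (to 0#) a
                                                         (α-zero (from∘to 0#)) (λ i i≢ → α-nonzero (λ ≈0 → i≢ (from≈⇒≡ ≈0)))) ⟩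
      a ^ (q ∸ 1) * P                                ≈⟨ *-comm _ _ ⟩
      P * a ^ (q ∸ 1)                                ∎))
      where
      open import Data.Fin.Permutation using (_⟨$⟩ʳ_)
      ν α : Carrier → Carrier
      ν x = δ x 0# + x
      α x with x ≟ 0#
      ... | yes _ = 1#
      ... | no  _ = a
      ν-cong : Cong ν
      ν-cong x≈y = +-cong (δ-cong x≈y refl) x≈y
      α-zero : ∀ {x} → x ≈ 0# → α x ≈ 1#
      α-zero {x} x≈0 with x ≟ 0#
      ... | yes _   = refl
      ... | no  x≉0 = ⊥-elim (x≉0 x≈0)
      α-nonzero : ∀ {x} → x ≉ 0# → α x ≈ a
      α-nonzero {x} x≉0 with x ≟ 0#
      ... | yes x≈0 = ⊥-elim (x≉0 x≈0)
      ... | no  _   = refl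
      ν-zero : ∀ {x} → x ≈ 0# → ν x ≈ 1#
      ν-zero x≈0 = trans (+-cong (δ-yes x≈0) x≈0) (+-identityʳ 1#)
      ν-nonzero : ∀ {x} → x ≉ 0# → ν x ≈ x
      ν-nonzero x≉0 = trans (+-congʳ (δ-no x≉0)) (+-identityˡ _)
      ν≉0 : ∀ x → ν x ≉ 0#
      ν≉0 x with x ≟ 0#
      ... | yes x≈0 = λ eq → 0≉1 (trans (sym eq) (ν-zero x≈0))
      ... | no  x≉0 = λ eq → x≉0 (trans (sym (ν-nonzero x≉0)) eq)
      ν-scale : ∀ x → ν (a * x) ≈ α x * ν x
      ν-scale x with x ≟ 0#
      ... | yes x≈0 = trans (ν-zero (trans (*-congˡ x≈0) (zeroʳ a)))
                        (sym (trans (*-identityˡ _) (ν-zero x≈0)))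
      ... | no  x≉0 = trans (ν-nonzero (*-≉0 a≉0 x≉0)) (sym (*-congˡ (ν-nonzero x≉0)))
      P = Π.sum (ν ∘ from)
      P≉0 = prod-≉0 (ν ∘ from) (ν≉0 ∘ from)
      πs = bijection-permutation (*-congˡ {a}) (scale-bijective a≉0)
      π = proj₁ πs
      π≈ = proj₂ πs

    abstract
      fermat : ∀ {a} → a ≉ 0# → a ^ (q ∸ 1) ≈ 1#
      fermat = fermat′

    -- The translation x ↦ x + 1 permutes the terms of Σ x and also increases the sum by q.
    ⟦q⟧≈0 : ⟦ q ⟧ ≈ 0#
    ⟦q⟧≈0 = begin
      ⟦ q ⟧                              ≈⟨ ∑ᴷ-1 ⟨
      ∑ᴷ (λ _ → 1#)                      ≈⟨ solve 2 (λ s n → n := (s :+ n) :- s) refl (∑ᴷ (λ x → x)) _ ⟩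
      ∑ᴷ (λ x → x) + ∑ᴷ (λ _ → 1#) - ∑ᴷ (λ x → x)
        ≈⟨ +-congʳ (∑ᴷ-+ (λ x → x) (λ _ → 1#)) ⟨
      ∑ᴷ (λ x → x + 1#) - ∑ᴷ (λ x → x)   ≈⟨ x≈y⇒x∙y⁻¹≈ε (∑ᴷ-reindex +-congʳ (shift-bijective 1#) (λ eq → eq)) ⟩
      0#                                 ∎

    -- Functions induced by polynomials of degree below n, in Horner form.
    Poly : ℕ → (Carrier → Carrier) → Set (c ⊔ ℓ)
    Poly zero    f = ∀ x → f x ≈ 0#
    Poly (suc n) f = ∃ λ a → ∃ λ g → Poly n g × (∀ x → f x ≈ a + x * g x)

    Poly-division : ∀ n {f} → Poly (suc n) f → ∀ r →
                    ∃ λ g → Poly n g × (∀ x → f x - f r ≈ (x - r) * g x)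
    Poly-division zero (a , g , g≈0 , f≈) r = (λ _ → 0#) , (λ _ → refl) , λ x → begin
      _ - _                          ≈⟨ +-cong (f≈ x) (-‿cong (f≈ r)) ⟩
      (a + x * g x) - (a + r * g r)  ≈⟨ +-cong (+-congˡ (*-congˡ (g≈0 x))) (-‿cong (+-congˡ (*-congˡ (g≈0 r)))) ⟩
      (a + x * 0#) - (a + r * 0#)    ≈⟨ solve 3 (λ a x r → (a :+ x :* con (ℤ.+ 0)) :- (a :+ r :* con (ℤ.+ 0)) := (x :- r) :* con (ℤ.+ 0)) refl a x r ⟩
      (x - r) * 0#                   ∎
    Poly-division (suc n) (a , g , Pg , f≈) r with Poly-division n Pg r
    ... | g′ , Pg′ , g≈ = (λ x → g r + x * g′ x) , (g r , g′ , Pg′ , λ _ → refl) , λ x → begin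
      _ - _                                    ≈⟨ +-cong (f≈ x) (-‿cong (f≈ r)) ⟩
      (a + x * g x) - (a + r * g r)            ≈⟨ solve 5 (λ a x r u v → (a :+ x :* u) :- (a :+ r :* v) := x :* (u :- v) :+ (x :- r) :* v) refl a x r (g x) (g r) ⟩
      x * (g x - g r) + (x - r) * g r          ≈⟨ +-congʳ (*-congˡ (g≈ x)) ⟩
      x * ((x - r) * g′ x) + (x - r) * g r     ≈⟨ solve 4 (λ x r u v → x :* ((x :- r) :* u) :+ (x :- r) :* v := (x :- r) :* (v :+ x :* u)) refl x r (g′ x) (g r) ⟩
      (x - r) * (g r + x * g′ x)               ∎

    Poly-vanish : ∀ n {f} → Poly n f → (ρ : Fin n → Carrier) →
                  (∀ {i j} → ρ i ≈ ρ j → i ≡ j) → (∀ i → f (ρ i) ≈ 0#) → ∀ x → f x ≈ 0#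
    Poly-vanish zero    P ρ ρ-inj roots x = P x
    Poly-vanish (suc n) {f} P ρ ρ-inj roots x with Poly-division n P (ρ Fin.zero)
    ... | g , Pg , f≈ = trans (f≈′ x) (trans (*-congˡ (g≈0 x)) (zeroʳ _))
      where
      f≈′ : ∀ x → f x ≈ (x - ρ Fin.zero) * g x
      f≈′ x = begin
        f x                       ≈⟨ solve 2 (λ u v → u := (u :- v) :+ v) refl (f x) (f (ρ Fin.zero)) ⟩
        f x - f (ρ Fin.zero) + f (ρ Fin.zero)  ≈⟨ +-cong (f≈ x) (roots Fin.zero) ⟩
        (x - ρ Fin.zero) * g x + 0#            ≈⟨ +-identityʳ _ ⟩
        (x - ρ Fin.zero) * g x                 ∎
      g≈0 : ∀ x → g x ≈ 0#
      g≈0 = Poly-vanish n Pg (ρ ∘ Fin.suc) (λ eq → Finₚ.suc-injective (ρ-inj eq))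
        (λ i → *-cancel-0 (λ eq → Finₚ.0≢1+n (≡.sym (ρ-inj (x-y≈0⇒x≈y eq))))
                          (trans (sym (f≈′ _)) (roots (Fin.suc i))))

    Poly-^ : ∀ n → Poly (suc n) (_^ n)
    Poly-^ zero    = 1# , (λ _ → 0#) , (λ _ → refl) , λ x → sym (trans (+-congˡ (zeroʳ x)) (+-identityʳ 1#))
    Poly-^ (suc n) = 0# , (_^ n) , Poly-^ n , λ x → sym (+-identityˡ _)

    -- Otherwise x^m - 1, of degree m, would vanish at m + 1 non-zero points, hence everywhere,
    -- hence at 0. This takes the place of a primitive element: all later arguments need only one x
    -- whose m-th power differs from 1.
    ∃-nonroot′ : ∀ m → 0 ℕ.< m → suc m ℕ.< q → ∃ λ x → x ≉ 0# × x ^ m ≉ 1#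
    ∃-nonroot′ (suc m) _ m<q
      with Finₚ.any? (λ i → Dec.¬? (from i ≟ 0#) Dec.×-dec Dec.¬? (from i ^ suc m ≟ 1#))
    ... | yes (i , ≉0 , ≉1) = from i , ≉0 , ≉1
    ... | no none = ⊥-elim (0≉1 (trans (sym (0^[1+n] m refl)) (x-y≈0⇒x≈y (vanish 0#))))
      where
      av = avoid (to 0#) m<q
      ρ : Fin (suc (suc m)) → Carrier
      ρ = from ∘ proj₁ av
      ρ≉0 : ∀ i → ρ i ≉ 0#
      ρ≉0 i eq = proj₂ (proj₂ av) i (from≈⇒≡ eq)
      root : ∀ x → x ≉ 0# → x ^ suc m ≈ 1#
      root x x≉0 with x ^ suc m ≟ 1#
      ... | yes eq  = eq
      ... | no  neq = ⊥-elim (none (to x , (λ eq → x≉0 (trans (sym (from∘to x)) eq)) ,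
                        (λ eq → neq (trans (^-congˡ (suc m) (sym (from∘to x))) eq))))
      vanish : ∀ x → x ^ suc m - 1# ≈ 0#
      vanish = Poly-vanish (suc (suc m)) (- 1# , (_^ m) , Poly-^ m , λ x → +-comm _ _) ρ
        (λ eq → proj₁ (proj₂ av) (≡.trans (≡.sym (to∘from _)) (≡.trans (E.cong eq) (to∘from _))))
        (λ i → x≈y⇒x∙y⁻¹≈ε (root (ρ i) (ρ≉0 i)))

    abstract
      ∃-nonroot : ∀ m → 0 ℕ.< m → suc m ℕ.< q → ∃ λ x → x ≉ 0# × x ^ m ≉ 1#
      ∃-nonroot = ∃-nonroot′

  distinct⇒1<n : ∀ {n} (i j : Fin n) → i ≢ j → 1 ℕ.< n
  distinct⇒1<n {suc zero}    Fin.zero Fin.zero i≢j = ⊥-elim (i≢j ≡.refl)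
  distinct⇒1<n {suc (suc _)} _        _        _   = s≤s (s≤s z≤n)

  ^-complement : ∀ p n k → n ≢ 0 → p ℕ.^ ((n ∸ 1) ℕ.* k) ℕ.* p ℕ.^ k ≡ (p ℕ.^ n) ℕ.^ k
  ^-complement p n k n≢0 = begin
    p ℕ.^ ((n ∸ 1) ℕ.* k) ℕ.* p ℕ.^ k   ≡⟨ ℕₚ.^-distribˡ-+-* p ((n ∸ 1) ℕ.* k) k ⟨
    p ℕ.^ ((n ∸ 1) ℕ.* k ℕ.+ k)         ≡⟨ ≡.cong (p ℕ.^_) (ℕₚ.+-comm _ k) ⟩
    p ℕ.^ (suc (n ∸ 1) ℕ.* k)           ≡⟨ ≡.cong (λ m → p ℕ.^ (m ℕ.* k)) (ℕₚ.m+[n∸m]≡n (ℕₚ.n≢0⇒n>0 n≢0)) ⟩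
    p ℕ.^ (n ℕ.* k)                     ≡⟨ ℕₚ.^-*-assoc p n k ⟨
    (p ℕ.^ n) ℕ.^ k                     ∎
    where open ≡.≡-Reasoning

  -- Characteristic p: Frobenius maps, sparse sums, planar monomials

  module CharP {c ℓ : Level} {q : ℕ} (F : FiniteField c ℓ q)
               {p : ℕ} (pr : Prime p) (n : ℕ) (q≡pⁿ : q ≡ p ℕ.^ n) where
    open FiniteField F
    open Field F public
    import Algebra.Properties.CommutativeSemiring.Binomial commutativeSemiring as Binomial
    open import Relation.Binary.Reasoning.Setoid setoid

    private instance
      p≢0 : NonZero p
      p≢0 = prime⇒nonZero pr

    ⟦⟧-^ : ∀ m k → ⟦ m ℕ.^ k ⟧ ≈ ⟦ m ⟧ ^ k
    ⟦⟧-^ m zero    = +-identityʳ 1#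
    ⟦⟧-^ m (suc k) = trans (⟦⟧-* m (m ℕ.^ k)) (*-congˡ (⟦⟧-^ m k))

    ⟦p⟧≈0 : ⟦ p ⟧ ≈ 0#
    ⟦p⟧≈0 with ⟦ p ⟧ ≟ 0#
    ... | yes eq  = eq
    ... | no  neq = ⊥-elim (^-≉0 n neq (trans (sym (⟦⟧-^ p n)) (trans (⟦⟧-cong (≡.sym q≡pⁿ)) ⟦q⟧≈0)))

    p∣⇒⟦⟧≈0 : ∀ {m} → p ∣ m → ⟦ m ⟧ ≈ 0#
    p∣⇒⟦⟧≈0 (divides k ≡.refl) = trans (⟦⟧-* k p) (trans (*-congˡ ⟦p⟧≈0) (zeroʳ _))

    -- If p did not divide m, Bézout would write 1 as a combination of p and m, both of which are 0
    -- in the field.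
    ⟦⟧≈0⇒p∣ : ∀ {m} → ⟦ m ⟧ ≈ 0# → p ∣ m
    ⟦⟧≈0⇒p∣ {m} ⟦m⟧≈0 with p ∣? m
    ... | yes p∣m = p∣m
    ... | no  p∤m = ⊥-elim (absurd (coprime-Bézout coprime))
      where
      coprime : Coprime p m
      coprime (d∣p , d∣m) with prime⇒irreducible pr d∣p
      ... | inj₁ d≡1    = d≡1
      ... | inj₂ ≡.refl = ⊥-elim (p∤m d∣m)
      multiple : ∀ a {b} → ⟦ b ⟧ ≈ 0# → ⟦ a ℕ.* b ⟧ ≈ 0#
      multiple a {b} b≈0 = trans (⟦⟧-* a b) (trans (*-congˡ b≈0) (zeroʳ _))
      unit : ∀ {a b} → suc a ≡ b → ⟦ a ⟧ ≈ 0# → ⟦ b ⟧ ≈ 0# → 0# ≈ 1#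
      unit {a} ≡.refl a≈0 b≈0 = trans (sym b≈0) (trans (+-congˡ a≈0) (+-identityʳ 1#))
      absurd : ¬ Bézout.Identity 1 p m
      absurd (Bézout.Identity.+- x y eq) = 0≉1 (unit eq (multiple y ⟦m⟧≈0) (multiple x ⟦p⟧≈0))
      absurd (Bézout.Identity.-+ x y eq) = 0≉1 (unit eq (multiple x ⟦p⟧≈0) (multiple y ⟦m⟧≈0))

    p∤⇒⟦⟧≉0 : ∀ {m} → ¬ p ∣ m → ⟦ m ⟧ ≉ 0#
    p∤⇒⟦⟧≉0 p∤m = p∤m ∘ ⟦⟧≈0⇒p∣

    -- The summand is a function on all natural numbers, so ranges can be cut, extended and reversed
    -- without transporting indices between `Fin` types.
    S : ℕ → (ℕ → Carrier) → Carrier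
    S m h = ∑[ i < m ] h (toℕ i)

    S-cong : ∀ m {g h} → (∀ i → i ℕ.< m → g i ≈ h i) → S m g ≈ S m h
    S-cong m g≈h = sum-cong-≋ {m} (λ i → g≈h (toℕ i) (Finₚ.toℕ<n i))

    S-0 : ∀ m {h} → (∀ i → i ℕ.< m → h i ≈ 0#) → S m h ≈ 0#
    S-0 m h≈0 = trans (S-cong m h≈0) (sum-replicate-zero m)

    S-+ : ∀ m g h → S m (λ i → g i + h i) ≈ S m g + S m h
    S-+ m g h = ∑-distrib-+ {m} (g ∘ toℕ) (h ∘ toℕ)

    S-*ˡ : ∀ m a h → S m (λ i → a * h i) ≈ a * S m h
    S-*ˡ m a h = sym (*-distribˡ-sum {m} a (h ∘ toℕ))

    S-last : ∀ m h → S (suc m) h ≈ S m h + h m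
    S-last zero    h = +-comm _ _
    S-last (suc m) h = trans (+-congˡ (S-last m (h ∘ suc))) (sym (+-assoc _ _ _))

    ∑ᴷ-S : ∀ m (h : Carrier → ℕ → Carrier) → ∑ᴷ (λ x → S m (h x)) ≈ S m (λ i → ∑ᴷ (λ x → h x i))
    ∑ᴷ-S m h = ∑ᴷ-∑ {m} (λ x i → h x (toℕ i))

    private
      without : ℕ → (ℕ → Carrier) → ℕ → Carrier
      without a h i with i ℕ.≟ a
      ... | yes _ = 0#
      ... | no  _ = h i

      without-≢ : ∀ a h {i} → i ≢ a → without a h i ≈ h i
      without-≢ a h {i} i≢a with i ℕ.≟ a
      ... | yes i≡a = ⊥-elim (i≢a i≡a)
      ... | no  _   = refl

      without-≡ : ∀ a h {i} → i ≡ a → without a h i ≈ 0#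
      without-≡ a h {i} i≡a with i ℕ.≟ a
      ... | yes _   = refl
      ... | no  i≢a = ⊥-elim (i≢a i≡a)

      without-suc : ∀ a h i → without (suc a) h (suc i) ≈ without a (h ∘ suc) i
      without-suc a h i with i ℕ.≟ a
      ... | yes i≡a = without-≡ (suc a) h (≡.cong suc i≡a)
      ... | no  i≢a = without-≢ (suc a) h (i≢a ∘ ℕₚ.suc-injective)

      S-remove : ∀ m a h → a ℕ.< m → S m h ≈ h a + S m (without a h)
      S-remove (suc m) zero    h _ = +-congˡ (sym (trans (+-identityˡ _)
        (S-cong m (λ i _ → without-≢ 0 h {suc i} (λ ())))))
      S-remove (suc m) (suc a) h (s≤s a<m) = begin
        h 0 + S m (h ∘ suc)                                  ≈⟨ +-congˡ (S-remove m a (h ∘ suc) a<m) ⟩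
        h 0 + (h (suc a) + S m (without a (h ∘ suc)))        ≈⟨ solve 3 (λ x y z → x :+ (y :+ z) := y :+ (x :+ z)) refl _ _ _ ⟩
        h (suc a) + (h 0 + S m (without a (h ∘ suc)))
          ≈⟨ +-congˡ (+-cong (sym (without-≢ (suc a) h (λ ()))) (S-cong m (λ i _ → sym (without-suc a h i)))) ⟩
        h (suc a) + S (suc m) (without (suc a) h)            ∎

    total : (ℕ → Carrier) → List ℕ → Carrier
    total h []       = 0#
    total h (a ∷ as) = h a + total h as

    total-cong : ∀ {g h} {as} → All (λ a → g a ≈ h a) as → total g as ≈ total h as
    total-cong []         = refl
    total-cong (eq ∷ eqs) = +-cong eq (total-cong eqs)

    -- The sums produced by Lucas' theorem and by power sums have only a few non-zero terms; they
    -- are all evaluated through this lemma.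
    S-pick : ∀ m h as → All (ℕ._< m) as → AllPairs _≢_ as →
             (∀ i → i ℕ.< m → All (i ≢_) as → h i ≈ 0#) → S m h ≈ total h as
    S-pick m h []       _           _          h≈0 = S-0 m (λ i i<m → h≈0 i i<m [])
    S-pick m h (a ∷ as) (a<m ∷ as<m) (a≢ ∷ as≢) h≈0 = begin
      S m h                       ≈⟨ S-remove m a h a<m ⟩
      h a + S m (without a h)     ≈⟨ +-congˡ (S-pick m (without a h) as as<m as≢ rest) ⟩
      h a + total (without a h) as ≈⟨ +-congˡ (total-cong (All.map (λ a≢b → without-≢ a h (a≢b ∘ ≡.sym)) a≢)) ⟩
      h a + total h as            ∎
      where
      rest : ∀ i → i ℕ.< m → All (i ≢_) as → without a h i ≈ 0#
      rest i i<m i∉as with i ℕ.≟ a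
      ... | yes _   = refl
      ... | no  i≢a = h≈0 i i<m (i≢a ∷ i∉as)

    binomial : ∀ m x y → (x + y) ^ m ≈ S (suc m) (λ k → ⟦ m C k ⟧ * (x ^ k * y ^ (m ∸ k)))
    binomial m x y = trans (Binomial.theorem m x y) (sum-cong-≋ {suc m} (λ k →
      sym (trans (×-assoc-* (m C toℕ k) 1# (x ^ toℕ k * y ^ (m ∸ toℕ k))) (×-congʳ (m C toℕ k) (*-identityˡ _)))))
      where open import Algebra.Properties.Semiring.Mult semiring using (×-congʳ)

    frobenius-+ : ∀ k x y → (x + y) ^ (p ℕ.^ k) ≈ x ^ (p ℕ.^ k) + y ^ (p ℕ.^ k)
    frobenius-+ k x y = begin
      (x + y) ^ A            ≈⟨ binomial A x y ⟩
      S (suc A) term         ≈⟨ S-pick (suc A) term (A ∷ 0 ∷ []) (ℕₚ.n<1+n A ∷ s≤s z≤n ∷ []) ((A≢0 ∷ []) ∷ [] ∷ []) middle ⟩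
      term A + (term 0 + 0#) ≈⟨ +-cong termA (+-congʳ term0) ⟩
      x ^ A + (y ^ A + 0#)   ≈⟨ +-congˡ (+-identityʳ _) ⟩
      x ^ A + y ^ A          ∎
      where
      A = p ℕ.^ k
      A≢0 : A ≢ 0
      A≢0 = ℕ.≢-nonZero⁻¹ A {{ℕₚ.m^n≢0 p k}}
      term : ℕ → Carrier
      term i = ⟦ A C i ⟧ * (x ^ i * y ^ (A ∸ i))
      termA : term A ≈ x ^ A
      termA = begin
        ⟦ A C A ⟧ * (x ^ A * y ^ (A ∸ A))  ≈⟨ *-cong (⟦⟧-cong (nCn≡1 A)) (*-congˡ (^-≡ y (ℕₚ.n∸n≡0 A))) ⟩
        ⟦ 1 ⟧ * (x ^ A * 1#)               ≈⟨ *-cong (+-identityʳ 1#) (*-identityʳ _) ⟩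
        1# * x ^ A                         ≈⟨ *-identityˡ _ ⟩
        x ^ A                              ∎
      term0 : term 0 ≈ y ^ A
      term0 = trans (*-cong (+-identityʳ 1#) (*-identityˡ _)) (*-identityˡ _)
      middle : ∀ i → i ℕ.< suc A → All (i ≢_) (A ∷ 0 ∷ []) → term i ≈ 0#
      middle i (s≤s i≤A) (i≢A ∷ i≢0 ∷ []) =
        trans (*-congʳ (p∣⇒⟦⟧≈0 (p∣pᵏCi pr k i (ℕₚ.n≢0⇒n>0 i≢0) (ℕₚ.≤∧≢⇒< i≤A i≢A)))) (zeroˡ _)

    frobenius-- : ∀ k x y → (x - y) ^ (p ℕ.^ k) ≈ x ^ (p ℕ.^ k) - y ^ (p ℕ.^ k)
    frobenius-- k x y = begin
      (x - y) ^ A                        ≈⟨ solve 2 (λ u v → u := (u :+ v) :- v) refl _ (y ^ A) ⟩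
      (x - y) ^ A + y ^ A - y ^ A        ≈⟨ +-congʳ (frobenius-+ k (x - y) y) ⟨
      (x - y + y) ^ A - y ^ A            ≈⟨ +-congʳ (^-congˡ A (solve 2 (λ x y → (x :- y) :+ y := x) refl x y)) ⟩
      x ^ A - y ^ A                      ∎
      where A = p ℕ.^ k

    frobenius-injective : ∀ k {x y} → x ^ (p ℕ.^ k) ≈ y ^ (p ℕ.^ k) → x ≈ y
    frobenius-injective k {x} {y} eq with x - y ≟ 0#
    ... | yes x-y≈0 = x-y≈0⇒x≈y x-y≈0
    ... | no  x-y≉0 = ⊥-elim (^-≉0 (p ℕ.^ k) x-y≉0 (trans (frobenius-- k x y) (x≈y⇒x∙y⁻¹≈ε eq)))

    1<q : 1 ℕ.< q
    1<q = distinct⇒1<n (to 0#) (to 1#) (λ eq → 0≉1 (trans (sym (from∘to 0#))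
      (trans (reflexive (≡.cong from eq)) (from∘to 1#))))

    suc[q∸1]≡q : suc (q ∸ 1) ≡ q
    suc[q∸1]≡q = ℕₚ.m+[n∸m]≡n (ℕₚ.<⇒≤ 1<q)

    0<q∸1 : 0 ℕ.< q ∸ 1
    0<q∸1 = ℕₚ.m<n⇒0<n∸m 1<q

    fermat-fixed : ∀ x → x ^ q ≈ x
    fermat-fixed x with x ≟ 0#
    ... | yes x≈0 = trans (^-≡ x (≡.sym suc[q∸1]≡q)) (trans (0^[1+n] (q ∸ 1) x≈0) (sym x≈0))
    ... | no  x≉0 = trans (^-≡ x (≡.sym suc[q∸1]≡q)) (trans (*-congˡ (fermat x≉0)) (*-identityʳ x))

    fixed-^ : ∀ {r x} → x ^ r ≈ x → ∀ k → x ^ (r ℕ.^ k) ≈ x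
    fixed-^ {r} {x} xʳ≈x zero    = *-identityʳ x
    fixed-^ {r} {x} xʳ≈x (suc k) = begin
      x ^ (r ℕ.* r ℕ.^ k)   ≈⟨ ^-assocʳ x r (r ℕ.^ k) ⟨
      (x ^ r) ^ (r ℕ.^ k)   ≈⟨ ^-congˡ (r ℕ.^ k) xʳ≈x ⟩
      x ^ (r ℕ.^ k)         ≈⟨ fixed-^ xʳ≈x k ⟩
      x                     ∎

    -- A preimage of y is its power with exponent p^((n - 1) k): the two exponents multiply to q^k,
    -- and y^(q^k) = y.
    frobenius-bijective : ∀ k → Bijective _≈_ _≈_ (_^ (p ℕ.^ k))
    frobenius-bijective k = frobenius-injective k , λ y → y ^ (p ℕ.^ ((n ∸ 1) ℕ.* k)) , λ {z} z≈ → begin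
      z ^ A                                  ≈⟨ ^-congˡ A z≈ ⟩
      (y ^ (p ℕ.^ ((n ∸ 1) ℕ.* k))) ^ A        ≈⟨ ^-assocʳ y (p ℕ.^ ((n ∸ 1) ℕ.* k)) A ⟩
      y ^ (p ℕ.^ ((n ∸ 1) ℕ.* k) ℕ.* A)        ≈⟨ ^-≡ y exponent ⟩
      y ^ (q ℕ.^ k)                          ≈⟨ fixed-^ (fermat-fixed y) k ⟩
      y                                      ∎
      where A = p ℕ.^ k
            n≢0 : n ≢ 0
            n≢0 n≡0 = ℕₚ.<-irrefl (≡.sym (≡.trans q≡pⁿ (≡.cong (p ℕ.^_) n≡0))) 1<q
            exponent : p ℕ.^ ((n ∸ 1) ℕ.* k) ℕ.* A ≡ q ℕ.^ k
            exponent = ≡.trans (^-complement p n k n≢0) (≡.cong (ℕ._^ k) (≡.sym q≡pⁿ))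

    -- The constant F(α) of the definition is dropped: subtracting it is a translation and does not
    -- affect bijectivity.
    Planar : ℕ → Set (c ⊔ ℓ)
    Planar d = ∀ α → α ≉ 0# → Bijective _≈_ _≈_ (λ x → (x + α) ^ d - x ^ d)

    bijective-resp : ∀ {f g} → (∀ x → f x ≈ g x) → Bijective _≈_ _≈_ f → Bijective _≈_ _≈_ g
    bijective-resp f≈g (inj , surj) =
      (λ eq → inj (trans (f≈g _) (trans eq (sym (f≈g _))))) ,
      (λ y → proj₁ (surj y) , λ z≈ → trans (sym (f≈g _)) (proj₂ (surj y) z≈))

    bijective-∘ : ∀ {f g} → Bijective _≈_ _≈_ f → Bijective _≈_ _≈_ g → Bijective _≈_ _≈_ (g ∘ f)
    bijective-∘ (f-inj , f-surj) (g-inj , g-surj) =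
      f-inj ∘ g-inj ,
      λ z → proj₁ (f-surj (proj₁ (g-surj z))) ,
            λ eq → proj₂ (g-surj z) (proj₂ (f-surj (proj₁ (g-surj z))) eq)

    IsPlanar⇒Planar : ∀ d → IsPlanar F (monomial F d) → Planar d
    IsPlanar⇒Planar d planar α α≉0 =
      bijective-resp (λ x → trans (solve 3 (λ a b c → ((a :- b) :- c) :+ c := a :- b) refl _ _ (pow F α d))
                              (+-cong (pow≈^ (x + α) d) (-‿cong (pow≈^ x d))))
        (bijective-∘ (planar α α≉0) (shift-bijective (pow F α d)))

    Planar⇒IsPlanar : ∀ d → Planar d → IsPlanar F (monomial F d)
    Planar⇒IsPlanar d planar α α≉0 =
      bijective-resp (λ x → +-congʳ (sym (+-cong (pow≈^ (x + α) d) (-‿cong (pow≈^ x d)))))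
        (bijective-∘ (planar α α≉0) (shift-bijective (- pow F α d)))

    Planar-frobenius : ∀ {d} k → Planar d → Planar (d ℕ.* p ℕ.^ k)
    Planar-frobenius {d} k planar α α≉0 =
      bijective-resp (λ x → trans (frobenius-- k _ _) (+-cong (^-assocʳ (x + α) d _) (-‿cong (^-assocʳ x d _))))
        (bijective-∘ (planar α α≉0) (frobenius-bijective k))

    -- Positivity of both exponents makes this hold at x = 0 too, where a zero exponent would give
    -- 1.
    ^-periodic : ∀ {d d′} → 0 ℕ.< d → 0 ℕ.< d′ → ∀ {r} → (∃ λ i → ∃ λ j → d ℕ.+ i ℕ.* r ≡ d′ ℕ.+ j ℕ.* r) →
                 ∀ {x} → x ^ suc r ≈ x → x ^ d ≈ x ^ d′
    ^-periodic {d} {d′} 0<d 0<d′ {r} (i , j , eq) {x} fixed = begin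
      x ^ d                 ≈⟨ absorb {d} i 0<d ⟨
      x ^ (d ℕ.+ i ℕ.* r)   ≈⟨ ^-≡ x eq ⟩
      x ^ (d′ ℕ.+ j ℕ.* r)  ≈⟨ absorb {d′} j 0<d′ ⟩
      x ^ d′                ∎
      where
      absorb : ∀ {d} i → 0 ℕ.< d → x ^ (d ℕ.+ i ℕ.* r) ≈ x ^ d
      absorb {suc d} zero    _ = ^-≡ x (ℕₚ.+-identityʳ (suc d))
      absorb {suc d} (suc i) _ = begin
        x ^ (suc d ℕ.+ (r ℕ.+ i ℕ.* r))       ≈⟨ ^-≡ x (≡.cong suc (ℕₚ.+-comm d (r ℕ.+ i ℕ.* r))) ⟩
        x ^ (suc (r ℕ.+ i ℕ.* r ℕ.+ d))       ≈⟨ ^-≡ x (≡.cong suc (ℕₚ.+-assoc r (i ℕ.* r) d)) ⟩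
        x ^ (suc r ℕ.+ (i ℕ.* r ℕ.+ d))       ≈⟨ ^-homo-* x (suc r) _ ⟩
        x ^ suc r * x ^ (i ℕ.* r ℕ.+ d)       ≈⟨ *-congʳ fixed ⟩
        x ^ suc (i ℕ.* r ℕ.+ d)               ≈⟨ ^-≡ x (≡.cong suc (ℕₚ.+-comm (i ℕ.* r) d)) ⟩
        x ^ (suc d ℕ.+ i ℕ.* r)               ≈⟨ absorb {suc d} i (s≤s z≤n) ⟩
        x ^ suc d                             ∎

    Planar⇒0< : ∀ d → Planar d → 0 ℕ.< d
    Planar⇒0< (suc d) _      = s≤s z≤n
    Planar⇒0< zero    planar = ⊥-elim (0≉1 (proj₁ (planar 1# (0≉1 ∘ sym)) refl))

    -- Induction through absorption: (i + 1) C(m + 1, i + 1) = (m + 1) C(m, i), and the right side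
    -- is a product of non-zero elements as long as m + 1 < p.
    ⟦nCk⟧≉0 : ∀ m i → i ℕ.≤ m → m ℕ.< p → ⟦ m C i ⟧ ≉ 0#
    ⟦nCk⟧≉0 m       zero    _         _   eq = 0≉1 (trans (sym eq) (+-identityʳ 1#))
    ⟦nCk⟧≉0 (suc m) (suc i) (s≤s i≤m) m<p eq =
      *-≉0 (p∤⇒⟦⟧≉0 (∣.>⇒∤ m<p)) (⟦nCk⟧≉0 m i i≤m (ℕₚ.<-trans (ℕₚ.n<1+n m) m<p)) (begin
        ⟦ suc m ⟧ * ⟦ m C i ⟧            ≈⟨ ⟦⟧-* (suc m) (m C i) ⟨
        ⟦ suc m ℕ.* (m C i) ⟧            ≡⟨ ≡.cong ⟦_⟧ (absorption m i) ⟨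
        ⟦ suc i ℕ.* (suc m C suc i) ⟧    ≈⟨ ⟦⟧-* (suc i) (suc m C suc i) ⟩
        ⟦ suc i ⟧ * ⟦ suc m C suc i ⟧    ≈⟨ *-congˡ eq ⟩
        ⟦ suc i ⟧ * 0#                   ≈⟨ zeroʳ _ ⟩
        0#                               ∎)

    Planar-2 : ⟦ 2 ⟧ ≉ 0# → Planar 2
    Planar-2 2≉0 α α≉0 = bijective-resp
      (λ x → solve 3 (λ a x o → (con (ℤ.+ 2) :* (a :* o)) :* x :+ a :* (a :* o) := (x :+ a) :* ((x :+ a) :* o) :- x :* (x :* o)) refl α x 1#)
      (bijective-∘ (scale-bijective (*-≉0 2≉0 (*-≉0 α≉0 (0≉1 ∘ sym)))) (shift-bijective (α * (α * 1#))))

  -- Power sums over a subfield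

  module Subfield {c ℓ : Level} {q : ℕ} (F : FiniteField c ℓ q)
               {p : ℕ} (pr : Prime p) (n : ℕ) (q≡pⁿ : q ≡ p ℕ.^ n)
               (k r : ℕ) (r+1≡pᵏ : suc r ≡ p ℕ.^ k) (0<r : 0 ℕ.< r) (r∣q-1 : r ∣ q ∸ 1) where
    open FiniteField F
    open CharP F pr n q≡pⁿ
    open import Relation.Binary.Reasoning.Setoid setoid

    private instance
      r≢0 : NonZero r
      r≢0 = ℕ.>-nonZero 0<r

    -- The subfield of r + 1 elements, realised inside the given field as the fixed points of a
    -- power of Frobenius, so that no embedding of fields has to be carried around.
    Fixed : Carrier → Set ℓ
    Fixed x = x ^ suc r ≈ x

    Fixed-resp : ∀ {x y} → x ≈ y → Fixed x → Fixed y
    Fixed-resp x≈y fx = trans (^-congˡ (suc r) (sym x≈y)) (trans fx x≈y)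

    Frob-+ : ∀ x y → (x + y) ^ suc r ≈ x ^ suc r + y ^ suc r
    Frob-+ x y = trans (^-≡ (x + y) r+1≡pᵏ) (trans (frobenius-+ k x y)
      (sym (+-cong (^-≡ x r+1≡pᵏ) (^-≡ y r+1≡pᵏ))))

    Frob-- : ∀ x y → (x - y) ^ suc r ≈ x ^ suc r - y ^ suc r
    Frob-- x y = trans (^-≡ (x - y) r+1≡pᵏ) (trans (frobenius-- k x y)
      (sym (+-cong (^-≡ x r+1≡pᵏ) (-‿cong (^-≡ y r+1≡pᵏ)))))

    Frob-bijective : Bijective _≈_ _≈_ (_^ suc r)
    Frob-bijective = bijective-resp (λ x → ^-≡ x (≡.sym r+1≡pᵏ)) (frobenius-bijective k)

    ^-comm : ∀ x a b → (x ^ a) ^ b ≈ (x ^ b) ^ a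
    ^-comm x a b = trans (^-assocʳ x a b) (trans (^-≡ x (ℕₚ.*-comm a b)) (sym (^-assocʳ x b a)))

    Fixed-0 : Fixed 0#
    Fixed-0 = zeroˡ _

    Fixed-1 : Fixed 1#
    Fixed-1 = 1^ (suc r)

    Fixed-+ : ∀ {x y} → Fixed x → Fixed y → Fixed (x + y)
    Fixed-+ fx fy = trans (Frob-+ _ _) (+-cong fx fy)

    Fixed-- : ∀ {x y} → Fixed x → Fixed y → Fixed (x - y)
    Fixed-- fx fy = trans (Frob-- _ _) (+-cong fx (-‿cong fy))

    Fixed-* : ∀ {x y} → Fixed x → Fixed y → Fixed (x * y)
    Fixed-* fx fy = trans (^-distrib-* _ _ (suc r)) (*-cong fx fy)

    Fixed-^ : ∀ {x} m → Fixed x → Fixed (x ^ m)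
    Fixed-^ {x} m fx = trans (^-comm x m (suc r)) (^-congˡ m fx)

    Fixed-⟦⟧ : ∀ m → Fixed ⟦ m ⟧
    Fixed-⟦⟧ zero    = Fixed-0
    Fixed-⟦⟧ (suc m) = Fixed-+ Fixed-1 (Fixed-⟦⟧ m)

    Fixed-div : ∀ {a x} → a ≉ 0# → Fixed a → Fixed (a * x) → Fixed x
    Fixed-div {a} {x} a≉0 fa fax = *-cancelˡ a≉0 (trans (*-congʳ (sym fa))
      (trans (sym (^-distrib-* a x (suc r))) fax))

    Fixed-⟦⟧≉0⇒^r≈1 : ∀ {x} → Fixed x → x ≉ 0# → x ^ r ≈ 1#
    Fixed-⟦⟧≉0⇒^r≈1 {x} fx x≉0 = *-cancelˡ x≉0 (trans fx (sym (*-identityʳ x)))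

    ∑′ : (Carrier → Carrier) → Carrier
    ∑′ h = ∑ᴷ (λ x → δ (x ^ suc r) x * h x)

    ∑′-cong : ∀ {g h} → (∀ x → Fixed x → g x ≈ h x) → ∑′ g ≈ ∑′ h
    ∑′-cong g≈h = ∑ᴷ-cong (λ x → δ-guard (g≈h x))

    ∑′-+ : ∀ g h → ∑′ (λ x → g x + h x) ≈ ∑′ g + ∑′ h
    ∑′-+ g h = trans (∑ᴷ-cong (λ x → distribˡ _ _ _)) (∑ᴷ-+ _ _)

    ∑′-*ˡ : ∀ a h → ∑′ (λ x → a * h x) ≈ a * ∑′ h
    ∑′-*ˡ a h = trans (∑ᴷ-cong (λ x → solve 3 (λ d a h → d :* (a :* h) := a :* (d :* h)) refl _ a (h x))) (∑ᴷ-*ˡ a _)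

    ∑′-0 : ∀ {h} → (∀ x → Fixed x → h x ≈ 0#) → ∑′ h ≈ 0#
    ∑′-0 h≈0 = ∑ᴷ-0 (λ x → trans (δ-guard (h≈0 x)) (zeroʳ _))

    ∑′-S : ∀ m (h : Carrier → ℕ → Carrier) → ∑′ (λ x → S m (h x)) ≈ S m (λ i → ∑′ (λ x → h x i))
    ∑′-S m h = trans (∑ᴷ-cong (λ x → sym (S-*ˡ m (δ (x ^ suc r) x) (h x)))) (∑ᴷ-S m (λ x i → δ (x ^ suc r) x * h x i))

    ∑′-swap : ∀ (h : Carrier → Carrier → Carrier) →
              ∑′ (λ x → ∑′ (h x)) ≈ ∑′ (λ y → ∑′ (λ x → h x y))
    ∑′-swap h = begin
      ∑′ (λ x → ∑′ (h x))                          ≈⟨ ∑ᴷ-cong (λ x → ∑ᴷ-*ˡ (ι x) (λ y → ι y * h x y)) ⟨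
      ∑ᴷ (λ x → ∑ᴷ (λ y → ι x * (ι y * h x y)))    ≈⟨ ∑ᴷ-swap (λ x y → ι x * (ι y * h x y)) ⟩
      ∑ᴷ (λ y → ∑ᴷ (λ x → ι x * (ι y * h x y)))
        ≈⟨ ∑ᴷ-cong (λ y → ∑ᴷ-cong (λ x → solve 3 (λ a b h → a :* (b :* h) := b :* (a :* h)) refl (ι x) (ι y) (h x y))) ⟩
      ∑ᴷ (λ y → ∑ᴷ (λ x → ι y * (ι x * h x y)))    ≈⟨ ∑ᴷ-cong (λ y → ∑ᴷ-*ˡ (ι y) (λ x → ι x * h x y)) ⟩
      ∑′ (λ y → ∑′ (λ x → h x y))                  ∎
      where
      ι : Carrier → Carrier
      ι x = δ (x ^ suc r) x

    ∑′-reindex : ∀ {φ h} → Cong φ → Bijective _≈_ _≈_ φ → (∀ {x} → Fixed x → Fixed (φ x)) →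
                 (∀ {x} → Fixed (φ x) → Fixed x) → Cong h → ∑′ (λ x → h (φ x)) ≈ ∑′ h
    ∑′-reindex {φ} {h} φ-cong φ-bij fix unfix h-cong = trans
      (∑ᴷ-cong {λ x → δ (x ^ suc r) x * h (φ x)} {λ x → δ (φ x ^ suc r) (φ x) * h (φ x)}
        (λ x → *-congʳ (δ-⇔ (fix {x}) (unfix {x}))))
      (∑ᴷ-reindex {φ} {λ x → δ (x ^ suc r) x * h x} φ-cong φ-bij (λ x≈y → *-cong (δ-cong (^-congˡ (suc r) x≈y) x≈y) (h-cong x≈y)))

    ∑′-shift : ∀ {a h} → Fixed a → Cong h → ∑′ (λ x → h (x + a)) ≈ ∑′ h
    ∑′-shift {a} {h} fa = ∑′-reindex {_+ a} {h} +-congʳ (shift-bijective a) (λ {x} fx → Fixed-+ {x} {a} fx fa)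
      (λ {x} fxa → Fixed-resp (solve 2 (λ x a → (x :+ a) :- a := x) refl x a) (Fixed-- {x + a} {a} fxa fa))

    ∑′-1 : ∑′ (λ _ → 1#) ≈ 0#
    ∑′-1 = begin
      ∑′ (λ _ → 1#)                                  ≈⟨ solve 2 (λ s n → n := (s :+ n) :- s) refl (∑′ (λ x → x)) (∑′ (λ _ → 1#)) ⟩
      ∑′ (λ x → x) + ∑′ (λ _ → 1#) - ∑′ (λ x → x)    ≈⟨ +-congʳ (∑′-+ (λ x → x) (λ _ → 1#)) ⟨
      ∑′ (λ x → x + 1#) - ∑′ (λ x → x)               ≈⟨ x≈y⇒x∙y⁻¹≈ε (∑′-shift {1#} {λ x → x} Fixed-1 (λ eq → eq)) ⟩
      0#                                             ∎

    -- With g = (q - 1)/r, every g-th power of a non-zero element lies in the subfield. An x with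
    -- x^(g m) ≠ 1 yields t = x^g.
    ∃-fixed-nonroot : ∀ m → 0 ℕ.< m → m ℕ.< r → ∃ λ t → t ≉ 0# × Fixed t × t ^ m ≉ 1#
    ∃-fixed-nonroot m 0<m m<r = power r∣q-1
      where
      power : r ∣ q ∸ 1 → ∃ λ t → t ≉ 0# × Fixed t × t ^ m ≉ 1#
      power (divides g q-1≡gr) = raise (∃-nonroot (g ℕ.* m) (ℕₚ.*-mono-< 0<g 0<m) gm<q)
        where
        0<g : 0 ℕ.< g
        0<g = ℕₚ.n≢0⇒n>0 (λ g≡0 → ℕₚ.<-irrefl (≡.sym (≡.trans q-1≡gr (≡.cong (ℕ._* r) g≡0))) 0<q∸1)
        gm<q : suc (g ℕ.* m) ℕ.< q
        gm<q = ≡.subst (suc (g ℕ.* m) ℕ.<_) suc[q∸1]≡q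
          (s≤s (≡.subst (g ℕ.* m ℕ.<_) (≡.sym q-1≡gr) (ℕₚ.*-monoʳ-< g {{ℕ.>-nonZero 0<g}} m<r)))
        raise : (∃ λ x → x ≉ 0# × x ^ (g ℕ.* m) ≉ 1#) → ∃ λ t → t ≉ 0# × Fixed t × t ^ m ≉ 1#
        raise (x , x≉0 , xᵍᵐ≉1) = x ^ g , ^-≉0 g x≉0 ,
          trans (*-congˡ (trans (^-assocʳ x g r) (trans (^-≡ x (≡.sym q-1≡gr)) (fermat x≉0)))) (*-identityʳ _) ,
          (λ eq → xᵍᵐ≉1 (trans (sym (^-assocʳ x g m)) eq))

    -- Scaling by t permutes the terms and multiplies the sum by t^m; choose t in the subfield with
    -- t^m ≠ 1. The sum runs over the whole field, so that the weight contained in `h` may cut out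
    -- any set stable under the subfield, for instance the solutions of z^Q = -z.
    ∑′-scale-0 : ∀ {m} (h : Carrier → Carrier) → Cong h → 0 ℕ.< m → m ℕ.< r →
                 (∀ {t x} → t ≉ 0# → Fixed t → h (t * x) ≈ t ^ m * h x) → ∑ᴷ h ≈ 0#
    ∑′-scale-0 {m} h h-cong 0<m m<r homogeneous = vanish (∃-fixed-nonroot m 0<m m<r)
      where
      vanish : (∃ λ t → t ≉ 0# × Fixed t × t ^ m ≉ 1#) → ∑ᴷ h ≈ 0#
      vanish (t , t≉0 , ft , tᵐ≉1) = *-cancel-0 (λ eq → tᵐ≉1 (x-y≈0⇒x≈y eq)) (begin
        (t ^ m - 1#) * ∑ᴷ h              ≈⟨ solve 3 (λ u o s → (u :- o) :* s := u :* s :- o :* s) refl (t ^ m) 1# (∑ᴷ h) ⟩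
        t ^ m * ∑ᴷ h - 1# * ∑ᴷ h         ≈⟨ +-congˡ (-‿cong (*-identityˡ _)) ⟩
        t ^ m * ∑ᴷ h - ∑ᴷ h              ≈⟨ +-congʳ (∑ᴷ-*ˡ (t ^ m) h) ⟨
        ∑ᴷ (λ x → t ^ m * h x) - ∑ᴷ h    ≈⟨ +-congʳ (∑ᴷ-cong {λ x → h (t * x)} {λ x → t ^ m * h x} (λ x → homogeneous {t} {x} t≉0 ft)) ⟨
        ∑ᴷ (λ x → h (t * x)) - ∑ᴷ h      ≈⟨ x≈y⇒x∙y⁻¹≈ε (∑ᴷ-reindex {t *_} {h} (*-congˡ {t}) (scale-bijective t≉0) h-cong) ⟩
        0#                               ∎)

    ∑′-^-0 : ∀ m → ¬ r ∣ m → ∑′ (_^ m) ≈ 0#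
    ∑′-^-0 m r∤m = ∑′-scale-0 {m % r} (λ x → δ (x ^ suc r) x * x ^ m)
      (λ x≈y → *-cong (δ-cong (^-congˡ (suc r) x≈y) x≈y) (^-congˡ m x≈y))
      (ℕₚ.n≢0⇒n>0 (r∤m ∘ ∣.m%n≡0⇒n∣m m r)) (m%n<n m r)
      (λ {t} {x} t≉0 ft → begin
        δ ((t * x) ^ suc r) (t * x) * (t * x) ^ m     ≈⟨ *-cong (δ-⇔ (Fixed-div {t} {x} t≉0 ft) (Fixed-* {t} {x} ft)) (^-distrib-* t x m) ⟩
        δ (x ^ suc r) x * (t ^ m * x ^ m)             ≈⟨ solve 3 (λ d a b → d :* (a :* b) := a :* (d :* b)) refl _ (t ^ m) (x ^ m) ⟩
        t ^ m * (δ (x ^ suc r) x * x ^ m)             ≈⟨ *-congʳ (reduce t≉0 ft) ⟩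
        t ^ (m % r) * (δ (x ^ suc r) x * x ^ m)       ∎)
      where
      reduce : ∀ {t} → t ≉ 0# → Fixed t → t ^ m ≈ t ^ (m % r)
      reduce {t} t≉0 ft = begin
        t ^ m                                 ≈⟨ ^-≡ t (m≡m%n+[m/n]*n m r) ⟩
        t ^ (m % r ℕ.+ m / r ℕ.* r)           ≈⟨ ^-homo-* t (m % r) (m / r ℕ.* r) ⟩
        t ^ (m % r) * t ^ (m / r ℕ.* r)       ≈⟨ *-congˡ (^-≡ t (ℕₚ.*-comm (m / r) r)) ⟩
        t ^ (m % r) * t ^ (r ℕ.* (m / r))     ≈⟨ *-congˡ (^-assocʳ t r (m / r)) ⟨
        t ^ (m % r) * (t ^ r) ^ (m / r)       ≈⟨ *-congˡ (trans (^-congˡ (m / r) (Fixed-⟦⟧≉0⇒^r≈1 ft t≉0)) (1^ (m / r))) ⟩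
        t ^ (m % r) * 1#                      ≈⟨ *-identityʳ _ ⟩
        t ^ (m % r)                           ∎

    -- Adding the indicator of 0 turns x^m into the constant 1, whose sum over the subfield
    -- vanishes; the indicator itself contributes 1.
    ∑′-^-1 : ∀ m → 0 ℕ.< m → r ∣ m → ∑′ (_^ m) ≈ - 1#
    ∑′-^-1 m 0<m (divides g m≡gr) = begin
      ∑′ (_^ m)                                      ≈⟨ solve 2 (λ s z → s := (s :+ z) :- z) refl (∑′ (_^ m)) (∑′ (λ x → δ 0# x)) ⟩
      ∑′ (_^ m) + ∑′ (λ x → δ 0# x) - ∑′ (λ x → δ 0# x)   ≈⟨ +-congʳ (∑′-+ (_^ m) (λ x → δ 0# x)) ⟨
      ∑′ (λ x → x ^ m + δ 0# x) - ∑′ (λ x → δ 0# x)  ≈⟨ +-cong (∑′-cong ones) (-‿cong zeros) ⟩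
      ∑′ (λ _ → 1#) - 1#                             ≈⟨ +-congʳ ∑′-1 ⟩
      0# - 1#                                        ≈⟨ +-identityˡ _ ⟩
      - 1#                                           ∎
      where
      ones : ∀ x → Fixed x → x ^ m + δ 0# x ≈ 1#
      ones x fx with x ≟ 0#
      ... | yes x≈0 = trans (+-cong (trans (^-congˡ m x≈0) (0^ m 0<m)) (δ-yes (sym x≈0))) (+-identityˡ 1#)
        where
        0^ : ∀ m → 0 ℕ.< m → 0# ^ m ≈ 0#
        0^ (suc m) _ = zeroˡ _
      ... | no  x≉0 = trans (+-cong
          (trans (^-≡ x (≡.trans m≡gr (ℕₚ.*-comm g r))) (trans (sym (^-assocʳ x r g))
            (trans (^-congˡ g (Fixed-⟦⟧≉0⇒^r≈1 fx x≉0)) (1^ g))))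
          (δ-no (x≉0 ∘ sym))) (+-identityʳ 1#)
      zeros : ∑′ (λ x → δ 0# x) ≈ 1#
      zeros = trans (∑ᴷ-cong (λ x → *-comm _ _)) (trans
        (∑ᴷ-δ 0# {λ x → δ (x ^ suc r) x} (λ x≈y → δ-cong (^-congˡ (suc r) x≈y) x≈y))
        (δ-yes Fixed-0))

    D : ℕ → Carrier → Carrier → Carrier
    D d α x = (x + α) ^ d - x ^ d

    D-cong : ∀ d {α β x y} → α ≈ β → x ≈ y → D d α x ≈ D d β y
    D-cong d α≈β x≈y = +-cong (^-congˡ d (+-cong x≈y α≈β)) (-‿cong (^-congˡ d x≈y))

    D-Frob : ∀ d α x → D d α x ^ suc r ≈ D d (α ^ suc r) (x ^ suc r)
    D-Frob d α x = begin
      ((x + α) ^ d - x ^ d) ^ suc r                    ≈⟨ Frob-- _ _ ⟩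
      ((x + α) ^ d) ^ suc r - (x ^ d) ^ suc r          ≈⟨ +-cong (^-comm (x + α) d (suc r)) (-‿cong (^-comm x d (suc r))) ⟩
      ((x + α) ^ suc r) ^ d - (x ^ suc r) ^ d          ≈⟨ +-congʳ (^-congˡ d (Frob-+ x α)) ⟩
      (x ^ suc r + α ^ suc r) ^ d - (x ^ suc r) ^ d    ∎

    -- Planarity descends to subfields. For α in the subfield the difference map commutes with the
    -- Frobenius power, so it preserves the subfield, and by injectivity nothing outside the
    -- subfield is mapped into it.
    ∑′-planar : ∀ {d α h} → Planar d → α ≉ 0# → Fixed α → Cong h →
                ∑′ (λ x → h (D d α x)) ≈ ∑′ h
    ∑′-planar {d} {α} {h} planar α≉0 fα = ∑′-reindex {D d α} {h} (D-cong d refl) (planar α α≉0)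
      (λ {x} fx → trans (D-Frob d α x) (D-cong d fα fx))
      (λ {x} fDx → proj₁ (planar α α≉0) (trans (D-cong d (sym fα) refl) (trans (sym (D-Frob d α x)) fDx)))

  ∣-between : ∀ {r m} → 0 ℕ.< m → m ℕ.< r ℕ.+ r → m ≢ r → ¬ r ∣ m
  ∣-between {r} 0<m m<2r m≢r (divides zero          ≡.refl) = ℕₚ.<-irrefl ≡.refl 0<m
  ∣-between {r} 0<m m<2r m≢r (divides (suc zero)    ≡.refl) = m≢r (ℕₚ.+-identityʳ r)
  ∣-between {r} 0<m m<2r m≢r (divides (suc (suc g)) ≡.refl) = ℕₚ.<-irrefl ≡.refl
    (ℕₚ.<-≤-trans m<2r (ℕₚ.+-monoʳ-≤ r (ℕₚ.m≤m+n r (g ℕ.* r))))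

  -- The second power sum of a difference map

  module Moments {c ℓ : Level} {q : ℕ} (F : FiniteField c ℓ q)
               {p : ℕ} (pr : Prime p) (n : ℕ) (q≡pⁿ : q ≡ p ℕ.^ n)
               (k r : ℕ) (r+1≡pᵏ : suc r ≡ p ℕ.^ k) (0<r : 0 ℕ.< r) (r∣q-1 : r ∣ q ∸ 1) where
    open FiniteField F
    open CharP F pr n q≡pⁿ
    open Subfield F pr n q≡pⁿ k r r+1≡pᵏ 0<r r∣q-1
    open import Relation.Binary.Reasoning.Setoid setoid

    ^-double : ∀ x m → x ^ m * x ^ m ≈ x ^ (m ℕ.+ m)
    ^-double x m = sym (^-homo-* x m m)

    module _ {d e : ℕ} (planar : Planar d) (0<d : 0 ℕ.< d) (0<e : 0 ℕ.< e) (d≡e : d ≡ e mod r)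
             {h : ℕ} (r≡h+h : r ≡ h ℕ.+ h) (h≤e : h ℕ.≤ e) (e<r : e ℕ.< r)
             (r∤2e : ¬ r ∣ e ℕ.+ e) (r∤2 : ¬ r ∣ 2) (2≉0 : ⟦ 2 ⟧ ≉ 0#) where

      private
        -- The difference is centred: with t = 1/2, the square of (x + t)^d - (x - t)^d has a cross
        -- term built from (x² - t²)^d, a function of x² alone.
        t : Carrier
        t = proj₁ (inverse ⟦ 2 ⟧ 2≉0)
        2t≈1 : ⟦ 2 ⟧ * t ≈ 1#
        2t≈1 = proj₂ (inverse ⟦ 2 ⟧ 2≉0)
        t≉0 : t ≉ 0#
        t≉0 t≈0 = 0≉1 (trans (sym (zeroʳ _)) (trans (*-congˡ (sym t≈0)) 2t≈1))
        t+t≈1 : t + t ≈ 1#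
        t+t≈1 = trans (solve 2 (λ t o → t :+ t := t :* con (ℤ.+ 2)) refl t 1#) (trans (*-comm _ _) 2t≈1)
        Ft : Fixed t
        Ft = Fixed-div 2≉0 (Fixed-⟦⟧ 2) (Fixed-resp (sym 2t≈1) Fixed-1)
        F-t : Fixed (- t)
        F-t = Fixed-resp (+-identityˡ _) (Fixed-- Fixed-0 Ft)

        r∤2d : ¬ r ∣ d ℕ.+ d
        r∤2d r∣2d = r∤2e (mod⇒∣ (mod-trans (mod-sym (mod-+ d≡e d≡e)) (∣⇒mod r∣2d)))

        A B AB : Carrier → Carrier
        A x = (x + t) ^ d
        B x = (x - t) ^ d
        AB x = (x * x + - (t * t)) ^ e

        squares : ∀ {a} → Fixed a → ∑′ (λ x → (x + a) ^ d * (x + a) ^ d) ≈ 0#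
        squares {a} Fa = trans (∑′-shift {a} {λ x → x ^ d * x ^ d} Fa (λ x≈y → *-cong (^-congˡ d x≈y) (^-congˡ d x≈y)))
          (trans (∑′-cong (λ x _ → ^-double x d)) (∑′-^-0 (d ℕ.+ d) r∤2d))

        expand : ∀ x → Fixed x → D d 1# (x - t) * D d 1# (x - t) ≈ (A x * A x + B x * B x) + (- ⟦ 2 ⟧) * AB x
        expand x fx = begin
          D d 1# (x - t) * D d 1# (x - t)    ≈⟨ *-cong D≈ D≈ ⟩
          (A x - B x) * (A x - B x)          ≈⟨ solve 2 (λ a b → (a :- b) :* (a :- b) := (a :* a :+ b :* b) :+ (:- con (ℤ.+ 2)) :* (a :* b)) refl (A x) (B x) ⟩
          (A x * A x + B x * B x) + (- ⟦ 2 ⟧) * (A x * B x)  ≈⟨ +-congˡ (*-congˡ AB≈) ⟩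
          (A x * A x + B x * B x) + (- ⟦ 2 ⟧) * AB x         ∎
          where
          D≈ : D d 1# (x - t) ≈ A x - B x
          D≈ = +-congʳ (^-congˡ d (trans (+-congˡ (sym t+t≈1)) (solve 2 (λ x t → (x :- t) :+ (t :+ t) := x :+ t) refl x t)))
          AB≈ : A x * B x ≈ AB x
          AB≈ = begin
            (x + t) ^ d * (x - t) ^ d      ≈⟨ ^-distrib-* (x + t) (x - t) d ⟨
            ((x + t) * (x - t)) ^ d        ≈⟨ ^-congˡ d (solve 2 (λ x t → (x :+ t) :* (x :- t) := x :* x :+ (:- (t :* t))) refl x t) ⟩
            (x * x + - (t * t)) ^ d        ≈⟨ ^-periodic 0<d 0<e d≡e (Fixed-resp (solve 2 (λ x t → (x :* x) :- (t :* t) := x :* x :+ (:- (t :* t))) refl x t)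
                                                (Fixed-- (Fixed-* fx fx) (Fixed-* Ft Ft))) ⟩
            (x * x + - (t * t)) ^ e        ∎

        ∑AB≈0 : ∑′ AB ≈ 0#
        ∑AB≈0 = *-cancel-0 (λ eq → 2≉0 (trans (sym (-‿involutive _)) (trans (-‿cong eq) -0#≈0#))) (begin
          (- ⟦ 2 ⟧) * ∑′ AB                                             ≈⟨ +-identityˡ _ ⟨
          0# + (- ⟦ 2 ⟧) * ∑′ AB                                        ≈⟨ +-congʳ (trans (∑′-+ _ _) (trans (+-cong (squares Ft) (squares F-t)) (+-identityˡ 0#))) ⟨
          ∑′ (λ x → A x * A x + B x * B x) + (- ⟦ 2 ⟧) * ∑′ AB          ≈⟨ +-congˡ (∑′-*ˡ (- ⟦ 2 ⟧) AB) ⟨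
          ∑′ (λ x → A x * A x + B x * B x) + ∑′ (λ x → (- ⟦ 2 ⟧) * AB x) ≈⟨ ∑′-+ _ _ ⟨
          ∑′ (λ x → (A x * A x + B x * B x) + (- ⟦ 2 ⟧) * AB x)         ≈⟨ ∑′-cong expand ⟨
          ∑′ (λ x → D d 1# (x - t) * D d 1# (x - t))                    ≈⟨ ∑′-shift { (- t) } {λ x → D d 1# x * D d 1# x} F-t (λ x≈y → *-cong (D-cong d refl x≈y) (D-cong d refl x≈y)) ⟩
          ∑′ (λ x → D d 1# x * D d 1# x)                                ≈⟨ ∑′-planar {d} {1#} {λ z → z * z} planar (0≉1 ∘ sym) Fixed-1 (λ x≈y → *-cong x≈y x≈y) ⟩
          ∑′ (λ z → z * z)                                              ≈⟨ ∑′-cong (λ z _ → *-congˡ (sym (*-identityʳ z))) ⟩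
          ∑′ (_^ 2)                                                     ≈⟨ ∑′-^-0 2 r∤2 ⟩
          0#                                                            ∎)

        u : Carrier
        u = - (t * t)
        u≉0 : u ≉ 0#
        u≉0 eq = *-≉0 t≉0 t≉0 (trans (sym (-‿involutive _)) (trans (-‿cong eq) -0#≈0#))

        coefficient : ℕ → Carrier
        coefficient i = (⟦ e C i ⟧ * u ^ (e ∸ i)) * ∑′ (_^ (i ℕ.+ i))

        ∑AB-expansion : ∑′ AB ≈ S (suc e) coefficient
        ∑AB-expansion = begin
          ∑′ AB                    ≈⟨ ∑′-cong (λ x _ → binomial e (x * x) u) ⟩
          ∑′ (λ x → S (suc e) (λ i → ⟦ e C i ⟧ * ((x * x) ^ i * u ^ (e ∸ i))))
            ≈⟨ ∑′-S (suc e) (λ x i → ⟦ e C i ⟧ * ((x * x) ^ i * u ^ (e ∸ i))) ⟩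
          S (suc e) (λ i → ∑′ (λ x → ⟦ e C i ⟧ * ((x * x) ^ i * u ^ (e ∸ i))))
            ≈⟨ S-cong (suc e) (λ i _ → trans (∑′-cong (λ x _ → rearrange i x)) (∑′-*ˡ _ _)) ⟩
          S (suc e) coefficient    ∎
          where
          rearrange : ∀ i x → ⟦ e C i ⟧ * ((x * x) ^ i * u ^ (e ∸ i)) ≈ (⟦ e C i ⟧ * u ^ (e ∸ i)) * x ^ (i ℕ.+ i)
          rearrange i x = trans (*-congˡ (*-congʳ (trans (^-distrib-* x x i) (^-double x i))))
            (solve 3 (λ a b c → a :* (b :* c) := (a :* c) :* b) refl _ _ _)

      -- The squares of the centred differences sum to Σ z² = 0, and the sums of (x ± t)^(2d) vanish
      -- because r does not divide 2d. Hence Σ (x² - t²)^e = 0. In its expansion x^(2i) with i ≤ e <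
      -- r has a non-zero sum only for 2i = r, and what remains is -C(e, h) (-t²)^(e - h).
      hermite₂ : ⟦ e C h ⟧ ≈ 0#
      hermite₂ with ⟦ e C h ⟧ ≟ 0#
      ... | yes eq  = eq
      ... | no  neq = ⊥-elim (*-≉0 (*-≉0 neq (^-≉0 (e ∸ h) u≉0))
          (λ eq → 0≉1 (sym (trans (sym (-‿involutive 1#)) (trans (-‿cong (trans (sym ∑h) eq)) -0#≈0#)))) single)
        where
        ∑h : ∑′ (_^ (h ℕ.+ h)) ≈ - 1#
        ∑h = ∑′-^-1 (h ℕ.+ h) (≡.subst (0 ℕ.<_) r≡h+h 0<r) (∣.∣-reflexive r≡h+h)
        vanish : ∀ i → i ℕ.< suc e → All (i ≢_) (h ∷ []) → coefficient i ≈ 0#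
        vanish zero    _         _          = trans (*-congˡ (trans (∑′-cong (λ _ _ → refl)) ∑′-1)) (zeroʳ _)
        vanish (suc i) (s≤s i<e) (i≢h ∷ []) = trans (*-congˡ (∑′-^-0 _ (∣-between (s≤s z≤n)
          (ℕₚ.+-mono-< i<r i<r) (λ eq → i≢h (double-injective (≡.trans eq r≡h+h)))))) (zeroʳ _)
          where
          i<r = ℕₚ.≤-<-trans i<e e<r
          double-injective : ∀ {a b} → a ℕ.+ a ≡ b ℕ.+ b → a ≡ b
          double-injective {a} {b} eq = ℕₚ.*-cancelˡ-≡ a b 2
            (≡.trans (≡.cong (a ℕ.+_) (ℕₚ.+-identityʳ a)) (≡.trans eq (≡.sym (≡.cong (b ℕ.+_) (ℕₚ.+-identityʳ b)))))
        single : coefficient h ≈ 0#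
        single = begin
          coefficient h             ≈⟨ +-identityʳ _ ⟨
          total coefficient (h ∷ []) ≈⟨ S-pick (suc e) coefficient (h ∷ []) (s≤s h≤e ∷ []) ([] ∷ []) vanish ⟨
          S (suc e) coefficient     ≈⟨ ∑AB-expansion ⟨
          ∑′ AB                     ≈⟨ ∑AB≈0 ⟩
          0#                        ∎

  -- The prime field: d ≡ 2 modulo p - 1

  module PrimeSubfield {c ℓ : Level} {q : ℕ} (F : FiniteField c ℓ q)
               {p : ℕ} (pr : Prime p) (n : ℕ) (q≡pⁿ : q ≡ p ℕ.^ n)
               (r : ℕ) (r+1≡p : suc r ≡ p) (5<p : 5 ℕ.< p) (r∣q-1 : r ∣ q ∸ 1) where
    open FiniteField F
    open CharP F pr n q≡pⁿ

    private
      r+1≡p¹ : suc r ≡ p ℕ.^ 1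
      r+1≡p¹ = ≡.trans r+1≡p (≡.sym (ℕₚ.^-identityʳ p))
      5≤r : 5 ℕ.≤ r
      5≤r = ℕₚ.≤-pred (≡.subst (5 ℕ.<_) (≡.sym r+1≡p) 5<p)
      0<r : 0 ℕ.< r
      0<r = ℕₚ.≤-trans (s≤s z≤n) 5≤r
      instance
        r≢0 : NonZero r
        r≢0 = ℕ.>-nonZero 0<r

    open Subfield F pr n q≡pⁿ 1 r r+1≡p¹ 0<r r∣q-1
    open Moments F pr n q≡pⁿ 1 r r+1≡p¹ 0<r r∣q-1
    open import Relation.Binary.Reasoning.Setoid setoid

    ⟦⟧≉0 : ∀ {m} → 0 ℕ.< m → m ℕ.< p → ⟦ m ⟧ ≉ 0#
    ⟦⟧≉0 {suc m} _ m<p = p∤⇒⟦⟧≉0 (∣.>⇒∤ m<p)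

    neg-^ : ∀ x m → (- x) ^ m ≈ (- 1#) ^ m * x ^ m
    neg-^ x m = trans (^-congˡ m (trans (-‿cong (sym (*-identityˡ x))) (-‿distribˡ-* 1# x))) (^-distrib-* (- 1#) x m)

    -1≉0 : - 1# ≉ 0#
    -1≉0 eq = 0≉1 (sym (trans (sym (-‿involutive 1#)) (trans (-‿cong eq) -0#≈0#)))

    module _ {d : ℕ} (planar : Planar d) where

      -- The linear term leaves every difference map bijective, since it only translates it. The
      -- parameter b serves to extract single coefficients from the moments later.
      G : Carrier → Carrier → Carrier
      G b x = x ^ d + b * x

      private
        G-cong : ∀ b {x y} → x ≈ y → G b x ≈ G b y
        G-cong b x≈y = +-cong (^-congˡ d x≈y) (*-congˡ x≈y)

        M : Carrier → ℕ → Carrier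
        M b s = ∑′ (λ x → G b x ^ s)

      -- After the substitution of u + x for y the difference is D_u(x) + b u, which for u ≠ 0 runs
      -- over the whole subfield; u = 0 contributes nothing because m > 0.
      double-sum : ∀ {b} → Fixed b → ∀ m → 0 ℕ.< m → m ℕ.< r →
                   ∑′ (λ x → ∑′ (λ y → (G b y - G b x) ^ m)) ≈ 0#
      double-sum {b} Fb m 0<m m<r = begin
        ∑′ (λ x → ∑′ (λ y → (G b y - G b x) ^ m))          ≈⟨ ∑′-cong (λ x fx → ∑′-shift {x} {λ y → (G b y - G b x) ^ m} fx
                                                               (λ y≈z → ^-congˡ m (+-congʳ (G-cong b y≈z)))) ⟨
        ∑′ (λ x → ∑′ (λ u → (G b (u + x) - G b x) ^ m))    ≈⟨ ∑′-swap (λ x u → (G b (u + x) - G b x) ^ m) ⟩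
        ∑′ (λ u → ∑′ (λ x → (G b (u + x) - G b x) ^ m))    ≈⟨ ∑′-0 inner ⟩
        0#                                                 ∎
        where
        r∤m : ¬ r ∣ m
        r∤m = ∣-between 0<m (ℕₚ.<-≤-trans m<r (ℕₚ.m≤m+n r r)) (λ eq → ℕₚ.<-irrefl eq m<r)
        0^m : ∀ {x} m → 0 ℕ.< m → x ≈ 0# → x ^ m ≈ 0#
        0^m (suc m) _ = 0^[1+n] m
        inner : ∀ u → Fixed u → ∑′ (λ x → (G b (u + x) - G b x) ^ m) ≈ 0#
        inner u fu with u ≟ 0#
        ... | yes u≈0 = ∑′-0 (λ x _ → 0^m m 0<m (x≈y⇒x∙y⁻¹≈ε (G-cong b (trans (+-congʳ u≈0) (+-identityˡ x)))))
        ... | no  u≉0 = begin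
          ∑′ (λ x → (G b (u + x) - G b x) ^ m)     ≈⟨ ∑′-cong (λ x _ → ^-congˡ m (difference x)) ⟩
          ∑′ (λ x → (D d u x + b * u) ^ m)         ≈⟨ ∑′-planar {d} {u} {λ z → (z + b * u) ^ m} planar u≉0 fu (λ x≈y → ^-congˡ m (+-congʳ x≈y)) ⟩
          ∑′ (λ z → (z + b * u) ^ m)               ≈⟨ ∑′-shift {b * u} {_^ m} (Fixed-* Fb fu) (^-congˡ m) ⟩
          ∑′ (_^ m)                                ≈⟨ ∑′-^-0 m r∤m ⟩
          0#                                       ∎
          where
          difference : ∀ x → G b (u + x) - G b x ≈ D d u x + b * u
          difference x = trans (+-congʳ (+-congʳ (^-congˡ d (+-comm u x))))
            (solve 5 (λ a c b u x → (a :+ b :* (u :+ x)) :- (c :+ b :* x) := (a :- c) :+ b :* u) refl _ _ b u x)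

      -- Strong induction on s. In the expansion of the double sum with exponent 2s, every term but
      -- the middle one contains a moment of order below s. So C(2s, s) times the square of the s-th
      -- moment vanishes up to sign, and 2s < p makes the binomial coefficient invertible.
      moment≈0 : ∀ {b} → Fixed b → ∀ s → s ℕ.+ s ℕ.< r → M b s ≈ 0#
      moment≈0 {b} Fb = <-rec _ step
        where
        step : ∀ s → (∀ {i} → i ℕ.< s → i ℕ.+ i ℕ.< r → M b i ≈ 0#) → s ℕ.+ s ℕ.< r → M b s ≈ 0#
        step zero       rec _    = trans (∑′-cong (λ _ _ → refl)) ∑′-1
        step s@(suc s′) rec 2s<r = square-0 (*-cancel-0 (⟦nCk⟧≉0 N s (ℕₚ.m≤m+n s s) N<p) (begin
          ⟦ N C s ⟧ * (M b s * ((- 1#) ^ s * M b s))           ≈⟨ *-congˡ (*-congˡ (*-cong (^-≡ (- 1#) N∸s) (∑′-cong (λ x _ → ^-≡ (G b x) N∸s)))) ⟨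
          term s                                               ≈⟨ +-identityʳ _ ⟨
          total term (s ∷ [])                                  ≈⟨ S-pick (suc N) term (s ∷ []) (s≤s (ℕₚ.m≤m+n s s) ∷ []) ([] ∷ []) others ⟨
          S (suc N) term                                       ≈⟨ expansion ⟨
          ∑′ (λ x → ∑′ (λ y → (G b y - G b x) ^ N))            ≈⟨ double-sum Fb N (s≤s z≤n) 2s<r ⟩
          0#                                                   ∎))
          where
          N = s ℕ.+ s
          N<p : N ℕ.< p
          N<p = ≡.subst (N ℕ.<_) r+1≡p (ℕₚ.m<n⇒m<1+n 2s<r)
          N∸s : N ∸ s ≡ s
          N∸s = ℕₚ.m+n∸n≡m s s
          term : ℕ → Carrier
          term i = ⟦ N C i ⟧ * (M b i * ((- 1#) ^ (N ∸ i) * M b (N ∸ i)))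
          square-0 : M b s * ((- 1#) ^ s * M b s) ≈ 0# → M b s ≈ 0#
          square-0 eq with M b s ≟ 0#
          ... | yes M≈0 = M≈0
          ... | no  M≉0 = ⊥-elim (*-≉0 M≉0 (*-≉0 (^-≉0 s -1≉0) M≉0) eq)
          others : ∀ i → i ℕ.< suc N → All (i ≢_) (s ∷ []) → term i ≈ 0#
          others i (s≤s i≤N) (i≢s ∷ []) with ℕₚ.<-cmp i s
          ... | tri< i<s _ _ = trans (*-congˡ (trans (*-congʳ (rec i<s (ℕₚ.<-trans (ℕₚ.+-mono-< i<s i<s) 2s<r))) (zeroˡ _))) (zeroʳ _)
          ... | tri≈ _ i≡s _ = ⊥-elim (i≢s i≡s)
          ... | tri> _ _ s<i = trans (*-congˡ (trans (*-congˡ (trans (*-congˡ (rec N∸i<s (ℕₚ.<-trans (ℕₚ.+-mono-< N∸i<s N∸i<s) 2s<r))) (zeroʳ _))) (zeroʳ _))) (zeroʳ _)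
            where
            N∸i<s : N ∸ i ℕ.< s
            N∸i<s = ≡.subst (N ∸ i ℕ.<_) N∸s (ℕₚ.∸-monoʳ-< s<i i≤N)
          expansion : ∑′ (λ x → ∑′ (λ y → (G b y - G b x) ^ N)) ≈ S (suc N) term
          expansion = begin
            ∑′ (λ x → ∑′ (λ y → (G b y - G b x) ^ N))
              ≈⟨ ∑′-cong (λ x _ → trans (∑′-cong (λ y _ → binomial N (G b y) (- G b x))) (∑′-S (suc N) (λ y i → ⟦ N C i ⟧ * (G b y ^ i * (- G b x) ^ (N ∸ i))))) ⟩
            ∑′ (λ x → S (suc N) (λ i → ∑′ (λ y → ⟦ N C i ⟧ * (G b y ^ i * (- G b x) ^ (N ∸ i)))))
              ≈⟨ ∑′-S (suc N) (λ x i → ∑′ (λ y → ⟦ N C i ⟧ * (G b y ^ i * (- G b x) ^ (N ∸ i)))) ⟩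
            S (suc N) (λ i → ∑′ (λ x → ∑′ (λ y → ⟦ N C i ⟧ * (G b y ^ i * (- G b x) ^ (N ∸ i)))))
              ≈⟨ S-cong (suc N) (λ i _ → separate i) ⟩
            S (suc N) term ∎
            where
            separate : ∀ i → ∑′ (λ x → ∑′ (λ y → ⟦ N C i ⟧ * (G b y ^ i * (- G b x) ^ (N ∸ i)))) ≈ term i
            separate i = begin
              ∑′ (λ x → ∑′ (λ y → ⟦ N C i ⟧ * (G b y ^ i * (- G b x) ^ (N ∸ i))))
                ≈⟨ ∑′-cong (λ x _ → trans (∑′-cong (λ y _ → trans (*-congˡ (*-congˡ (neg-^ (G b x) (N ∸ i))))
                     (solve 4 (λ c g n h → c :* (g :* (n :* h)) := (c :* (n :* h)) :* g) refl _ _ _ _))) (∑′-*ˡ _ _)) ⟩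
              ∑′ (λ x → (⟦ N C i ⟧ * ((- 1#) ^ (N ∸ i) * G b x ^ (N ∸ i))) * M b i)
                ≈⟨ ∑′-cong (λ x _ → solve 4 (λ c n h m → (c :* (n :* h)) :* m := (c :* (m :* n)) :* h) refl _ _ _ (M b i)) ⟩
              ∑′ (λ x → (⟦ N C i ⟧ * (M b i * (- 1#) ^ (N ∸ i))) * G b x ^ (N ∸ i))
                ≈⟨ ∑′-*ˡ _ _ ⟩
              (⟦ N C i ⟧ * (M b i * (- 1#) ^ (N ∸ i))) * M b (N ∸ i)
                ≈⟨ solve 4 (λ c m n h → (c :* (m :* n)) :* h := c :* (m :* (n :* h))) refl _ _ _ _ ⟩
              term i ∎

      -- Multiplying the moment of order j = s + ρ by b^(r - ρ) and summing over b extracts the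
      -- coefficient of b^ρ, which is C(j, s) Σ x^(d s + ρ). As d s + ρ ≡ 0 (mod r), both power sums
      -- are -1, so C(j, s) would vanish although j < p.
      moment-contradiction : ∀ {D s ρ} → d ≡ D mod r → r ≡ ρ ℕ.+ s ℕ.* D → 0 ℕ.< s →
                             (s ℕ.+ ρ) ℕ.+ (s ℕ.+ ρ) ℕ.< r → ⊥
      moment-contradiction {D} {s} {ρ} d≡D r≡ 0<s 2j<r = *-≉0 (⟦nCk⟧≉0 j s (ℕₚ.m≤m+n s ρ) j<p)
          (*-≉0 -1≉0 -1≉0) (trans (sym (trans (+-identityʳ _) (*-congˡ (*-cong ∑b ∑x)))) (begin
        total term (s ∷ [])                                ≈⟨ S-pick (suc j) term (s ∷ []) (s≤s (ℕₚ.m≤m+n s ρ) ∷ []) ([] ∷ []) others ⟨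
        S (suc j) term                                     ≈⟨ S-cong (suc j) (λ t _ → separate t) ⟨
        S (suc j) (λ t → ∑′ (λ b → ∑′ (λ x → full t b x))) ≈⟨ ∑′-S (suc j) (λ b t → ∑′ (λ x → full t b x)) ⟨
        ∑′ (λ b → S (suc j) (λ t → ∑′ (λ x → full t b x))) ≈⟨ ∑′-cong (λ b _ → ∑′-S (suc j) (λ x t → full t b x)) ⟨
        ∑′ (λ b → ∑′ (λ x → S (suc j) (λ t → full t b x))) ≈⟨ ∑′-cong (λ b _ → trans (∑′-cong (λ x _ →
                                                                 trans (S-*ˡ (suc j) (b ^ β) (λ t → ⟦ j C t ⟧ * ((x ^ d) ^ t * (b * x) ^ (j ∸ t)))) (*-congˡ (sym (binomial j (x ^ d) (b * x)))))) (∑′-*ˡ (b ^ β) _)) ⟩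
        ∑′ (λ b → b ^ β * M b j)                           ≈⟨ ∑′-0 (λ b Fb → trans (*-congˡ (moment≈0 Fb j 2j<r)) (zeroʳ _)) ⟩
        0#                                                 ∎))
        where
        j = s ℕ.+ ρ
        β = r ∸ ρ
        j<r : j ℕ.< r
        j<r = ℕₚ.≤-<-trans (ℕₚ.m≤m+n j j) 2j<r
        j<p : j ℕ.< p
        j<p = ≡.subst (j ℕ.<_) r+1≡p (ℕₚ.m<n⇒m<1+n j<r)
        ρ<r : ρ ℕ.< r
        ρ<r = ℕₚ.≤-<-trans (ℕₚ.m≤n+m ρ s) j<r
        full : ℕ → Carrier → Carrier → Carrier
        full t b x = b ^ β * (⟦ j C t ⟧ * ((x ^ d) ^ t * (b * x) ^ (j ∸ t)))
        term : ℕ → Carrier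
        term t = ⟦ j C t ⟧ * (∑′ (_^ (β ℕ.+ (j ∸ t))) * ∑′ (_^ (d ℕ.* t ℕ.+ (j ∸ t))))
        separate : ∀ t → ∑′ (λ b → ∑′ (λ x → full t b x)) ≈ term t
        separate t = begin
          ∑′ (λ b → ∑′ (λ x → full t b x))
            ≈⟨ ∑′-cong (λ b _ → trans (∑′-cong (λ x _ → monomials b x)) (∑′-*ˡ _ _)) ⟩
          ∑′ (λ b → (⟦ j C t ⟧ * b ^ (β ℕ.+ (j ∸ t))) * X)
            ≈⟨ ∑′-cong (λ b _ → solve 3 (λ c b x → (c :* b) :* x := (c :* x) :* b) refl _ _ X) ⟩
          ∑′ (λ b → (⟦ j C t ⟧ * X) * b ^ (β ℕ.+ (j ∸ t)))
            ≈⟨ ∑′-*ˡ _ _ ⟩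
          (⟦ j C t ⟧ * X) * ∑′ (_^ (β ℕ.+ (j ∸ t)))
            ≈⟨ solve 3 (λ c x b → (c :* x) :* b := c :* (b :* x)) refl _ X _ ⟩
          term t ∎
          where
          X = ∑′ (_^ (d ℕ.* t ℕ.+ (j ∸ t)))
          monomials : ∀ b x → full t b x ≈ (⟦ j C t ⟧ * b ^ (β ℕ.+ (j ∸ t))) * x ^ (d ℕ.* t ℕ.+ (j ∸ t))
          monomials b x = begin
            b ^ β * (⟦ j C t ⟧ * ((x ^ d) ^ t * (b * x) ^ (j ∸ t)))
              ≈⟨ *-congˡ (*-congˡ (*-cong (^-assocʳ x d t) (^-distrib-* b x (j ∸ t)))) ⟩
            b ^ β * (⟦ j C t ⟧ * (x ^ (d ℕ.* t) * (b ^ (j ∸ t) * x ^ (j ∸ t))))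
              ≈⟨ solve 5 (λ b c x b′ x′ → b :* (c :* (x :* (b′ :* x′))) := (c :* (b :* b′)) :* (x :* x′)) refl _ _ _ _ _ ⟩
            (⟦ j C t ⟧ * (b ^ β * b ^ (j ∸ t))) * (x ^ (d ℕ.* t) * x ^ (j ∸ t))
              ≈⟨ *-cong (*-congˡ (^-homo-* b β (j ∸ t))) (^-homo-* x (d ℕ.* t) (j ∸ t)) ⟨
            (⟦ j C t ⟧ * b ^ (β ℕ.+ (j ∸ t))) * x ^ (d ℕ.* t ℕ.+ (j ∸ t)) ∎
        j∸s : j ∸ s ≡ ρ
        j∸s = ℕₚ.m+n∸m≡n s ρ
        β+ρ : β ℕ.+ ρ ≡ r
        β+ρ = ℕₚ.m∸n+n≡m (ℕₚ.<⇒≤ ρ<r)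
        0<β : 0 ℕ.< β
        0<β = ℕₚ.m<n⇒0<n∸m ρ<r
        ∑b : ∑′ (_^ (β ℕ.+ (j ∸ s))) ≈ - 1#
        ∑b = ∑′-^-1 _ (ℕₚ.≤-trans 0<β (ℕₚ.m≤m+n β _)) (∣.∣-reflexive (≡.sym (≡.trans (≡.cong (β ℕ.+_) j∸s) β+ρ)))
        exponent≡0 : d ℕ.* s ℕ.+ (j ∸ s) ≡ 0 mod r
        exponent≡0 = mod-trans (mod-+ (mod-*ʳ s d≡D) (mod-reflexive j∸s))
          (∣⇒mod (∣.∣-reflexive (≡.trans r≡ (≡.trans (ℕₚ.+-comm ρ (s ℕ.* D)) (≡.cong (ℕ._+ ρ) (ℕₚ.*-comm s D))))))
        0<d : 0 ℕ.< d
        0<d = Planar⇒0< d planar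
        ∑x : ∑′ (_^ (d ℕ.* s ℕ.+ (j ∸ s))) ≈ - 1#
        ∑x = ∑′-^-1 _ (ℕₚ.≤-trans (ℕₚ.*-mono-< 0<d 0<s) (ℕₚ.m≤m+n _ _)) (mod⇒∣ exponent≡0)
        others : ∀ t → t ℕ.< suc j → All (t ≢_) (s ∷ []) → term t ≈ 0#
        others t (s≤s t≤j) (t≢s ∷ []) = trans (*-congˡ (trans (*-congʳ (∑′-^-0 _ (∣-between
          (ℕₚ.≤-trans 0<β (ℕₚ.m≤m+n β _))
          (ℕₚ.+-mono-≤-< (ℕₚ.m∸n≤m r ρ) (ℕₚ.≤-<-trans (ℕₚ.m∸n≤m j t) j<r))
          (λ eq → t≢s (ℕₚ.∸-cancelˡ-≡ t≤j (ℕₚ.m≤m+n s ρ)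
            (≡.trans (ℕₚ.+-cancelˡ-≡ β _ _ (≡.trans eq (≡.sym β+ρ))) (≡.sym j∸s))))))) (zeroˡ _))) (zeroʳ _)

      private
        f≈ : ∀ {D} → 0 ℕ.< D → d ≡ D mod r → ∀ {x} → Fixed x → x ^ d ≈ x ^ D
        f≈ 0<D d≡D = ^-periodic (Planar⇒0< d planar) 0<D d≡D

        -- The residues 0, 1 and 3 of d are ruled out by explicit collisions for α = 1: between the
        -- points 1 and 2, the points 0 and 1, and the points 0 and -1.
        collision : ∀ {x y} → D d 1# x ≈ D d 1# y → x ≈ y
        collision = proj₁ (planar 1# (0≉1 ∘ sym))

        r∤d : ¬ r ∣ d
        r∤d (divides g d≡gr) = 0≉1 (sym (x-y≈0⇒x≈y (begin
          1# - 0#                    ≈⟨ solve 1 (λ o → o :- con (ℤ.+ 0) := (o :+ (o :+ con (ℤ.+ 0))) :- o) refl 1# ⟩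
          ⟦ 2 ⟧ - 1#                 ≈⟨ x≈y⇒x∙y⁻¹≈ε (collision (trans (const (⟦⟧≉0 (s≤s z≤n) 2<p) (Fixed-⟦⟧ 2) 3≉0 (Fixed-+ (Fixed-⟦⟧ 2) Fixed-1)) (sym (const (0≉1 ∘ sym) Fixed-1 2≉0 (Fixed-+ Fixed-1 Fixed-1))))) ⟩
          0#                         ∎)))
          where
          2<p : 2 ℕ.< p
          2<p = ℕₚ.≤-trans (s≤s (s≤s (s≤s z≤n))) 5<p
          2≉0 : 1# + 1# ≉ 0#
          2≉0 eq = ⟦⟧≉0 {2} (s≤s z≤n) 2<p (trans (+-congˡ (+-identityʳ 1#)) eq)
          3≉0 : ⟦ 2 ⟧ + 1# ≉ 0#
          3≉0 eq = ⟦⟧≉0 {3} (s≤s z≤n) (ℕₚ.≤-trans (s≤s (s≤s (s≤s (s≤s z≤n)))) 5<p) (trans (+-comm 1# ⟦ 2 ⟧) eq)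
          unit : ∀ {x} → x ≉ 0# → Fixed x → x ^ d ≈ 1#
          unit {x} x≉0 fx = begin
            x ^ d            ≈⟨ ^-≡ x (≡.trans d≡gr (ℕₚ.*-comm g r)) ⟩
            x ^ (r ℕ.* g)    ≈⟨ ^-assocʳ x r g ⟨
            (x ^ r) ^ g      ≈⟨ ^-congˡ g (Fixed-⟦⟧≉0⇒^r≈1 fx x≉0) ⟩
            1# ^ g           ≈⟨ 1^ g ⟩
            1#               ∎
          const : ∀ {x} → x ≉ 0# → Fixed x → x + 1# ≉ 0# → Fixed (x + 1#) → D d 1# x ≈ 0#
          const x≉0 fx x+1≉0 fx+1 = x≈y⇒x∙y⁻¹≈ε (trans (unit x+1≉0 fx+1) (sym (unit x≉0 fx)))

        d≢1 : ¬ d ≡ 1 mod r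
        d≢1 d≡1 = 0≉1 (collision (begin
          (0# + 1#) ^ d - 0# ^ d    ≈⟨ +-cong (trans (^-congˡ d (+-identityˡ 1#)) (1^ d)) (-‿cong (trans (f≈ (s≤s z≤n) d≡1 Fixed-0) (*-identityʳ 0#))) ⟩
          1# - 0#                   ≈⟨ solve 1 (λ o → o :- con (ℤ.+ 0) := (o :+ o) :- o) refl 1# ⟩
          (1# + 1#) - 1#            ≈⟨ +-cong (trans (f≈ (s≤s z≤n) d≡1 (Fixed-+ Fixed-1 Fixed-1)) (*-identityʳ _)) (-‿cong (1^ d)) ⟨
          (1# + 1#) ^ d - 1# ^ d    ∎))

        d≢3 : ¬ d ≡ 3 mod r
        d≢3 d≡3 = 0≉1 (sym (trans (sym (-‿involutive 1#)) (trans (-‿cong (sym (collision (begin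
          (0# + 1#) ^ d - 0# ^ d     ≈⟨ +-cong (trans (^-congˡ d (+-identityˡ 1#)) (1^ d)) (-‿cong 0^d) ⟩
          1# - 0#                    ≈⟨ trans (+-congˡ -0#≈0#) (+-identityʳ 1#) ⟩
          1#                         ≈⟨ cube ⟩
          0# - (- 1#) ^ 3            ≈⟨ +-cong (trans (^-congˡ d (-‿inverseˡ 1#)) 0^d) (-‿cong (f≈ (s≤s z≤n) d≡3 F-1)) ⟨
          (- 1# + 1#) ^ d - (- 1#) ^ d   ∎)))) -0#≈0#)))
          where
          F-1 : Fixed (- 1#)
          F-1 = Fixed-resp (+-identityˡ _) (Fixed-- Fixed-0 Fixed-1)
          0^d : 0# ^ d ≈ 0#
          0^d = trans (f≈ (s≤s z≤n) d≡3 Fixed-0) (zeroˡ _)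
          cube : 1# ≈ 0# - (- 1#) ^ 3
          cube = sym (begin
            0# - (- 1#) * ((- 1#) * ((- 1#) * 1#))  ≈⟨ solve 1 (λ o → con (ℤ.+ 0) :- (:- o) :* ((:- o) :* ((:- o) :* o)) := o :* (o :* (o :* o))) refl 1# ⟩
            1# * (1# * (1# * 1#))                   ≈⟨ trans (*-identityˡ _) (trans (*-identityˡ _) (*-identityˡ _)) ⟩
            1#                                      ∎)

      planar⇒d≡2 : d ≡ 2 mod r
      planar⇒d≡2 = by-cases (d % r) ≡.refl
        where
        2<r : 2 ℕ.< r
        2<r = ℕₚ.≤-trans (s≤s (s≤s (s≤s z≤n))) 5≤r
        2<p : 2 ℕ.< p
        2<p = ℕₚ.≤-trans (s≤s (s≤s (s≤s z≤n))) 5<p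
        r-even : ∃ λ h → r ≡ h ℕ.+ h
        r-even with odd-prime pr 2<p
        ... | h , p≡ = h , ℕₚ.suc-injective (≡.trans r+1≡p (≡.trans p≡ (≡.cong (λ z → suc (h ℕ.+ z)) (ℕₚ.+-identityʳ h))))
        -- For 2D > r the second power sum would make C(D, r/2) vanish although D < p. For 2D ≤ r,
        -- division with remainder r = s D + ρ selects the moment of order s + ρ, and D ≥ 4, s ≥ 2
        -- give 2 (s + ρ) < r.
        large : ∀ D → 4 ℕ.≤ D → D ℕ.< r → d ≡ D mod r → ⊥
        large D 4≤D D<r d≡D with ℕₚ.≤-<-connex (D ℕ.+ D) r
        ... | inj₂ r<2D = ⟦nCk⟧≉0 D h h≤D (≡.subst (D ℕ.<_) r+1≡p (ℕₚ.m<n⇒m<1+n D<r))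
              (hermite₂ planar (Planar⇒0< d planar) (ℕₚ.≤-trans (s≤s z≤n) 4≤D) d≡D r≡h+h h≤D D<r
                (∣-between (ℕₚ.≤-<-trans z≤n r<2D) (ℕₚ.+-mono-< D<r D<r) (λ eq → ℕₚ.<-irrefl (≡.sym eq) r<2D))
                (∣-between (s≤s z≤n) (ℕₚ.<-≤-trans 2<r (ℕₚ.m≤m+n r r)) (λ eq → ℕₚ.<-irrefl eq 2<r))
                (⟦⟧≉0 (s≤s z≤n) 2<p))
          where
          h = proj₁ r-even
          r≡h+h = proj₂ r-even
          h≤D : h ℕ.≤ D
          h≤D with ℕₚ.≤-<-connex h D
          ... | inj₁ h≤D = h≤D
          ... | inj₂ D<h = ⊥-elim (ℕₚ.<-asym r<2D (≡.subst (D ℕ.+ D ℕ.<_) (≡.sym r≡h+h) (ℕₚ.+-mono-< D<h D<h)))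
        ... | inj₁ 2D≤r = moment-contradiction {D} {r / D} {r % D} d≡D r≡ (ℕₚ.≤-trans (s≤s z≤n) 2≤s) bound
          where
          instance
            D≢0 : NonZero D
            D≢0 = ℕ.>-nonZero (ℕₚ.≤-trans (s≤s z≤n) 4≤D)
          s = r / D
          ρ = r % D
          r≡ : r ≡ ρ ℕ.+ s ℕ.* D
          r≡ = m≡m%n+[m/n]*n r D
          ρ<D : ρ ℕ.< D
          ρ<D = m%n<n r D
          2≤s : 2 ℕ.≤ s
          2≤s with ℕₚ.≤-<-connex 2 s
          ... | inj₁ 2≤s = 2≤s
          ... | inj₂ (s≤s s≤1) = ⊥-elim (ℕₚ.<-irrefl (≡.sym r≡) (ℕₚ.<-≤-trans (ℕₚ.+-mono-<-≤ ρ<D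
                  (ℕₚ.≤-trans (ℕₚ.*-monoˡ-≤ D s≤1) (ℕₚ.≤-reflexive (ℕₚ.+-identityʳ D)))) 2D≤r))
          small : ∀ {s D ρ} → 2 ℕ.≤ s → 4 ℕ.≤ D → ρ ℕ.< D → s ℕ.+ s ℕ.+ ρ ℕ.< s ℕ.* D
          small {suc (suc s)} {suc (suc (suc (suc D)))} {ρ} (s≤s (s≤s _)) (s≤s (s≤s (s≤s (s≤s _)))) (s≤s ρ≤) = ℕₚ.≤-trans
            (s≤s (ℕₚ.+-monoʳ-≤ (suc (suc s) ℕ.+ suc (suc s)) ρ≤))
            (ℕₚ.≤-trans (ℕₚ.m≤m+n _ (s ℕ.+ s ℕ.+ (D ℕ.+ s ℕ.* D)))
              (ℕₚ.≤-reflexive (solve′ 2 (λ s D → con′ 1 :+′ ((con′ 2 :+′ s) :+′ (con′ 2 :+′ s) :+′ (con′ 3 :+′ D)) :+′ (s :+′ s :+′ (D :+′ s :*′ D))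
                 :=′ (con′ 2 :+′ s) :*′ (con′ 4 :+′ D)) ≡.refl s D)))
            where open +-*-Solver renaming (solve to solve′; con to con′; _:+_ to _:+′_; _:*_ to _:*′_; _:=_ to _:=′_)
          bound : (s ℕ.+ ρ) ℕ.+ (s ℕ.+ ρ) ℕ.< r
          bound = ≡.subst₂ ℕ._<_ (rearrange s ρ) (≡.sym (≡.trans r≡ (ℕₚ.+-comm ρ _)))
            (ℕₚ.+-monoˡ-< ρ (small 2≤s 4≤D ρ<D))
            where
            rearrange : ∀ s ρ → s ℕ.+ s ℕ.+ ρ ℕ.+ ρ ≡ (s ℕ.+ ρ) ℕ.+ (s ℕ.+ ρ)
            rearrange = solve′ 2 (λ s ρ → s :+′ s :+′ ρ :+′ ρ :=′ (s :+′ ρ) :+′ (s :+′ ρ)) ≡.refl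
              where open +-*-Solver renaming (solve to solve′; con to con′; _:+_ to _:+′_; _:*_ to _:*′_; _:=_ to _:=′_)
        by-cases : ∀ D → d % r ≡ D → d ≡ 2 mod r
        by-cases 0 eq = ⊥-elim (r∤d (∣.m%n≡0⇒n∣m d r eq))
        by-cases 1 eq = ⊥-elim (d≢1 (≡.subst (d ≡_mod r) eq (n%m≡n d r)))
        by-cases 2 eq = ≡.subst (d ≡_mod r) eq (n%m≡n d r)
        by-cases 3 eq = ⊥-elim (d≢3 (≡.subst (d ≡_mod r) eq (n%m≡n d r)))
        by-cases D@(suc (suc (suc (suc _)))) eq = ⊥-elim (large D (s≤s (s≤s (s≤s (s≤s z≤n))))
          (≡.subst (ℕ._< r) eq (m%n<n d r)) (≡.subst (d ≡_mod r) eq (n%m≡n d r)))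

  -- Manipulation of sums; binomial coefficients in characteristic p

  module Sums {c ℓ : Level} {q : ℕ} (F : FiniteField c ℓ q)
               {p : ℕ} (pr : Prime p) (n : ℕ) (q≡pⁿ : q ≡ p ℕ.^ n) where
    open FiniteField F
    open CharP F pr n q≡pⁿ
    open import Relation.Binary.Reasoning.Setoid setoid

    sgn : ℕ → Carrier
    sgn m = (- 1#) ^ m

    neg-^ : ∀ x m → (- x) ^ m ≈ sgn m * x ^ m
    neg-^ x m = trans (^-congˡ m (trans (-‿cong (sym (*-identityˡ x))) (-‿distribˡ-* 1# x))) (^-distrib-* (- 1#) x m)

    sgn-suc : ∀ m → sgn (suc m) ≈ - sgn m
    sgn-suc m = trans (sym (-‿distribˡ-* 1# (sgn m))) (-‿cong (*-identityˡ _))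

    sgn-even : ∀ m → sgn (m ℕ.+ m) ≈ 1#
    sgn-even zero    = refl
    sgn-even (suc m) = begin
      sgn (suc (m ℕ.+ suc m))    ≈⟨ ^-≡ (- 1#) (≡.cong suc (ℕₚ.+-suc m m)) ⟩
      sgn (suc (suc (m ℕ.+ m)))  ≈⟨ trans (sgn-suc (suc (m ℕ.+ m))) (-‿cong (sgn-suc (m ℕ.+ m))) ⟩
      - - sgn (m ℕ.+ m)          ≈⟨ -‿involutive _ ⟩
      sgn (m ℕ.+ m)              ≈⟨ sgn-even m ⟩
      1#                         ∎

    S-append : ∀ a b h → S (a ℕ.+ b) h ≈ S a h + S b (λ i → h (a ℕ.+ i))
    S-append zero    b h = sym (+-identityˡ _)
    S-append (suc a) b h = trans (+-congˡ (S-append a b (h ∘ suc))) (sym (+-assoc _ _ _))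

    S-extend : ∀ {a b} h → a ℕ.≤ b → (∀ i → a ℕ.≤ i → h i ≈ 0#) → S a h ≈ S b h
    S-extend {a} {b} h a≤b h≈0 = begin
      S a h                                          ≈⟨ +-identityʳ _ ⟨
      S a h + 0#                                     ≈⟨ +-congˡ (S-0 (b ∸ a) (λ i _ → h≈0 (a ℕ.+ i) (ℕₚ.m≤m+n a i))) ⟨
      S a h + S (b ∸ a) (λ i → h (a ℕ.+ i))          ≈⟨ S-append a (b ∸ a) h ⟨
      S (a ℕ.+ (b ∸ a)) h                            ≡⟨ ≡.cong (λ m → S m h) (ℕₚ.m+[n∸m]≡n a≤b) ⟩
      S b h                                          ∎

    S-reverse : ∀ m h → S m (λ i → h (m ∸ suc i)) ≈ S m h
    S-reverse zero    h = refl
    S-reverse (suc m) h = trans (+-congˡ (S-reverse m h)) (trans (+-comm _ _) (sym (S-last m h)))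

    S-even : ∀ m h → (∀ i → h (suc (i ℕ.+ i)) ≈ 0#) → S (suc (m ℕ.+ m)) h ≈ S (suc m) (λ i → h (i ℕ.+ i))
    S-even zero    h h≈0 = refl
    S-even (suc m) h h≈0 = begin
      S (suc (suc m ℕ.+ suc m)) h                      ≡⟨ ≡.cong (λ k → S (suc (suc k)) h) (ℕₚ.+-suc m m) ⟩
      S (suc (suc (suc (m ℕ.+ m)))) h                  ≈⟨ trans (S-last _ h) (+-congʳ (S-last _ h)) ⟩
      S (suc (m ℕ.+ m)) h + h (suc (m ℕ.+ m)) + h (suc (suc (m ℕ.+ m)))
        ≈⟨ +-cong (trans (+-cong (S-even m h h≈0) (h≈0 m)) (+-identityʳ _)) (reflexive (≡.cong (h ∘ suc) (≡.sym (ℕₚ.+-suc m m)))) ⟩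
      S (suc m) (λ i → h (i ℕ.+ i)) + h (suc m ℕ.+ suc m)   ≈⟨ S-last (suc m) (λ i → h (i ℕ.+ i)) ⟨
      S (suc (suc m)) (λ i → h (i ℕ.+ i))              ∎

    S-symmetric : ∀ m h → (∀ i → i ℕ.< m → h (m ℕ.+ suc i) ≈ h (m ∸ suc i)) →
                  S (suc (m ℕ.+ m)) h ≈ ⟦ 2 ⟧ * S m h + h m
    S-symmetric m h h-sym = begin
      S (suc (m ℕ.+ m)) h                            ≡⟨ ≡.cong (λ k → S k h) (≡.sym (ℕₚ.+-suc m m)) ⟩
      S (m ℕ.+ suc m) h                              ≈⟨ S-append m (suc m) h ⟩
      S m h + (h (m ℕ.+ 0) + S m (λ i → h (m ℕ.+ suc i)))
        ≈⟨ +-congˡ (+-cong (reflexive (≡.cong h (ℕₚ.+-identityʳ m))) (trans (S-cong m h-sym) (S-reverse m h))) ⟩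
      S m h + (h m + S m h)                          ≈⟨ solve 2 (λ s t → s :+ (t :+ s) := con (ℤ.+ 2) :* s :+ t) refl (S m h) (h m) ⟩
      ⟦ 2 ⟧ * S m h + h m                            ∎

    -- In characteristic p, (1 + X)^(p^k) = 1 + X^(p^k). Multiplication by it leaves coefficients of
    -- degree below p^k unchanged; `C-shift` describes the higher ones.
    C-periodic : ∀ k a M → M ℕ.< p ℕ.^ k → ⟦ (a ℕ.+ p ℕ.^ k) C M ⟧ ≈ ⟦ a C M ⟧
    C-shift : ∀ k a M → ⟦ (a ℕ.+ p ℕ.^ k) C (p ℕ.^ k ℕ.+ M) ⟧ ≈ ⟦ a C (p ℕ.^ k ℕ.+ M) ⟧ + ⟦ a C M ⟧

    C-periodic k a       zero    M<A = refl
    C-periodic k zero    (suc M) M<A = p∣⇒⟦⟧≈0 (p∣pᵏCi pr k (suc M) (s≤s z≤n) M<A)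
    C-periodic k (suc a) (suc M) M<A = begin
      ⟦ suc (a ℕ.+ A) C suc M ⟧                    ≈⟨ trans (⟦⟧-cong (pascal (a ℕ.+ A) M)) (⟦⟧-+ ((a ℕ.+ A) C M) _) ⟩
      ⟦ (a ℕ.+ A) C M ⟧ + ⟦ (a ℕ.+ A) C suc M ⟧    ≈⟨ +-cong (C-periodic k a M (ℕₚ.<-trans (ℕₚ.n<1+n M) M<A)) (C-periodic k a (suc M) M<A) ⟩
      ⟦ a C M ⟧ + ⟦ a C suc M ⟧                    ≈⟨ trans (⟦⟧-cong (pascal a M)) (⟦⟧-+ (a C M) _) ⟨
      ⟦ suc a C suc M ⟧                            ∎
      where A = p ℕ.^ k

    C-shift k zero zero = begin
      ⟦ A C (A ℕ.+ 0) ⟧             ≡⟨ ≡.cong (λ z → ⟦ A C z ⟧) (ℕₚ.+-identityʳ A) ⟩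
      ⟦ A C A ⟧                     ≡⟨ ≡.cong ⟦_⟧ (nCn≡1 A) ⟩
      ⟦ 1 ⟧                         ≈⟨ +-identityˡ _ ⟨
      0# + ⟦ 1 ⟧                    ≈⟨ +-congʳ (⟦⟧-cong (≡.sym (k>n⇒nCk≡0 0 (A ℕ.+ 0) (≡.subst (0 ℕ.<_) (≡.sym (ℕₚ.+-identityʳ A)) 0<A)))) ⟩
      ⟦ 0 C (A ℕ.+ 0) ⟧ + ⟦ 1 ⟧     ∎
      where
      A = p ℕ.^ k
      0<A : 0 ℕ.< A
      0<A = ℕₚ.m^n>0 p {{prime⇒nonZero pr}} k
        where open import Data.Nat.Primality using (prime⇒nonZero)
    C-shift k zero (suc M) = begin
      ⟦ A C (A ℕ.+ suc M) ⟧                  ≡⟨ ≡.cong ⟦_⟧ (k>n⇒nCk≡0 A _ (ℕₚ.m<m+n A (s≤s z≤n))) ⟩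
      0#                                     ≈⟨ +-identityˡ _ ⟨
      0# + 0#                                ≈⟨ +-congʳ (⟦⟧-cong (≡.sym (k>n⇒nCk≡0 0 (A ℕ.+ suc M) (ℕₚ.≤-trans (s≤s z≤n) (ℕₚ.m≤n+m (suc M) A))))) ⟩
      ⟦ 0 C (A ℕ.+ suc M) ⟧ + ⟦ 0 C suc M ⟧  ∎
      where A = p ℕ.^ k
    C-shift k (suc a) M with p ℕ.^ k in eq
    ... | zero  = ⊥-elim (ℕₚ.<-irrefl (≡.sym eq) (ℕₚ.m^n>0 p {{prime⇒nonZero pr}} k))
      where open import Data.Nat.Primality using (prime⇒nonZero)
    ... | suc A = begin
      ⟦ suc (a ℕ.+ suc A) C suc (A ℕ.+ M) ⟧
        ≈⟨ trans (⟦⟧-cong (pascal (a ℕ.+ suc A) (A ℕ.+ M))) (⟦⟧-+ ((a ℕ.+ suc A) C (A ℕ.+ M)) _) ⟩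
      ⟦ (a ℕ.+ suc A) C (A ℕ.+ M) ⟧ + ⟦ (a ℕ.+ suc A) C suc (A ℕ.+ M) ⟧
        ≈⟨ +-cong (lower M) (≡.subst (λ z → ⟦ (a ℕ.+ z) C (z ℕ.+ M) ⟧ ≈ ⟦ a C (z ℕ.+ M) ⟧ + ⟦ a C M ⟧) eq (C-shift k a M)) ⟩
      (⟦ a C (A ℕ.+ M) ⟧ + low M) + (⟦ a C suc (A ℕ.+ M) ⟧ + ⟦ a C M ⟧)
        ≈⟨ solve 4 (λ a b c d → (a :+ b) :+ (c :+ d) := (a :+ c) :+ (b :+ d)) refl _ _ _ _ ⟩
      (⟦ a C (A ℕ.+ M) ⟧ + ⟦ a C suc (A ℕ.+ M) ⟧) + (low M + ⟦ a C M ⟧)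
        ≈⟨ +-cong (trans (⟦⟧-cong (pascal a (A ℕ.+ M))) (⟦⟧-+ (a C (A ℕ.+ M)) _)) (upper M) ⟨
      ⟦ suc a C suc (A ℕ.+ M) ⟧ + ⟦ suc a C M ⟧ ∎
      where
      low : ℕ → Carrier
      low zero    = 0#
      low (suc M) = ⟦ a C M ⟧
      lower : ∀ M → ⟦ (a ℕ.+ suc A) C (A ℕ.+ M) ⟧ ≈ ⟦ a C (A ℕ.+ M) ⟧ + low M
      lower zero    = trans (≡.subst (λ z → ⟦ (a ℕ.+ z) C (A ℕ.+ 0) ⟧ ≈ ⟦ a C (A ℕ.+ 0) ⟧) eq
        (C-periodic k a (A ℕ.+ 0) (ℕₚ.≤-reflexive (≡.trans (≡.cong suc (ℕₚ.+-identityʳ A)) (≡.sym eq))))) (sym (+-identityʳ _))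
      lower (suc M) = ≡.subst (λ z → ⟦ (a ℕ.+ suc A) C z ⟧ ≈ ⟦ a C z ⟧ + ⟦ a C M ⟧) (≡.sym (ℕₚ.+-suc A M))
        (≡.subst (λ z → ⟦ (a ℕ.+ z) C (z ℕ.+ M) ⟧ ≈ ⟦ a C (z ℕ.+ M) ⟧ + ⟦ a C M ⟧) eq (C-shift k a M))
      upper : ∀ M → ⟦ suc a C M ⟧ ≈ low M + ⟦ a C M ⟧
      upper zero    = sym (+-identityˡ _)
      upper (suc M) = trans (⟦⟧-cong (pascal a M)) (⟦⟧-+ (a C M) _)

    -- One step of Lucas' theorem in base p^k. Only the low parts x and z are digits; the high parts
    -- a and b are arbitrary, so the same lemma splits off digits in base p, p^b and p^a.
    C-lucas : ∀ k a x b z → x ℕ.< p ℕ.^ k → z ℕ.< p ℕ.^ k →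
              ⟦ (a ℕ.* p ℕ.^ k ℕ.+ x) C (b ℕ.* p ℕ.^ k ℕ.+ z) ⟧ ≈ ⟦ a C b ⟧ * ⟦ x C z ⟧
    C-lucas k zero    x zero    z x<A z<A = sym (trans (*-congʳ (+-identityʳ 1#)) (*-identityˡ _))
    C-lucas k zero    x (suc b) z x<A z<A = trans
      (⟦⟧-cong (k>n⇒nCk≡0 x _ (ℕₚ.<-≤-trans x<A (ℕₚ.≤-trans (ℕₚ.m≤m+n _ (b ℕ.* p ℕ.^ k)) (ℕₚ.m≤m+n _ z)))))
      (sym (zeroˡ _))
    C-lucas k (suc a) x zero    z x<A z<A = begin
      ⟦ (A ℕ.+ a ℕ.* A ℕ.+ x) C z ⟧    ≡⟨ ≡.cong (λ m → ⟦ m C z ⟧) (≡.trans (ℕₚ.+-assoc A _ x) (ℕₚ.+-comm A _)) ⟩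
      ⟦ (a ℕ.* A ℕ.+ x ℕ.+ A) C z ⟧    ≈⟨ C-periodic k _ z z<A ⟩
      ⟦ (a ℕ.* A ℕ.+ x) C z ⟧          ≈⟨ C-lucas k a x 0 z x<A z<A ⟩
      ⟦ 1 ⟧ * ⟦ x C z ⟧                ∎
      where A = p ℕ.^ k
    C-lucas k (suc a) x (suc b) z x<A z<A = begin
      ⟦ (A ℕ.+ a ℕ.* A ℕ.+ x) C (A ℕ.+ b ℕ.* A ℕ.+ z) ⟧
        ≡⟨ ≡.cong₂ (λ m l → ⟦ m C l ⟧) (≡.trans (ℕₚ.+-assoc A _ x) (ℕₚ.+-comm A _)) (ℕₚ.+-assoc A _ z) ⟩
      ⟦ (a ℕ.* A ℕ.+ x ℕ.+ A) C (A ℕ.+ (b ℕ.* A ℕ.+ z)) ⟧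
        ≈⟨ C-shift k (a ℕ.* A ℕ.+ x) (b ℕ.* A ℕ.+ z) ⟩
      ⟦ (a ℕ.* A ℕ.+ x) C (A ℕ.+ (b ℕ.* A ℕ.+ z)) ⟧ + ⟦ (a ℕ.* A ℕ.+ x) C (b ℕ.* A ℕ.+ z) ⟧
        ≈⟨ +-cong (trans (⟦⟧-cong (≡.cong ((a ℕ.* A ℕ.+ x) C_) (≡.sym (ℕₚ.+-assoc A _ z)))) (C-lucas k a x (suc b) z x<A z<A)) (C-lucas k a x b z x<A z<A) ⟩
      ⟦ a C suc b ⟧ * ⟦ x C z ⟧ + ⟦ a C b ⟧ * ⟦ x C z ⟧
        ≈⟨ solve 3 (λ u v w → u :* w :+ v :* w := (v :+ u) :* w) refl _ _ _ ⟩
      (⟦ a C b ⟧ + ⟦ a C suc b ⟧) * ⟦ x C z ⟧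
        ≈⟨ *-congʳ (trans (⟦⟧-cong (pascal a b)) (⟦⟧-+ (a C b) _)) ⟨
      ⟦ suc a C suc b ⟧ * ⟦ x C z ⟧ ∎
      where A = p ℕ.^ k

    -- Modulo p^k, m is -N - 1, and (-1)^l C(-N - 1, l) = C(l + N, l). The induction on N reaches
    -- this by Pascal's rule without negative upper indices.
    C-reflect : ∀ k N m l → suc (m ℕ.+ N) ≡ p ℕ.^ k → l ℕ.≤ m → sgn l * ⟦ m C l ⟧ ≈ ⟦ (l ℕ.+ N) C N ⟧
    C-reflect k zero m l eq l≤m = begin
      sgn l * ⟦ m C l ⟧      ≈⟨ row l l≤m ⟩
      1#                     ≈⟨ +-identityʳ 1# ⟨
      ⟦ (l ℕ.+ 0) C 0 ⟧      ∎
      where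
      sm≡A : suc m ≡ p ℕ.^ k
      sm≡A = ≡.trans (≡.cong suc (≡.sym (ℕₚ.+-identityʳ m))) eq
      row : ∀ l → l ℕ.≤ m → sgn l * ⟦ m C l ⟧ ≈ 1#
      row zero    _   = trans (*-identityˡ _) (+-identityʳ 1#)
      row (suc l) l<m = begin
        sgn (suc l) * ⟦ m C suc l ⟧                 ≈⟨ *-congʳ (sgn-suc l) ⟩
        - sgn l * ⟦ m C suc l ⟧
          ≈⟨ solve 3 (λ s a b → (:- s) :* a := s :* b :- s :* (b :+ a)) refl (sgn l) ⟦ m C suc l ⟧ ⟦ m C l ⟧ ⟩
        sgn l * ⟦ m C l ⟧ - sgn l * (⟦ m C l ⟧ + ⟦ m C suc l ⟧)
          ≈⟨ +-cong (row l (ℕₚ.<⇒≤ l<m)) (-‿cong (*-congˡ (trans (sym (trans (⟦⟧-cong (pascal m l)) (⟦⟧-+ (m C l) _)))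
               (p∣⇒⟦⟧≈0 (≡.subst (λ z → p ∣ z C suc l) (≡.sym sm≡A) (p∣pᵏCi pr k (suc l) (s≤s z≤n) (≡.subst (suc l ℕ.<_) sm≡A (s≤s l<m)))))))) ⟩
        1# - sgn l * 0#                             ≈⟨ +-congˡ (trans (-‿cong (zeroʳ _)) -0#≈0#) ⟩
        1# + 0#                                     ≈⟨ +-identityʳ 1# ⟩
        1#                                          ∎
    C-reflect k (suc N) m zero    eq l≤m = trans (*-identityˡ _) (⟦⟧-cong (≡.sym (nCn≡1 (suc N))))
    C-reflect k (suc N) m (suc l) eq l<m = begin
      sgn (suc l) * ⟦ m C suc l ⟧
        ≈⟨ solve 4 (λ s t a b → t :* a := t :* (b :+ a) :- t :* b) refl (sgn l) (sgn (suc l)) ⟦ m C suc l ⟧ ⟦ m C l ⟧ ⟩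
      sgn (suc l) * (⟦ m C l ⟧ + ⟦ m C suc l ⟧) - sgn (suc l) * ⟦ m C l ⟧
        ≈⟨ +-cong (*-congˡ (sym (trans (⟦⟧-cong (pascal m l)) (⟦⟧-+ (m C l) _))))
             (trans (-‿cong (trans (*-congʳ (sgn-suc l)) (sym (-‿distribˡ-* _ _)))) (-‿involutive _)) ⟩
      sgn (suc l) * ⟦ suc m C suc l ⟧ + sgn l * ⟦ m C l ⟧
        ≈⟨ +-cong (C-reflect k N (suc m) (suc l) (≡.trans (≡.cong suc (≡.sym (ℕₚ.+-suc m N))) eq) (s≤s (ℕₚ.<⇒≤ l<m)))
                  (C-reflect k (suc N) m l eq (ℕₚ.<⇒≤ l<m)) ⟩
      ⟦ suc (l ℕ.+ N) C N ⟧ + ⟦ (l ℕ.+ suc N) C suc N ⟧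
        ≈⟨ +-congˡ (⟦⟧-cong (≡.cong (_C suc N) (ℕₚ.+-suc l N))) ⟩
      ⟦ suc (l ℕ.+ N) C N ⟧ + ⟦ suc (l ℕ.+ N) C suc N ⟧
        ≈⟨ trans (⟦⟧-cong (pascal (suc (l ℕ.+ N)) N)) (⟦⟧-+ (suc (l ℕ.+ N) C N) _) ⟨
      ⟦ suc (suc (l ℕ.+ N)) C suc N ⟧
        ≡⟨ ≡.cong (λ z → ⟦ suc z C suc N ⟧) (≡.sym (ℕₚ.+-suc l N)) ⟩
      ⟦ (suc l ℕ.+ suc N) C suc N ⟧ ∎

    Planar-periodic : ∀ {d d′} → Planar d → 0 ℕ.< d′ → d ≡ d′ mod (q ∸ 1) → Planar d′
    Planar-periodic {d} {d′} planar 0<d′ d≡d′ α α≉0 = bijective-resp (λ x → +-cong (same (x + α)) (-‿cong (same x))) (planar α α≉0)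
      where
      same : ∀ x → x ^ d ≈ x ^ d′
      same x = ^-periodic (Planar⇒0< d planar) 0<d′ d≡d′ (trans (^-≡ x suc[q∸1]≡q) (fermat-fixed x))

  -- The vanishing sum over a quadratic extension

  module Quadratic {c ℓ : Level} {q : ℕ} (F : FiniteField c ℓ q)
               {p : ℕ} (pr : Prime p) (n : ℕ) (q≡pⁿ : q ≡ p ℕ.^ n)
               (h u : ℕ) (u+1≡pʰ : suc u ≡ p ℕ.^ h) (0<u : 0 ℕ.< u)
               (H : ℕ) (u+2≡2H : u ℕ.+ 2 ≡ H ℕ.+ H)
               (u[u+2]∣q-1 : u ℕ.* (u ℕ.+ 2) ∣ q ∸ 1) where
    open FiniteField F
    open CharP F pr n q≡pⁿ
    open Sums F pr n q≡pⁿ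

    r₂ : ℕ
    r₂ = u ℕ.* (u ℕ.+ 2)

    Q : ℕ
    Q = suc u

    r₂+1≡Q*Q : suc r₂ ≡ Q ℕ.* Q
    r₂+1≡Q*Q = solve′ 1 (λ u → con′ 1 :+′ u :*′ (u :+′ con′ 2) :=′ (con′ 1 :+′ u) :*′ (con′ 1 :+′ u)) ≡.refl u
      where open +-*-Solver renaming (solve to solve′; con to con′; _:+_ to _:+′_; _:*_ to _:*′_; _:=_ to _:=′_)

    private
      r₂+1≡p : suc r₂ ≡ p ℕ.^ (h ℕ.+ h)
      r₂+1≡p = ≡.trans r₂+1≡Q*Q (≡.trans (≡.cong₂ ℕ._*_ u+1≡pʰ u+1≡pʰ) (≡.sym (ℕₚ.^-distribˡ-+-* p h h)))
      0<r₂ : 0 ℕ.< r₂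
      0<r₂ = ℕₚ.*-mono-< 0<u (ℕₚ.≤-trans (s≤s z≤n) (ℕₚ.m≤n+m 2 u))

    module L₁ = Subfield F pr n q≡pⁿ h u u+1≡pʰ 0<u (∣-trans (∣.m∣m*n (u ℕ.+ 2)) u[u+2]∣q-1)
    module L₂ = Subfield F pr n q≡pⁿ (h ℕ.+ h) r₂ r₂+1≡p 0<r₂ u[u+2]∣q-1
    open L₂ using () renaming (∑′ to ∑₂)
    open L₁ using (D; D-cong; D-Frob; Frob-+; Frob--; ^-comm)
    open import Relation.Binary.Reasoning.Setoid setoid

    Fixed₂⇒ : ∀ {x} → L₂.Fixed x → (x ^ Q) ^ Q ≈ x
    Fixed₂⇒ {x} fx = trans (^-assocʳ x Q Q) (trans (^-≡ x (≡.sym r₂+1≡Q*Q)) fx)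

    ⇒Fixed₂ : ∀ {x} → (x ^ Q) ^ Q ≈ x → L₂.Fixed x
    ⇒Fixed₂ {x} eq = trans (^-≡ x r₂+1≡Q*Q) (trans (sym (^-assocʳ x Q Q)) eq)

    ε : Carrier → Carrier
    ε x = x ^ Q - x

    φ : ℕ → Carrier → Carrier
    φ d x = (x ^ Q) ^ d - x ^ d

    module _ {d : ℕ} (planar : Planar d) where

      -- Conjugation gives D_k(x)^Q = D_(-k)(x^Q) = -D_k(x^Q - k). If this equals -D_k(x),
      -- injectivity of D_k yields x^Q - k = x.
      D-antisymmetric : ∀ {k} → k ≉ 0# → k ^ Q ≈ - k → ∀ x → D d k x ^ Q ≈ - D d k x → x ^ Q ≈ x + k
      D-antisymmetric {k} k≉0 kQ≈-k x DQ≈-D = begin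
        x ^ Q            ≈⟨ solve 2 (λ y k → y := (y :- k) :+ k) refl (x ^ Q) k ⟩
        (x ^ Q - k) + k  ≈⟨ +-congʳ (proj₁ (planar k k≉0) (begin
          D d k (x ^ Q - k)                          ≈⟨ +-congʳ (^-congˡ d (solve 2 (λ y k → (y :- k) :+ k := y) refl (x ^ Q) k)) ⟩
          (x ^ Q) ^ d - (x ^ Q - k) ^ d              ≈⟨ solve 2 (λ a b → a :- b := :- (b :- a)) refl _ _ ⟩
          - ((x ^ Q - k) ^ d - (x ^ Q) ^ d)          ≈⟨ -‿cong (D-cong d (sym kQ≈-k) refl) ⟩
          - D d (k ^ Q) (x ^ Q)                      ≈⟨ -‿cong (D-Frob d k x) ⟨
          - (D d k x ^ Q)                            ≈⟨ -‿cong DQ≈-D ⟩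
          - - D d k x                                ≈⟨ -‿involutive _ ⟩
          D d k x                                    ∎)) ⟩
        x + k            ∎

      antisymmetric-D : ∀ {k} → k ^ Q ≈ - k → ∀ x → x ^ Q ≈ x + k → D d k x ^ Q ≈ - D d k x
      antisymmetric-D {k} kQ≈-k x xQ≈x+k = begin
        D d k x ^ Q                            ≈⟨ D-Frob d k x ⟩
        D d (k ^ Q) (x ^ Q)                    ≈⟨ D-cong d kQ≈-k xQ≈x+k ⟩
        (x + k - k) ^ d - (x + k) ^ d          ≈⟨ +-congʳ (^-congˡ d (solve 2 (λ y k → (y :+ k) :- k := y) refl x k)) ⟩
        x ^ d - (x + k) ^ d                    ≈⟨ solve 2 (λ a b → a :- b := :- (b :- a)) refl _ _ ⟩
        - D d k x                              ∎

      module _ {m : ℕ} (0<m : 0 ℕ.< m) (m<u : m ℕ.< u) where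

        private
          g : Carrier → Carrier
          g z = δ (z ^ Q) (- z) * z ^ m

          g-cong : Cong g
          g-cong x≈y = *-cong (δ-cong (^-congˡ Q x≈y) (-‿cong x≈y)) (^-congˡ m x≈y)

          ∑g≈0 : ∑ᴷ g ≈ 0#
          ∑g≈0 = L₁.∑′-scale-0 {m} g g-cong 0<m m<u (λ {t} {x} t≉0 ft → begin
            δ ((t * x) ^ Q) (- (t * x)) * (t * x) ^ m    ≈⟨ *-cong (δ-⇔ (λ eq → *-cancelˡ t≉0 (trans (*-congʳ (sym ft)) (trans (sym (^-distrib-* t x Q)) (trans eq (-‿distribʳ-* t x)))))
                                                                         (λ eq → trans (^-distrib-* t x Q) (trans (*-cong ft eq) (sym (-‿distribʳ-* t x)))))
                                                               (^-distrib-* t x m) ⟩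
            δ (x ^ Q) (- x) * (t ^ m * x ^ m)            ≈⟨ solve 3 (λ a b c → a :* (b :* c) := b :* (a :* c)) refl _ _ _ ⟩
            t ^ m * g x                                  ∎)

        ∑-fibre≈0 : ∀ {k} → k ≉ 0# → k ^ Q ≈ - k → ∑ᴷ (λ x → δ (x ^ Q) (x + k) * D d k x ^ m) ≈ 0#
        ∑-fibre≈0 {k} k≉0 kQ≈-k = begin
          ∑ᴷ (λ x → δ (x ^ Q) (x + k) * D d k x ^ m)   ≈⟨ ∑ᴷ-cong (λ x → *-congʳ (δ-⇔ (antisymmetric-D kQ≈-k x) (D-antisymmetric k≉0 kQ≈-k x))) ⟩
          ∑ᴷ (λ x → g (D d k x))                       ≈⟨ ∑ᴷ-reindex {D d k} {g} (D-cong d refl) (planar k k≉0) g-cong ⟩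
          ∑ᴷ g                                         ≈⟨ ∑g≈0 ⟩
          0#                                           ∎

        -- The terms are grouped by k = x^Q - x. Over the field of Q² elements k^Q = -k holds
        -- automatically, and x^Q = x + k turns `φ d x` into D_k(x), so each fibre with k ≠ 0 sums
        -- to 0. The fibre k = 0 drops out because N > 0.
        key-sum : ∀ {N} → 0 ℕ.< N → ∑₂ (λ x → φ d x ^ m * ε x ^ N) ≈ 0#
        key-sum {suc N′} _ = begin
          ∑₂ (λ x → φ d x ^ m * ε x ^ N)                              ≈⟨ ∑ᴷ-cong (λ x → sym (fibre x)) ⟩
          ∑ᴷ (λ x → ∑ᴷ (λ k → δ (ε x) k * w x k))                     ≈⟨ ∑ᴷ-swap (λ x k → δ (ε x) k * w x k) ⟩
          ∑ᴷ (λ k → ∑ᴷ (λ x → δ (ε x) k * w x k))                     ≈⟨ ∑ᴷ-0 inner ⟩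
          0#                                                          ∎
          where
          N = suc N′
          ι : Carrier → Carrier
          ι x = δ (x ^ suc r₂) x
          w : Carrier → Carrier → Carrier
          w x k = ι x * (D d k x ^ m * k ^ N)
          fibre : ∀ x → ∑ᴷ (λ k → δ (ε x) k * w x k) ≈ ι x * (φ d x ^ m * ε x ^ N)
          fibre x = trans (∑ᴷ-δ (ε x) {w x} (λ {k} {k′} k≈ → *-congˡ (*-cong (^-congˡ m (D-cong d k≈ refl)) (^-congˡ N k≈))))
            (*-congˡ (*-congʳ (^-congˡ m (+-congʳ (^-congˡ d (solve 2 (λ y x → x :+ (y :- x) := y) refl (x ^ Q) x))))))
          two-deltas : ∀ k x → k ^ Q ≈ - k → δ (ε x) k * ι x ≈ δ (x ^ Q) (x + k)
          two-deltas k x kQ≈-k with x ^ Q ≟ x + k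
          ... | yes eq = trans (*-cong (δ-yes εx≈k) (δ-yes (⇒Fixed₂ xQQ≈x))) (trans (*-identityʳ 1#) (sym (δ-yes eq)))
            where
            εx≈k : ε x ≈ k
            εx≈k = trans (+-congʳ eq) (solve 2 (λ x k → (x :+ k) :- x := k) refl x k)
            xQQ≈x : (x ^ Q) ^ Q ≈ x
            xQQ≈x = trans (^-congˡ Q eq) (trans (Frob-+ x k) (trans (+-cong eq kQ≈-k) (solve 2 (λ x k → (x :+ k) :- k := x) refl x k)))
          ... | no neq = trans (trans (*-congʳ (δ-no (λ εx≈k → neq (trans (solve 2 (λ y x → y := x :+ (y :- x)) refl (x ^ Q) x) (+-congˡ εx≈k))))) (zeroˡ _)) (sym (δ-no neq))
          inner : ∀ k → ∑ᴷ (λ x → δ (ε x) k * w x k) ≈ 0#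
          inner k with k ≟ 0# | k ^ Q ≟ - k
          ... | yes k≈0 | _ = ∑ᴷ-0 (λ x → trans (*-congˡ (trans (*-congˡ (trans (*-congˡ (0^[1+n] N′ k≈0)) (zeroʳ _))) (zeroʳ _))) (zeroʳ _))
          ... | no k≉0 | yes kQ≈-k = begin
            ∑ᴷ (λ x → δ (ε x) k * w x k)                                ≈⟨ ∑ᴷ-cong (λ x → trans (solve 4 (λ a i d k → a :* (i :* (d :* k)) := k :* ((a :* i) :* d)) refl _ _ _ _) (*-congˡ (*-congʳ (two-deltas k x kQ≈-k)))) ⟩
            ∑ᴷ (λ x → k ^ N * (δ (x ^ Q) (x + k) * D d k x ^ m))        ≈⟨ ∑ᴷ-*ˡ (k ^ N) _ ⟩
            k ^ N * ∑ᴷ (λ x → δ (x ^ Q) (x + k) * D d k x ^ m)          ≈⟨ *-congˡ (∑-fibre≈0 k≉0 kQ≈-k) ⟩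
            k ^ N * 0#                                                  ≈⟨ zeroʳ _ ⟩
            0#                                                          ∎
          ... | no k≉0 | no kQ≉-k = ∑ᴷ-0 (λ x → trans (sym (*-assoc _ _ _)) (trans (*-congʳ (empty x)) (zeroˡ _)))
            where
            empty : ∀ x → δ (ε x) k * ι x ≈ 0#
            empty x with ε x ≟ k | x ^ suc r₂ ≟ x
            ... | no neq | _ = trans (*-congʳ (δ-no neq)) (zeroˡ _)
            ... | yes _ | no neq = trans (*-congˡ (δ-no neq)) (zeroʳ _)
            ... | yes εx≈k | yes fx = ⊥-elim (kQ≉-k (begin
              k ^ Q                   ≈⟨ ^-congˡ Q εx≈k ⟨
              (x ^ Q - x) ^ Q         ≈⟨ Frob-- _ _ ⟩
              (x ^ Q) ^ Q - x ^ Q     ≈⟨ +-congʳ (Fixed₂⇒ fx) ⟩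
              x - x ^ Q               ≈⟨ solve 2 (λ a b → a :- b := :- (b :- a)) refl _ _ ⟩
              - ε x                   ≈⟨ -‿cong εx≈k ⟩
              - k                     ∎))

  halve : ∀ {a b} → a ℕ.+ a ≡ b ℕ.+ b → a ≡ b
  halve {a} {b} eq = ℕₚ.*-cancelˡ-≡ a b 2
    (≡.trans (≡.cong (a ℕ.+_) (ℕₚ.+-identityʳ a)) (≡.trans eq (≡.sym (≡.cong (b ℕ.+_) (ℕₚ.+-identityʳ b)))))

  even≢odd : ∀ a b → a ℕ.+ a ≢ suc (b ℕ.+ b)
  even≢odd (suc a) zero    eq with ≡.trans (≡.sym (ℕₚ.+-suc a a)) (ℕₚ.suc-injective eq)
  ... | ()
  even≢odd (suc a) (suc b) eq = even≢odd a b (ℕₚ.suc-injective (≡.trans (≡.sym (ℕₚ.+-suc a a))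
    (≡.trans (ℕₚ.suc-injective eq) (≡.cong suc (ℕₚ.+-suc b b)))))

  mod-halve : ∀ {m a b} → a ℕ.+ a ≡ b ℕ.+ b mod (m ℕ.+ m) → a ≡ b mod m
  mod-halve {m} {a} {b} (i , j , eq) = i , j , halve (begin
    (a ℕ.+ i ℕ.* m) ℕ.+ (a ℕ.+ i ℕ.* m)   ≡⟨ regroup a i m ⟩
    (a ℕ.+ a) ℕ.+ i ℕ.* (m ℕ.+ m)         ≡⟨ eq ⟩
    (b ℕ.+ b) ℕ.+ j ℕ.* (m ℕ.+ m)         ≡⟨ regroup b j m ⟨
    (b ℕ.+ j ℕ.* m) ℕ.+ (b ℕ.+ j ℕ.* m)   ∎)
    where
    open ≡.≡-Reasoning
    open +-*-Solver
    regroup : ∀ a i m → (a ℕ.+ i ℕ.* m) ℕ.+ (a ℕ.+ i ℕ.* m) ≡ (a ℕ.+ a) ℕ.+ i ℕ.* (m ℕ.+ m)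
    regroup = solve 3 (λ a i m → (a :+ i :* m) :+ (a :+ i :* m) := (a :+ a) :+ i :* (m :+ m)) ≡.refl

  mod-double : ∀ {m a b} → a ≡ b mod m → a ℕ.+ a ≡ b ℕ.+ b mod (m ℕ.+ m)
  mod-double {m} {a} {b} (i , j , eq) = i , j , (begin
    (a ℕ.+ a) ℕ.+ i ℕ.* (m ℕ.+ m)         ≡⟨ regroup a i m ⟨
    (a ℕ.+ i ℕ.* m) ℕ.+ (a ℕ.+ i ℕ.* m)   ≡⟨ ≡.cong₂ ℕ._+_ eq eq ⟩
    (b ℕ.+ j ℕ.* m) ℕ.+ (b ℕ.+ j ℕ.* m)   ≡⟨ regroup b j m ⟩
    (b ℕ.+ b) ℕ.+ j ℕ.* (m ℕ.+ m)         ∎)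
    where
    open ≡.≡-Reasoning
    open +-*-Solver
    regroup : ∀ a i m → (a ℕ.+ i ℕ.* m) ℕ.+ (a ℕ.+ i ℕ.* m) ≡ (a ℕ.+ a) ℕ.+ i ℕ.* (m ℕ.+ m)
    regroup = solve 3 (λ a i m → (a :+ i :* m) :+ (a :+ i :* m) := (a :+ a) :+ i :* (m :+ m)) ≡.refl

  -- The exponent of x in a term of the expansion is u W; this identity governs W modulo 2H = u + 2.
  weight-identity : ∀ μ J l l′ b → let u = (l ℕ.+ l′) ℕ.+ (J ℕ.+ J); H₂ = u ℕ.+ 2; d = 2 ℕ.+ suc μ ℕ.* u in
    (d ℕ.* l′ ℕ.+ b ℕ.+ 2 ℕ.+ suc μ ℕ.* (l ℕ.+ l′)) ℕ.+ (μ ℕ.+ μ) ℕ.* H₂ ℕ.+ (J ℕ.+ J)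
      ≡ b ℕ.+ suc μ ℕ.* suc l′ ℕ.* H₂ ℕ.+ (μ ℕ.* (l ℕ.+ suc J) ℕ.+ μ ℕ.* (l ℕ.+ suc J))
  weight-identity = solve 5 (λ μ J l l′ b →
    let u = (l :+ l′) :+ (J :+ J); H₂ = u :+ con 2; n = con 1 :+ μ; d = con 2 :+ n :* u in
    (d :* l′ :+ b :+ con 2 :+ n :* (l :+ l′)) :+ (μ :+ μ) :* H₂ :+ (J :+ J)
      := b :+ n :* (con 1 :+ l′) :* H₂ :+ (μ :* (l :+ (con 1 :+ J)) :+ μ :* (l :+ (con 1 :+ J)))) ≡.refl
    where open +-*-Solver

  -- The relations l + l′ + N = u and d ≡ 2 (mod u) make the exponent a multiple of u. The summand
  -- 2N is added on both sides so that b + b′ can be substituted without subtraction.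
  exponent-identity : ∀ μ N l l′ b b′ → b ℕ.+ b′ ≡ N ℕ.+ N → let u = (l ℕ.+ l′) ℕ.+ N; d = 2 ℕ.+ suc μ ℕ.* u in
    suc u ℕ.* (d ℕ.* l′ ℕ.+ b) ℕ.+ (d ℕ.* l ℕ.+ b′) ≡ u ℕ.* (d ℕ.* l′ ℕ.+ b ℕ.+ 2 ℕ.+ suc μ ℕ.* (l ℕ.+ l′))
  exponent-identity μ N l l′ b b′ b+b′≡2N = ℕₚ.+-cancelʳ-≡ (N ℕ.+ N) _ _ (begin
    lhs ℕ.+ (N ℕ.+ N)       ≡⟨ solve 6 (λ μ N l l′ b b′ →
        let u = (l :+ l′) :+ N; d = con 2 :+ (con 1 :+ μ) :* u in
        ((con 1 :+ u) :* (d :* l′ :+ b) :+ (d :* l :+ b′)) :+ (N :+ N)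
          := u :* (d :* l′ :+ b :+ con 2 :+ (con 1 :+ μ) :* (l :+ l′)) :+ (b :+ b′)) ≡.refl μ N l l′ b b′ ⟩
    rhs ℕ.+ (b ℕ.+ b′)      ≡⟨ ≡.cong (rhs ℕ.+_) b+b′≡2N ⟩
    rhs ℕ.+ (N ℕ.+ N)       ∎)
    where
    open ≡.≡-Reasoning
    open +-*-Solver
    u = (l ℕ.+ l′) ℕ.+ N
    d = 2 ℕ.+ suc μ ℕ.* u
    lhs = suc u ℕ.* (d ℕ.* l′ ℕ.+ b) ℕ.+ (d ℕ.* l ℕ.+ b′)
    rhs = u ℕ.* (d ℕ.* l′ ℕ.+ b ℕ.+ 2 ℕ.+ suc μ ℕ.* (l ℕ.+ l′))

  -- Expansion of the vanishing sum into binomial relations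

  module Expansion {c ℓ : Level} {q : ℕ} (F : FiniteField c ℓ q)
               {p : ℕ} (pr : Prime p) (n : ℕ) (q≡pⁿ : q ≡ p ℕ.^ n)
               (h u : ℕ) (u+1≡pʰ : suc u ≡ p ℕ.^ h) (0<u : 0 ℕ.< u)
               (H : ℕ) (u+2≡2H : u ℕ.+ 2 ≡ H ℕ.+ H)
               (u[u+2]∣q-1 : u ℕ.* (u ℕ.+ 2) ∣ q ∸ 1) where
    open FiniteField F
    open CharP F pr n q≡pⁿ
    open Sums F pr n q≡pⁿ
    open Quadratic F pr n q≡pⁿ h u u+1≡pʰ 0<u H u+2≡2H u[u+2]∣q-1
    open L₂ using () renaming (∑′ to ∑₂)
    open import Relation.Binary.Reasoning.Setoid setoid

    -- The two clauses on Λ evaluate it when the range 0 ≤ l < Q contains two solutions l, l + H of the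
    -- congruence, respectively only one.
    KeyAt : ℕ → ℕ → Set (c ⊔ ℓ)
    KeyAt e J = ∃ λ (Λ : ℕ → Carrier) →
      (⟦ 2 ⟧ * S J (λ r → ⟦ (N ℕ.+ N) C (r ℕ.+ r) ⟧ * Λ (J ∸ r)) + ⟦ (N ℕ.+ N) C N ⟧ * Λ 0 ≈ 0#) ×
      (∀ t l → t ℕ.≤ J → suc l ℕ.< H → l ℕ.+ suc J ≡ e ℕ.* t mod H →
         Λ t ≈ ⟦ (l ℕ.+ N) C N ⟧ + ⟦ (l ℕ.+ H ℕ.+ N) C N ⟧) ×
      (∀ t l → t ℕ.≤ J → suc l ≡ H → l ℕ.+ suc J ≡ e ℕ.* t mod H → Λ t ≈ ⟦ (l ℕ.+ N) C N ⟧)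
      where N = J ℕ.+ J

    Key : ℕ → Set (c ⊔ ℓ)
    Key e = ∀ J → 0 ℕ.< J → J ℕ.+ J ℕ.< u → KeyAt e J

    module _ {d μ : ℕ} (planar : Planar d) (d≡ : d ≡ 2 ℕ.+ suc μ ℕ.* u)
             {e : ℕ} (eμ≡1 : e ℕ.* μ ≡ 1 mod H)
             (J M : ℕ) (0<J : 0 ℕ.< J) (0<M : 0 ℕ.< M) (M+J+1≡H : M ℕ.+ suc J ≡ H) where

      private
        N N₂ m : ℕ
        N = J ℕ.+ J
        N₂ = N ℕ.+ N
        m = M ℕ.+ M

        m+N≡u : m ℕ.+ N ≡ u
        m+N≡u = ℕₚ.+-cancelʳ-≡ 2 _ _ (≡.trans (solve′ 2 (λ M J → ((M :+′ M) :+′ (J :+′ J)) :+′ con′ 2 :=′ (M :+′ (con′ 1 :+′ J)) :+′ (M :+′ (con′ 1 :+′ J))) ≡.refl M J)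
          (≡.trans (≡.cong₂ ℕ._+_ M+J+1≡H M+J+1≡H) (≡.sym u+2≡2H)))
          where open +-*-Solver renaming (solve to solve′; con to con′; _:+_ to _:+′_; _:*_ to _:*′_; _:=_ to _:=′_)

        0<N : 0 ℕ.< N
        0<N = ℕₚ.≤-trans 0<J (ℕₚ.m≤m+n J J)
        0<m : 0 ℕ.< m
        0<m = ℕₚ.≤-trans 0<M (ℕₚ.m≤m+n M M)
        m<u : m ℕ.< u
        m<u = ≡.subst (m ℕ.<_) m+N≡u (ℕₚ.m<m+n m 0<N)

        W : ℕ → ℕ → ℕ
        W l′ b = d ℕ.* l′ ℕ.+ b ℕ.+ 2 ℕ.+ suc μ ℕ.* m

        E : ℕ → ℕ → ℕ
        E l b = Q ℕ.* (d ℕ.* (m ∸ l) ℕ.+ b) ℕ.+ (d ℕ.* l ℕ.+ (N₂ ∸ b))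

        E≡uW : ∀ {l b} → l ℕ.≤ m → b ℕ.≤ N₂ → E l b ≡ u ℕ.* W (m ∸ l) b
        E≡uW {l} {b} l≤m b≤N₂ = ≡.subst₂ (λ v m′ → ∀ {d′} → d′ ≡ 2 ℕ.+ suc μ ℕ.* v →
            suc v ℕ.* (d′ ℕ.* (m ∸ l) ℕ.+ b) ℕ.+ (d′ ℕ.* l ℕ.+ (N₂ ∸ b)) ≡ v ℕ.* (d′ ℕ.* (m ∸ l) ℕ.+ b ℕ.+ 2 ℕ.+ suc μ ℕ.* m′))
          (≡.trans (≡.cong (ℕ._+ N) l+l′≡m) m+N≡u) l+l′≡m
          (λ { ≡.refl → exponent-identity μ N l (m ∸ l) b (N₂ ∸ b) (ℕₚ.m+[n∸m]≡n b≤N₂) }) d≡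
          where
          l+l′≡m : l ℕ.+ (m ∸ l) ≡ m
          l+l′≡m = ℕₚ.m+[n∸m]≡n l≤m

        W-identity : ∀ {l} → l ℕ.≤ m → ∀ b → W (m ∸ l) b ℕ.+ (μ ℕ.+ μ) ℕ.* (H ℕ.+ H) ℕ.+ N
          ≡ b ℕ.+ suc μ ℕ.* suc (m ∸ l) ℕ.* (H ℕ.+ H) ℕ.+ (μ ℕ.* (l ℕ.+ suc J) ℕ.+ μ ℕ.* (l ℕ.+ suc J))
        W-identity {l} l≤m b = ≡.subst (λ z → W (m ∸ l) b ℕ.+ (μ ℕ.+ μ) ℕ.* z ℕ.+ N
            ≡ b ℕ.+ suc μ ℕ.* suc (m ∸ l) ℕ.* z ℕ.+ (μ ℕ.* (l ℕ.+ suc J) ℕ.+ μ ℕ.* (l ℕ.+ suc J))) u+2≡2H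
          (≡.subst₂ (λ v m′ → ∀ {d′} → d′ ≡ 2 ℕ.+ suc μ ℕ.* v →
              (d′ ℕ.* (m ∸ l) ℕ.+ b ℕ.+ 2 ℕ.+ suc μ ℕ.* m′) ℕ.+ (μ ℕ.+ μ) ℕ.* (v ℕ.+ 2) ℕ.+ N
              ≡ b ℕ.+ suc μ ℕ.* suc (m ∸ l) ℕ.* (v ℕ.+ 2) ℕ.+ (μ ℕ.* (l ℕ.+ suc J) ℕ.+ μ ℕ.* (l ℕ.+ suc J)))
            (≡.trans (≡.cong (ℕ._+ N) l+l′≡m) m+N≡u) l+l′≡m
            (λ { ≡.refl → weight-identity μ J l (m ∸ l) b }) d≡)
          where
          l+l′≡m : l ℕ.+ (m ∸ l) ≡ m
          l+l′≡m = ℕₚ.m+[n∸m]≡n l≤m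

        W-mod : ∀ {l} → l ℕ.≤ m → ∀ b → W (m ∸ l) b ℕ.+ N ≡ b ℕ.+ (μ ℕ.* (l ℕ.+ suc J) ℕ.+ μ ℕ.* (l ℕ.+ suc J)) mod (H ℕ.+ H)
        W-mod {l} l≤m b = (μ ℕ.+ μ) , suc μ ℕ.* suc (m ∸ l) , ≡.trans (swap (W (m ∸ l) b) _ _) (≡.trans (W-identity l≤m b) (swap b _ _))
          where
          swap : ∀ x y z → x ℕ.+ z ℕ.+ y ≡ x ℕ.+ y ℕ.+ z
          swap x y z = ≡.trans (ℕₚ.+-assoc x z y) (≡.trans (≡.cong (x ℕ.+_) (ℕₚ.+-comm z y)) (≡.sym (ℕₚ.+-assoc x y z)))

        -- Divisibility of W by 2H for b = 2r and t = J - r, after halving. Multiplication by e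
        -- turns it into l + J + 1 ≡ e t (mod H).
        Class : ℕ → ℕ → Set
        Class l t = μ ℕ.* (l ℕ.+ suc J) ≡ t mod H

        class⇒∣ : ∀ {l r t} → l ℕ.≤ m → r ℕ.+ t ≡ J → Class l t → (u ℕ.+ 2) ∣ W (m ∸ l) (r ℕ.+ r)
        class⇒∣ {l} {r} {t} l≤m r+t≡J cl = ≡.subst (_∣ W (m ∸ l) (r ℕ.+ r)) (≡.sym u+2≡2H)
          (mod⇒∣ (mod-+-cancelˡ N (mod-trans (mod-reflexive (ℕₚ.+-comm N _)) (mod-trans (W-mod l≤m (r ℕ.+ r))
            (mod-trans (mod-+ {a = r ℕ.+ r} {r ℕ.+ r} (mod-reflexive ≡.refl) (mod-double cl)) (mod-reflexive
              (≡.trans (split r t) (≡.trans (≡.cong₂ ℕ._+_ r+t≡J r+t≡J) (≡.sym (ℕₚ.+-identityʳ N))))))))))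
          where
          split : ∀ r t → (r ℕ.+ r) ℕ.+ (t ℕ.+ t) ≡ (r ℕ.+ t) ℕ.+ (r ℕ.+ t)
          split = solve′ 2 (λ r t → (r :+′ r) :+′ (t :+′ t) :=′ (r :+′ t) :+′ (r :+′ t)) ≡.refl
            where open +-*-Solver renaming (solve to solve′; con to con′; _:+_ to _:+′_; _:*_ to _:*′_; _:=_ to _:=′_)

        ∣⇒class : ∀ {l r t} → l ℕ.≤ m → r ℕ.+ t ≡ J → (u ℕ.+ 2) ∣ W (m ∸ l) (r ℕ.+ r) → Class l t
        ∣⇒class {l} {r} {t} l≤m r+t≡J ∣W = mod-halve (mod-sym (mod-+-cancelˡ (r ℕ.+ r)
          (mod-trans (mod-reflexive (≡.trans (split r t) (≡.cong₂ ℕ._+_ r+t≡J r+t≡J)))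
            (mod-trans (mod-+ {a = 0} (mod-sym (∣⇒mod (≡.subst (_∣ W (m ∸ l) (r ℕ.+ r)) u+2≡2H ∣W))) (mod-reflexive ≡.refl))
              (W-mod l≤m (r ℕ.+ r))))))
          where
          split : ∀ r t → (r ℕ.+ r) ℕ.+ (t ℕ.+ t) ≡ (r ℕ.+ t) ℕ.+ (r ℕ.+ t)
          split = solve′ 2 (λ r t → (r :+′ r) :+′ (t :+′ t) :=′ (r :+′ t) :+′ (r :+′ t)) ≡.refl
            where open +-*-Solver renaming (solve to solve′; con to con′; _:+_ to _:+′_; _:*_ to _:*′_; _:=_ to _:=′_)

        -- Modulo the even number 2H, W + N has the parity of b, whereas N = 2J is even.
        odd-∤ : ∀ {l} → l ℕ.≤ m → ∀ i → ¬ (u ℕ.+ 2) ∣ W (m ∸ l) (suc (i ℕ.+ i))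
        odd-∤ {l} l≤m i ∣W with mod-trans (mod-+ {a = 0} {c = N} (mod-sym (∣⇒mod (≡.subst (_∣ W (m ∸ l) (suc (i ℕ.+ i))) u+2≡2H ∣W))) (mod-reflexive ≡.refl))
                                (W-mod l≤m (suc (i ℕ.+ i)))
        ... | a , b , eq = even≢odd (J ℕ.+ a ℕ.* H) (i ℕ.+ μ ℕ.* (l ℕ.+ suc J) ℕ.+ b ℕ.* H)
          (≡.trans (lhs J a H) (≡.trans eq (≡.cong suc (rhs i (μ ℕ.* (l ℕ.+ suc J)) b H))))
          where
          open +-*-Solver renaming (solve to solve′; con to con′; _:+_ to _:+′_; _:*_ to _:*′_; _:=_ to _:=′_)
          lhs : ∀ J a H → (J ℕ.+ a ℕ.* H) ℕ.+ (J ℕ.+ a ℕ.* H) ≡ (J ℕ.+ J) ℕ.+ a ℕ.* (H ℕ.+ H)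
          lhs = solve′ 3 (λ J a H → (J :+′ a :*′ H) :+′ (J :+′ a :*′ H) :=′ (J :+′ J) :+′ a :*′ (H :+′ H)) ≡.refl
          rhs : ∀ i z b H → ((i ℕ.+ i) ℕ.+ (z ℕ.+ z)) ℕ.+ b ℕ.* (H ℕ.+ H) ≡ (i ℕ.+ z ℕ.+ b ℕ.* H) ℕ.+ (i ℕ.+ z ℕ.+ b ℕ.* H)
          rhs = solve′ 4 (λ i z b H → ((i :+′ i) :+′ (z :+′ z)) :+′ b :*′ (H :+′ H) :=′ (i :+′ z :+′ b :*′ H) :+′ (i :+′ z :+′ b :*′ H)) ≡.refl

        PS-0 : ∀ {l b} → l ℕ.≤ m → b ℕ.≤ N₂ → ¬ (u ℕ.+ 2) ∣ W (m ∸ l) b → ∑₂ (_^ E l b) ≈ 0#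
        PS-0 {l} {b} l≤m b≤N₂ ∤W = L₂.∑′-^-0 (E l b) (λ ∣E → ∤W (∣.*-cancelˡ-∣ u {{ℕ.>-nonZero 0<u}} (≡.subst (r₂ ∣_) (E≡uW l≤m b≤N₂) ∣E)))

        PS-1 : ∀ {l b} → l ℕ.≤ m → b ℕ.≤ N₂ → (u ℕ.+ 2) ∣ W (m ∸ l) b → ∑₂ (_^ E l b) ≈ - 1#
        PS-1 {l} {b} l≤m b≤N₂ ∣W = L₂.∑′-^-1 (E l b)
          (≡.subst (0 ℕ.<_) (≡.sym (E≡uW l≤m b≤N₂)) (ℕₚ.*-mono-< {0} {u} {0} {W (m ∸ l) b} 0<u (ℕₚ.≤-trans (s≤s z≤n) (ℕₚ.≤-trans (ℕₚ.m≤n+m 2 (d ℕ.* (m ∸ l) ℕ.+ b)) (ℕₚ.m≤m+n (d ℕ.* (m ∸ l) ℕ.+ b ℕ.+ 2) (suc μ ℕ.* m))))))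
          (≡.subst (r₂ ∣_) (≡.sym (E≡uW l≤m b≤N₂)) (∣.*-monoʳ-∣ u ∣W))

        R : ℕ → Carrier
        R b = ∑₂ (λ x → φ d x ^ m * ((x ^ Q) ^ b * x ^ (N₂ ∸ b)))

        term : ℕ → ℕ → Carrier
        term b l = (sgn l * ⟦ m C l ⟧) * ∑₂ (_^ E l b)

        R-expansion : ∀ b → R b ≈ S (suc m) (term b)
        R-expansion b = begin
          R b ≈⟨ L₂.∑′-cong (λ x _ → expand x) ⟩
          ∑₂ (λ x → S (suc m) (λ l → (sgn l * ⟦ m C l ⟧) * x ^ E l b)) ≈⟨ L₂.∑′-S (suc m) (λ x l → (sgn l * ⟦ m C l ⟧) * x ^ E l b) ⟩
          S (suc m) (λ l → ∑₂ (λ x → (sgn l * ⟦ m C l ⟧) * x ^ E l b)) ≈⟨ S-cong (suc m) (λ l _ → L₂.∑′-*ˡ (sgn l * ⟦ m C l ⟧) (_^ E l b)) ⟩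
          S (suc m) (term b) ∎
          where
          monomial-term : ∀ x l → ((x ^ Q) ^ b * x ^ (N₂ ∸ b)) * (⟦ m C l ⟧ * ((- (x ^ d)) ^ l * ((x ^ Q) ^ d) ^ (m ∸ l))) ≈ (sgn l * ⟦ m C l ⟧) * x ^ E l b
          monomial-term x l = begin
            ((x ^ Q) ^ b * x ^ (N₂ ∸ b)) * (⟦ m C l ⟧ * ((- (x ^ d)) ^ l * ((x ^ Q) ^ d) ^ (m ∸ l)))
              ≈⟨ *-congˡ (*-congˡ (*-cong (trans (neg-^ (x ^ d) l) (*-congˡ (^-assocʳ x d l))) (^-assocʳ (x ^ Q) d (m ∸ l)))) ⟩
            ((x ^ Q) ^ b * x ^ (N₂ ∸ b)) * (⟦ m C l ⟧ * ((sgn l * x ^ (d ℕ.* l)) * (x ^ Q) ^ (d ℕ.* (m ∸ l))))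
              ≈⟨ solve 6 (λ B b′ c s y Y → (B :* b′) :* (c :* ((s :* y) :* Y)) := (s :* c) :* ((Y :* B) :* (y :* b′))) refl _ _ _ _ _ _ ⟩
            (sgn l * ⟦ m C l ⟧) * (((x ^ Q) ^ (d ℕ.* (m ∸ l)) * (x ^ Q) ^ b) * (x ^ (d ℕ.* l) * x ^ (N₂ ∸ b)))
              ≈⟨ *-congˡ (*-cong (trans (sym (^-homo-* (x ^ Q) (d ℕ.* (m ∸ l)) b)) (^-assocʳ x Q (d ℕ.* (m ∸ l) ℕ.+ b))) (sym (^-homo-* x (d ℕ.* l) (N₂ ∸ b)))) ⟩
            (sgn l * ⟦ m C l ⟧) * (x ^ (Q ℕ.* (d ℕ.* (m ∸ l) ℕ.+ b)) * x ^ (d ℕ.* l ℕ.+ (N₂ ∸ b)))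
              ≈⟨ *-congˡ (^-homo-* x (Q ℕ.* (d ℕ.* (m ∸ l) ℕ.+ b)) _) ⟨
            (sgn l * ⟦ m C l ⟧) * x ^ E l b ∎
          expand : ∀ x → φ d x ^ m * ((x ^ Q) ^ b * x ^ (N₂ ∸ b)) ≈ S (suc m) (λ l → (sgn l * ⟦ m C l ⟧) * x ^ E l b)
          expand x = begin
            φ d x ^ m * ((x ^ Q) ^ b * x ^ (N₂ ∸ b))  ≈⟨ *-comm _ _ ⟩
            ((x ^ Q) ^ b * x ^ (N₂ ∸ b)) * φ d x ^ m  ≈⟨ *-congˡ (trans (^-congˡ m (+-comm _ _)) (binomial m (- (x ^ d)) ((x ^ Q) ^ d))) ⟩
            ((x ^ Q) ^ b * x ^ (N₂ ∸ b)) * S (suc m) (λ l → ⟦ m C l ⟧ * ((- (x ^ d)) ^ l * ((x ^ Q) ^ d) ^ (m ∸ l)))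
              ≈⟨ S-*ˡ (suc m) _ (λ l → ⟦ m C l ⟧ * ((- (x ^ d)) ^ l * ((x ^ Q) ^ d) ^ (m ∸ l))) ⟨
            S (suc m) (λ l → ((x ^ Q) ^ b * x ^ (N₂ ∸ b)) * (⟦ m C l ⟧ * ((- (x ^ d)) ^ l * ((x ^ Q) ^ d) ^ (m ∸ l))))
              ≈⟨ S-cong (suc m) (λ l _ → monomial-term x l) ⟩
            S (suc m) (λ l → (sgn l * ⟦ m C l ⟧) * x ^ E l b) ∎

        R-odd : ∀ i → suc (i ℕ.+ i) ℕ.≤ N₂ → R (suc (i ℕ.+ i)) ≈ 0#
        R-odd i b≤N₂ = trans (R-expansion (suc (i ℕ.+ i))) (S-0 (suc m) {term (suc (i ℕ.+ i))} (λ { l (s≤s l≤m) →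
          trans (*-congˡ (PS-0 {l} {suc (i ℕ.+ i)} l≤m b≤N₂ (odd-∤ l≤m i))) (zeroʳ _) }))

        -- Substitute x^Q for x. On the field of Q² elements this exchanges x and x^Q and changes
        -- the sign of φ, which is invisible because the exponent m = 2M is even.
        R-symmetric : ∀ {b b′} → b ℕ.+ b′ ≡ N₂ → R b ≈ R b′
        R-symmetric {b} {b′} b+b′≡N₂ = begin
          R b                                                      ≈⟨ L₂.∑′-cong (λ x fx → conjugate x fx) ⟩
          ∑₂ (λ x → w′ (x ^ Q))                                    ≈⟨ L₂.∑′-reindex {_^ Q} {w′} (^-congˡ Q) L₁.Frob-bijective (L₂.Fixed-^ Q) unfix w′-cong ⟩
          R b′                                                     ∎
          where
          w′ : Carrier → Carrier
          w′ x = φ d x ^ m * ((x ^ Q) ^ b′ * x ^ (N₂ ∸ b′))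
          φ-cong : ∀ {x y} → x ≈ y → φ d x ≈ φ d y
          φ-cong x≈y = +-cong (^-congˡ d (^-congˡ Q x≈y)) (-‿cong (^-congˡ d x≈y))
          w′-cong : Cong w′
          w′-cong x≈y = *-cong (^-congˡ m (φ-cong x≈y)) (*-cong (^-congˡ b′ (^-congˡ Q x≈y)) (^-congˡ (N₂ ∸ b′) x≈y))
          unfix : ∀ {x} → L₂.Fixed (x ^ Q) → L₂.Fixed x
          unfix {x} fxQ = proj₁ L₁.Frob-bijective (trans (L₁.^-comm x (suc r₂) Q) fxQ)
          N₂∸b : N₂ ∸ b ≡ b′
          N₂∸b = ≡.trans (≡.cong (_∸ b) (≡.sym b+b′≡N₂)) (ℕₚ.m+n∸m≡n b b′)
          N₂∸b′ : N₂ ∸ b′ ≡ b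
          N₂∸b′ = ≡.trans (≡.cong (_∸ b′) (≡.sym b+b′≡N₂)) (ℕₚ.m+n∸n≡m b b′)
          conjugate : ∀ x → L₂.Fixed x → φ d x ^ m * ((x ^ Q) ^ b * x ^ (N₂ ∸ b)) ≈ w′ (x ^ Q)
          conjugate x fx = sym (begin
            φ d (x ^ Q) ^ m * (((x ^ Q) ^ Q) ^ b′ * (x ^ Q) ^ (N₂ ∸ b′))
              ≈⟨ *-cong (trans (^-congˡ m φ≈) (trans (neg-^ (φ d x) m) (trans (*-congʳ (sgn-even M)) (*-identityˡ _))))
                        (*-cong (^-congˡ b′ (Fixed₂⇒ fx)) (^-≡ (x ^ Q) N₂∸b′)) ⟩
            φ d x ^ m * (x ^ b′ * (x ^ Q) ^ b)    ≈⟨ *-congˡ (trans (*-comm _ _) (*-congˡ (^-≡ x (≡.sym N₂∸b)))) ⟩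
            φ d x ^ m * ((x ^ Q) ^ b * x ^ (N₂ ∸ b)) ∎)
            where
            φ≈ : φ d (x ^ Q) ≈ - φ d x
            φ≈ = trans (+-congʳ (^-congˡ d (Fixed₂⇒ fx))) (solve 2 (λ a b → a :- b := :- (b :- a)) refl _ _)

        g : ℕ → Carrier
        g b = ⟦ N₂ C b ⟧ * (sgn (N₂ ∸ b) * R b)

        ∑g≈0 : S (suc N₂) g ≈ 0#
        ∑g≈0 = begin
          S (suc N₂) g                                                              ≈⟨ S-cong (suc N₂) (λ b _ → separate b) ⟨
          S (suc N₂) (λ b → ∑₂ (λ x → φ d x ^ m * (⟦ N₂ C b ⟧ * ((x ^ Q) ^ b * (- x) ^ (N₂ ∸ b)))))
            ≈⟨ L₂.∑′-S (suc N₂) (λ x b → φ d x ^ m * (⟦ N₂ C b ⟧ * ((x ^ Q) ^ b * (- x) ^ (N₂ ∸ b)))) ⟨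
          ∑₂ (λ x → S (suc N₂) (λ b → φ d x ^ m * (⟦ N₂ C b ⟧ * ((x ^ Q) ^ b * (- x) ^ (N₂ ∸ b)))))
            ≈⟨ L₂.∑′-cong (λ x _ → trans (S-*ˡ (suc N₂) (φ d x ^ m) (λ b → ⟦ N₂ C b ⟧ * ((x ^ Q) ^ b * (- x) ^ (N₂ ∸ b)))) (*-congˡ (sym (binomial N₂ (x ^ Q) (- x))))) ⟩
          ∑₂ (λ x → φ d x ^ m * ε x ^ N₂)                                           ≈⟨ key-sum {d} planar {m} 0<m m<u {N₂} (ℕₚ.≤-trans 0<N (ℕₚ.m≤m+n N N)) ⟩
          0#                                                                        ∎
          where
          separate : ∀ b → ∑₂ (λ x → φ d x ^ m * (⟦ N₂ C b ⟧ * ((x ^ Q) ^ b * (- x) ^ (N₂ ∸ b)))) ≈ g b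
          separate b = begin
            ∑₂ (λ x → φ d x ^ m * (⟦ N₂ C b ⟧ * ((x ^ Q) ^ b * (- x) ^ (N₂ ∸ b))))
              ≈⟨ L₂.∑′-cong (λ x _ → trans (*-congˡ (*-congˡ (*-congˡ (neg-^ x (N₂ ∸ b)))))
                   (solve 5 (λ f c X s y → f :* (c :* (X :* (s :* y))) := (c :* s) :* (f :* (X :* y))) refl _ _ _ _ _)) ⟩
            ∑₂ (λ x → (⟦ N₂ C b ⟧ * sgn (N₂ ∸ b)) * (φ d x ^ m * ((x ^ Q) ^ b * x ^ (N₂ ∸ b))))
              ≈⟨ L₂.∑′-*ˡ (⟦ N₂ C b ⟧ * sgn (N₂ ∸ b)) (λ x → φ d x ^ m * ((x ^ Q) ^ b * x ^ (N₂ ∸ b))) ⟩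
            (⟦ N₂ C b ⟧ * sgn (N₂ ∸ b)) * R b   ≈⟨ *-assoc _ _ _ ⟩
            g b ∎

        g-odd : ∀ i → g (suc (i ℕ.+ i)) ≈ 0#
        g-odd i with ℕₚ.≤-<-connex (suc (i ℕ.+ i)) N₂
        ... | inj₁ b≤N₂ = trans (*-congˡ {⟦ N₂ C suc (i ℕ.+ i) ⟧} (trans (*-congˡ {sgn (N₂ ∸ suc (i ℕ.+ i))} (R-odd i b≤N₂)) (zeroʳ _))) (zeroʳ _)
        ... | inj₂ N₂<b = trans (*-congʳ (⟦⟧-cong (k>n⇒nCk≡0 N₂ _ N₂<b))) (zeroˡ _)

        -- The sign cancels the value -1 of the surviving power sums, so that Λ becomes a plain sum
        -- of binomial coefficients.
        Λ : ℕ → Carrier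
        Λ t = - R ((J ∸ t) ℕ.+ (J ∸ t))

        g-even : ∀ r → r ℕ.≤ N → g (r ℕ.+ r) ≈ ⟦ N₂ C (r ℕ.+ r) ⟧ * R (r ℕ.+ r)
        g-even r r≤N = *-congˡ (trans (*-congʳ (trans (^-≡ (- 1#) (∸-double r≤N)) (sgn-even (N ∸ r)))) (*-identityˡ _))
          where
          ∸-double : ∀ {a b} → a ℕ.≤ b → (b ℕ.+ b) ∸ (a ℕ.+ a) ≡ (b ∸ a) ℕ.+ (b ∸ a)
          ∸-double {a} {b} a≤b = ≡.trans (≡.cong₂ (λ y z → (y ℕ.+ z) ∸ (a ℕ.+ a)) (≡.sym (ℕₚ.m∸n+n≡m a≤b)) (≡.sym (ℕₚ.m∸n+n≡m a≤b)))
            (≡.trans (≡.cong (_∸ (a ℕ.+ a)) (exchange (b ∸ a) a)) (ℕₚ.m+n∸n≡m _ (a ℕ.+ a)))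
            where
            exchange : ∀ x a → (x ℕ.+ a) ℕ.+ (x ℕ.+ a) ≡ (x ℕ.+ x) ℕ.+ (a ℕ.+ a)
            exchange = solve′ 2 (λ x a → (x :+′ a) :+′ (x :+′ a) :=′ (x :+′ x) :+′ (a :+′ a)) ≡.refl
              where open +-*-Solver renaming (solve to solve′; con to con′; _:+_ to _:+′_; _:*_ to _:*′_; _:=_ to _:=′_)

        equation : ⟦ 2 ⟧ * S J (λ r → ⟦ N₂ C (r ℕ.+ r) ⟧ * Λ (J ∸ r)) + ⟦ N₂ C N ⟧ * Λ 0 ≈ 0#
        equation = begin
          ⟦ 2 ⟧ * S J (λ r → ⟦ N₂ C (r ℕ.+ r) ⟧ * Λ (J ∸ r)) + ⟦ N₂ C N ⟧ * Λ 0
            ≈⟨ +-cong (*-congˡ (trans (S-cong J (λ r r<J → to-g r (ℕₚ.<⇒≤ r<J))) (S-*ˡ J (- 1#) (λ r → g (r ℕ.+ r))))) (to-g₀) ⟩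
          ⟦ 2 ⟧ * (- 1# * S J (λ r → g (r ℕ.+ r))) + - 1# * g (J ℕ.+ J)
            ≈⟨ solve 4 (λ t o s z → t :* (o :* s) :+ o :* z := o :* (t :* s :+ z)) refl _ _ _ _ ⟩
          - 1# * (⟦ 2 ⟧ * S J (λ r → g (r ℕ.+ r)) + g (J ℕ.+ J))
            ≈⟨ *-congˡ (S-symmetric J (λ r → g (r ℕ.+ r)) g-sym) ⟨
          - 1# * S (suc N) (λ r → g (r ℕ.+ r))   ≈⟨ *-congˡ (S-even N g g-odd) ⟨
          - 1# * S (suc N₂) g                    ≈⟨ *-congˡ ∑g≈0 ⟩
          - 1# * 0#                              ≈⟨ zeroʳ _ ⟩
          0#                                     ∎
          where
          neg : ∀ a x → a * - x ≈ - 1# * (a * x)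
          neg a x = trans (sym (-‿distribʳ-* a x)) (trans (-‿cong (sym (*-identityˡ _))) (-‿distribˡ-* 1# (a * x)))
          to-g : ∀ r → r ℕ.≤ J → ⟦ N₂ C (r ℕ.+ r) ⟧ * Λ (J ∸ r) ≈ - 1# * g (r ℕ.+ r)
          to-g r r≤J = trans (*-congˡ (-‿cong (reflexive (≡.cong (λ i → R (i ℕ.+ i)) (ℕₚ.m∸[m∸n]≡n r≤J)))))
            (trans (neg _ _) (*-congˡ (sym (g-even r (ℕₚ.≤-trans r≤J (ℕₚ.m≤m+n J J))))))
          to-g₀ : ⟦ N₂ C N ⟧ * Λ 0 ≈ - 1# * g (J ℕ.+ J)
          to-g₀ = trans (neg _ _) (*-congˡ (sym (g-even J (ℕₚ.m≤m+n J J))))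
          g-sym : ∀ i → i ℕ.< J → g ((J ℕ.+ suc i) ℕ.+ (J ℕ.+ suc i)) ≈ g ((J ∸ suc i) ℕ.+ (J ∸ suc i))
          g-sym i i<J = begin
            g (a ℕ.+ a)                        ≈⟨ g-even a a≤N ⟩
            ⟦ N₂ C (a ℕ.+ a) ⟧ * R (a ℕ.+ a)   ≈⟨ *-cong (⟦⟧-cong C-sym) (R-symmetric {a ℕ.+ a} {a′ ℕ.+ a′} a+a′) ⟩
            ⟦ N₂ C (a′ ℕ.+ a′) ⟧ * R (a′ ℕ.+ a′) ≈⟨ g-even a′ (ℕₚ.≤-trans (ℕₚ.m∸n≤m J (suc i)) (ℕₚ.m≤m+n J J)) ⟨
            g (a′ ℕ.+ a′)                      ∎
            where
            a = J ℕ.+ suc i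
            a′ = J ∸ suc i
            a≤N : a ℕ.≤ N
            a≤N = ℕₚ.+-monoʳ-≤ J i<J
            sums : a ℕ.+ a′ ≡ N
            sums = ≡.trans (ℕₚ.+-assoc J (suc i) a′) (≡.cong (J ℕ.+_) (ℕₚ.m+[n∸m]≡n i<J))
            a+a′ : (a ℕ.+ a) ℕ.+ (a′ ℕ.+ a′) ≡ N₂
            a+a′ = ≡.trans (exchange a a′) (≡.cong₂ ℕ._+_ sums sums)
              where
              exchange : ∀ x a → (x ℕ.+ x) ℕ.+ (a ℕ.+ a) ≡ (x ℕ.+ a) ℕ.+ (x ℕ.+ a)
              exchange = solve′ 2 (λ x a → (x :+′ x) :+′ (a :+′ a) :=′ (x :+′ a) :+′ (x :+′ a)) ≡.refl
                where open +-*-Solver renaming (solve to solve′; con to con′; _:+_ to _:+′_; _:*_ to _:*′_; _:=_ to _:=′_)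
            C-sym : N₂ C (a ℕ.+ a) ≡ N₂ C (a′ ℕ.+ a′)
            C-sym = ≡.trans (nCk≡nC[n∸k] (≡.subst (a ℕ.+ a ℕ.≤_) a+a′ (ℕₚ.m≤m+n _ _)))
              (≡.cong (N₂ C_) (≡.trans (≡.cong (_∸ (a ℕ.+ a)) (≡.sym a+a′)) (ℕₚ.m+n∸m≡n (a ℕ.+ a) _)))

        Q≡2H-1 : suc Q ≡ H ℕ.+ H
        Q≡2H-1 = ≡.trans (ℕₚ.+-comm 2 u) u+2≡2H

        -- For l ≤ m this is `C-reflect` times the power sum -1. For m < l < Q both sides vanish:
        -- C(m, l) = 0, and on the right l + N may be reduced to l + N - Q < N. Thus l can run over
        -- all of 0 ≤ l < Q, and m disappears from the result.
        term-value : ∀ {r t} → r ℕ.+ t ≡ J → ∀ {l} → l ℕ.< Q → Class l t → term (r ℕ.+ r) l ≈ - ⟦ (l ℕ.+ N) C N ⟧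
        term-value {r} {t} r+t≡J {l} l<Q cl with ℕₚ.≤-<-connex l m
        ... | inj₁ l≤m = trans (*-cong (C-reflect h N m l (≡.trans (≡.cong suc m+N≡u) u+1≡pʰ) l≤m) (PS-1 l≤m 2r≤N₂ (class⇒∣ l≤m r+t≡J cl)))
            (trans (sym (-‿distribʳ-* _ _)) (-‿cong (*-identityʳ _)))
          where
          2r≤N₂ : r ℕ.+ r ℕ.≤ N₂
          2r≤N₂ = ℕₚ.+-mono-≤ r≤N r≤N
            where r≤N = ℕₚ.≤-trans (≡.subst (r ℕ.≤_) r+t≡J (ℕₚ.m≤m+n r t)) (ℕₚ.m≤m+n J J)
        ... | inj₂ m<l = trans (*-congʳ (trans (*-congˡ (⟦⟧-cong (k>n⇒nCk≡0 m l m<l))) (zeroʳ _))) (trans (zeroˡ _)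
            (sym (trans (-‿cong (trans (⟦⟧-cong (≡.cong (_C N) l+N≡)) (trans (C-periodic h x N N<pʰ) (⟦⟧-cong (k>n⇒nCk≡0 x N x<N))))) -0#≈0#)))
          where
          N<pʰ : N ℕ.< p ℕ.^ h
          N<pʰ = ≡.subst (N ℕ.<_) u+1≡pʰ (s≤s (≡.subst (N ℕ.≤_) m+N≡u (ℕₚ.m≤n+m N m)))
          Q≤l+N : Q ℕ.≤ l ℕ.+ N
          Q≤l+N = ≡.subst (ℕ._≤ l ℕ.+ N) (≡.cong suc m+N≡u) (ℕₚ.+-monoˡ-≤ N m<l)
          x = (l ℕ.+ N) ∸ Q
          l+N≡ : l ℕ.+ N ≡ x ℕ.+ p ℕ.^ h
          l+N≡ = ≡.trans (≡.sym (ℕₚ.m∸n+n≡m Q≤l+N)) (≡.cong (x ℕ.+_) u+1≡pʰ)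
          x<N : x ℕ.< N
          x<N = ℕₚ.+-cancelʳ-< Q x N (≡.subst (ℕ._< N ℕ.+ Q) (≡.sym (ℕₚ.m∸n+n≡m Q≤l+N)) (≡.subst (l ℕ.+ N ℕ.<_) (ℕₚ.+-comm Q N) (ℕₚ.+-monoˡ-< N l<Q)))

        term-zero : ∀ {r t} → r ℕ.+ t ≡ J → ∀ {l} → ¬ Class l t → term (r ℕ.+ r) l ≈ 0#
        term-zero {r} {t} r+t≡J {l} ¬cl with ℕₚ.≤-<-connex l m
        ... | inj₁ l≤m = trans (*-congˡ (PS-0 l≤m (ℕₚ.+-mono-≤ r≤N r≤N) (¬cl ∘ ∣⇒class l≤m r+t≡J))) (zeroʳ _)
          where r≤N = ℕₚ.≤-trans (≡.subst (r ℕ.≤_) r+t≡J (ℕₚ.m≤m+n r t)) (ℕₚ.m≤m+n J J)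
        ... | inj₂ m<l = trans (*-congʳ (trans (*-congˡ (⟦⟧-cong (k>n⇒nCk≡0 m l m<l))) (zeroʳ _))) (zeroˡ _)

        Class⇒≡ : ∀ {l l₁ t} → Class l t → Class l₁ t → l ≡ l₁ mod H
        Class⇒≡ {l} {l₁} {t} cl cl₁ = mod-+-cancelˡ (suc J) (≡.subst₂ (_≡_mod H) (ℕₚ.+-comm l _) (ℕₚ.+-comm l₁ _)
          (mod-trans (mod-sym (invert l)) (mod-trans (mod-*ˡ e (mod-trans cl (mod-sym cl₁))) (invert l₁))))
          where
          invert : ∀ l → e ℕ.* (μ ℕ.* (l ℕ.+ suc J)) ≡ l ℕ.+ suc J mod H
          invert l = mod-trans (mod-reflexive (≡.sym (ℕₚ.*-assoc e μ _))) (mod-trans (mod-*ʳ (l ℕ.+ suc J) eμ≡1) (mod-reflexive (ℕₚ.*-identityˡ _)))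

        lifts : ∀ {l l₁} → l ℕ.< Q → l₁ ℕ.< H → l ≡ l₁ mod H → l ≡ l₁ ⊎ l ≡ l₁ ℕ.+ H
        lifts {l} {l₁} l<Q l₁<H eq with ℕₚ.≤-<-connex H l
        ... | inj₂ l<H = inj₁ (mod-unique l<H l₁<H eq)
        ... | inj₁ H≤l = inj₂ (≡.trans (≡.sym (ℕₚ.m∸n+n≡m H≤l)) (≡.cong (ℕ._+ H) (mod-unique l-H<H l₁<H
              (mod-trans (mod-sym (mod-trans (mod-reflexive (≡.trans (≡.sym (ℕₚ.m∸n+n≡m H≤l)) (≡.cong (l ∸ H ℕ.+_) (≡.sym (ℕₚ.*-identityˡ H))))) (mod-multiple (l ∸ H) 1))) eq))))
          where
          l-H<H : l ∸ H ℕ.< H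
          l-H<H = ℕₚ.+-cancelʳ-< H (l ∸ H) H (≡.subst (ℕ._< H ℕ.+ H) (≡.sym (ℕₚ.m∸n+n≡m H≤l)) (≡.subst (l ℕ.<_) Q≡2H-1 (ℕₚ.m<n⇒m<1+n l<Q)))

        Λ-sum : ∀ {t} → t ℕ.≤ J → Λ t ≈ - S Q (term ((J ∸ t) ℕ.+ (J ∸ t)))
        Λ-sum {t} t≤J = -‿cong (trans (R-expansion _) (S-extend (term ((J ∸ t) ℕ.+ (J ∸ t))) (s≤s (ℕₚ.<⇒≤ m<u))
          (λ l m<l → trans (*-congʳ (trans (*-congˡ (⟦⟧-cong (k>n⇒nCk≡0 m l m<l))) (zeroʳ _))) (zeroˡ _))))

        toClass : ∀ {t l} → l ℕ.+ suc J ≡ e ℕ.* t mod H → Class l t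
        toClass {t} {l} eq = mod-trans (mod-*ˡ μ eq) (mod-trans (mod-reflexive (≡.trans (≡.sym (ℕₚ.*-assoc μ e t)) (≡.cong (ℕ._* t) (ℕₚ.*-comm μ e))))
          (mod-trans (mod-*ʳ t eμ≡1) (mod-reflexive (ℕₚ.*-identityˡ t))))

        eval₂ : ∀ t l → t ℕ.≤ J → suc l ℕ.< H → l ℕ.+ suc J ≡ e ℕ.* t mod H →
                Λ t ≈ ⟦ (l ℕ.+ N) C N ⟧ + ⟦ (l ℕ.+ H ℕ.+ N) C N ⟧
        eval₂ t l t≤J l<H eq = begin
          Λ t                                       ≈⟨ Λ-sum t≤J ⟩
          - S Q (term b)                            ≈⟨ -‿cong (S-pick Q (term b) (l ∷ l ℕ.+ H ∷ []) (l<Q ∷ l+H<Q ∷ []) ((l≢ ∷ []) ∷ [] ∷ []) others) ⟩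
          - (term b l + (term b (l ℕ.+ H) + 0#))    ≈⟨ -‿cong (+-cong (term-value J∸t+t l<Q cl) (trans (+-identityʳ _) (term-value J∸t+t l+H<Q cl′))) ⟩
          - (- ⟦ (l ℕ.+ N) C N ⟧ + - ⟦ (l ℕ.+ H ℕ.+ N) C N ⟧)  ≈⟨ solve 2 (λ a b → :- (:- a :+ :- b) := a :+ b) refl _ _ ⟩
          ⟦ (l ℕ.+ N) C N ⟧ + ⟦ (l ℕ.+ H ℕ.+ N) C N ⟧ ∎
          where
          b = (J ∸ t) ℕ.+ (J ∸ t)
          J∸t+t : J ∸ t ℕ.+ t ≡ J
          J∸t+t = ℕₚ.m∸n+n≡m t≤J
          cl : Class l t
          cl = toClass eq
          cl′ : Class (l ℕ.+ H) t
          cl′ = mod-trans (mod-*ˡ μ (mod-trans (mod-reflexive (≡.trans (ℕₚ.+-assoc l H (suc J)) (≡.trans (≡.cong (l ℕ.+_) (ℕₚ.+-comm H (suc J)))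
            (≡.trans (≡.sym (ℕₚ.+-assoc l (suc J) H)) (≡.cong (l ℕ.+ suc J ℕ.+_) (≡.sym (ℕₚ.*-identityˡ H))))))) (mod-multiple (l ℕ.+ suc J) 1))) cl
          l+H<Q : l ℕ.+ H ℕ.< Q
          l+H<Q = ℕₚ.≤-pred (≡.subst (suc (suc (l ℕ.+ H)) ℕ.≤_) (≡.sym Q≡2H-1) (ℕₚ.+-monoˡ-≤ H l<H))
          l<Q : l ℕ.< Q
          l<Q = ℕₚ.≤-<-trans (ℕₚ.m≤m+n l H) l+H<Q
          l≢ : l ≢ l ℕ.+ H
          l≢ eq′ = ℕₚ.<-irrefl eq′ (ℕₚ.m<m+n l (ℕₚ.≤-<-trans z≤n l<H))
          others : ∀ i → i ℕ.< Q → All (i ≢_) (l ∷ l ℕ.+ H ∷ []) → term b i ≈ 0#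
          others i i<Q (i≢l ∷ i≢l+H ∷ []) = term-zero J∸t+t (λ cli → neither (lifts i<Q (ℕₚ.<-trans (ℕₚ.n<1+n l) l<H) (Class⇒≡ cli cl)))
            where
            neither : ¬ (i ≡ l ⊎ i ≡ l ℕ.+ H)
            neither (inj₁ eq′) = i≢l eq′
            neither (inj₂ eq′) = i≢l+H eq′

        eval₁ : ∀ t l → t ℕ.≤ J → suc l ≡ H → l ℕ.+ suc J ≡ e ℕ.* t mod H → Λ t ≈ ⟦ (l ℕ.+ N) C N ⟧
        eval₁ t l t≤J l+1≡H eq = begin
          Λ t                            ≈⟨ Λ-sum t≤J ⟩
          - S Q (term b)                 ≈⟨ -‿cong (S-pick Q (term b) (l ∷ []) (l<Q ∷ []) ([] ∷ []) others) ⟩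
          - (term b l + 0#)              ≈⟨ -‿cong (trans (+-identityʳ _) (term-value J∸t+t l<Q cl)) ⟩
          - - ⟦ (l ℕ.+ N) C N ⟧          ≈⟨ -‿involutive _ ⟩
          ⟦ (l ℕ.+ N) C N ⟧              ∎
          where
          b = (J ∸ t) ℕ.+ (J ∸ t)
          J∸t+t : J ∸ t ℕ.+ t ≡ J
          J∸t+t = ℕₚ.m∸n+n≡m t≤J
          cl : Class l t
          cl = toClass eq
          l<H : l ℕ.< H
          l<H = ≡.subst (l ℕ.<_) l+1≡H (ℕₚ.n<1+n l)
          l+H≡Q : l ℕ.+ H ≡ Q
          l+H≡Q = ℕₚ.suc-injective (≡.trans (≡.cong (ℕ._+ H) l+1≡H) (≡.sym Q≡2H-1))
          l<Q : l ℕ.< Q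
          l<Q = ≡.subst (l ℕ.<_) l+H≡Q (ℕₚ.m<m+n l (ℕₚ.≤-<-trans z≤n l<H))
          others : ∀ i → i ℕ.< Q → All (i ≢_) (l ∷ []) → term b i ≈ 0#
          others i i<Q (i≢l ∷ []) = term-zero J∸t+t (λ cli → neither (lifts i<Q l<H (Class⇒≡ cli cl)))
            where
            neither : ¬ (i ≡ l ⊎ i ≡ l ℕ.+ H)
            neither (inj₁ eq′) = i≢l eq′
            neither (inj₂ eq′) = ℕₚ.<-irrefl (≡.trans eq′ l+H≡Q) i<Q

      keyAt : KeyAt e J
      keyAt = Λ , equation , eval₂ , eval₁

    planar⇒Key : ∀ {d μ e} → Planar d → d ≡ 2 ℕ.+ suc μ ℕ.* u → e ℕ.* μ ≡ 1 mod H → Key e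
    planar⇒Key {d} {μ} {e} planar d≡ eμ≡1 J 0<J 2J<u = keyAt {d} {μ} planar d≡ {e} eμ≡1 J (H ∸ suc J) 0<J
      (ℕₚ.m<n⇒0<n∸m J+1<H) (ℕₚ.m∸n+n≡m (ℕₚ.<⇒≤ J+1<H))
      where
      J+1<H : suc J ℕ.< H
      J+1<H with ℕₚ.≤-<-connex H (suc J)
      ... | inj₂ J+1<H = J+1<H
      ... | inj₁ H≤J+1 = ⊥-elim (ℕₚ.<-irrefl ≡.refl (ℕₚ.<-≤-trans 2J<u (ℕₚ.+-cancelʳ-≤ 2 u (J ℕ.+ J)
            (≡.subst₂ ℕ._≤_ (≡.sym u+2≡2H) (≡.trans (≡.cong suc (ℕₚ.+-suc J J)) (ℕₚ.+-comm 2 (J ℕ.+ J))) (ℕₚ.+-mono-≤ H≤J+1 H≤J+1)))))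

-- Passing from the field of Q elements to the field of Q² elements

module QuadraticTower where
  open Congruence
  open IntegerSolver
  open PlanarPowerSums
  open import Data.Nat
  import Data.Nat.Properties as ℕₚ
  import Data.Integer as ℤ
  open import Data.Nat.DivMod using (_%_; m%n<n)
  open import Data.Nat.Combinatorics using (_C_; nC1≡n; nCk≡nC[n∸k])
  open import Data.Nat.Coprimality using (Coprime; coprime-Bézout)
  open import Data.Nat.GCD using (module Bézout)
  open import Data.Nat.Divisibility as ∣ using (_∣_; divides; ∣-trans; _∣?_)
  open import Data.Nat.Primality using (Prime; prime⇒nonZero; prime⇒nonTrivial)
  open import Data.Nat.Solver using (module +-*-Solver)
  open +-*-Solver using () renaming (solve to solve′; con to con′; _:+_ to _:+′_; _:*_ to _:*′_; _:=_ to _:=′_)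
  open import Data.List using ([]; _∷_)
  open import Data.List.Relation.Unary.All using (All; []; _∷_)
  open import Data.List.Relation.Unary.AllPairs using ([]; _∷_)
  open import Data.Product using (∃; _×_; _,_; proj₁; proj₂)
  open import Data.Sum using (_⊎_; inj₁; inj₂)
  open import Data.Empty using (⊥; ⊥-elim)
  open import Function using (_∘_)
  open import Relation.Nullary using (¬_; Dec; yes; no)
  import Relation.Binary.PropositionalEquality as ≡
  open ≡ using (_≡_; _≢_)

  next-multiple : ∀ {a x y} → a ∣ x → a ∣ y → x < y → x + a ≤ y
  next-multiple {a} (divides i ≡.refl) (divides j ≡.refl) x<y =
    ≡.subst (_≤ j * a) (ℕₚ.+-comm a (i * a)) (ℕₚ.*-monoˡ-≤ a (ℕₚ.*-cancelʳ-< a i j x<y))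

  p∣p^ : ∀ {p k} → 0 < k → p ∣ p ^ k
  p∣p^ {p} {suc k} _ = ∣.m∣m*n (p ^ k)

  double-cancel-≤ : ∀ {a b} → a + a ≤ b + b → a ≤ b
  double-cancel-≤ {a} {b} a+a≤b+b = ℕₚ.≮⇒≥ (λ b<a → ℕₚ.<⇒≱ (ℕₚ.+-mono-< b<a b<a) a+a≤b+b)

  double-cancel-< : ∀ {a b} → a + a < b + b → a < b
  double-cancel-< {a} {b} a+a<b+b = ℕₚ.≰⇒> (λ b≤a → ℕₚ.<⇒≱ a+a<b+b (ℕₚ.+-mono-≤ b≤a b≤a))

  ≡⇒≤ : ∀ {a b} c → a + c ≡ b → a ≤ b
  ≡⇒≤ {a} c eq = ≡.subst (a ≤_) eq (ℕₚ.m≤m+n a c)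

  p-part : ∀ {p} → Prime p → ∀ Y → 0 < Y → p ∣ Y → ∃ λ a → ∃ λ y → 0 < a × ¬ p ∣ y × Y ≡ y * p ^ a
  p-part {p} pr Y 0<Y p∣Y = positive (split Y Y ℕₚ.≤-refl 0<Y)
    where
    split : ∀ f Y → Y ≤ f → 0 < Y → ∃ λ a → ∃ λ y → ¬ p ∣ y × Y ≡ y * p ^ a
    split zero    Y Y≤0 0<Y = ⊥-elim (ℕₚ.<⇒≱ 0<Y Y≤0)
    split (suc f) Y Y≤f 0<Y with p ∣? Y
    ... | no p∤Y = 0 , Y , p∤Y , ≡.sym (ℕₚ.*-identityʳ Y)
    ... | yes (divides k ≡.refl) with split f k (s≤s⁻¹ (ℕₚ.<-≤-trans k<kp Y≤f)) 0<k
      where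
      0<k : 0 < k
      0<k = ℕₚ.n≢0⇒n>0 (λ { ≡.refl → ℕₚ.<-irrefl ≡.refl 0<Y })
      k<kp : k < k * p
      k<kp = ℕₚ.m<m*n k p {{>-nonZero 0<k}} (nonTrivial⇒n>1 p {{prime⇒nonTrivial pr}})
        where open import Data.Nat.Primality using (prime⇒nonTrivial)
    ...   | a , y , p∤y , k≡ = suc a , y , p∤y , ≡.trans (≡.cong (_* p) k≡) (solve′ 3 (λ y A p → y :*′ A :*′ p :=′ y :*′ (p :*′ A)) ≡.refl y (p ^ a) p)
    positive : (∃ λ a → ∃ λ y → ¬ p ∣ y × Y ≡ y * p ^ a) → ∃ λ a → ∃ λ y → 0 < a × ¬ p ∣ y × Y ≡ y * p ^ a
    positive (zero  , y , p∤y , Y≡) = ⊥-elim (p∤y (≡.subst (p ∣_) (≡.trans Y≡ (ℕₚ.*-identityʳ y)) p∣Y))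
    positive (suc a , y , p∤y , Y≡) = suc a , y , s≤s z≤n , p∤y , Y≡

  inverse-mod : ∀ {μ H} → 1 < H → Coprime μ H → ∃ λ e → 0 < e × e < H × e * μ ≡ 1 mod H
  inverse-mod {μ} {H} 1<H coprime = reduce (solution (coprime-Bézout coprime))
    where
    instance
      H≢0 : NonZero H
      H≢0 = >-nonZero (ℕₚ.<-trans (s≤s z≤n) 1<H)
    solution : Bézout.Identity 1 μ H → ∃ λ e → e * μ ≡ 1 mod H
    solution (Bézout.Identity.+- x y eq) = x , 0 , y , ≡.trans (ℕₚ.+-identityʳ _) (≡.sym eq)
    -- A negative Bézout coefficient -x is represented by x (H - 1).
    solution (Bézout.Identity.-+ x y eq) = x * pred H , mod-+-cancelˡ (x * μ)
      (mod-trans (∣⇒mod (divides (x * μ) (≡.trans (solve′ 3 (λ x μ K → x :*′ μ :+′ x :*′ K :*′ μ :=′ x :*′ μ :*′ (con′ 1 :+′ K)) ≡.refl x μ (pred H)) (≡.cong (x * μ *_) (ℕₚ.suc-pred H)))))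
        (mod-sym (∣⇒mod (divides y (≡.trans (ℕₚ.+-comm (x * μ) 1) eq)))))
    reduce : (∃ λ e → e * μ ≡ 1 mod H) → ∃ λ e → 0 < e × e < H × e * μ ≡ 1 mod H
    reduce (e , eμ≡1) = e % H , ℕₚ.n≢0⇒n>0 nonzero , m%n<n e H , e%Hμ≡1
      where
      e%Hμ≡1 : (e % H) * μ ≡ 1 mod H
      e%Hμ≡1 = mod-trans (mod-*ʳ μ (mod-sym (n%m≡n e H))) eμ≡1
      nonzero : e % H ≢ 0
      nonzero eq = ∣.>⇒∤ 1<H (mod⇒∣ (mod-sym (≡.subst (λ v → v * μ ≡ 1 mod H) eq e%Hμ≡1)))

  -- Reductions modulo p and the relation for J = 1

  module Tower {c ℓ : Level} {q : ℕ} (F : FiniteField c ℓ q)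
               {p : ℕ} (pr : Prime p) (n : ℕ) (q≡pⁿ : q ≡ p ^ n)
               (h u : ℕ) (u+1≡pʰ : suc u ≡ p ^ h) (0<u : 0 < u)
               (H : ℕ) (u+2≡2H : u + 2 ≡ H + H)
               (u[u+2]∣q-1 : u * (u + 2) ∣ q ∸ 1)
               (5<p : 5 < p) where
    open FiniteField F renaming (_+_ to _⊕_; _*_ to _⊛_; -_ to ⊖_; _-_ to _⊝_)
    open CharP F pr n q≡pⁿ renaming (_^_ to _↑_; _≟_ to _≟ᴷ_)
    open Sums F pr n q≡pⁿ
    open Expansion F pr n q≡pⁿ h u u+1≡pʰ 0<u H u+2≡2H u[u+2]∣q-1
    open import Relation.Binary.Reasoning.Setoid setoid

    Q : ℕ
    Q = suc u

    Q+1≡2H : suc Q ≡ H + H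
    Q+1≡2H = ≡.trans (ℕₚ.+-comm 2 u) u+2≡2H

    ⟦⟧-pos : ∀ {m} → 0 < m → m < p → ⟦ m ⟧ ≉ 0#
    ⟦⟧-pos {suc m} _ m<p = p∤⇒⟦⟧≉0 (∣.>⇒∤ m<p)

    2≉0 : ⟦ 2 ⟧ ≉ 0#
    2≉0 = ⟦⟧-pos (s≤s z≤n) (ℕₚ.≤-trans (s≤s (s≤s (s≤s z≤n))) 5<p)

    0<h : 0 < h
    0<h = ℕₚ.n≢0⇒n>0 (λ h≡0 → ℕₚ.<-irrefl (≡.sym (ℕₚ.suc-injective (≡.trans u+1≡pʰ (≡.cong (p ^_) h≡0)))) 0<u)

    p∣Q : p ∣ Q
    p∣Q = ≡.subst (p ∣_) (≡.sym u+1≡pʰ) (p∣p^ 0<h)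

    ⟦Q⟧≈0 : ⟦ Q ⟧ ≈ 0#
    ⟦Q⟧≈0 = p∣⇒⟦⟧≈0 p∣Q

    p≤Q : p ≤ Q
    p≤Q = ∣.∣⇒≤ p∣Q

    -- As Q is 0 in the field, H is one half there; quantities that depend on H become constants.
    H+H≈1 : ⟦ H ⟧ ⊕ ⟦ H ⟧ ≈ ⟦ 1 ⟧
    H+H≈1 = begin
      ⟦ H ⟧ ⊕ ⟦ H ⟧   ≈⟨ ⟦⟧-+ H H ⟨
      ⟦ H + H ⟧       ≡⟨ ≡.cong ⟦_⟧ (≡.sym Q+1≡2H) ⟩
      1# ⊕ ⟦ Q ⟧      ≈⟨ +-congˡ ⟦Q⟧≈0 ⟩
      ⟦ 1 ⟧           ∎

    C-mod : ∀ k {T T′ M} → M < p ^ k → T ≡ T′ mod (p ^ k) → ⟦ T C M ⟧ ≈ ⟦ T′ C M ⟧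
    C-mod k {T} {T′} {M} M<A (i , j , eq) = trans (sym (absorb i T)) (trans (⟦⟧-cong (≡.cong (_C M) eq)) (absorb j T′))
      where
      absorb : ∀ i T → ⟦ (T + i * p ^ k) C M ⟧ ≈ ⟦ T C M ⟧
      absorb zero    T = ⟦⟧-cong (≡.cong (_C M) (ℕₚ.+-identityʳ T))
      absorb (suc i) T = trans (⟦⟧-cong (≡.cong (_C M) (≡.trans (≡.cong (T +_) (ℕₚ.+-comm (p ^ k) (i * p ^ k))) (≡.sym (ℕₚ.+-assoc T _ _)))))
        (trans (C-periodic k (T + i * p ^ k) M M<A) (absorb i T))

    C-mod-0 : ∀ k {T T′ M} → M < p ^ k → T ≡ T′ mod (p ^ k) → T′ < M → ⟦ T C M ⟧ ≈ 0#
    C-mod-0 k {T} {T′} {M} M<A eq T′<M = trans (C-mod k M<A eq) (⟦⟧-cong (k>n⇒nCk≡0 T′ M T′<M))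

    2C2 : ∀ m → ⟦ 2 ⟧ ⊛ ⟦ m C 2 ⟧ ≈ ⟦ m ⟧ ⊛ (⟦ m ⟧ ⊝ ⟦ 1 ⟧)
    2C2 zero    = trans (zeroʳ _) (sym (zeroˡ _))
    2C2 (suc m) = begin
      ⟦ 2 ⟧ ⊛ ⟦ suc m C 2 ⟧            ≈⟨ ⟦⟧-* 2 (suc m C 2) ⟨
      ⟦ 2 * (suc m C 2) ⟧              ≡⟨ ≡.cong ⟦_⟧ (≡.trans (absorption m 1) (≡.cong (suc m *_) (nC1≡n m))) ⟩
      ⟦ suc m * m ⟧                    ≈⟨ ⟦⟧-* (suc m) m ⟩
      ⟦ suc m ⟧ ⊛ ⟦ m ⟧                ≈⟨ *-congˡ (trans (solve 2 (λ o m → m := (o :+ m) :- o) refl 1# ⟦ m ⟧) (+-congˡ (-‿cong (sym (+-identityʳ 1#))))) ⟩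
      ⟦ suc m ⟧ ⊛ (⟦ suc m ⟧ ⊝ ⟦ 1 ⟧)  ∎

    0<H : 0 < H
    0<H = ℕₚ.n≢0⇒n>0 λ { ≡.refl → case Q+1≡2H }
      where
      case : suc Q ≡ 0 → ⊥
      case ()

    -- For J = 1 the relation is 2 Λ(1) + 6 Λ(0) = 0 with Λ(1) = C(e, 2) + C(e + H, 2) and Λ(0) =
    -- C(H, 2) + C(2H, 2). Putting H = 1/2 leaves the stated product.
    quadratic-test : ∀ {e} → Key e → 2 ≤ e → e < H → (⟦ e ⟧ ⊝ ⟦ 1 ⟧) ⊛ (⟦ 2 ⟧ ⊛ ⟦ e ⟧ ⊕ ⟦ 1 ⟧) ≈ 0#
    quadratic-test {e} key 2≤e e<H = conclude (key 1 (s≤s z≤n) 2<u)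
      where
      2<u : 2 < u
      2<u = s≤s⁻¹ (ℕₚ.≤-trans (ℕₚ.≤-trans (s≤s (s≤s (s≤s (s≤s z≤n)))) 5<p) p≤Q)
      shift : ∀ {m} → 2 ≤ m → m ∸ 2 + 2 ≡ m
      shift 2≤m = ℕₚ.m∸n+n≡m 2≤m
      below : ∀ {m} → 2 ≤ m → m ≤ H → suc (m ∸ 2) < H
      below {m} 2≤m m≤H = ℕₚ.≤-trans (ℕₚ.≤-reflexive (≡.trans (ℕₚ.+-comm 2 (m ∸ 2)) (shift 2≤m))) m≤H
      lift : ∀ {m} → 2 ≤ m → m ∸ 2 + H + 2 ≡ m + H
      lift {m} 2≤m = ≡.trans (ℕₚ.+-assoc (m ∸ 2) H 2) (≡.trans (≡.cong (m ∸ 2 +_) (ℕₚ.+-comm H 2)) (≡.trans (≡.sym (ℕₚ.+-assoc (m ∸ 2) 2 H)) (≡.cong (_+ H) (shift 2≤m))))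
      2≤H : 2 ≤ H
      2≤H = ℕₚ.≤-trans 2≤e (ℕₚ.<⇒≤ e<H)
      x η : Carrier
      x = ⟦ e ⟧
      η = ⟦ H ⟧
      conclude : KeyAt e 1 → (x ⊝ ⟦ 1 ⟧) ⊛ (⟦ 2 ⟧ ⊛ x ⊕ ⟦ 1 ⟧) ≈ 0#
      conclude (Λ , sum≈0 , eval , _) = *-cancel-0 2≉0 (begin
        ⟦ 2 ⟧ ⊛ ((x ⊝ ⟦ 1 ⟧) ⊛ (⟦ 2 ⟧ ⊛ x ⊕ ⟦ 1 ⟧))
          -- For a free variable η the identity holds only after subtracting a multiple of 2η - 1,
          -- which vanishes at η = H.
          ≈⟨ solve 2 (λ x η →
               let o = con (ℤ.+ 1); 𝟚 = con (ℤ.+ 2); sq = λ v → v :* (v :- o) in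
               𝟚 :* ((x :- o) :* (𝟚 :* x :+ o)) :=
                 (𝟚 :* (sq x :+ sq (x :+ η)) :+ con (ℤ.+ 6) :* (sq η :+ sq (η :+ η)))
                   :- ((η :+ η) :- o) :* (𝟚 :* x :+ con (ℤ.+ 16) :* η :- 𝟚)) refl x η ⟩
        (⟦ 2 ⟧ ⊛ (sq x ⊕ sq (x ⊕ η)) ⊕ ⟦ 6 ⟧ ⊛ (sq η ⊕ sq (η ⊕ η))) ⊝ ((η ⊕ η) ⊝ ⟦ 1 ⟧) ⊛ (⟦ 2 ⟧ ⊛ x ⊕ ⟦ 16 ⟧ ⊛ η ⊝ ⟦ 2 ⟧)
          ≈⟨ +-cong (+-cong (*-congˡ (2Λ≈ e Λ₁)) (*-congˡ (2Λ≈ H Λ₀))) (-‿cong (sym (trans (*-congʳ (trans (+-congʳ H+H≈1) (-‿inverseʳ _))) (zeroˡ _)))) ⟨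
        (⟦ 2 ⟧ ⊛ (⟦ 2 ⟧ ⊛ Λ 1) ⊕ ⟦ 6 ⟧ ⊛ (⟦ 2 ⟧ ⊛ Λ 0)) ⊝ 0#
          ≈⟨ solve 2 (λ a b → (con (ℤ.+ 2) :* (con (ℤ.+ 2) :* a) :+ con (ℤ.+ 6) :* (con (ℤ.+ 2) :* b)) :- con (ℤ.+ 0)
               := con (ℤ.+ 2) :* (con (ℤ.+ 2) :* (con (ℤ.+ 1) :* a :+ con (ℤ.+ 0)) :+ con (ℤ.+ 6) :* b)) refl (Λ 1) (Λ 0) ⟩
        ⟦ 2 ⟧ ⊛ (⟦ 2 ⟧ ⊛ (⟦ 1 ⟧ ⊛ Λ 1 ⊕ 0#) ⊕ ⟦ 6 ⟧ ⊛ Λ 0)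
          ≈⟨ trans (*-congˡ sum≈0) (zeroʳ _) ⟩
        0# ∎)
        where
        sq : Carrier → Carrier
        sq v = v ⊛ (v ⊝ ⟦ 1 ⟧)
        2Λ≈ : ∀ m {t} → Λ t ≈ ⟦ m C 2 ⟧ ⊕ ⟦ (m + H) C 2 ⟧ → ⟦ 2 ⟧ ⊛ Λ t ≈ sq ⟦ m ⟧ ⊕ sq (⟦ m ⟧ ⊕ η)
        2Λ≈ m eq = trans (*-congˡ eq) (trans (distribˡ _ _ _) (+-cong (2C2 m) (trans (2C2 (m + H)) (*-cong (⟦⟧-+ m H) (+-congʳ (⟦⟧-+ m H))))))
        at : ∀ {m} t → t ≤ 1 → 2 ≤ m → m ≤ H → m ≡ e * t mod H → Λ t ≈ ⟦ m C 2 ⟧ ⊕ ⟦ (m + H) C 2 ⟧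
        at {m} t t≤1 2≤m m≤H eq = trans (eval t (m ∸ 2) t≤1 (below 2≤m m≤H) (mod-trans (mod-reflexive (shift 2≤m)) eq))
          (+-cong (⟦⟧-cong (≡.cong (_C 2) (shift 2≤m))) (⟦⟧-cong (≡.cong (_C 2) (lift 2≤m))))
        Λ₁ : Λ 1 ≈ ⟦ e C 2 ⟧ ⊕ ⟦ (e + H) C 2 ⟧
        Λ₁ = at 1 ℕₚ.≤-refl 2≤e (ℕₚ.<⇒≤ e<H) (mod-reflexive (≡.sym (ℕₚ.*-identityʳ e)))
        Λ₀ : Λ 0 ≈ ⟦ H C 2 ⟧ ⊕ ⟦ (H + H) C 2 ⟧
        Λ₀ = at 0 z≤n 2≤H ℕₚ.≤-refl (0 , 1 , ≡.trans (ℕₚ.+-identityʳ H) (≡.sym (≡.cong₂ _+_ (ℕₚ.*-zeroʳ e) (ℕₚ.*-identityˡ H))))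

    -- The values of Λ for e = 1 + Y and for e = 1

    module _ {Y J : ℕ} (key : KeyAt (suc Y) J) where
      -- With z = J + t - 1, the congruence l + J + 1 ≡ (1 + Y) t says that T = l + 2J is congruent
      -- to t Y + z; w counts how often H has been subtracted.
      Λ-eval : ∀ {T z} t w → T + w * H ≡ t * Y + z → suc z ≡ J + t → t ≤ J → J + J ≤ T → suc T < H + (J + J) →
               proj₁ key t ≈ ⟦ T C (J + J) ⟧ ⊕ ⟦ (T + H) C (J + J) ⟧
      Λ-eval {T} {z} t w T≡ z≡ t≤J N≤T T<H+N = trans (proj₁ (proj₂ (proj₂ key)) t l t≤J l<H l≡)
        (+-cong (⟦⟧-cong (≡.cong (_C (J + J)) l+N≡T)) (⟦⟧-cong (≡.cong (_C (J + J)) l+H+N≡T+H)))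
        where
        l = T ∸ (J + J)
        l+N≡T : l + (J + J) ≡ T
        l+N≡T = ℕₚ.m∸n+n≡m N≤T
        l+H+N≡T+H : l + H + (J + J) ≡ T + H
        l+H+N≡T+H = ≡.trans (solve′ 3 (λ l H N → l :+′ H :+′ N :=′ l :+′ N :+′ H) ≡.refl l H (J + J)) (≡.cong (_+ H) l+N≡T)
        l<H : suc l < H
        l<H = ℕₚ.+-cancelʳ-< (J + J) (suc l) H (≡.subst (λ z → suc z < H + (J + J)) (≡.sym l+N≡T) T<H+N)
        l≡ : l + suc J ≡ suc Y * t mod H
        l≡ = w , 0 , ℕₚ.+-cancelʳ-≡ (J + J) _ _ (≡.trans
          (solve′ 4 (λ l J w H → (l :+′ (con′ 1 :+′ J) :+′ w :*′ H) :+′ (J :+′ J) :=′ (l :+′ (J :+′ J) :+′ w :*′ H) :+′ con′ 1 :+′ J) ≡.refl l J w H)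
          (≡.trans (≡.cong (λ x → x + 1 + J) (≡.trans (≡.cong (_+ w * H) l+N≡T) T≡))
          (≡.trans (solve′ 4 (λ t Y z J → t :*′ Y :+′ z :+′ con′ 1 :+′ J :=′ t :*′ Y :+′ (con′ 1 :+′ z) :+′ J) ≡.refl t Y z J)
          (≡.trans (≡.cong (λ x → t * Y + x + J) z≡)
          (solve′ 4 (λ t Y J H → t :*′ Y :+′ (J :+′ t) :+′ J :=′ ((con′ 1 :+′ Y) :*′ t :+′ con′ 0 :*′ H) :+′ (J :+′ J)) ≡.refl t Y J H)))))

    -- Modulo Q = 2H - 1, subtracting H is adding H - 1, and a binomial with lower index below Q
    -- depends on its upper index only modulo Q. Wrapped upper indices can therefore be written as t
    -- Y + z plus a constant.
    H′ : ℕ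
    H′ = H ∸ 1

    suc-H′ : suc H′ ≡ H
    suc-H′ = ℕₚ.m+[n∸m]≡n 0<H

    Q≡H+H′ : Q ≡ H + H′
    Q≡H+H′ = ℕₚ.suc-injective (≡.trans Q+1≡2H (≡.trans (≡.cong (H +_) (≡.sym suc-H′)) (ℕₚ.+-suc H H′)))

    <Q⇒<pʰ : ∀ {m} → m < Q → m < p ^ h
    <Q⇒<pʰ = ≡.subst (_ <_) u+1≡pʰ

    C-modQ : ∀ {T T′ M} → M < Q → T + Q ≡ T′ → ⟦ T C M ⟧ ≈ ⟦ T′ C M ⟧
    C-modQ {T} M<Q eq = C-mod h (<Q⇒<pʰ M<Q) (1 , 0 , ≡.trans (≡.cong (T +_) (≡.trans (ℕₚ.+-identityʳ _) (≡.sym u+1≡pʰ))) (≡.trans eq (≡.sym (ℕₚ.+-identityʳ _))))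

    pᵃ∣Q : ∀ {a} → a ≤ h → p ^ a ∣ Q
    pᵃ∣Q {a} a≤h = ≡.subst (p ^ a ∣_) (≡.trans (≡.sym (ℕₚ.^-distribˡ-+-* p a (h ∸ a))) (≡.trans (≡.cong (p ^_) (ℕₚ.m+[n∸m]≡n a≤h)) (≡.sym u+1≡pʰ))) (∣.m∣m*n _)

    -- The value of Λ t depends on how often t Y wraps around H; divisibility by A keeps t Y away from
    -- multiples of H by enough to absorb the shift c = J + 1 − t.
    module Wraps (A : ℕ) (A∣Q : A ∣ Q) {Y J : ℕ} (key : KeyAt (suc Y) J) (A∣Y : A ∣ Y) (N<Q : J + J < Q) where
      private
        N : ℕ
        N = J + J
        Λ : ℕ → Carrier
        Λ = proj₁ key

      Λ-wrap₀ : ∀ {z} t → suc z ≡ J + t → t ≤ J → suc J ≤ t * Y + t → t * Y < H →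
                Λ t ≈ ⟦ (t * Y + z) C N ⟧ ⊕ ⟦ (t * Y + z + H) C N ⟧
      Λ-wrap₀ {z} t z≡ t≤J c≤tY tY<H = Λ-eval key t 0 (ℕₚ.+-identityʳ _) z≡ t≤J
        (s≤s⁻¹ (ℕₚ.≤-trans (ℕₚ.≤-reflexive (≡.sym (ℕₚ.+-suc J J))) (ℕₚ.≤-trans (ℕₚ.+-monoʳ-≤ J c≤tY)
          (ℕₚ.≤-reflexive (≡.trans (solve′ 3 (λ J t Y → J :+′ (t :*′ Y :+′ t) :=′ t :*′ Y :+′ (J :+′ t)) ≡.refl J t Y) (≡.trans (≡.cong (t * Y +_) (≡.sym z≡)) (ℕₚ.+-suc _ z)))))))
        (ℕₚ.≤-<-trans (ℕₚ.≤-reflexive (≡.trans (≡.sym (ℕₚ.+-suc _ z)) (≡.cong (t * Y +_) z≡))) (ℕₚ.+-mono-<-≤ tY<H (ℕₚ.+-monoʳ-≤ J t≤J)))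

      Λ-wrap₁ : ∀ {z} t → suc z ≡ J + t → t ≤ J → N + 3 ≤ A + (t + t) → H ≤ t * Y → t * Y < H + H →
                Λ t ≈ ⟦ (t * Y + z + H′) C N ⟧ ⊕ ⟦ (t * Y + z) C N ⟧
      Λ-wrap₁ {z} t z≡ t≤J c≤A H≤tY tY<2H = trans
        (Λ-eval key t 1 (≡.trans (≡.cong (T +_) (ℕₚ.*-identityˡ H)) T+H≡) z≡ t≤J N≤T T<)
        (+-cong (C-modQ N<Q (≡.trans (≡.cong (T +_) Q≡H+H′) (≡.trans (≡.sym (ℕₚ.+-assoc T H H′)) (≡.cong (_+ H′) T+H≡))))
                (⟦⟧-cong (≡.cong (_C N) T+H≡)))
        where
        T = t * Y + z ∸ H
        T+H≡ : T + H ≡ t * Y + z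
        T+H≡ = ℕₚ.m∸n+n≡m (ℕₚ.≤-trans H≤tY (ℕₚ.m≤m+n _ z))
        sT+H≡ : suc T + H ≡ t * Y + (J + t)
        sT+H≡ = ≡.trans (≡.cong suc T+H≡) (≡.trans (≡.sym (ℕₚ.+-suc _ z)) (≡.cong (t * Y +_) z≡))
        -- Both 2 t Y and Q are multiples of A, and 2 t Y ≥ 2H > Q, so they differ by at least A.
        Q+A≤2tY : Q + A ≤ t * Y + t * Y
        Q+A≤2tY = next-multiple A∣Q (∣.∣m∣n⇒∣m+n (∣.∣n⇒∣m*n t A∣Y) (∣.∣n⇒∣m*n t A∣Y)) (ℕₚ.≤-trans (ℕₚ.≤-reflexive Q+1≡2H) (ℕₚ.+-mono-≤ H≤tY H≤tY))
        N≤T : N ≤ T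
        N≤T = s≤s⁻¹ (ℕₚ.+-cancelʳ-≤ H (suc N) (suc T) (double-cancel-≤ (≡.subst₂ _≤_ {x = (N + 3) + (N + Q)}
            (≡.trans (≡.trans (solve′ 2 (λ N Q → (N :+′ con′ 3) :+′ (N :+′ Q) :=′ N :+′ N :+′ con′ 2 :+′ (con′ 1 :+′ Q)) ≡.refl N Q) (≡.cong (N + N + 2 +_) Q+1≡2H))
              (solve′ 2 (λ N H → N :+′ N :+′ con′ 2 :+′ (H :+′ H) :=′ (con′ 1 :+′ N :+′ H) :+′ (con′ 1 :+′ N :+′ H)) ≡.refl N H))
            (≡.trans (solve′ 3 (λ w t J → (t :+′ t) :+′ (J :+′ J :+′ (w :+′ w)) :=′ (w :+′ (J :+′ t)) :+′ (w :+′ (J :+′ t))) ≡.refl (t * Y) t J) (≡.sym (≡.cong₂ _+_ sT+H≡ sT+H≡)))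
            (ℕₚ.≤-trans (ℕₚ.+-monoˡ-≤ (N + Q) c≤A)
              (ℕₚ.≤-trans (ℕₚ.≤-reflexive (solve′ 4 (λ A t N Q → (A :+′ (t :+′ t)) :+′ (N :+′ Q) :=′ (t :+′ t) :+′ (N :+′ (Q :+′ A))) ≡.refl A t N Q))
                (ℕₚ.+-monoʳ-≤ (t + t) (ℕₚ.+-monoʳ-≤ N Q+A≤2tY)))))))
        T< : suc T < H + N
        T< = ℕₚ.+-cancelʳ-< H (suc T) (H + N) (ℕₚ.≤-<-trans (ℕₚ.≤-reflexive sT+H≡)
          (ℕₚ.<-≤-trans (ℕₚ.+-mono-<-≤ tY<2H (ℕₚ.+-monoʳ-≤ J t≤J)) (ℕₚ.≤-reflexive (solve′ 2 (λ H N → (H :+′ H) :+′ N :=′ H :+′ N :+′ H) ≡.refl H N))))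

      -- Two wraps subtract 2H = Q + 1, which is 1 modulo Q. Accordingly z stands here for J + t -
      -- 2, one less than for fewer wraps.
      Λ-wrap₂ : ∀ {z} t → suc (suc z) ≡ J + t → t ≤ J → J + 2 ≤ A + t → H + H ≤ t * Y → t * Y < H + H + H →
                Λ t ≈ ⟦ (t * Y + z) C N ⟧ ⊕ ⟦ (t * Y + suc z + H′) C N ⟧
      Λ-wrap₂ {z} t z≡ t≤J c≤A 2H≤tY tY<3H = trans
        (Λ-eval key t 2 (≡.trans (≡.cong (T +_) (≡.cong (H +_) (ℕₚ.+-identityʳ H))) T+2H≡) z≡ t≤J N≤T T<)
        (+-cong (C-modQ N<Q (ℕₚ.suc-injective (≡.trans (≡.sym (ℕₚ.+-suc T Q)) (≡.trans (≡.cong (T +_) Q+1≡2H) (≡.trans T+2H≡ (ℕₚ.+-suc _ z))))))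
                (C-modQ N<Q (≡.trans (≡.cong (T + H +_) Q≡H+H′) (≡.trans (≡.trans (≡.sym (ℕₚ.+-assoc (T + H) H H′)) (≡.cong (_+ H′) (ℕₚ.+-assoc T H H))) (≡.cong (_+ H′) T+2H≡)))))
        where
        T = t * Y + suc z ∸ (H + H)
        T+2H≡ : T + (H + H) ≡ t * Y + suc z
        T+2H≡ = ℕₚ.m∸n+n≡m (ℕₚ.≤-trans 2H≤tY (ℕₚ.m≤m+n _ (suc z)))
        sT+2H≡ : suc T + (H + H) ≡ t * Y + (J + t)
        sT+2H≡ = ≡.trans (≡.cong suc T+2H≡) (≡.trans (≡.sym (ℕₚ.+-suc _ (suc z))) (≡.cong (t * Y +_) z≡))
        Q+A≤tY : Q + A ≤ t * Y
        Q+A≤tY = next-multiple A∣Q (∣.∣n⇒∣m*n t A∣Y) (ℕₚ.≤-trans (ℕₚ.≤-reflexive Q+1≡2H) 2H≤tY)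
        N≤T : N ≤ T
        N≤T = s≤s⁻¹ (ℕₚ.+-cancelʳ-≤ (H + H) (suc N) (suc T) (≡.subst₂ _≤_ {x = (J + 2) + (J + Q)}
            (≡.trans (solve′ 2 (λ J Q → (J :+′ con′ 2) :+′ (J :+′ Q) :=′ (con′ 1 :+′ (J :+′ J)) :+′ (con′ 1 :+′ Q)) ≡.refl J Q) (≡.cong (suc N +_) Q+1≡2H))
            (≡.trans (solve′ 3 (λ w t J → t :+′ (J :+′ w) :=′ w :+′ (J :+′ t)) ≡.refl (t * Y) t J) (≡.sym sT+2H≡))
            (ℕₚ.≤-trans (ℕₚ.+-monoˡ-≤ (J + Q) c≤A)
              (ℕₚ.≤-trans (ℕₚ.≤-reflexive (solve′ 4 (λ A t J Q → (A :+′ t) :+′ (J :+′ Q) :=′ t :+′ (J :+′ (Q :+′ A))) ≡.refl A t J Q))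
                (ℕₚ.+-monoʳ-≤ t (ℕₚ.+-monoʳ-≤ J Q+A≤tY))))))
        T< : suc T < H + N
        T< = ℕₚ.+-cancelʳ-< (H + H) (suc T) (H + N) (ℕₚ.≤-<-trans (ℕₚ.≤-reflexive sT+2H≡)
          (ℕₚ.<-≤-trans (ℕₚ.+-mono-<-≤ tY<3H (ℕₚ.+-monoʳ-≤ J t≤J)) (ℕₚ.≤-reflexive (solve′ 2 (λ H N → (H :+′ H :+′ H) :+′ N :=′ H :+′ N :+′ (H :+′ H)) ≡.refl H N))))

    -- For t < J the second solution l + H contributes C(J + t, 2J) modulo Q, which is 0 as J + t <
    -- 2J. For t = J there is only the solution l = H - 1.
    Λ₁-eval : ∀ {J z} (key : KeyAt 1 J) t → suc z ≡ J + t → 0 < t → t ≤ J → J + J < Q → proj₁ key t ≈ ⟦ (z + H) C (J + J) ⟧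
    Λ₁-eval {J} {z} key t z≡ 0<t t≤J N<Q = by-cases (t ℕₚ.<? J)
      where
      N = J + J
      suc-J≤t+H : suc J ≤ t + H
      suc-J≤t+H = double-cancel-≤ (≡.subst₂ _≤_ (≡.trans (≡.cong (2 +_) ≡.refl) (≡.cong suc (≡.sym (ℕₚ.+-suc J J)))) (solve′ 2 (λ t H → (t :+′ t) :+′ (H :+′ H) :=′ (t :+′ H) :+′ (t :+′ H)) ≡.refl t H)
        (ℕₚ.+-mono-≤ (ℕₚ.≤-trans 0<t (ℕₚ.m≤m+n t t)) (ℕₚ.≤-trans N<Q (ℕₚ.≤-trans (ℕₚ.n≤1+n Q) (ℕₚ.≤-reflexive Q+1≡2H)))))
      l = t + H ∸ suc J
      l+J+1 : l + suc J ≡ t + H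
      l+J+1 = ℕₚ.m∸n+n≡m suc-J≤t+H
      l≡ : l + suc J ≡ 1 * t mod H
      l≡ = 0 , 1 , ≡.trans (ℕₚ.+-identityʳ _) (≡.trans l+J+1 (solve′ 2 (λ t H → t :+′ H :=′ con′ 1 :*′ t :+′ con′ 1 :*′ H) ≡.refl t H))
      l+N≡ : l + N ≡ z + H
      l+N≡ = ℕₚ.suc-injective (≡.trans (solve′ 2 (λ l J → con′ 1 :+′ (l :+′ (J :+′ J)) :=′ (l :+′ (con′ 1 :+′ J)) :+′ J) ≡.refl l J)
        (≡.trans (≡.cong (_+ J) l+J+1) (≡.trans (solve′ 3 (λ t H J → t :+′ H :+′ J :=′ (J :+′ t) :+′ H) ≡.refl t H J) (≡.cong (_+ H) (≡.sym z≡)))))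
      by-cases : Dec (t < J) → proj₁ key t ≈ ⟦ (z + H) C N ⟧
      by-cases (yes t<J) = begin
        proj₁ key t                                  ≈⟨ proj₁ (proj₂ (proj₂ key)) t l t≤J
          (ℕₚ.+-cancelʳ-< J (suc l) H (≡.subst₂ _<_ (≡.trans (≡.sym l+J+1) (ℕₚ.+-suc l J)) (ℕₚ.+-comm J H) (ℕₚ.+-monoˡ-< H t<J))) l≡ ⟩
        ⟦ (l + N) C N ⟧ ⊕ ⟦ (l + H + N) C N ⟧        ≈⟨ +-cong (⟦⟧-cong (≡.cong (_C N) l+N≡)) second≈0 ⟩
        ⟦ (z + H) C N ⟧ ⊕ 0#                         ≈⟨ +-identityʳ _ ⟩
        ⟦ (z + H) C N ⟧                              ∎
        where
        second≈0 : ⟦ (l + H + N) C N ⟧ ≈ 0#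
        second≈0 = trans (sym (C-modQ {J + t} N<Q (≡.trans (≡.cong (_+ Q) (≡.sym z≡)) (≡.trans (≡.sym (ℕₚ.+-suc z Q)) (≡.trans (≡.cong (z +_) Q+1≡2H)
          (≡.trans (≡.sym (ℕₚ.+-assoc z H H)) (≡.trans (≡.cong (_+ H) (≡.sym l+N≡)) (solve′ 3 (λ l H N → l :+′ N :+′ H :=′ l :+′ H :+′ N) ≡.refl l H N))))))))
          (⟦⟧-cong (k>n⇒nCk≡0 (J + t) N (ℕₚ.+-monoʳ-< J t<J)))
      by-cases (no t≮J) = trans (proj₂ (proj₂ (proj₂ key)) t l t≤J
          (ℕₚ.+-cancelʳ-≡ J _ _ (≡.trans (≡.sym (ℕₚ.+-suc l J)) (≡.trans l+J+1 (≡.trans (≡.cong (_+ H) (ℕₚ.≤-antisym t≤J (ℕₚ.≮⇒≥ t≮J))) (ℕₚ.+-comm J H))))) l≡)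
        (⟦⟧-cong (≡.cong (_C N) l+N≡))

    -- At t = 0 the congruence that defines the range of l does not involve the exponent.
    Λ-0-unique : ∀ {e e′ J} (key : KeyAt e J) (key′ : KeyAt e′ J) → 0 < J → J + J < u → proj₁ key 0 ≈ proj₁ key′ 0
    Λ-0-unique {e} {e′} {J} key key′ 0<J N<u = trans (at {e} key) (sym (at {e′} key′))
      where
      suc-J≤H : suc J ≤ H
      suc-J≤H = double-cancel-≤ (≡.subst₂ _≤_ (≡.cong suc (≡.sym (ℕₚ.+-suc J J))) Q+1≡2H (s≤s (ℕₚ.<⇒≤ (s≤s N<u))))
      l+J+1 : H ∸ suc J + suc J ≡ H
      l+J+1 = ℕₚ.m∸n+n≡m suc-J≤H
      at : ∀ {e} (key : KeyAt e J) → proj₁ key 0 ≈ ⟦ (H ∸ suc J + (J + J)) C (J + J) ⟧ ⊕ ⟦ (H ∸ suc J + H + (J + J)) C (J + J) ⟧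
      at {e} key = proj₁ (proj₂ (proj₂ key)) 0 (H ∸ suc J) z≤n
        (ℕₚ.<-≤-trans (ℕₚ.m<m+n (suc (H ∸ suc J)) 0<J) (ℕₚ.≤-reflexive (≡.trans (≡.sym (ℕₚ.+-suc _ J)) l+J+1)))
        (0 , 1 , ≡.trans (ℕₚ.+-identityʳ _) (≡.trans l+J+1 (≡.sym (≡.cong₂ _+_ (ℕₚ.*-zeroʳ e) (ℕₚ.*-identityˡ H)))))

    -- Serves to compare 1 + Y with 1. The middle terms cancel because Λ(0) is common to both, and
    -- the remaining factor 2 is invertible.
    difference-sum : ∀ {e e′ J} (key : KeyAt e J) (key′ : KeyAt e′ J) → 0 < J → J + J < u → let N = J + J in
      S J (λ r → ⟦ (N + N) C (r + r) ⟧ ⊛ (proj₁ key (J ∸ r) ⊝ proj₁ key′ (J ∸ r))) ≈ 0#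
    difference-sum {e} {e′} {J} key key′ 0<J N<u = *-cancel-0 2≉0 (begin
      ⟦ 2 ⟧ ⊛ S J (λ r → C₂ r ⊛ (Λ (J ∸ r) ⊝ Λ′ (J ∸ r)))
        ≈⟨ *-congˡ (trans (S-cong J (λ r _ → solve 3 (λ c x y → c :* (x :- y) := c :* x :+ (:- con (ℤ.+ 1)) :* (c :* y)) refl (C₂ r) (Λ (J ∸ r)) (Λ′ (J ∸ r))))
             (trans (S-+ J (λ r → C₂ r ⊛ Λ (J ∸ r)) (λ r → (⊖ ⟦ 1 ⟧) ⊛ (C₂ r ⊛ Λ′ (J ∸ r)))) (+-congˡ (S-*ˡ J (⊖ ⟦ 1 ⟧) (λ r → C₂ r ⊛ Λ′ (J ∸ r)))))) ⟩
      ⟦ 2 ⟧ ⊛ (S₁ ⊕ (⊖ ⟦ 1 ⟧) ⊛ S₂)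
        ≈⟨ solve 4 (λ a b c d → con (ℤ.+ 2) :* (a :+ (:- con (ℤ.+ 1)) :* b) := (con (ℤ.+ 2) :* a :+ c :* d) :- (con (ℤ.+ 2) :* b :+ c :* d)) refl S₁ S₂ ⟦ (N + N) C N ⟧ (Λ 0) ⟩
      (⟦ 2 ⟧ ⊛ S₁ ⊕ ⟦ (N + N) C N ⟧ ⊛ Λ 0) ⊝ (⟦ 2 ⟧ ⊛ S₂ ⊕ ⟦ (N + N) C N ⟧ ⊛ Λ 0)
        ≈⟨ +-cong (proj₁ (proj₂ key)) (-‿cong (trans (+-congˡ (*-congˡ (Λ-0-unique {e} {e′} key key′ 0<J N<u))) (proj₁ (proj₂ key′)))) ⟩
      0# ⊝ 0#   ≈⟨ -‿inverseʳ 0# ⟩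
      0#        ∎)
      where
      N = J + J
      Λ = proj₁ key
      Λ′ = proj₁ key′
      C₂ : ℕ → Carrier
      C₂ r = ⟦ (N + N) C (r + r) ⟧
      S₁ = S J (λ r → C₂ r ⊛ Λ (J ∸ r))
      S₂ = S J (λ r → C₂ r ⊛ Λ′ (J ∸ r))

    module Small {a : ℕ} (a≤h : a ≤ h) {Y J : ℕ} (key : KeyAt (suc Y) J) (A∣Y : p ^ a ∣ Y) (0<Y : 0 < Y) (N<A : J + J < p ^ a) where
      private
        A N : ℕ
        A = p ^ a
        N = J + J
        A≤Q : A ≤ Q
        A≤Q = ∣.∣⇒≤ (pᵃ∣Q a≤h)
        N<Q : N < Q
        N<Q = ℕₚ.<-≤-trans N<A A≤Q
        open Wraps A (pᵃ∣Q a≤h) key A∣Y N<Q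

        modA : ∀ t x → t * Y + x ≡ x mod A
        modA t x = mod-+ (∣⇒mod (∣.∣n⇒∣m*n t A∣Y)) (mod-reflexive ≡.refl)

        vanish : ∀ t {x} → x < N → ⟦ (t * Y + x) C N ⟧ ≈ 0#
        vanish t x<N = C-mod-0 a N<A (modA t _) x<N

        keep : ∀ t x y → ⟦ (t * Y + x + y) C N ⟧ ≈ ⟦ (x + y) C N ⟧
        keep t x y = C-mod a N<A (mod-trans (mod-reflexive (ℕₚ.+-assoc (t * Y) x y)) (modA t (x + y)))

        z<N : ∀ {z t} → suc z ≡ J + t → t ≤ J → z < N
        z<N z≡ t≤J = ℕₚ.≤-trans (ℕₚ.≤-reflexive z≡) (ℕₚ.+-monoʳ-≤ J t≤J)

      -- Since 2J < A and A divides Y, the summand t Y is invisible modulo A. The value is the one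
      -- for e = 1, so unwrapped t cancel in `difference-sum`.
      unwrapped : ∀ {z} t → suc z ≡ J + t → 0 < t → t ≤ J → t * Y < H → proj₁ key t ≈ ⟦ (z + H) C N ⟧
      unwrapped {z} t z≡ 0<t t≤J tY<H = trans (Λ-wrap₀ t z≡ t≤J
          (ℕₚ.≤-trans (ℕₚ.≤-trans (s≤s (ℕₚ.m≤m+n J J)) N<A) (ℕₚ.≤-trans (∣.∣⇒≤ {{>-nonZero (ℕₚ.*-mono-< 0<t 0<Y)}} (∣.∣n⇒∣m*n t A∣Y)) (ℕₚ.m≤m+n _ t))) tY<H)
        (trans (+-cong (vanish t (z<N z≡ t≤J)) (keep t z H)) (+-identityˡ _))

      -- One and two wraps give the same value: in both cases one of the two binomials has an upper
      -- index that reduces below 2J modulo A, and the other carries H - 1 in place of H.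
      wrapped : ∀ {z} t → suc z ≡ J + t → 0 < t → t ≤ J → N + 3 ≤ A + (t + t) → H ≤ t * Y → t * Y < H + H + H → proj₁ key t ≈ ⟦ (z + H′) C N ⟧
      wrapped {z} t z≡ 0<t t≤J c≤A H≤tY tY<3H = by-cases (t * Y ℕₚ.<? H + H)
        where
        by-cases : Dec (t * Y < H + H) → proj₁ key t ≈ ⟦ (z + H′) C N ⟧
        by-cases (yes tY<2H) = trans (Λ-wrap₁ t z≡ t≤J c≤A H≤tY tY<2H) (trans (+-cong (keep t z H′) (vanish t (z<N z≡ t≤J))) (+-identityʳ _))
        by-cases (no tY≮2H) = twice z z≡
          where
          twice : ∀ z → suc z ≡ J + t → proj₁ key t ≈ ⟦ (z + H′) C N ⟧
          twice zero    z≡ = ⊥-elim (ℕₚ.<-irrefl z≡ (ℕₚ.+-mono-≤ (ℕₚ.≤-trans 0<t t≤J) 0<t))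
          twice (suc z) z≡ = trans (Λ-wrap₂ t z≡ t≤J
              (ℕₚ.+-cancelʳ-≤ J (J + 2) (A + t) (ℕₚ.≤-trans (ℕₚ.≤-reflexive (solve′ 1 (λ J → J :+′ con′ 2 :+′ J :=′ J :+′ J :+′ con′ 2) ≡.refl J))
                (ℕₚ.≤-trans (ℕₚ.≤-trans (ℕₚ.+-monoʳ-≤ N (s≤s (s≤s z≤n))) c≤A) (ℕₚ.≤-trans (ℕₚ.≤-reflexive (≡.sym (ℕₚ.+-assoc A t t))) (ℕₚ.+-monoʳ-≤ (A + t) t≤J)))))
              (ℕₚ.≮⇒≥ tY≮2H) tY<3H)
            (trans (+-cong (vanish t (ℕₚ.<-trans (ℕₚ.n<1+n z) (z<N z≡ t≤J))) (keep t (suc z) H′)) (+-identityˡ _))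

    -- Digits of H and the ladder that bounds Y

    odd-double : ∀ {m} → (∃ λ g → m ≡ suc (2 * g)) → ∃ λ g → m ≡ suc (g + g)
    odd-double (g , eq) = g , ≡.trans eq (≡.cong (λ x → suc (g + x)) (ℕₚ.+-identityʳ g))

    p-odd : ∃ λ π → p ≡ suc (π + π)
    p-odd = odd-double (odd-prime pr (ℕₚ.≤-trans (s≤s (s≤s (s≤s z≤n))) 5<p))

    p^-odd : ∀ k → ∃ λ g → p ^ k ≡ suc (g + g)
    p^-odd k = odd-double (odd-^ {p} {proj₁ (odd-prime pr (ℕₚ.≤-trans (s≤s (s≤s (s≤s z≤n))) 5<p))} (proj₂ (odd-prime pr (ℕₚ.≤-trans (s≤s (s≤s (s≤s z≤n))) 5<p))) k)

    -- Halving Q = B p (2g + 1): the base-B and base-p digits of H.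
    H-digits : ∀ {b} → b < h → let π = proj₁ p-odd; β = proj₁ (p^-odd b) in ∃ λ g → H′ ≡ (g * p + π) * p ^ b + β
    H-digits {b} b<h = g , ≡.sym (halve (ℕₚ.suc-injective (≡.trans (≡.sym expand) (≡.trans Q≡ (≡.trans Q≡H+H′ (≡.cong (_+ H′) (≡.sym suc-H′)))))))
      where
      π = proj₁ p-odd
      β = proj₁ (p^-odd b)
      k = h ∸ suc b
      g = proj₁ (p^-odd k)
      B = p ^ b
      expand : (suc (g + g) * suc (π + π)) * suc (β + β) ≡ suc (((g * p + π) * B + β) + ((g * p + π) * B + β))
      expand = ≡.trans (solve′ 3 (λ g π β → ((con′ 1 :+′ (g :+′ g)) :*′ (con′ 1 :+′ (π :+′ π))) :*′ (con′ 1 :+′ (β :+′ β))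
          :=′ con′ 1 :+′ (((g :*′ (con′ 1 :+′ (π :+′ π)) :+′ π) :*′ (con′ 1 :+′ (β :+′ β)) :+′ β) :+′ ((g :*′ (con′ 1 :+′ (π :+′ π)) :+′ π) :*′ (con′ 1 :+′ (β :+′ β)) :+′ β))) ≡.refl g π β)
        (≡.cong₂ (λ P B → suc (((g * P + π) * B + β) + ((g * P + π) * B + β))) (≡.sym (proj₂ p-odd)) (≡.sym (proj₂ (p^-odd b))))
      Q≡ : (suc (g + g) * suc (π + π)) * suc (β + β) ≡ Q
      Q≡ = ≡.trans (≡.cong₂ (λ x y → x * y) (≡.cong₂ _*_ (≡.sym (proj₂ (p^-odd k))) (≡.sym (proj₂ p-odd))) (≡.sym (proj₂ (p^-odd b))))
        (≡.trans (solve′ 3 (λ x y z → x :*′ y :*′ z :=′ (y :*′ z) :*′ x) ≡.refl (p ^ k) p B)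
        (≡.trans (≡.sym (ℕₚ.^-distribˡ-+-* p (suc b) k)) (≡.trans (≡.cong (p ^_) (ℕₚ.m+[n∸m]≡n b<h)) (≡.sym u+1≡pʰ))))

    -- Against the relation for e = 1, only r = 0, 1 and (B + 1)/2 with a wrapped t = J − r survive, where
    -- B = p^b; X and X₂ are the contributions of r ≤ 1 and r = (B + 1)/2.
    module Step {a b : ℕ} (a≤h : a ≤ h) (b<a : b < a) {Y J s : ℕ} (key : KeyAt (suc Y) J) (key₁ : KeyAt 1 J)
                (A∣Y : p ^ a ∣ Y) (0<Y : 0 < Y) (0<J : 0 < J) (N<u : J + J < u)
                (N≡ : J + J ≡ suc (s * p ^ b)) (2s≤p : s + s ≤ p)
                (far : ∀ r → p ^ b ≤ r → (J ∸ r) * Y < H) (JY<3H : J * Y < H + H + H) where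
      private
        A B N π β g h′ : ℕ
        A = p ^ a
        B = p ^ b
        N = J + J
        π = proj₁ p-odd
        β = proj₁ (p^-odd b)
        b<h : b < h
        b<h = ℕₚ.<-≤-trans b<a a≤h
        g = proj₁ (H-digits b<h)
        h′ = g * p + π
        B≡ : B ≡ suc (β + β)
        B≡ = proj₂ (p^-odd b)
        H′≡ : H′ ≡ h′ * B + β
        H′≡ = proj₂ (H-digits b<h)

        pB≤A : p * B ≤ A
        pB≤A = ℕₚ.^-monoʳ-≤ p {{prime⇒nonZero pr}} b<a
        6B≤A : 6 * B ≤ A
        6B≤A = ℕₚ.≤-trans (ℕₚ.*-monoˡ-≤ B 5<p) pB≤A
        1≤B : 1 ≤ B
        1≤B = ℕₚ.≤-trans (s≤s z≤n) (ℕₚ.≤-reflexive (≡.sym B≡))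
        B+5≤A : B + 5 ≤ A
        B+5≤A = ℕₚ.≤-trans (ℕₚ.+-monoʳ-≤ B (ℕₚ.*-monoʳ-≤ 5 1≤B)) 6B≤A

        N<A : N < A
        N<A = double-cancel-< (ℕₚ.≤-<-trans (ℕₚ.≤-reflexive (≡.trans (≡.cong₂ _+_ N≡ N≡) (solve′ 2 (λ s B → (con′ 1 :+′ s :*′ B) :+′ (con′ 1 :+′ s :*′ B) :=′ (s :+′ s) :*′ B :+′ con′ 2) ≡.refl s B)))
          (ℕₚ.≤-<-trans (ℕₚ.+-monoˡ-≤ 2 (ℕₚ.≤-trans (ℕₚ.*-monoˡ-≤ B 2s≤p) pB≤A)) (ℕₚ.+-monoʳ-< A (ℕₚ.≤-trans (ℕₚ.≤-trans (s≤s (s≤s (s≤s z≤n))) (ℕₚ.m≤n+m 5 B)) B+5≤A))))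
        N<Q : N < Q
        N<Q = ℕₚ.<-trans N<u (ℕₚ.n<1+n u)

        open Small a≤h key A∣Y 0<Y N<A

        Δ : ℕ → Carrier
        Δ r = proj₁ key₁ (J ∸ r) ⊝ proj₁ key (J ∸ r)

        pred-z : ∀ t → suc (pred (J + t)) ≡ J + t
        pred-z t = ℕₚ.suc-pred (J + t) {{>-nonZero (ℕₚ.≤-trans 0<J (ℕₚ.m≤m+n J t))}}

        Δ-unwrapped : ∀ r → (J ∸ r) * Y < H → Δ r ≈ 0#
        Δ-unwrapped r = at (J ∸ r) (ℕₚ.m∸n≤m J r)
          where
          at : ∀ t → t ≤ J → t * Y < H → proj₁ key₁ t ⊝ proj₁ key t ≈ 0#
          at zero    t≤J tY<H = trans (+-congʳ (Λ-0-unique {1} {suc Y} key₁ key 0<J N<u)) (-‿inverseʳ _)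
          at (suc t) t≤J tY<H = trans (+-cong (Λ₁-eval key₁ (suc t) (pred-z (suc t)) (s≤s z≤n) t≤J N<Q)
            (-‿cong (unwrapped (suc t) (pred-z (suc t)) (s≤s z≤n) t≤J tY<H))) (-‿inverseʳ _)

        -- The two values have upper indices z + H and z + H - 1 and the same lower index s B + 1.
        -- By Pascal's rule their difference is C(z + H′, s B), and by Lucas only the part m of z +
        -- H′ above its last base-B digit matters.
        Δ-wrapped : ∀ r {m x} → r + r + 3 ≤ A → H ≤ (J ∸ r) * Y → r + (m * B + x) ≡ (s + h′) * B + β → x < B → Δ r ≈ ⟦ m C s ⟧
        Δ-wrapped r {m} {x} 2r+3≤A H≤tY m≡ x<B = begin
          proj₁ key₁ t ⊝ proj₁ key t
            ≈⟨ +-cong (Λ₁-eval key₁ t (pred-z t) 0<t t≤J N<Q) (-‿cong (wrapped t (pred-z t) 0<t t≤J c≤A H≤tY (ℕₚ.≤-<-trans (ℕₚ.*-monoˡ-≤ Y t≤J) JY<3H))) ⟩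
          ⟦ (z + H) C N ⟧ ⊝ ⟦ (z + H′) C N ⟧
            ≡⟨ ≡.cong₂ (λ v w → ⟦ v C w ⟧ ⊝ ⟦ (z + H′) C w ⟧) (≡.trans (≡.cong (z +_) (≡.sym suc-H′)) (ℕₚ.+-suc z H′)) N≡ ⟩
          ⟦ suc (z + H′) C suc (s * B) ⟧ ⊝ ⟦ (z + H′) C suc (s * B) ⟧
            ≈⟨ +-congʳ (trans (⟦⟧-cong (pascal (z + H′) (s * B))) (⟦⟧-+ ((z + H′) C (s * B)) _)) ⟩
          (⟦ (z + H′) C (s * B) ⟧ ⊕ ⟦ (z + H′) C suc (s * B) ⟧) ⊝ ⟦ (z + H′) C suc (s * B) ⟧
            ≈⟨ solve 2 (λ x y → (x :+ y) :- y := x) refl _ _ ⟩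
          ⟦ (z + H′) C (s * B) ⟧
            ≡⟨ ≡.cong₂ (λ v w → ⟦ v C w ⟧) z+H′≡ (≡.sym (ℕₚ.+-identityʳ (s * B))) ⟩
          ⟦ (m * B + x) C (s * B + 0) ⟧
            ≈⟨ C-lucas b m x s 0 x<B 1≤B ⟩
          ⟦ m C s ⟧ ⊛ ⟦ 1 ⟧
            ≈⟨ trans (*-congˡ (+-identityʳ 1#)) (*-identityʳ _) ⟩
          ⟦ m C s ⟧ ∎
          where
          t = J ∸ r
          z = pred (J + t)
          t≤J : t ≤ J
          t≤J = ℕₚ.m∸n≤m J r
          0<t : 0 < t
          0<t = ℕₚ.n≢0⇒n>0 (λ t≡0 → ℕₚ.<⇒≱ 0<H (≡.subst (λ v → H ≤ v * Y) t≡0 H≤tY))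
          t+r≡J : t + r ≡ J
          t+r≡J = ℕₚ.m∸n+n≡m (ℕₚ.<⇒≤ (ℕₚ.m∸n≢0⇒n<m {J} {r} (λ t≡0 → ℕₚ.<-irrefl (≡.sym t≡0) 0<t)))
          c≤A : N + 3 ≤ A + (t + t)
          c≤A = ℕₚ.≤-trans (ℕₚ.≤-reflexive (≡.trans (≡.cong (λ v → v + v + 3) (≡.sym t+r≡J))
              (solve′ 2 (λ t r → (t :+′ r) :+′ (t :+′ r) :+′ con′ 3 :=′ (r :+′ r :+′ con′ 3) :+′ (t :+′ t)) ≡.refl t r))) (ℕₚ.+-monoˡ-≤ (t + t) 2r+3≤A)
          r+z≡ : r + z ≡ s * B
          r+z≡ = ℕₚ.suc-injective (≡.trans (≡.sym (ℕₚ.+-suc r z)) (≡.trans (≡.cong (r +_) (pred-z t))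
            (≡.trans (solve′ 3 (λ r J t → r :+′ (J :+′ t) :=′ J :+′ (t :+′ r)) ≡.refl r J t) (≡.trans (≡.cong (J +_) t+r≡J) N≡))))
          z+H′≡ : z + H′ ≡ m * B + x
          z+H′≡ = ℕₚ.+-cancelˡ-≡ r _ _ (≡.trans (≡.sym (ℕₚ.+-assoc r z H′)) (≡.trans (≡.cong₂ _+_ r+z≡ H′≡)
            (≡.trans (solve′ 4 (λ s B h β → s :*′ B :+′ (h :*′ B :+′ β) :=′ (s :+′ h) :*′ B :+′ β) ≡.refl s B h′ β) (≡.sym m≡))))

        X : Carrier
        X = ⟦ (s + h′) C s ⟧
        -- Modulo p, h′ is π = (p - 1)/2, so Lucas gives X = C(s + π, s), and 2s ≤ p ensures s + π <
        -- p.
        X≉0 : X ≉ 0#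
        X≉0 X≈0 = ⟦nCk⟧≉0 (s + π) s (ℕₚ.m≤m+n s π) s+π<p (begin
          ⟦ (s + π) C s ⟧                          ≈⟨ trans (sym (*-identityˡ _)) (*-congʳ (sym (+-identityʳ 1#))) ⟩
          ⟦ g C 0 ⟧ ⊛ ⟦ (s + π) C s ⟧              ≈⟨ C-lucas 1 g (s + π) 0 s (≡.subst (s + π <_) (≡.sym (ℕₚ.*-identityʳ p)) s+π<p) (≡.subst (s <_) (≡.sym (ℕₚ.*-identityʳ p)) (ℕₚ.≤-<-trans (ℕₚ.m≤m+n s π) s+π<p)) ⟨
          ⟦ (g * p ^ 1 + (s + π)) C s ⟧            ≡⟨ ≡.cong (λ v → ⟦ v C s ⟧) (≡.trans (≡.cong (λ v → g * v + (s + π)) (ℕₚ.*-identityʳ p)) (solve′ 4 (λ g p s π → g :*′ p :+′ (s :+′ π) :=′ s :+′ (g :*′ p :+′ π)) ≡.refl g p s π)) ⟩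
          X                                        ≈⟨ X≈0 ⟩
          0#                                       ∎)
          where
          s+π<p : s + π < p
          s+π<p = double-cancel-< (ℕₚ.≤-<-trans (ℕₚ.≤-reflexive (solve′ 2 (λ s π → (s :+′ π) :+′ (s :+′ π) :=′ (s :+′ s) :+′ (π :+′ π)) ≡.refl s π))
            (ℕₚ.+-mono-≤-< 2s≤p (ℕₚ.≤-reflexive (≡.sym (proj₂ p-odd)))))

        C₂ : ℕ → Carrier
        C₂ r = ⟦ (N + N) C (r + r) ⟧

        N+N≡ : N + N ≡ (s + s) * B + 2
        N+N≡ = ≡.trans (≡.cong₂ _+_ N≡ N≡) (solve′ 2 (λ s B → (con′ 1 :+′ s :*′ B) :+′ (con′ 1 :+′ s :*′ B) :=′ (s :+′ s) :*′ B :+′ con′ 2) ≡.refl s B)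

        -- The range is extended beyond J, where all differences vanish, so that 0, 1 and β + 1 lie
        -- in it without being compared with J.
        M : ℕ
        M = J + suc B

        sum≈0 : S M (λ r → C₂ r ⊛ Δ r) ≈ 0#
        sum≈0 = trans (sym (S-extend (λ r → C₂ r ⊛ Δ r) (ℕₚ.m≤m+n J (suc B)) (λ r J≤r →
          trans (*-congˡ (Δ-unwrapped r (≡.subst (λ v → v * Y < H) (≡.sym (ℕₚ.m≤n⇒m∸n≡0 J≤r)) 0<H))) (zeroʳ _)))) (difference-sum {1} {suc Y} key₁ key 0<J N<u)

        Δ₀≈X : H ≤ J * Y → Δ 0 ≈ X
        Δ₀≈X H≤JY = Δ-wrapped 0 {s + h′} {β} (ℕₚ.≤-trans (s≤s (s≤s (s≤s z≤n))) (ℕₚ.≤-trans (ℕₚ.m≤n+m 5 B) B+5≤A)) H≤JY ≡.refl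
          (ℕₚ.≤-trans (s≤s (ℕₚ.m≤m+n β β)) (ℕₚ.≤-reflexive (≡.sym B≡)))

        1*x≈x : ∀ {x} → ⟦ 1 ⟧ ⊛ x ≈ x
        1*x≈x = trans (*-congʳ (+-identityʳ 1#)) (*-identityˡ _)

        2X≉0 : ⟦ 2 ⟧ ⊛ X ≉ 0#
        2X≉0 = *-≉0 2≉0 X≉0

        Δ-cases : ∀ r {m x} → r + r + 3 ≤ A → r + (m * B + x) ≡ (s + h′) * B + β → x < B →
                  ((J ∸ r) * Y < H × Δ r ≈ 0#) ⊎ (H ≤ (J ∸ r) * Y × Δ r ≈ ⟦ m C s ⟧)
        Δ-cases r 2r+3≤A m≡ x<B = by-cases ((J ∸ r) * Y ℕₚ.<? H)
          where
          by-cases : Dec ((J ∸ r) * Y < H) → _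
          by-cases (yes tY<H) = inj₁ (tY<H , Δ-unwrapped r tY<H)
          by-cases (no tY≮H)  = inj₂ (ℕₚ.≮⇒≥ tY≮H , Δ-wrapped r 2r+3≤A (ℕₚ.≮⇒≥ tY≮H) m≡ x<B)

        B≡1-case : B ≡ 1 → H ≤ J * Y → ⊥
        B≡1-case B≡1 H≤JY = X≉0 (begin
          X                              ≈⟨ Δ₀≈X H≤JY ⟨
          Δ 0                            ≈⟨ trans (sym 1*x≈x) (sym (+-identityʳ _)) ⟩
          ⟦ 1 ⟧ ⊛ Δ 0 ⊕ 0#               ≈⟨ S-pick M (λ r → C₂ r ⊛ Δ r) (0 ∷ []) (ℕₚ.≤-trans 0<J (ℕₚ.m≤m+n J (suc B)) ∷ []) ([] ∷ []) others ⟨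
          S M (λ r → C₂ r ⊛ Δ r)         ≈⟨ sum≈0 ⟩
          0#                             ∎)
          where
          others : ∀ i → i < M → All (i ≢_) (0 ∷ []) → C₂ i ⊛ Δ i ≈ 0#
          others i _ (i≢0 ∷ []) = trans (*-congˡ (Δ-unwrapped i (far i (ℕₚ.≤-trans (ℕₚ.≤-reflexive B≡1) (ℕₚ.n≢0⇒n>0 i≢0))))) (zeroʳ _)

        module _ {β′} (β≡ : β ≡ suc β′) {m s′} (s≡ : s ≡ suc s′) (m≡ : suc m ≡ s + h′) (H≤JY : H ≤ J * Y) where
          X₂ : Carrier
          X₂ = ⟦ m C s ⟧

          2<B : 2 < B
          2<B = ≡.subst (3 ≤_) (≡.sym (≡.trans B≡ (≡.cong suc (≡.cong₂ _+_ β≡ β≡)))) (s≤s (s≤s (ℕₚ.≤-trans (s≤s z≤n) (ℕₚ.m≤n+m (suc β′) β′))))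

          coefficient : ∀ i {x z} → i + i ≡ x * B + z → z < B → C₂ i ≈ ⟦ (s + s) C x ⟧ ⊛ ⟦ 2 C z ⟧
          coefficient i {x} {z} i≡ z<B = trans (⟦⟧-cong (≡.cong₂ _C_ N+N≡ i≡)) (C-lucas b (s + s) 2 x z 2<B z<B)

          vanishing : ∀ i {x z} → i + i ≡ x * B + z → z < B → 2 < z → C₂ i ≈ 0#
          vanishing i {x} {z} i≡ z<B 2<z = trans (coefficient i {x} i≡ z<B) (trans (*-congˡ (⟦⟧-cong (k>n⇒nCk≡0 2 z 2<z))) (zeroʳ _))

          past-middle : ∀ v → (suc β + v) + (suc β + v) ≡ 1 * B + suc (v + v)
          past-middle v = ≡.trans (solve′ 2 (λ β v → (con′ 1 :+′ β :+′ v) :+′ (con′ 1 :+′ β :+′ v) :=′ con′ 1 :*′ (con′ 1 :+′ (β :+′ β)) :+′ (con′ 1 :+′ (v :+′ v))) ≡.refl β v)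
            (≡.cong (λ B → 1 * B + suc (v + v)) (≡.sym B≡))

          -- The last base-B digit of 2N is 2, so by Lucas C(2N, 2r) can be non-zero only if the
          -- last digit of 2r is at most 2. For r < B this digit is 2r when r ≤ β and the odd number
          -- 2r - B otherwise, which leaves 0, 1 and β + 1. For r ≥ B there is no wrap.
          others : ∀ i → i < M → All (i ≢_) (0 ∷ 1 ∷ suc β ∷ []) → C₂ i ⊛ Δ i ≈ 0#
          others i _ (i≢0 ∷ i≢1 ∷ i≢β ∷ []) = by-size (i ℕₚ.<? B) (i ℕₚ.≤? β)
            where
            by-size : Dec (i < B) → Dec (i ≤ β) → C₂ i ⊛ Δ i ≈ 0#
            by-size (no i≮B) _ = trans (*-congˡ (Δ-unwrapped i (far i (ℕₚ.≮⇒≥ i≮B)))) (zeroʳ _)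
            by-size (yes i<B) (yes i≤β) = trans (*-congʳ (vanishing i {0} ≡.refl (ℕₚ.≤-trans (s≤s (ℕₚ.+-mono-≤ i≤β i≤β)) (ℕₚ.≤-reflexive (≡.sym B≡)))
              (ℕₚ.≤-trans (ℕₚ.n≤1+n 3) (ℕₚ.+-mono-≤ 2≤i 2≤i)))) (zeroˡ _)
              where
              2≤i : 2 ≤ i
              2≤i = ℕₚ.≤∧≢⇒< (ℕₚ.n≢0⇒n>0 i≢0) (i≢1 ∘ ≡.sym)
            by-size (yes i<B) (no i≰β) = trans (*-congʳ (vanishing i {1} i+i≡ z<B (s≤s (ℕₚ.+-mono-≤ 1≤v 1≤v)))) (zeroˡ _)
              where
              v = i ∸ suc β
              i≡ : suc β + v ≡ i
              i≡ = ℕₚ.m+[n∸m]≡n (ℕₚ.≰⇒> i≰β)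
              i+i≡ : i + i ≡ 1 * B + suc (v + v)
              i+i≡ = ≡.trans (≡.cong₂ _+_ (≡.sym i≡) (≡.sym i≡)) (past-middle v)
              1≤v : 1 ≤ v
              1≤v = ℕₚ.n≢0⇒n>0 (λ v≡0 → i≢β (≡.trans (≡.sym i≡) (≡.trans (≡.cong (suc β +_) v≡0) (ℕₚ.+-identityʳ _))))
              z<B : suc (v + v) < B
              z<B = ℕₚ.+-cancelˡ-< B _ _ (ℕₚ.≤-<-trans (ℕₚ.≤-reflexive (≡.trans (≡.cong (_+ suc (v + v)) (≡.sym (ℕₚ.*-identityˡ B))) (≡.sym i+i≡))) (ℕₚ.+-mono-< i<B i<B))

          three-terms : Δ 0 ⊕ (Δ 1 ⊕ (⟦ s + s ⟧ ⊛ ⟦ 2 ⟧) ⊛ Δ (suc β)) ≈ 0#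
          three-terms = begin
            Δ 0 ⊕ (Δ 1 ⊕ (⟦ s + s ⟧ ⊛ ⟦ 2 ⟧) ⊛ Δ (suc β))
              ≈⟨ +-cong (sym 1*x≈x) (+-cong (trans (sym 1*x≈x) (*-congʳ (sym (trans (coefficient 1 {0} {2} ≡.refl 2<B) 1*x≈x))))
                   (trans (*-congʳ (trans (*-congʳ (⟦⟧-cong (≡.sym (nC1≡n (s + s))))) (sym (coefficient (suc β) {1} {1} (≡.trans (≡.cong (λ v → v + v) (≡.sym (ℕₚ.+-identityʳ (suc β)))) (past-middle 0)) (ℕₚ.<-trans (ℕₚ.n<1+n 1) 2<B)))))
                     (sym (+-identityʳ _)))) ⟩
            C₂ 0 ⊛ Δ 0 ⊕ (C₂ 1 ⊛ Δ 1 ⊕ (C₂ (suc β) ⊛ Δ (suc β) ⊕ 0#))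
              ≈⟨ S-pick M (λ r → C₂ r ⊛ Δ r) (0 ∷ 1 ∷ suc β ∷ [])
                   (ℕₚ.≤-trans 0<J (ℕₚ.m≤m+n J (suc B)) ∷ ℕₚ.+-mono-≤ 0<J (s≤s z≤n) ∷ ℕₚ.≤-trans (s≤s (ℕₚ.≤-trans (s≤s (ℕₚ.m≤m+n β β)) (ℕₚ.≤-reflexive (≡.sym B≡)))) (ℕₚ.m≤n+m (suc B) J) ∷ [])
                   (((λ ()) ∷ (λ ()) ∷ []) ∷ ((λ 1≡ → 0≢β (ℕₚ.suc-injective 1≡)) ∷ []) ∷ [] ∷ []) others ⟨
            S M (λ r → C₂ r ⊛ Δ r)   ≈⟨ sum≈0 ⟩
            0# ∎
            where
            0≢β : 0 ≢ β
            0≢β 0≡β with ≡.trans 0≡β β≡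
            ... | ()

          -- Absorption gives (s + h′)(X - X₂) = s X, and 2 h′ + 1 = 0 in the field.
          X+[2s-1]X₂≈0 : X ⊕ (⟦ 2 ⟧ ⊛ ⟦ s ⟧ ⊝ ⟦ 1 ⟧) ⊛ X₂ ≈ 0#
          X+[2s-1]X₂≈0 = begin
            X ⊕ (⟦ 2 ⟧ ⊛ ⟦ s ⟧ ⊝ ⟦ 1 ⟧) ⊛ X₂
              ≈⟨ +-cong (sym 1*x≈x) (*-congʳ (+-congʳ (sym 2P+1≈2s))) ⟩
            ⟦ 1 ⟧ ⊛ X ⊕ (⟦ 2 ⟧ ⊛ P ⊕ ⟦ 1 ⟧ ⊝ ⟦ 1 ⟧) ⊛ X₂
              ≈⟨ solve 4 (λ P s X Z → con (ℤ.+ 1) :* X :+ (con (ℤ.+ 2) :* P :+ con (ℤ.+ 1) :- con (ℤ.+ 1)) :* Z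
                   := (con (ℤ.+ 2) :* P :+ con (ℤ.+ 1) :- con (ℤ.+ 2) :* s) :* X :- con (ℤ.+ 2) :* (P :* (X :- Z) :- s :* X)) refl P ⟦ s ⟧ X X₂ ⟩
            (⟦ 2 ⟧ ⊛ P ⊕ ⟦ 1 ⟧ ⊝ ⟦ 2 ⟧ ⊛ ⟦ s ⟧) ⊛ X ⊝ ⟦ 2 ⟧ ⊛ (P ⊛ (X ⊝ X₂) ⊝ ⟦ s ⟧ ⊛ X)
              ≈⟨ +-cong (trans (*-congʳ (trans (+-congʳ 2P+1≈2s) (-‿inverseʳ _))) (zeroˡ _)) (-‿cong (trans (*-congˡ (trans (+-congʳ P[X-X₂]≈sX) (-‿inverseʳ _))) (zeroʳ _))) ⟩
            0# ⊝ 0#   ≈⟨ -‿inverseʳ 0# ⟩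
            0#        ∎
            where
            P : Carrier
            P = ⟦ suc m ⟧
            P[X-X₂]≈sX : P ⊛ (X ⊝ X₂) ≈ ⟦ s ⟧ ⊛ X
            P[X-X₂]≈sX = begin
              P ⊛ (X ⊝ X₂)                ≈⟨ *-congˡ (+-congʳ (trans (⟦⟧-cong (≡.trans (≡.cong₂ _C_ (≡.sym m≡) s≡) (pascal m s′))) (⟦⟧-+ (m C s′) _))) ⟩
              P ⊛ ((⟦ m C s′ ⟧ ⊕ ⟦ m C suc s′ ⟧) ⊝ X₂) ≈⟨ *-congˡ (trans (+-congˡ (-‿cong (⟦⟧-cong (≡.cong (m C_) s≡)))) (solve 2 (λ x y → (x :+ y) :- y := x) refl _ _)) ⟩
              P ⊛ ⟦ m C s′ ⟧              ≈⟨ ⟦⟧-* (suc m) (m C s′) ⟨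
              ⟦ suc m * (m C s′) ⟧        ≡⟨ ≡.cong ⟦_⟧ (absorption m s′) ⟨
              ⟦ suc s′ * (suc m C suc s′) ⟧ ≡⟨ ≡.cong₂ (λ v w → ⟦ v * (w C v) ⟧) (≡.sym s≡) m≡ ⟩
              ⟦ s * ((s + h′) C s) ⟧      ≈⟨ ⟦⟧-* s ((s + h′) C s) ⟩
              ⟦ s ⟧ ⊛ X                   ∎
            2P+1≈2s : ⟦ 2 ⟧ ⊛ P ⊕ ⟦ 1 ⟧ ≈ ⟦ 2 ⟧ ⊛ ⟦ s ⟧
            2P+1≈2s = begin
              ⟦ 2 ⟧ ⊛ P ⊕ ⟦ 1 ⟧                  ≈⟨ trans (+-congʳ (sym (⟦⟧-* 2 (suc m)))) (sym (⟦⟧-+ (2 * suc m) 1)) ⟩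
              ⟦ 2 * suc m + 1 ⟧                  ≡⟨ ≡.cong ⟦_⟧ (≡.trans (≡.cong (λ v → 2 * v + 1) m≡) (≡.trans (solve′ 4 (λ s g P π → con′ 2 :*′ (s :+′ (g :*′ P :+′ π)) :+′ con′ 1 :=′ con′ 2 :*′ s :+′ (con′ 2 :*′ g :*′ P :+′ (con′ 1 :+′ (π :+′ π)))) ≡.refl s g p π)
                   (≡.cong (λ v → 2 * s + (2 * g * p + v)) (≡.sym (proj₂ p-odd))))) ⟩
              ⟦ 2 * s + (2 * g * p + p) ⟧        ≈⟨ ⟦⟧-+ (2 * s) _ ⟩
              ⟦ 2 * s ⟧ ⊕ ⟦ 2 * g * p + p ⟧      ≈⟨ +-cong (⟦⟧-* 2 s) (p∣⇒⟦⟧≈0 (∣.∣m∣n⇒∣m+n (∣.n∣m*n (2 * g)) ∣.∣-refl)) ⟩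
              ⟦ 2 ⟧ ⊛ ⟦ s ⟧ ⊕ 0#                 ≈⟨ +-identityʳ _ ⟩
              ⟦ 2 ⟧ ⊛ ⟦ s ⟧                      ∎

          monotone : (J ∸ 1) * Y < H → (J ∸ suc β) * Y < H
          monotone = ℕₚ.≤-<-trans (ℕₚ.*-monoˡ-≤ Y (ℕₚ.∸-monoʳ-≤ J (s≤s z≤n)))

          -- If r = β + 1 wraps, then so does r = 1. With only r = 0 wrapped the relation reads X =
          -- 0, with r = 0 and 1 it reads 2X = 0. With all three it reads 2X + 4s X₂ = 0, and
          -- eliminating X₂ by X + (2s - 1) X₂ = 0 again gives 2X = 0.
          contradiction : ⊥
          contradiction = conclude
            (Δ-cases 1 {s + h′} {β′} (ℕₚ.≤-trans (ℕₚ.m≤n+m 5 B) B+5≤A) (≡.trans (≡.sym (ℕₚ.+-suc _ β′)) (≡.cong ((s + h′) * B +_) (≡.sym β≡)))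
              (ℕₚ.≤-trans (ℕₚ.≤-trans (ℕₚ.≤-reflexive (≡.sym β≡)) (ℕₚ.≤-trans (ℕₚ.m≤m+n β β) (ℕₚ.n≤1+n _))) (ℕₚ.≤-reflexive (≡.sym B≡))))
            (Δ-cases (suc β) {m} {β + β} (ℕₚ.≤-trans (ℕₚ.≤-reflexive (≡.trans (solve′ 1 (λ β → (con′ 1 :+′ β) :+′ (con′ 1 :+′ β) :+′ con′ 3 :=′ (con′ 1 :+′ (β :+′ β)) :+′ con′ 4) ≡.refl β) (≡.cong (_+ 4) (≡.sym B≡)))) (ℕₚ.≤-trans (ℕₚ.+-monoʳ-≤ B (ℕₚ.n≤1+n 4)) B+5≤A))
              (≡.trans (solve′ 3 (λ β m B → (con′ 1 :+′ β) :+′ (m :*′ B :+′ (β :+′ β)) :=′ m :*′ B :+′ (con′ 1 :+′ (β :+′ β)) :+′ β) ≡.refl β m B)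
                (≡.trans (≡.cong (λ v → m * B + v + β) (≡.sym B≡)) (≡.trans (≡.cong (_+ β) (ℕₚ.+-comm (m * B) B)) (≡.cong (λ v → v * B + β) m≡))))
              (ℕₚ.≤-reflexive (≡.sym B≡)))
            where
            conclude : ((J ∸ 1) * Y < H × Δ 1 ≈ 0#) ⊎ (H ≤ (J ∸ 1) * Y × Δ 1 ≈ X) →
                       ((J ∸ suc β) * Y < H × Δ (suc β) ≈ 0#) ⊎ (H ≤ (J ∸ suc β) * Y × Δ (suc β) ≈ X₂) → ⊥
            conclude (inj₁ (lt , _)) (inj₂ (ge , _)) = ℕₚ.<⇒≱ (monotone lt) ge
            conclude (inj₁ (_ , Δ₁)) (inj₁ (_ , Δᵦ)) = X≉0 (begin
              X                                                 ≈⟨ solve 2 (λ x k → x := x :+ (con (ℤ.+ 0) :+ k :* con (ℤ.+ 0))) refl X (⟦ s + s ⟧ ⊛ ⟦ 2 ⟧) ⟩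
              X ⊕ (0# ⊕ (⟦ s + s ⟧ ⊛ ⟦ 2 ⟧) ⊛ 0#)               ≈⟨ +-cong (Δ₀≈X H≤JY) (+-cong Δ₁ (*-congˡ Δᵦ)) ⟨
              Δ 0 ⊕ (Δ 1 ⊕ (⟦ s + s ⟧ ⊛ ⟦ 2 ⟧) ⊛ Δ (suc β))     ≈⟨ three-terms ⟩
              0#                                                ∎)
            conclude (inj₂ (_ , Δ₁)) (inj₁ (_ , Δᵦ)) = 2X≉0 (begin
              ⟦ 2 ⟧ ⊛ X                                         ≈⟨ solve 2 (λ x k → con (ℤ.+ 2) :* x := x :+ (x :+ k :* con (ℤ.+ 0))) refl X (⟦ s + s ⟧ ⊛ ⟦ 2 ⟧) ⟩
              X ⊕ (X ⊕ (⟦ s + s ⟧ ⊛ ⟦ 2 ⟧) ⊛ 0#)                ≈⟨ +-cong (Δ₀≈X H≤JY) (+-cong Δ₁ (*-congˡ Δᵦ)) ⟨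
              Δ 0 ⊕ (Δ 1 ⊕ (⟦ s + s ⟧ ⊛ ⟦ 2 ⟧) ⊛ Δ (suc β))     ≈⟨ three-terms ⟩
              0#                                                ∎)
            conclude (inj₂ (_ , Δ₁)) (inj₂ (_ , Δᵦ)) = 2X≉0 (begin
              ⟦ 2 ⟧ ⊛ X
                ≈⟨ solve 3 (λ x z s → con (ℤ.+ 2) :* x := con (ℤ.+ 4) :* s :* (x :+ (con (ℤ.+ 2) :* s :- con (ℤ.+ 1)) :* z)
                     :- (con (ℤ.+ 2) :* s :- con (ℤ.+ 1)) :* (x :+ (x :+ ((s :+ s) :* con (ℤ.+ 2)) :* z))) refl X X₂ ⟦ s ⟧ ⟩
              ⟦ 4 ⟧ ⊛ ⟦ s ⟧ ⊛ (X ⊕ (⟦ 2 ⟧ ⊛ ⟦ s ⟧ ⊝ ⟦ 1 ⟧) ⊛ X₂) ⊝ (⟦ 2 ⟧ ⊛ ⟦ s ⟧ ⊝ ⟦ 1 ⟧) ⊛ (X ⊕ (X ⊕ ((⟦ s ⟧ ⊕ ⟦ s ⟧) ⊛ ⟦ 2 ⟧) ⊛ X₂))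
                ≈⟨ +-cong (trans (*-congˡ X+[2s-1]X₂≈0) (zeroʳ _)) (-‿cong (trans (*-congˡ (trans (+-cong (sym (Δ₀≈X H≤JY)) (+-cong (sym Δ₁) (*-cong (*-congʳ (sym (⟦⟧-+ s s))) (sym Δᵦ)))) three-terms)) (zeroʳ _))) ⟩
              0# ⊝ 0#   ≈⟨ -‿inverseʳ 0# ⟩
              0#        ∎)

      step : J * Y < H
      step = ℕₚ.≰⇒> (by-β β ≡.refl s ≡.refl)
        where
        by-β : ∀ β₀ → β ≡ β₀ → ∀ s₀ → s ≡ s₀ → H ≤ J * Y → ⊥
        by-β zero     β≡ _        _  = B≡1-case (≡.trans B≡ (≡.cong (λ v → suc (v + v)) β≡))
        by-β (suc β′) β≡ zero     s≡ _ = even≢odd J 0 (≡.trans N≡ (≡.cong (λ v → suc (v * B)) s≡))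
        by-β (suc β′) β≡ (suc s′) s≡ = contradiction {β′} β≡ {s′ + h′} {s′} s≡ (≡.cong (_+ h′) (≡.sym s≡))

    module Ladder {a : ℕ} (a≤h : a ≤ h) {Y : ℕ} (key : Key (suc Y)) (key₁ : Key 1) (A∣Y : p ^ a ∣ Y) (0<Y : 0 < Y) (Y<H : Y < H) where
      -- The rungs of the ladder: the values J with 2J = (2i + 1) p^b + 1, to which `Step` applies
      -- with s = 2i + 1.
      half : ℕ → ℕ → ℕ
      half b i = i * p ^ b + suc (proj₁ (p^-odd b))

      double-half : ∀ b i → half b i + half b i ≡ suc (suc (i + i) * p ^ b)
      double-half b i = ≡.trans (≡.cong (λ B → (i * B + suc β) + (i * B + suc β)) B≡)
        (≡.trans (solve′ 2 (λ i β → (i :*′ (con′ 1 :+′ (β :+′ β)) :+′ (con′ 1 :+′ β)) :+′ (i :*′ (con′ 1 :+′ (β :+′ β)) :+′ (con′ 1 :+′ β))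
          :=′ con′ 1 :+′ (con′ 1 :+′ (i :+′ i)) :*′ (con′ 1 :+′ (β :+′ β))) ≡.refl i β) (≡.cong (λ B → suc (suc (i + i) * B)) (≡.sym B≡)))
        where
        β = proj₁ (p^-odd b)
        B≡ = proj₂ (p^-odd b)

      Below : ℕ → ℕ → Set
      Below b i = half b i * Y < H

      climb : ∀ {b} i → b < a → suc (i + i) + suc (i + i) ≤ p → (∀ r → p ^ b ≤ r → (half b i ∸ r) * Y < H) →
              half b i * Y < H + H + H → Below b i
      climb {b} i b<a 2s≤p far JY<3H = Step.step a≤h b<a (key J 0<J N<u) (key₁ J 0<J N<u) A∣Y 0<Y 0<J N<u N≡ 2s≤p far JY<3H
        where
        J = half b i
        s = suc (i + i)
        N≡ : J + J ≡ suc (s * p ^ b)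
        N≡ = double-half b i
        0<J : 0 < J
        0<J = ℕₚ.≤-trans (s≤s z≤n) (ℕₚ.m≤n+m (suc (proj₁ (p^-odd b))) (i * p ^ b))
        N<u : J + J < u
        N<u = s≤s⁻¹ (double-cancel-≤ (ℕₚ.≤-trans (ℕₚ.≤-trans (ℕₚ.≤-reflexive
            (≡.trans (≡.cong (λ N → (2 + N) + (2 + N)) N≡) (solve′ 2 (λ s B → (con′ 3 :+′ s :*′ B) :+′ (con′ 3 :+′ s :*′ B) :=′ (s :+′ s) :*′ B :+′ con′ 6) ≡.refl s (p ^ b))))
            (ℕₚ.+-mono-≤ (ℕₚ.*-monoˡ-≤ (p ^ b) 2s≤p) 5<p)) (ℕₚ.+-mono-≤ (∣.∣⇒≤ (pᵃ∣Q (ℕₚ.<-≤-trans b<a a≤h))) p≤Q)))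

      scale : ∀ J {J′} → J ≤ J′ + J′ + J′ → J′ * Y < H → J * Y < H + H + H
      scale J {J′} J≤3J′ J′Y<H = ℕₚ.≤-<-trans (ℕₚ.≤-trans (ℕₚ.*-monoˡ-≤ Y J≤3J′)
        (ℕₚ.≤-reflexive (solve′ 2 (λ J Y → (J :+′ J :+′ J) :*′ Y :=′ J :*′ Y :+′ J :*′ Y :+′ J :*′ Y) ≡.refl J′ Y))) (ℕₚ.+-mono-< (ℕₚ.+-mono-< J′Y<H J′Y<H) J′Y<H)

      -- Raising i by one adds B = p^b to J. Hence J - r with r ≥ B is at most the previous rung,
      -- and the new J is at most three times the previous one, which gives both bounds that `climb`
      -- asks for.
      climb-digit : ∀ {b} → b < a → Below b 0 → ∀ i → suc (i + i) + suc (i + i) ≤ p → Below b i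
      climb-digit b<a start zero    _     = start
      climb-digit {b} b<a start (suc i) 2s≤p = climb (suc i) b<a 2s≤p far (scale (half b (suc i)) {J′} J≤3J′ previous)
        where
        B = p ^ b
        J′ = half b i
        previous : Below b i
        previous = climb-digit b<a start i (ℕₚ.≤-trans (ℕₚ.+-mono-≤ i≤ i≤) 2s≤p)
          where
          i≤ : suc (i + i) ≤ suc (suc i + suc i)
          i≤ = s≤s (ℕₚ.+-mono-≤ (ℕₚ.n≤1+n i) (ℕₚ.n≤1+n i))
        J≡ : half b (suc i) ≡ B + J′
        J≡ = ℕₚ.+-assoc B (i * B) _
        far : ∀ r → B ≤ r → (half b (suc i) ∸ r) * Y < H
        far r B≤r = ℕₚ.≤-<-trans (ℕₚ.*-monoˡ-≤ Y (ℕₚ.≤-trans (ℕₚ.∸-monoʳ-≤ (half b (suc i)) B≤r) (ℕₚ.≤-reflexive (≡.trans (≡.cong (_∸ B) J≡) (ℕₚ.m+n∸m≡n B J′))))) previous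
        J≤3J′ : half b (suc i) ≤ J′ + J′ + J′
        J≤3J′ = ℕₚ.≤-trans (ℕₚ.≤-reflexive J≡) (ℕₚ.+-monoˡ-≤ J′ (ℕₚ.≤-trans (ℕₚ.≤-trans (ℕₚ.m≤m+n B ((i + i) * B)) (ℕₚ.n≤1+n _)) (ℕₚ.≤-reflexive (≡.sym (double-half b i)))))

      module _ (i₀ : ℕ) (4i₀+2≤p : suc (i₀ + i₀) + suc (i₀ + i₀) ≤ p) (p≤6i₀+3 : p ≤ suc (i₀ + i₀) + suc (i₀ + i₀) + suc (i₀ + i₀)) where

        -- As p ≤ 3s, three times s B + 1 is at least p B + 3. This covers p B + 1, twice the first
        -- rung of the next digit, and the surplus 2 produces A + 3 in the final bound.
        triple-half : ∀ b → suc (p * p ^ b) + 2 ≤ (half b i₀ + half b i₀ + half b i₀) + (half b i₀ + half b i₀ + half b i₀)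
        triple-half b = ℕₚ.≤-trans (ℕₚ.+-monoˡ-≤ 2 (s≤s (ℕₚ.*-monoˡ-≤ (p ^ b) p≤6i₀+3))) (ℕₚ.≤-reflexive
          (≡.trans (solve′ 2 (λ s B → con′ 1 :+′ (s :+′ s :+′ s) :*′ B :+′ con′ 2 :=′ (con′ 1 :+′ s :*′ B) :+′ (con′ 1 :+′ s :*′ B) :+′ (con′ 1 :+′ s :*′ B)) ≡.refl (suc (i₀ + i₀)) (p ^ b))
          (≡.trans (≡.cong (λ v → v + v + v) (≡.sym (double-half b i₀))) (solve′ 1 (λ J → (J :+′ J) :+′ (J :+′ J) :+′ (J :+′ J) :=′ (J :+′ J :+′ J) :+′ (J :+′ J :+′ J)) ≡.refl (half b i₀)))))

        bottom : ∀ b → b < a → Below b 0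
        bottom zero    0<a = ≡.subst (λ v → v * Y < H) (halve {1} {half 0 0} (≡.sym (double-half 0 0))) (ℕₚ.≤-<-trans (ℕₚ.≤-reflexive (ℕₚ.*-identityˡ Y)) Y<H)
        bottom (suc b) b<a = climb 0 b<a (ℕₚ.≤-trans (s≤s (s≤s z≤n)) 5<p) far
          (scale (half (suc b) 0) {half b i₀} (double-cancel-≤ (ℕₚ.≤-trans (ℕₚ.≤-reflexive (≡.trans (double-half (suc b) 0) (≡.cong suc (ℕₚ.*-identityˡ _)))) (ℕₚ.≤-trans (ℕₚ.m≤m+n _ 2) (triple-half b))))
            (climb-digit (ℕₚ.<-trans (ℕₚ.n<1+n b) b<a) (bottom b (ℕₚ.<-trans (ℕₚ.n<1+n b) b<a)) i₀ 4i₀+2≤p))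
          where
          -- The first rung of a digit is at most p^(b + 1), so the truncated difference is 0.
          far : ∀ r → p ^ suc b ≤ r → (half (suc b) 0 ∸ r) * Y < H
          far r B≤r = ≡.subst (λ v → v * Y < H) (≡.sym (ℕₚ.m≤n⇒m∸n≡0 (ℕₚ.≤-trans
            (double-cancel-≤ (ℕₚ.≤-trans (ℕₚ.≤-reflexive (≡.trans (double-half (suc b) 0) (≡.cong suc (ℕₚ.*-identityˡ _))))
              (ℕₚ.+-monoˡ-≤ (p ^ suc b) (ℕₚ.m^n>0 p {{prime⇒nonZero pr}} (suc b))))) B≤r))) 0<H

        ladder-top : ∀ {b} → suc b ≡ a → Below b i₀
        ladder-top {b} ≡.refl = climb-digit (ℕₚ.n<1+n b) (bottom b (ℕₚ.n<1+n b)) i₀ 4i₀+2≤p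

        top-bound : ∀ J → 0 < a → J + J ≤ p ^ a + 3 → J * Y < H + H + H
        top-bound J 0<a 2J≤ = scale J {half (pred a) i₀} (double-cancel-≤ (ℕₚ.≤-trans 2J≤ (ℕₚ.≤-trans (ℕₚ.≤-reflexive (≡.trans (≡.cong (λ v → p ^ v + 3) (≡.sym a≡)) (ℕₚ.+-suc (p * p ^ pred a) 2))) (triple-half (pred a))))) (ladder-top a≡)
          where
          a≡ : suc (pred a) ≡ a
          a≡ = ℕₚ.suc-pred a {{>-nonZero 0<a}}

    -- κ k C(m, k) = φ k (2m): falling factorials in steps of 2, so that the arguments, which are
    -- half-integers in characteristic p, become integers.
    φ : ℕ → Carrier → Carrier
    φ zero    X = ⟦ 1 ⟧
    φ (suc k) X = φ k X ⊛ (X ⊝ ⟦ k + k ⟧)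

    φ-cong : ∀ k {X X′} → X ≈ X′ → φ k X ≈ φ k X′
    φ-cong zero    eq = refl
    φ-cong (suc k) eq = *-cong (φ-cong k eq) (+-congʳ eq)

    κ : ℕ → Carrier
    κ zero    = ⟦ 1 ⟧
    κ (suc k) = κ k ⊛ (⟦ 2 ⟧ ⊛ ⟦ suc k ⟧)

    1⊛x≈x : ∀ {x} → ⟦ 1 ⟧ ⊛ x ≈ x
    1⊛x≈x = trans (*-congʳ (+-identityʳ 1#)) (*-identityˡ _)

    C-next : ∀ m k → ⟦ suc k ⟧ ⊛ ⟦ m C suc k ⟧ ≈ ⟦ m C k ⟧ ⊛ (⟦ m ⟧ ⊝ ⟦ k ⟧)
    C-next m k = begin
      ⟦ suc k ⟧ ⊛ ⟦ m C suc k ⟧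
        ≈⟨ solve 3 (λ s a b → s :* b := s :* (a :+ b) :- s :* a) refl ⟦ suc k ⟧ ⟦ m C k ⟧ ⟦ m C suc k ⟧ ⟩
      ⟦ suc k ⟧ ⊛ (⟦ m C k ⟧ ⊕ ⟦ m C suc k ⟧) ⊝ ⟦ suc k ⟧ ⊛ ⟦ m C k ⟧
        ≈⟨ +-congʳ (*-congˡ (trans (⟦⟧-cong (pascal m k)) (⟦⟧-+ (m C k) _))) ⟨
      ⟦ suc k ⟧ ⊛ ⟦ suc m C suc k ⟧ ⊝ ⟦ suc k ⟧ ⊛ ⟦ m C k ⟧
        ≈⟨ +-congʳ (trans (sym (⟦⟧-* (suc k) (suc m C suc k))) (trans (⟦⟧-cong (absorption m k)) (⟦⟧-* (suc m) (m C k)))) ⟩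
      ⟦ suc m ⟧ ⊛ ⟦ m C k ⟧ ⊝ ⟦ suc k ⟧ ⊛ ⟦ m C k ⟧
        ≈⟨ solve 4 (λ o m k x → (o :+ m) :* x :- (o :+ k) :* x := x :* (m :- k)) refl 1# ⟦ m ⟧ ⟦ k ⟧ ⟦ m C k ⟧ ⟩
      ⟦ m C k ⟧ ⊛ (⟦ m ⟧ ⊝ ⟦ k ⟧) ∎

    C≈φ : ∀ m k → κ k ⊛ ⟦ m C k ⟧ ≈ φ k (⟦ m + m ⟧)
    C≈φ m zero    = 1⊛x≈x
    C≈φ m (suc k) = begin
      (κ k ⊛ (⟦ 2 ⟧ ⊛ ⟦ suc k ⟧)) ⊛ ⟦ m C suc k ⟧
        ≈⟨ solve 3 (λ a b c → (a :* (con (ℤ.+ 2) :* b)) :* c := a :* (con (ℤ.+ 2) :* (b :* c))) refl (κ k) ⟦ suc k ⟧ ⟦ m C suc k ⟧ ⟩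
      κ k ⊛ (⟦ 2 ⟧ ⊛ (⟦ suc k ⟧ ⊛ ⟦ m C suc k ⟧))
        ≈⟨ *-congˡ (*-congˡ (C-next m k)) ⟩
      κ k ⊛ (⟦ 2 ⟧ ⊛ (⟦ m C k ⟧ ⊛ (⟦ m ⟧ ⊝ ⟦ k ⟧)))
        ≈⟨ solve 4 (λ a c m k → a :* (con (ℤ.+ 2) :* (c :* (m :- k))) := (a :* c) :* ((m :+ m) :- (k :+ k))) refl (κ k) ⟦ m C k ⟧ ⟦ m ⟧ ⟦ k ⟧ ⟩
      (κ k ⊛ ⟦ m C k ⟧) ⊛ ((⟦ m ⟧ ⊕ ⟦ m ⟧) ⊝ (⟦ k ⟧ ⊕ ⟦ k ⟧))
        ≈⟨ *-cong (C≈φ m k) (+-cong (sym (⟦⟧-+ m m)) (-‿cong (sym (⟦⟧-+ k k)))) ⟩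
      φ k ⟦ m + m ⟧ ⊛ (⟦ m + m ⟧ ⊝ ⟦ k + k ⟧) ∎

    ⟦⟧-difference : ∀ {x y z} → x + y ≡ z → ⟦ x ⟧ ≈ ⟦ z ⟧ ⊝ ⟦ y ⟧
    ⟦⟧-difference {x} {y} {z} eq = trans (solve 2 (λ a b → a := (a :+ b) :- b) refl ⟦ x ⟧ ⟦ y ⟧) (+-congʳ (trans (sym (⟦⟧-+ x y)) (⟦⟧-cong eq)))

    -- The relations with 2J = A + s

    module Top {a : ℕ} (0<a : 0 < a) (a<h : a < h) (y v : ℕ) (0<y : 0 < y)
               (s≤α : suc (v + v) ≤ proj₁ (p^-odd a))
               (key : KeyAt (suc (y * p ^ a)) (suc (proj₁ (p^-odd a)) + v))
               (N<u : (suc (proj₁ (p^-odd a)) + v) + (suc (proj₁ (p^-odd a)) + v) < u) where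
      private
        A α s J : ℕ
        A = p ^ a
        α = proj₁ (p^-odd a)
        s = suc (v + v)
        J = suc α + v

      Y : ℕ
      Y = y * A
      private
        N π g : ℕ
        N = J + J
        π = proj₁ p-odd
        g = proj₁ (H-digits a<h)
        Λ : ℕ → Carrier
        Λ = proj₁ key
        A≡ : A ≡ suc (α + α)
        A≡ = proj₂ (p^-odd a)
        H′≡ : H′ ≡ (g * p + π) * A + α
        H′≡ = proj₂ (H-digits a<h)
        N<Q : N < Q
        N<Q = ℕₚ.<-trans N<u (ℕₚ.n<1+n u)
        N≡ : N ≡ 1 * A + s
        N≡ = ≡.trans (solve′ 2 (λ α v → (con′ 1 :+′ α :+′ v) :+′ (con′ 1 :+′ α :+′ v) :=′ con′ 1 :*′ (con′ 1 :+′ (α :+′ α)) :+′ (con′ 1 :+′ (v :+′ v))) ≡.refl α v)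
          (≡.cong (λ A → 1 * A + s) (≡.sym A≡))
        α<A : α < A
        α<A = ℕₚ.≤-trans (s≤s (ℕₚ.m≤m+n α α)) (ℕₚ.≤-reflexive (≡.sym A≡))
        s<A : s < A
        s<A = ℕₚ.≤-<-trans s≤α α<A

      ⟦A⟧≈0 : ⟦ A ⟧ ≈ 0#
      ⟦A⟧≈0 = p∣⇒⟦⟧≈0 (p∣p^ 0<a)

      private
        open Wraps A (pᵃ∣Q (ℕₚ.<⇒≤ a<h)) key (∣.n∣m*n y) N<Q

        -- In base A the lower index has the digits 1 and s, so the binomial is the leading part of
        -- the upper index times C(x′, s).
        lucas : ∀ t {x} k x′ → x ≡ k * A + x′ → x′ < A → ⟦ (t * Y + x) C N ⟧ ≈ ⟦ t * y + k ⟧ ⊛ ⟦ x′ C s ⟧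
        lucas t {x} k x′ x≡ x′<A = begin
          ⟦ (t * Y + x) C N ⟧                              ≡⟨ ≡.cong₂ (λ v w → ⟦ v C w ⟧) (≡.trans (≡.cong (t * Y +_) x≡) (solve′ 5 (λ t y A k x → t :*′ (y :*′ A) :+′ (k :*′ A :+′ x) :=′ (t :*′ y :+′ k) :*′ A :+′ x) ≡.refl t y A k x′)) N≡ ⟩
          ⟦ ((t * y + k) * A + x′) C (1 * A + s) ⟧         ≈⟨ C-lucas a (t * y + k) x′ 1 s x′<A s<A ⟩
          ⟦ (t * y + k) C 1 ⟧ ⊛ ⟦ x′ C s ⟧                 ≈⟨ *-congʳ (⟦⟧-cong (nC1≡n (t * y + k))) ⟩
          ⟦ t * y + k ⟧ ⊛ ⟦ x′ C s ⟧                       ∎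

        lucas-0 : ∀ t {x} k x′ → x ≡ k * A + x′ → x′ < s → ⟦ (t * Y + x) C N ⟧ ≈ 0#
        lucas-0 t k x′ x≡ x′<s = trans (lucas t k x′ x≡ (ℕₚ.<-trans x′<s s<A)) (trans (*-congˡ (⟦⟧-cong (k>n⇒nCk≡0 x′ s x′<s))) (zeroʳ _))

        -- The base-A leading part of z + H and of z + H′; in the field 2 k₀ = 1.
        k₀ : ℕ
        k₀ = suc (g * p + π)

      -- Clears the denominators: the factor 2 belongs to the leading part, `κ s` to C(x′, s). The
      -- values of `L` become polynomials in y with integer coefficients.
      scaleₛ : Carrier
      scaleₛ = ⟦ 2 ⟧ ⊛ κ s

      L : ℕ → Carrier
      L t = scaleₛ ⊛ Λ t

      private
        scaled : ∀ x′ {Z W T D : Carrier} → Z ≈ W ⊛ ⟦ x′ C s ⟧ → ⟦ 2 ⟧ ⊛ W ≈ T → ⟦ x′ + x′ ⟧ ≈ D → scaleₛ ⊛ Z ≈ T ⊛ φ s D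
        scaled x′ {Z} {W} {T} {D} Z≈ W≈ D≈ = begin
          (⟦ 2 ⟧ ⊛ κ s) ⊛ Z                      ≈⟨ *-congˡ Z≈ ⟩
          (⟦ 2 ⟧ ⊛ κ s) ⊛ (W ⊛ ⟦ x′ C s ⟧)       ≈⟨ solve 3 (λ k w c → (con (ℤ.+ 2) :* k) :* (w :* c) := (con (ℤ.+ 2) :* w) :* (k :* c)) refl (κ s) W ⟦ x′ C s ⟧ ⟩
          (⟦ 2 ⟧ ⊛ W) ⊛ (κ s ⊛ ⟦ x′ C s ⟧)       ≈⟨ *-cong W≈ (trans (C≈φ x′ s) (φ-cong s D≈)) ⟩
          T ⊛ φ s D                              ∎

        2x≈ : ∀ x c k m → x + x + k ≡ c * A + m → ⟦ x + x ⟧ ≈ ⟦ m ⟧ ⊝ ⟦ k ⟧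
        2x≈ x c k m eq = trans (⟦⟧-difference {x + x} {k} eq) (+-congʳ (trans (⟦⟧-+ (c * A) m)
          (trans (+-congʳ (trans (⟦⟧-* c A) (trans (*-congˡ ⟦A⟧≈0) (zeroʳ _)))) (+-identityˡ _))))

        J<tY+t : ∀ t → 0 < t → suc J ≤ t * Y + t
        J<tY+t t 0<t = ℕₚ.≤-trans (ℕₚ.≤-reflexive (ℕₚ.+-comm 1 J)) (ℕₚ.+-mono-≤ (ℕₚ.≤-trans J≤A (∣.∣⇒≤ {{>-nonZero (ℕₚ.*-mono-< 0<t (ℕₚ.*-mono-< 0<y (ℕₚ.≤-<-trans z≤n α<A)))}} (∣.∣n⇒∣m*n t (∣.n∣m*n y)))) 0<t)
          where
          J≤A : J ≤ A
          J≤A = ℕₚ.≤-trans (s≤s (ℕₚ.+-monoʳ-≤ α (ℕₚ.≤-trans (ℕₚ.m≤m+n v v) (ℕₚ.≤-trans (ℕₚ.n≤1+n _) s≤α)))) (ℕₚ.≤-reflexive (≡.sym A≡))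

      module At (r σ t : ℕ) (σ+r≡s : σ + r ≡ s) (t+r≡J : t + r ≡ J) where
        -- This is 2 t y: from 2t = A + s - 2r the field sees only s - 2r, so A disappears.
        T : Carrier
        T = (⟦ s ⟧ ⊝ ⟦ r + r ⟧) ⊛ ⟦ y ⟧

        private
          t≤J : t ≤ J
          t≤J = ≡.subst (t ≤_) t+r≡J (ℕₚ.m≤m+n t r)
          r≤s : r ≤ s
          r≤s = ≡.subst (r ≤_) σ+r≡s (ℕₚ.m≤n+m r σ)
          σ≤s : σ ≤ s
          σ≤s = ≡.subst (σ ≤_) σ+r≡s (ℕₚ.m≤m+n σ r)
          0<t : 0 < t
          0<t = ℕₚ.+-cancelʳ-< r 0 t (ℕₚ.≤-trans (s≤s (ℕₚ.≤-trans r≤s (ℕₚ.≤-trans s≤α (ℕₚ.m≤m+n α v)))) (ℕₚ.≤-reflexive (≡.sym t+r≡J)))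
          J+t≡ : J + t ≡ A + σ
          J+t≡ = ℕₚ.+-cancelʳ-≡ r _ _ (≡.trans (ℕₚ.+-assoc J t r) (≡.trans (≡.cong (J +_) t+r≡J) (≡.trans N≡ (≡.trans (≡.cong₂ _+_ (ℕₚ.*-identityˡ A) (≡.sym σ+r≡s)) (≡.sym (ℕₚ.+-assoc A σ r))))))
          z : ℕ
          z = α + α + σ
          z≡ : suc z ≡ J + t
          z≡ = ≡.trans (≡.cong (_+ σ) (≡.sym A≡)) (≡.sym J+t≡)
          2ty≈T : ⟦ 2 ⟧ ⊛ ⟦ t * y ⟧ ≈ T
          2ty≈T = begin
            ⟦ 2 ⟧ ⊛ ⟦ t * y ⟧                ≈⟨ *-congˡ (⟦⟧-* t y) ⟩
            ⟦ 2 ⟧ ⊛ (⟦ t ⟧ ⊛ ⟦ y ⟧)          ≈⟨ solve 2 (λ t y → con (ℤ.+ 2) :* (t :* y) := (t :+ t) :* y) refl ⟦ t ⟧ ⟦ y ⟧ ⟩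
            (⟦ t ⟧ ⊕ ⟦ t ⟧) ⊛ ⟦ y ⟧          ≈⟨ *-congʳ (trans (sym (⟦⟧-+ t t)) (⟦⟧-difference {t + t} {r + r} 2t+2r≡)) ⟩
            (⟦ A + s ⟧ ⊝ ⟦ r + r ⟧) ⊛ ⟦ y ⟧  ≈⟨ *-congʳ (+-congʳ (trans (⟦⟧-+ A s) (trans (+-congʳ ⟦A⟧≈0) (+-identityˡ _)))) ⟩
            T                                ∎
            where
            2t+2r≡ : (t + t) + (r + r) ≡ A + s
            2t+2r≡ = ≡.trans (solve′ 2 (λ t r → (t :+′ t) :+′ (r :+′ r) :=′ (t :+′ r) :+′ (t :+′ r)) ≡.refl t r) (≡.trans (≡.cong₂ _+_ t+r≡J t+r≡J) (≡.trans N≡ (≡.cong (_+ s) (ℕₚ.*-identityˡ A))))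
          2[ty+0]≈T : ⟦ 2 ⟧ ⊛ ⟦ t * y + 0 ⟧ ≈ T
          2[ty+0]≈T = trans (*-congˡ (⟦⟧-cong (ℕₚ.+-identityʳ (t * y)))) 2ty≈T
          2[ty+k₀]≈T+1 : ⟦ 2 ⟧ ⊛ ⟦ t * y + k₀ ⟧ ≈ T ⊕ ⟦ 1 ⟧
          2[ty+k₀]≈T+1 = begin
            ⟦ 2 ⟧ ⊛ ⟦ t * y + k₀ ⟧               ≈⟨ *-congˡ (⟦⟧-+ (t * y) k₀) ⟩
            ⟦ 2 ⟧ ⊛ (⟦ t * y ⟧ ⊕ ⟦ k₀ ⟧)         ≈⟨ trans (distribˡ _ _ _) (+-cong 2ty≈T (sym (⟦⟧-* 2 k₀))) ⟩
            T ⊕ ⟦ 2 * k₀ ⟧                       ≡⟨ ≡.cong (λ v → T ⊕ ⟦ v ⟧) (≡.trans (solve′ 3 (λ g P π → con′ 2 :*′ (con′ 1 :+′ (g :*′ P :+′ π)) :=′ con′ 1 :+′ (con′ 2 :*′ g :*′ P :+′ (con′ 1 :+′ (π :+′ π)))) ≡.refl g p π) (≡.cong (λ v → suc (2 * g * p + v)) (≡.sym (proj₂ p-odd)))) ⟩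
            T ⊕ ⟦ 1 + (2 * g * p + p) ⟧          ≈⟨ +-congˡ (trans (⟦⟧-+ 1 (2 * g * p + p)) (+-congˡ (p∣⇒⟦⟧≈0 (∣.∣m∣n⇒∣m+n (∣.n∣m*n (2 * g)) ∣.∣-refl)))) ⟩
            T ⊕ (⟦ 1 ⟧ ⊕ 0#)                     ≈⟨ +-congˡ (+-identityʳ _) ⟩
            T ⊕ ⟦ 1 ⟧                            ∎

          α+σ<A : α + σ < A
          α+σ<A = ℕₚ.≤-<-trans (ℕₚ.+-monoʳ-≤ α (ℕₚ.≤-trans σ≤s s≤α)) (ℕₚ.≤-reflexive (≡.sym A≡))

        -- Comes from the upper index t Y + A - 1 + σ. For σ = 0 its low digit is A - 1, whose
        -- double is -2 in the field. For σ > 0 a carry leaves the digit σ - 1 < s and the binomial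
        -- vanishes.
        low₁ : ℕ → Carrier
        low₁ zero    = T ⊛ φ s (⟦ 0 ⟧ ⊝ ⟦ 2 ⟧)
        low₁ (suc _) = 0#

        -- After two wraps the upper index is smaller by one, so the carry sets in one step later: σ
        -- = 0 and σ = 1 have the low digits A - 2 and A - 1.
        low₂ : ℕ → Carrier
        low₂ zero          = T ⊛ φ s (⟦ 0 ⟧ ⊝ ⟦ 4 ⟧)
        low₂ (suc zero)    = T ⊛ φ s (⟦ 0 ⟧ ⊝ ⟦ 2 ⟧)
        low₂ (suc (suc _)) = 0#

        private
          α≡ : suc (pred α) ≡ α
          α≡ = ℕₚ.suc-pred α {{>-nonZero (ℕₚ.≤-trans (s≤s z≤n) s≤α)}}

          4α+2≡ : ∀ {A} → A ≡ suc (α + α) → (α + α) + (α + α) + 2 ≡ 2 * A + 0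
          4α+2≡ ≡.refl = solve′ 1 (λ α → (α :+′ α) :+′ (α :+′ α) :+′ con′ 2 :=′ con′ 2 :*′ (con′ 1 :+′ (α :+′ α)) :+′ con′ 0) ≡.refl α

          4α-2≡ : ∀ {A} → A ≡ suc (α + α) → (pred α + α) + (pred α + α) + 4 ≡ 2 * A + 0
          4α-2≡ ≡.refl = ≡.trans (solve′ 2 (λ β α → (β :+′ α) :+′ (β :+′ α) :+′ con′ 4 :=′ ((con′ 1 :+′ β) :+′ α) :+′ ((con′ 1 :+′ β) :+′ α) :+′ con′ 2) ≡.refl (pred α) α)
            (≡.trans (≡.cong (λ w → (w + α) + (w + α) + 2) α≡) (4α+2≡ ≡.refl))

          2α<A : α + α < A
          2α<A = ℕₚ.≤-reflexive (≡.sym A≡)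

          low₁-value : ∀ σ → σ ≤ s → scaleₛ ⊛ ⟦ (t * Y + (α + α + σ)) C N ⟧ ≈ low₁ σ
          low₁-value zero    _   = scaled (α + α) (lucas t 0 (α + α) (ℕₚ.+-identityʳ _) 2α<A) 2[ty+0]≈T (2x≈ (α + α) 2 2 0 (4α+2≡ A≡))
          low₁-value (suc σ) σ<s = trans (*-congˡ (lucas-0 t 1 σ (≡.trans (ℕₚ.+-suc (α + α) σ) (≡.cong (_+ σ) (≡.trans (≡.sym A≡) (≡.sym (ℕₚ.*-identityˡ A))))) σ<s)) (zeroʳ _)

          low₂-value : ∀ σ {z′} → suc z′ ≡ α + α + σ → σ ≤ s → scaleₛ ⊛ ⟦ (t * Y + z′) C N ⟧ ≈ low₂ σ
          low₂-value zero       {z′} z′≡ _   = scaled (pred α + α) (lucas t 0 (pred α + α) (ℕₚ.suc-injective (≡.trans z′≡ (≡.trans (ℕₚ.+-identityʳ _) (≡.cong (_+ α) (≡.sym α≡)))))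
              (ℕₚ.≤-<-trans (ℕₚ.+-monoˡ-≤ α (ℕₚ.pred[n]≤n {α})) 2α<A)) 2[ty+0]≈T (2x≈ (pred α + α) 2 4 0 (4α-2≡ A≡))
          low₂-value (suc zero) {z′} z′≡ _   = scaled (α + α) (lucas t 0 (α + α) (ℕₚ.suc-injective (≡.trans z′≡ (ℕₚ.+-comm (α + α) 1))) 2α<A) 2[ty+0]≈T (2x≈ (α + α) 2 2 0 (4α+2≡ A≡))
          low₂-value (suc (suc σ)) {z′} z′≡ σ<s = trans (*-congˡ (lucas-0 t 1 σ (ℕₚ.suc-injective (≡.trans z′≡ (≡.trans (solve′ 2 (λ α σ → α :+′ α :+′ (con′ 2 :+′ σ) :=′ con′ 1 :+′ ((con′ 1 :+′ (α :+′ α)) :+′ σ)) ≡.refl α σ)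
              (≡.cong (λ w → suc (w + σ)) (≡.trans (≡.sym A≡) (≡.sym (ℕₚ.*-identityˡ A))))))) (ℕₚ.<-trans (ℕₚ.n<1+n σ) σ<s))) (zeroʳ _)

          z+H≡ : z + H ≡ k₀ * A + (α + σ)
          z+H≡ = ≡.trans (≡.cong (z +_) (≡.trans (≡.sym suc-H′) (≡.cong suc H′≡))) (≡.trans (solve′ 4 (λ α σ G A → (α :+′ α :+′ σ) :+′ (con′ 1 :+′ (G :*′ A :+′ α)) :=′ (con′ 1 :+′ (α :+′ α) :+′ G :*′ A) :+′ (α :+′ σ)) ≡.refl α σ (g * p + π) A)
            (≡.cong (λ w → w + (g * p + π) * A + (α + σ)) (≡.sym A≡)))

          z+H′≡ : z + H′ ≡ k₀ * A + (pred α + σ)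
          z+H′≡ = ℕₚ.suc-injective (≡.trans (≡.sym (ℕₚ.+-suc z H′)) (≡.trans (≡.cong (z +_) suc-H′) (≡.trans z+H≡ (≡.trans (≡.cong (λ w → k₀ * A + (w + σ)) (≡.sym α≡)) (ℕₚ.+-suc (k₀ * A) (pred α + σ))))))

          upper₀ : scaleₛ ⊛ ⟦ (t * Y + z + H) C N ⟧ ≈ (T ⊕ ⟦ 1 ⟧) ⊛ φ s (⟦ σ + σ ⟧ ⊝ ⟦ 1 ⟧)
          upper₀ = scaled (α + σ) (trans (⟦⟧-cong (≡.cong (_C N) (ℕₚ.+-assoc (t * Y) z H))) (lucas t k₀ (α + σ) z+H≡ α+σ<A)) 2[ty+k₀]≈T+1
            (2x≈ (α + σ) 1 1 (σ + σ) (≡.trans (solve′ 2 (λ α σ → (α :+′ σ) :+′ (α :+′ σ) :+′ con′ 1 :=′ con′ 1 :*′ (con′ 1 :+′ (α :+′ α)) :+′ (σ :+′ σ)) ≡.refl α σ) (≡.cong (λ w → 1 * w + (σ + σ)) (≡.sym A≡))))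

          upper₁ : scaleₛ ⊛ ⟦ (t * Y + z + H′) C N ⟧ ≈ (T ⊕ ⟦ 1 ⟧) ⊛ φ s (⟦ σ + σ ⟧ ⊝ ⟦ 3 ⟧)
          upper₁ = scaled (pred α + σ) (trans (⟦⟧-cong (≡.cong (_C N) (ℕₚ.+-assoc (t * Y) z H′))) (lucas t k₀ (pred α + σ) z+H′≡ (ℕₚ.≤-<-trans (ℕₚ.+-monoˡ-≤ σ (ℕₚ.pred[n]≤n {α})) α+σ<A))) 2[ty+k₀]≈T+1
            (2x≈ (pred α + σ) 1 3 (σ + σ) (≡.trans (≡.trans (solve′ 2 (λ β σ → (β :+′ σ) :+′ (β :+′ σ) :+′ con′ 3 :=′ con′ 1 :*′ (con′ 1 :+′ ((con′ 1 :+′ β) :+′ (con′ 1 :+′ β))) :+′ (σ :+′ σ)) ≡.refl (pred α) σ) (≡.cong (λ w → 1 * suc (w + w) + (σ + σ)) α≡)) (≡.cong (λ w → 1 * w + (σ + σ)) (≡.sym A≡))))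

        value₀ : t * Y < H → L t ≈ low₁ σ ⊕ (T ⊕ ⟦ 1 ⟧) ⊛ φ s (⟦ σ + σ ⟧ ⊝ ⟦ 1 ⟧)
        value₀ tY<H = trans (*-congˡ (Λ-wrap₀ t z≡ t≤J (J<tY+t t 0<t) tY<H)) (trans (distribˡ _ _ _) (+-cong (low₁-value σ σ≤s) upper₀))

        value₁ : r + r + 3 ≤ A → H ≤ t * Y → t * Y < H + H → L t ≈ low₁ σ ⊕ (T ⊕ ⟦ 1 ⟧) ⊛ φ s (⟦ σ + σ ⟧ ⊝ ⟦ 3 ⟧)
        value₁ 2r+3≤A H≤tY tY<2H = trans (*-congˡ (Λ-wrap₁ t z≡ t≤J (ℕₚ.≤-trans (ℕₚ.≤-reflexive (≡.trans (≡.cong (λ w → w + w + 3) (≡.sym t+r≡J))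
              (solve′ 2 (λ t r → (t :+′ r) :+′ (t :+′ r) :+′ con′ 3 :=′ (r :+′ r :+′ con′ 3) :+′ (t :+′ t)) ≡.refl t r))) (ℕₚ.+-monoˡ-≤ (t + t) 2r+3≤A)) H≤tY tY<2H))
          (trans (distribˡ _ _ _) (trans (+-comm _ _) (+-cong (low₁-value σ σ≤s) upper₁)))

        value₂ : H + H ≤ t * Y → t * Y < H + H + H → L t ≈ low₂ σ ⊕ (T ⊕ ⟦ 1 ⟧) ⊛ φ s (⟦ σ + σ ⟧ ⊝ ⟦ 3 ⟧)
        value₂ 2H≤tY tY<3H = trans (*-congˡ (Λ-wrap₂ t (≡.trans (≡.cong suc z-1≡) z≡) t≤J c≤A 2H≤tY tY<3H))
          (trans (distribˡ _ _ _) (+-cong (low₂-value σ z-1≡ σ≤s) (trans (*-congˡ (⟦⟧-cong (≡.cong (λ w → (t * Y + w + H′) C N) z-1≡))) upper₁)))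
          where
          z-1≡ : suc (pred z) ≡ z
          z-1≡ = ℕₚ.suc-pred z {{>-nonZero (ℕₚ.≤-trans (ℕₚ.≤-trans (s≤s z≤n) s≤α) (ℕₚ.≤-trans (ℕₚ.m≤m+n α α) (ℕₚ.m≤m+n _ σ)))}}
          c≤A : J + 2 ≤ A + t
          c≤A = ℕₚ.≤-trans (ℕₚ.≤-reflexive (≡.trans (≡.cong (_+ 2) (≡.sym t+r≡J)) (solve′ 2 (λ t r → t :+′ r :+′ con′ 2 :=′ (con′ 1 :+′ (con′ 1 :+′ r)) :+′ t) ≡.refl t r)))
            (ℕₚ.+-monoˡ-≤ t (ℕₚ.≤-trans (s≤s (ℕₚ.≤-trans (s≤s (ℕₚ.≤-trans r≤s s≤α)) (ℕₚ.+-monoˡ-≤ α (ℕₚ.≤-trans (s≤s z≤n) s≤α)))) (ℕₚ.≤-reflexive (≡.sym A≡))))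

      -- These t belong to the indices r with 2r > A. Here z = α + v + t is still below A, while z +
      -- H has the low digit v + t < s, so only the first binomial survives.
      even-value : ∀ t → 0 < t → t ≤ v → t * Y < H → L t ≈ (⟦ t + t ⟧ ⊛ ⟦ y ⟧) ⊛ φ s (⟦ s + (t + t) ⟧ ⊝ ⟦ 2 ⟧)
      even-value t 0<t t≤v tY<H = trans (*-congˡ (trans (Λ-wrap₀ t z≡ (ℕₚ.≤-trans t≤v (ℕₚ.m≤n+m v (suc α))) (J<tY+t t 0<t) tY<H) (trans (+-congˡ second≈0) (+-identityʳ _))))
        (scaled z (lucas t 0 z ≡.refl z<A) 2ty≈ (2x≈ z 1 2 (s + (t + t)) (≡.trans (solve′ 3 (λ α v t → (α :+′ (v :+′ t)) :+′ (α :+′ (v :+′ t)) :+′ con′ 2 :=′ con′ 1 :*′ (con′ 1 :+′ (α :+′ α)) :+′ ((con′ 1 :+′ (v :+′ v)) :+′ (t :+′ t))) ≡.refl α v t)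
          (≡.cong (λ w → 1 * w + (s + (t + t))) (≡.sym A≡)))))
        where
        z = α + (v + t)
        z≡ : suc z ≡ J + t
        z≡ = ≡.cong suc (≡.sym (ℕₚ.+-assoc α v t))
        v+t<s : v + t < s
        v+t<s = s≤s (ℕₚ.+-monoʳ-≤ v t≤v)
        z<A : z < A
        z<A = ℕₚ.≤-trans (s≤s (ℕₚ.+-monoʳ-≤ α (ℕₚ.≤-trans (ℕₚ.<⇒≤ v+t<s) s≤α))) (ℕₚ.≤-reflexive (≡.sym A≡))
        second≈0 : ⟦ (t * Y + z + H) C N ⟧ ≈ 0#
        second≈0 = trans (⟦⟧-cong (≡.cong (_C N) (ℕₚ.+-assoc (t * Y) z H))) (lucas-0 t k₀ (v + t) (≡.trans (≡.cong (z +_) (≡.trans (≡.sym suc-H′) (≡.cong suc H′≡)))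
          (≡.trans (solve′ 4 (λ α x G A → (α :+′ x) :+′ (con′ 1 :+′ (G :*′ A :+′ α)) :=′ (con′ 1 :+′ (α :+′ α) :+′ G :*′ A) :+′ x) ≡.refl α (v + t) (g * p + π) A) (≡.cong (λ w → w + (g * p + π) * A + (v + t)) (≡.sym A≡)))) v+t<s)
        2ty≈ : ⟦ 2 ⟧ ⊛ ⟦ t * y + 0 ⟧ ≈ ⟦ t + t ⟧ ⊛ ⟦ y ⟧
        2ty≈ = trans (sym (⟦⟧-* 2 (t * y + 0))) (trans (⟦⟧-cong (solve′ 2 (λ t y → con′ 2 :*′ (t :*′ y :+′ con′ 0) :=′ (t :+′ t) :*′ y) ≡.refl t y)) (⟦⟧-* (t + t) y))

      private
        -- Both binomials vanish: the first upper index has the low digit v < s in base A, the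
        -- second reduces to J < 2J modulo Q.
        Λ0≈0 : Λ 0 ≈ 0#
        Λ0≈0 = trans (proj₁ (proj₂ (proj₂ key)) 0 l z≤n (ℕₚ.<-≤-trans (ℕₚ.m<m+n (suc l) (s≤s z≤n)) (ℕₚ.≤-reflexive (≡.trans (≡.sym (ℕₚ.+-suc _ J)) l+J+1)))
            (0 , 1 , ≡.trans (ℕₚ.+-identityʳ _) (≡.trans l+J+1 (≡.sym (≡.cong₂ _+_ (ℕₚ.*-zeroʳ (suc Y)) (ℕₚ.*-identityˡ H))))))
          (trans (+-cong first≈0 second≈0) (+-identityʳ 0#))
          where
          suc-J≤H : suc J ≤ H
          suc-J≤H = double-cancel-≤ (≡.subst₂ _≤_ (≡.cong suc (≡.sym (ℕₚ.+-suc J J))) Q+1≡2H (s≤s (ℕₚ.<⇒≤ (s≤s N<u))))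
          l = H ∸ suc J
          l+J+1 : l + suc J ≡ H
          l+J+1 = ℕₚ.m∸n+n≡m suc-J≤H
          l+N≡ : l + N ≡ H′ + J
          l+N≡ = ℕₚ.suc-injective (≡.trans (solve′ 2 (λ l J → con′ 1 :+′ (l :+′ (J :+′ J)) :=′ (l :+′ (con′ 1 :+′ J)) :+′ J) ≡.refl l J) (≡.cong (_+ J) (≡.trans l+J+1 (≡.sym suc-H′))))
          first≈0 : ⟦ (l + N) C N ⟧ ≈ 0#
          first≈0 = trans (⟦⟧-cong (≡.cong (_C N) l+N≡)) (lucas-0 0 k₀ v (≡.trans (≡.cong (_+ J) H′≡) (≡.trans (solve′ 4 (λ α v G A → (G :*′ A :+′ α) :+′ (con′ 1 :+′ α :+′ v) :=′ (con′ 1 :+′ (α :+′ α) :+′ G :*′ A) :+′ v) ≡.refl α v (g * p + π) A)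
            (≡.cong (λ w → w + (g * p + π) * A + v) (≡.sym A≡)))) (s≤s (ℕₚ.m≤m+n v v)))
          second≈0 : ⟦ (l + H + N) C N ⟧ ≈ 0#
          second≈0 = trans (sym (C-modQ {J} N<Q (≡.trans (≡.cong (J +_) Q≡H+H′) (≡.trans (solve′ 3 (λ J H K → J :+′ (H :+′ K) :=′ H :+′ (K :+′ J)) ≡.refl J H H′) (≡.trans (≡.cong (H +_) (≡.sym l+N≡)) (solve′ 3 (λ l H N → H :+′ (l :+′ N) :=′ l :+′ H :+′ N) ≡.refl l H N))))))
            (⟦⟧-cong (k>n⇒nCk≡0 J N (ℕₚ.m<m+n J (s≤s z≤n))))

        coefficient : ∀ i {x z} → i + i ≡ x * A + z → z < A → ⟦ (N + N) C (i + i) ⟧ ≈ ⟦ 2 C x ⟧ ⊛ ⟦ (s + s) C z ⟧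
        coefficient i {x} {z} i≡ z<A = trans (⟦⟧-cong (≡.cong₂ _C_ (≡.trans (≡.cong₂ _+_ N≡ N≡) (solve′ 2 (λ A s → (con′ 1 :*′ A :+′ s) :+′ (con′ 1 :*′ A :+′ s) :=′ con′ 2 :*′ A :+′ (s :+′ s)) ≡.refl A s)) i≡))
          (C-lucas a 2 (s + s) x z (ℕₚ.≤-<-trans (ℕₚ.+-mono-≤ s≤α s≤α) (ℕₚ.≤-reflexive (≡.sym A≡))) z<A)

      -- By Lucas, with 2N = 2A + 2s, the coefficient C(2N, 2r) is C(2s, 2r) for 2r < A and 2 C(2s,
      -- 2i + 1) for 2r = A + 2i + 1. The former vanishes for r > s, so the number of remaining
      -- terms depends on s only.
      balance : S (suc s) (λ r → ⟦ (s + s) C (r + r) ⟧ ⊛ L (J ∸ r)) ⊕ S v (λ i → (⟦ 2 ⟧ ⊛ ⟦ (s + s) C suc (i + i) ⟧) ⊛ L (v ∸ i)) ≈ 0#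
      balance = begin
        S (suc s) (λ r → ⟦ (s + s) C (r + r) ⟧ ⊛ L (J ∸ r)) ⊕ S v (λ i → (⟦ 2 ⟧ ⊛ ⟦ (s + s) C suc (i + i) ⟧) ⊛ L (v ∸ i))
          ≈⟨ +-cong (trans (S-cong (suc s) low-coefficient) (trans (sym (+-identityʳ _)) (trans (+-congˡ (sym (S-0 (α ∸ s) middle≈0))) (sym (S-append (suc s) (α ∸ s) f))))) (S-cong v high-coefficient) ⟩
        S (suc s + (α ∸ s)) f ⊕ S v (λ i → f (suc α + i))
          ≡⟨ ≡.cong (λ w → S (suc w) f ⊕ S v (λ i → f (suc α + i))) (ℕₚ.m+[n∸m]≡n s≤α) ⟩
        S (suc α) f ⊕ S v (λ i → f (suc α + i))
          ≈⟨ S-append (suc α) v f ⟨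
        S J f
          ≈⟨ trans (S-cong J (λ r _ → solve 3 (λ c k x → c :* (k :* x) := k :* (c :* x)) refl ⟦ (N + N) C (r + r) ⟧ scaleₛ (Λ (J ∸ r)))) (S-*ˡ J scaleₛ (λ r → ⟦ (N + N) C (r + r) ⟧ ⊛ Λ (J ∸ r))) ⟩
        scaleₛ ⊛ Σ₀
          ≈⟨ trans (*-congˡ Σ₀≈0) (zeroʳ _) ⟩
        0# ∎
        where
        f : ℕ → Carrier
        f r = ⟦ (N + N) C (r + r) ⟧ ⊛ L (J ∸ r)
        Σ₀ : Carrier
        Σ₀ = S J (λ r → ⟦ (N + N) C (r + r) ⟧ ⊛ Λ (J ∸ r))
        Σ₀≈0 : Σ₀ ≈ 0#
        Σ₀≈0 = *-cancel-0 2≉0 (trans (sym (+-identityʳ _)) (trans (+-congˡ (sym (trans (*-congˡ Λ0≈0) (zeroʳ _)))) (proj₁ (proj₂ key))))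
        below : ∀ {r} → r ≤ α → r + r < A
        below r≤α = ℕₚ.≤-<-trans (ℕₚ.+-mono-≤ r≤α r≤α) (ℕₚ.≤-reflexive (≡.sym A≡))
        low-coefficient : ∀ r → r < suc s → ⟦ (s + s) C (r + r) ⟧ ⊛ L (J ∸ r) ≈ f r
        low-coefficient r r≤s = *-congʳ (sym (trans (coefficient r {0} ≡.refl (below (ℕₚ.≤-trans (s≤s⁻¹ r≤s) s≤α))) 1⊛x≈x))
        middle≈0 : ∀ i → i < α ∸ s → f (suc s + i) ≈ 0#
        middle≈0 i i<α-s = trans (*-congʳ (trans (coefficient r {0} ≡.refl (below r≤α)) (trans (*-congˡ (⟦⟧-cong (k>n⇒nCk≡0 (s + s) (r + r) (ℕₚ.+-mono-< s<r s<r)))) (zeroʳ _)))) (zeroˡ _)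
          where
          r = suc s + i
          s<r : s < r
          s<r = ℕₚ.m≤m+n (suc s) i
          r≤α : r ≤ α
          r≤α = ℕₚ.≤-trans (ℕₚ.≤-reflexive (≡.sym (ℕₚ.+-suc s i))) (ℕₚ.≤-trans (ℕₚ.+-monoʳ-≤ s i<α-s) (ℕₚ.≤-reflexive (ℕₚ.m+[n∸m]≡n s≤α)))
        high-coefficient : ∀ i → i < v → (⟦ 2 ⟧ ⊛ ⟦ (s + s) C suc (i + i) ⟧) ⊛ L (v ∸ i) ≈ f (suc α + i)
        high-coefficient i i<v = *-cong
          (sym (coefficient (suc α + i) {1} {suc (i + i)} (≡.trans (solve′ 2 (λ α i → (con′ 1 :+′ α :+′ i) :+′ (con′ 1 :+′ α :+′ i) :=′ con′ 1 :*′ (con′ 1 :+′ (α :+′ α)) :+′ (con′ 1 :+′ (i :+′ i))) ≡.refl α i) (≡.cong (λ w → 1 * w + suc (i + i)) (≡.sym A≡)))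
            (ℕₚ.≤-<-trans (s≤s (ℕₚ.+-mono-≤ (ℕₚ.<⇒≤ i<v) (ℕₚ.<⇒≤ i<v))) s<A)))
          (reflexive (≡.cong L (≡.sym (ℕₚ.[m+n]∸[m+o]≡n∸o (suc α) v i))))

    -- Elimination by the relations s = 1, 3 and 5

    module _ {m : ℕ} where
      # : ℕ → Polynomial m
      # k = con (ℤ.+ k)

      -- Reified copies of φ, T, the low parts and the values. They evaluate definitionally to the
      -- field expressions, so each pattern of wraps becomes a polynomial identity in y that the
      -- solver checks.
      φᴾ : ℕ → Polynomial m → Polynomial m
      φᴾ zero    X = # 1
      φᴾ (suc k) X = φᴾ k X :* (X :- # (k + k))

      Tᴾ : ℕ → ℕ → Polynomial m → Polynomial m
      Tᴾ s r y = (# s :- # (r + r)) :* y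

      lowᴾ₁ lowᴾ₂ : ℕ → ℕ → Polynomial m → Polynomial m
      lowᴾ₁ s zero    T = T :* φᴾ s (# 0 :- # 2)
      lowᴾ₁ s (suc _) T = # 0
      lowᴾ₂ s zero          T = T :* φᴾ s (# 0 :- # 4)
      lowᴾ₂ s (suc zero)    T = T :* φᴾ s (# 0 :- # 2)
      lowᴾ₂ s (suc (suc _)) T = # 0

      valueᴾ₀ valueᴾ₁ valueᴾ₂ : ℕ → ℕ → ℕ → Polynomial m → Polynomial m
      valueᴾ₀ s r σ y = lowᴾ₁ s σ (Tᴾ s r y) :+ (Tᴾ s r y :+ # 1) :* φᴾ s (# (σ + σ) :- # 1)
      valueᴾ₁ s r σ y = lowᴾ₁ s σ (Tᴾ s r y) :+ (Tᴾ s r y :+ # 1) :* φᴾ s (# (σ + σ) :- # 3)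
      valueᴾ₂ s r σ y = lowᴾ₂ s σ (Tᴾ s r y) :+ (Tᴾ s r y :+ # 1) :* φᴾ s (# (σ + σ) :- # 3)

      evenᴾ : ℕ → ℕ → Polynomial m → Polynomial m
      evenᴾ s t y = (# (t + t) :* y) :* φᴾ s (# (s + (t + t)) :- # 2)

    3≉0 : ⟦ 3 ⟧ ≉ 0#
    3≉0 = ⟦⟧-pos (s≤s z≤n) (ℕₚ.≤-trans (s≤s (s≤s (s≤s (s≤s z≤n)))) 5<p)

    4≉0 : ⟦ 4 ⟧ ≉ 0#
    4≉0 = ⟦⟧-pos (s≤s z≤n) (ℕₚ.<-trans (ℕₚ.n<1+n 4) 5<p)

    5≉0 : ⟦ 5 ⟧ ≉ 0#
    5≉0 = ⟦⟧-pos (s≤s z≤n) 5<p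

    ⟦*⟧-≉0 : ∀ {a b} → ⟦ a ⟧ ≉ 0# → ⟦ b ⟧ ≉ 0# → ⟦ a * b ⟧ ≉ 0#
    ⟦*⟧-≉0 {a} {b} a≉0 b≉0 eq = *-≉0 a≉0 b≉0 (trans (sym (⟦⟧-* a b)) eq)

    180≉0 : ⟦ 180 ⟧ ≉ 0#
    180≉0 = ⟦*⟧-≉0 {5} {36} 5≉0 (⟦*⟧-≉0 {4} {9} 4≉0 (⟦*⟧-≉0 {3} {3} 3≉0 3≉0))

    ⟦7⟧≈0⇒p≡7 : ⟦ 7 ⟧ ≈ 0# → p ≡ 7
    ⟦7⟧≈0⇒p≡7 eq = by-cases (ℕₚ.m≤n⇒m<n∨m≡n (∣.∣⇒≤ p∣7))
      where
      p∣7 : p ∣ 7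
      p∣7 = ⟦⟧≈0⇒p∣ eq
      by-cases : p < 7 ⊎ p ≡ 7 → p ≡ 7
      by-cases (inj₂ p≡7) = p≡7
      by-cases (inj₁ p<7) = ⊥-elim (∣.>⇒∤ (s≤s (s≤s z≤n)) (∣.∣m+n∣m⇒∣n {6} {6} {1} (≡.subst (_∣ 7) (ℕₚ.≤-antisym (s≤s⁻¹ p<7) 5<p) p∣7) ∣.∣-refl))

    -- Write s = 2i + 1. Climbing within a digit needs 2s ≤ p, passing to the next digit needs p ≤
    -- 3s. The choice s = 3 serves 6 to 9, and whenever s serves m, s + 2 serves m + 4.
    ladder-rung : ∃ λ i → suc (i + i) + suc (i + i) ≤ p × p ≤ suc (i + i) + suc (i + i) + suc (i + i)
    ladder-rung = find p 5<p
      where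
      find : ∀ m → 5 < m → ∃ λ i → suc (i + i) + suc (i + i) ≤ m × m ≤ suc (i + i) + suc (i + i) + suc (i + i)
      find (suc (suc (suc (suc m)))) 5<m with 5 ℕₚ.<? m
      ... | yes 5<m′ with find m 5<m′
      ...   | i , lo , hi = suc i , ≡.subst (_≤ 4 + m) (solve′ 1 (λ i → con′ 4 :+′ ((con′ 1 :+′ (i :+′ i)) :+′ (con′ 1 :+′ (i :+′ i))) :=′ (con′ 1 :+′ ((con′ 1 :+′ i) :+′ (con′ 1 :+′ i))) :+′ (con′ 1 :+′ ((con′ 1 :+′ i) :+′ (con′ 1 :+′ i)))) ≡.refl i) (ℕₚ.+-monoʳ-≤ 4 lo)
              , ℕₚ.≤-trans (ℕₚ.+-monoʳ-≤ 4 hi) (≡⇒≤ 2 (solve′ 1 (λ i → con′ 4 :+′ ((con′ 1 :+′ (i :+′ i)) :+′ (con′ 1 :+′ (i :+′ i)) :+′ (con′ 1 :+′ (i :+′ i))) :+′ con′ 2 :=′ (con′ 1 :+′ ((con′ 1 :+′ i) :+′ (con′ 1 :+′ i))) :+′ (con′ 1 :+′ ((con′ 1 :+′ i) :+′ (con′ 1 :+′ i))) :+′ (con′ 1 :+′ ((con′ 1 :+′ i) :+′ (con′ 1 :+′ i)))) ≡.refl i))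
      find (suc (suc (suc (suc m)))) 5<m | no m≤5 = 1 , 5<m , ℕₚ.+-monoʳ-≤ 4 (ℕₚ.≮⇒≥ m≤5)
      find 1 (s≤s ())
      find 2 (s≤s (s≤s ()))
      find 3 (s≤s (s≤s (s≤s ())))

    module _ {a : ℕ} (0<a : 0 < a) (a<h : a < h) {y : ℕ} (⟦y⟧≉0 : ⟦ y ⟧ ≉ 0#)
             (key : Key (suc (y * p ^ a))) (key₁ : Key 1) (Y<H : y * p ^ a < H) where
      private
        A α Y : ℕ
        A = p ^ a
        α = proj₁ (p^-odd a)
        Y = y * A
        ȳ : Carrier
        ȳ = ⟦ y ⟧
        A≡ : A ≡ suc (α + α)
        A≡ = proj₂ (p^-odd a)
        0<y : 0 < y
        0<y = ℕₚ.n≢0⇒n>0 (λ { ≡.refl → ⟦y⟧≉0 refl })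
        0<A : 0 < A
        0<A = ℕₚ.m^n>0 p {{prime⇒nonZero pr}} a
        0<Y : 0 < Y
        0<Y = ℕₚ.*-mono-< 0<y 0<A
        p≤A : p ≤ A
        p≤A = ∣.∣⇒≤ {{>-nonZero 0<A}} (p∣p^ 0<a)
        3≤α : 3 ≤ α
        3≤α = ℕₚ.≰⇒> (λ α≤2 → ℕₚ.<⇒≱ 5<p (ℕₚ.≤-trans p≤A (ℕₚ.≤-trans (ℕₚ.≤-reflexive A≡) (s≤s (ℕₚ.+-mono-≤ α≤2 α≤2)))))
        7≤A : 7 ≤ A
        7≤A = ℕₚ.≤-trans (s≤s (ℕₚ.+-mono-≤ 3≤α 3≤α)) (ℕₚ.≤-reflexive (≡.sym A≡))

        N<u : ∀ v → suc (v + v) ≤ α → (suc α + v) + (suc α + v) < u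
        N<u v s≤α = s≤s⁻¹ (ℕₚ.≤-trans (ℕₚ.≤-reflexive (≡.trans (solve′ 2 (λ α v → con′ 2 :+′ ((con′ 1 :+′ α :+′ v) :+′ (con′ 1 :+′ α :+′ v)) :=′ (con′ 1 :+′ (α :+′ α)) :+′ ((con′ 1 :+′ (v :+′ v)) :+′ con′ 2)) ≡.refl α v) (≡.cong (_+ (suc (v + v) + 2)) (≡.sym A≡))))
          (ℕₚ.≤-trans (ℕₚ.+-monoʳ-≤ A s+2≤A) (ℕₚ.≤-trans (ℕₚ.≤-reflexive (solve′ 1 (λ A → A :+′ A :=′ con′ 2 :*′ A) ≡.refl A)) (ℕₚ.≤-trans (ℕₚ.*-monoˡ-≤ A (ℕₚ.≤-trans (s≤s (s≤s z≤n)) 5<p)) (∣.∣⇒≤ (pᵃ∣Q a<h))))))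
          where
          s+2≤A : suc (v + v) + 2 ≤ A
          s+2≤A = ℕₚ.≤-trans (ℕₚ.+-mono-≤ s≤α (ℕₚ.≤-trans (ℕₚ.n≤1+n 2) 3≤α)) (ℕₚ.≤-trans (ℕₚ.n≤1+n _) (ℕₚ.≤-reflexive (≡.sym A≡)))

        module T (v : ℕ) (s≤α : suc (v + v) ≤ α) = Top 0<a a<h y v 0<y s≤α (key (suc α + v) (s≤s z≤n) (N<u v s≤α)) (N<u v s≤α)

        open Ladder (ℕₚ.<⇒≤ a<h) key key₁ (∣.n∣m*n y) 0<Y Y<H

        bound : ∀ t → t ≤ suc (suc α) → t * Y < H + H + H
        bound t t≤ = ℕₚ.≤-<-trans (ℕₚ.*-monoˡ-≤ Y t≤) (top-bound (proj₁ ladder-rung) (proj₁ (proj₂ ladder-rung)) (proj₂ (proj₂ ladder-rung)) (suc (suc α)) 0<a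
          (ℕₚ.≤-reflexive (≡.trans (solve′ 1 (λ α → (con′ 2 :+′ α) :+′ (con′ 2 :+′ α) :=′ (con′ 1 :+′ (α :+′ α)) :+′ con′ 3) ≡.refl α) (≡.cong (_+ 3) (≡.sym A≡)))))

        wraps : ∀ t → t * Y < H ⊎ (H ≤ t * Y × t * Y < H + H) ⊎ H + H ≤ t * Y
        wraps t = by-cases (t * Y ℕₚ.<? H) (t * Y ℕₚ.<? H + H)
          where
          by-cases : Dec (t * Y < H) → Dec (t * Y < H + H) → t * Y < H ⊎ (H ≤ t * Y × t * Y < H + H) ⊎ H + H ≤ t * Y
          by-cases (yes lt) _         = inj₁ lt
          by-cases (no nlt) (yes lt₂) = inj₂ (inj₁ (ℕₚ.≮⇒≥ nlt , lt₂))
          by-cases (no _)   (no nlt₂) = inj₂ (inj₂ (ℕₚ.≮⇒≥ nlt₂))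

        wrapped-value : ∀ {ℓ′} {X : Set ℓ′} t → (t * Y < H + H → X) → (H + H ≤ t * Y → X) → X
        wrapped-value t f g = by-cases (t * Y ℕₚ.<? H + H)
          where
          by-cases : Dec (t * Y < H + H) → _
          by-cases (yes lt) = f lt
          by-cases (no nlt) = g (ℕₚ.≮⇒≥ nlt)

        H≤2H : H ≤ H + H
        H≤2H = ℕₚ.m≤m+n H H

        up : ∀ {m t t′} → t ≤ t′ → m ≤ t * Y → m ≤ t′ * Y
        up t≤t′ m≤ = ℕₚ.≤-trans m≤ (ℕₚ.*-monoˡ-≤ Y t≤t′)

        down : ∀ {m t t′} → t ≤ t′ → t′ * Y < m → t * Y < m
        down t≤t′ <m = ℕₚ.≤-<-trans (ℕₚ.*-monoˡ-≤ Y t≤t′) <m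

        ∸-≡ : ∀ {t r J} → t + r ≡ J → J ∸ r ≡ t
        ∸-≡ {t} {r} eq = ≡.trans (≡.cong (_∸ r) (≡.sym eq)) (ℕₚ.m+n∸n≡m t r)

        root : ∀ k m → ⟦ k ⟧ ≉ 0# → ⟦ k ⟧ ⊛ (ȳ ⊝ ⟦ m ⟧) ≈ 0# → ȳ ≈ ⟦ m ⟧
        root k m k≉0 eq = x-y≈0⇒x≈y (*-cancel-0 k≉0 eq)

        const≈0 : ∀ k m c → ȳ ≈ ⟦ m ⟧ → ⟦ k ⟧ ⊛ (ȳ ⊝ ⟦ m ⟧) ⊕ ⟦ c ⟧ ≈ 0# → ⟦ c ⟧ ≈ 0#
        const≈0 k m c ȳ≈m eq = trans (sym (+-identityˡ _)) (trans (+-congʳ (sym (trans (*-congˡ (trans (+-congʳ ȳ≈m) (-‿inverseʳ _))) (zeroʳ _)))) eq)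

        2Y<H : 2 * Y < H
        2Y<H = down (two i₀ (proj₂ (proj₂ ladder-rung))) (ladder-top i₀ (proj₁ (proj₂ ladder-rung)) (proj₂ (proj₂ ladder-rung)) (ℕₚ.suc-pred a {{>-nonZero 0<a}}))
          where
          i₀ = proj₁ ladder-rung
          two : ∀ i → p ≤ suc (i + i) + suc (i + i) + suc (i + i) → 2 ≤ half (pred a) i
          two zero    p≤3 = ⊥-elim (ℕₚ.<⇒≱ 5<p (ℕₚ.≤-trans p≤3 (ℕₚ.m≤n+m 3 2)))
          two (suc i) _   = ℕₚ.+-mono-≤ (ℕₚ.≤-trans (ℕₚ.m^n>0 p {{prime⇒nonZero pr}} (pred a)) (ℕₚ.m≤m+n _ _)) (s≤s z≤n)

        α-1 α-2 : ℕ
        α-1 = α ∸ 1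
        α-2 = α ∸ 2

        α-1+1≡α : α-1 + 1 ≡ α
        α-1+1≡α = ℕₚ.m∸n+n≡m (ℕₚ.≤-trans (s≤s z≤n) 3≤α)

        α-2+2≡α : α-2 + 2 ≡ α
        α-2+2≡α = ℕₚ.m∸n+n≡m (ℕₚ.≤-trans (s≤s (s≤s z≤n)) 3≤α)

        half-wrapped : ∀ t {t′} → t′ ≤ t + t → H + H ≤ t′ * Y → H ≤ t * Y
        half-wrapped t t′≤2t ge = double-cancel-≤ (ℕₚ.≤-trans (up t′≤2t ge) (ℕₚ.≤-reflexive (ℕₚ.*-distribʳ-+ Y t t)))

        -- From 2Y < H ≤ (α - 1) Y it follows that α ≥ 4. This provides the room for r = 3 in the
        -- single-wrap value.
        9≤A : H ≤ α-1 * Y → 9 ≤ A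
        9≤A ge = ℕₚ.≤-trans (s≤s (ℕₚ.+-mono-≤ 4≤α 4≤α)) (ℕₚ.≤-reflexive (≡.sym A≡))
          where
          4≤α : 4 ≤ α
          4≤α = ℕₚ.≰⇒> (λ α≤3 → ℕₚ.<⇒≱ (down (ℕₚ.∸-monoˡ-≤ 1 α≤3) 2Y<H) ge)

      private module Test₁ where
        module T₁ = T 0 (ℕₚ.≤-trans (s≤s z≤n) 3≤α)
        α+1≡J : α + 1 ≡ suc α + 0
        α+1≡J = solve′ 1 (λ α → α :+′ con′ 1 :=′ con′ 1 :+′ α :+′ con′ 0) ≡.refl α
        module A₀ = T₁.At 0 1 (suc α) ≡.refl ≡.refl
        module A₁ = T₁.At 1 0 α ≡.refl α+1≡J

        combine : ∀ {E₀ E₁} → T₁.L (suc α) ≈ E₀ → T₁.L α ≈ E₁ → ⟦ 1 ⟧ ⊛ E₀ ⊕ (⟦ 1 ⟧ ⊛ E₁ ⊕ 0#) ⊕ 0# ≈ 0#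
        combine {E₀} {E₁} e₀ e₁ = trans (+-congʳ (+-cong (*-congˡ (trans (sym e₀) (reflexive (≡.cong T₁.L (≡.sym (ℕₚ.+-identityʳ (suc α)))))))
          (+-congʳ (*-congˡ (trans (sym e₁) (reflexive (≡.cong T₁.L (≡.sym (ℕₚ.+-identityʳ α))))))))) T₁.balance

        -- For s = 1 the relation is L(α + 1) + L(α) = 0, linear in y for each pattern of wraps.
        -- Without wraps it says 4y = 0; two wraps at α + 1 and none at α give 2 = 0; the other
        -- possible patterns give y = 1 or y = 2.
        test : H ≤ suc α * Y × (ȳ ≈ ⟦ 1 ⟧ ⊎ (ȳ ≈ ⟦ 2 ⟧ × H + H ≤ suc α * Y × α * Y < H + H))
        test = by-cases (wraps (suc α)) (wraps α)
          where
          sumᴾ : ∀ {m} → Polynomial m → Polynomial m → Polynomial m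
          sumᴾ a b = # 1 :* a :+ (# 1 :* b :+ # 0) :+ # 0
          2r+3≤A : 1 + 1 + 3 ≤ A
          2r+3≤A = ℕₚ.≤-trans (ℕₚ.m≤n+m 5 2) 7≤A
          3≤A : 0 + 0 + 3 ≤ A
          3≤A = ℕₚ.≤-trans (ℕₚ.m≤n+m 3 2) 2r+3≤A
          Result : Set _
          Result = H ≤ suc α * Y × (ȳ ≈ ⟦ 1 ⟧ ⊎ (ȳ ≈ ⟦ 2 ⟧ × H + H ≤ suc α * Y × α * Y < H + H))
          by-cases : suc α * Y < H ⊎ (H ≤ suc α * Y × suc α * Y < H + H) ⊎ H + H ≤ suc α * Y →
                     α * Y < H ⊎ (H ≤ α * Y × α * Y < H + H) ⊎ H + H ≤ α * Y → Result
          by-cases (inj₁ lt) (inj₁ lt′) = ⊥-elim (*-≉0 4≉0 ⟦y⟧≉0 (trans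
            (solve 1 (λ y → # 4 :* y := sumᴾ (valueᴾ₀ 1 0 1 y) (valueᴾ₀ 1 1 0 y)) refl ȳ) (combine (A₀.value₀ lt) (A₁.value₀ lt′))))
          by-cases (inj₁ lt) (inj₂ (inj₁ (ge , _))) = ⊥-elim (ℕₚ.<⇒≱ (down (ℕₚ.n≤1+n α) lt) ge)
          by-cases (inj₁ lt) (inj₂ (inj₂ ge)) = ⊥-elim (ℕₚ.<⇒≱ (down (ℕₚ.n≤1+n α) lt) (ℕₚ.≤-trans H≤2H ge))
          by-cases (inj₂ (inj₁ (ge , lt))) (inj₁ lt′) = ge , inj₁ (root 2 1 2≉0 (trans
            (solve 1 (λ y → # 2 :* (y :- # 1) := sumᴾ (valueᴾ₁ 1 0 1 y) (valueᴾ₀ 1 1 0 y)) refl ȳ) (combine (A₀.value₁ 3≤A ge lt) (A₁.value₀ lt′))))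
          by-cases (inj₂ (inj₁ (ge , lt))) (inj₂ (inj₁ (ge′ , lt′))) = ge , inj₁ (root 4 1 4≉0 (trans
            (solve 1 (λ y → # 4 :* (y :- # 1) := sumᴾ (valueᴾ₁ 1 0 1 y) (valueᴾ₁ 1 1 0 y)) refl ȳ) (combine (A₀.value₁ 3≤A ge lt) (A₁.value₁ 2r+3≤A ge′ lt′))))
          by-cases (inj₂ (inj₁ (_ , lt))) (inj₂ (inj₂ ge)) = ⊥-elim (ℕₚ.<⇒≱ (down (ℕₚ.n≤1+n α) lt) ge)
          by-cases (inj₂ (inj₂ ge)) (inj₁ lt′) = ⊥-elim (2≉0 (trans
            (solve 1 (λ y → # 2 := :- sumᴾ (valueᴾ₂ 1 0 1 y) (valueᴾ₀ 1 1 0 y)) refl ȳ) (trans (-‿cong (combine (A₀.value₂ ge (bound (suc α) (ℕₚ.n≤1+n _))) (A₁.value₀ lt′))) -0#≈0#)))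
          by-cases (inj₂ (inj₂ ge)) (inj₂ (inj₁ (ge′ , lt′))) = ℕₚ.≤-trans H≤2H ge , inj₂ (root 2 2 2≉0 (trans
            (solve 1 (λ y → # 2 :* (y :- # 2) := sumᴾ (valueᴾ₂ 1 0 1 y) (valueᴾ₁ 1 1 0 y)) refl ȳ) (combine (A₀.value₂ ge (bound (suc α) (ℕₚ.n≤1+n _))) (A₁.value₁ 2r+3≤A ge′ lt′))) , ge , lt′)
          by-cases (inj₂ (inj₂ ge)) (inj₂ (inj₂ ge′)) = ℕₚ.≤-trans H≤2H ge , inj₁ (root 4 1 4≉0 (trans
            (solve 1 (λ y → # 4 :* (y :- # 1) := sumᴾ (valueᴾ₂ 1 0 1 y) (valueᴾ₂ 1 1 0 y)) refl ȳ) (combine (A₀.value₂ ge (bound (suc α) (ℕₚ.n≤1+n _))) (A₁.value₂ ge′ (bound α (ℕₚ.≤-trans (ℕₚ.n≤1+n _) (ℕₚ.n≤1+n _)))))))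

      private module Test₃ where
        module T₃ = T 1 3≤α
        module A₀ = T₃.At 0 3 (suc (suc α)) ≡.refl (solve′ 1 (λ α → con′ 2 :+′ α :+′ con′ 0 :=′ con′ 1 :+′ α :+′ con′ 1) ≡.refl α)
        module A₁ = T₃.At 1 2 (suc α) ≡.refl ≡.refl
        α+2≡J : α + 2 ≡ suc α + 1
        α+2≡J = solve′ 1 (λ α → α :+′ con′ 2 :=′ con′ 1 :+′ α :+′ con′ 1) ≡.refl α
        module A₂ = T₃.At 2 1 α ≡.refl α+2≡J
        α-1+3≡J : α-1 + 3 ≡ suc α + 1
        α-1+3≡J = ≡.trans (≡.sym (ℕₚ.+-assoc α-1 1 2)) (≡.trans (≡.cong (_+ 2) α-1+1≡α) α+2≡J)
        module A₃ = T₃.At 3 0 α-1 ≡.refl α-1+3≡J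

        combine : ∀ {E₀ E₁ E₂ E₃ E₄} → T₃.L (suc (suc α)) ≈ E₀ → T₃.L (suc α) ≈ E₁ → T₃.L α ≈ E₂ → T₃.L α-1 ≈ E₃ → T₃.L 1 ≈ E₄ →
          (⟦ 1 ⟧ ⊛ E₀ ⊕ (⟦ 15 ⟧ ⊛ E₁ ⊕ (⟦ 15 ⟧ ⊛ E₂ ⊕ (⟦ 1 ⟧ ⊛ E₃ ⊕ 0#)))) ⊕ ((⟦ 2 ⟧ ⊛ ⟦ 6 ⟧) ⊛ E₄ ⊕ 0#) ≈ 0#
        combine e₀ e₁ e₂ e₃ e₄ = trans (+-cong
          (+-cong (*-congˡ (at 0 {suc (suc α)} (solve′ 1 (λ α → con′ 2 :+′ α :+′ con′ 0 :=′ con′ 1 :+′ α :+′ con′ 1) ≡.refl α) e₀))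
          (+-cong (*-congˡ (at 1 {suc α} ≡.refl e₁)) (+-cong (*-congˡ (at 2 {α} α+2≡J e₂)) (+-congʳ (*-congˡ (at 3 {α-1} α-1+3≡J e₃))))))
          (+-congʳ (*-congˡ (sym e₄)))) T₃.balance
          where
          at : ∀ r {t E} → t + r ≡ suc α + 1 → T₃.L t ≈ E → E ≈ T₃.L (suc α + 1 ∸ r)
          at r {t} eq e = trans (sym e) (reflexive (≡.cong T₃.L (≡.sym (∸-≡ {t} {r} eq))))

        -- What the relation for s = 3 cannot exclude: the two patterns whose constant has the prime
        -- factor 7.
        Survivor : Set _
        Survivor = ⟦ 7 ⟧ ≈ 0# × H + H ≤ suc α * Y ×
          ((ȳ ≈ ⟦ 1 ⟧ × H + H ≤ α-1 * Y) ⊎ (ȳ ≈ ⟦ 2 ⟧ × H ≤ α-1 * Y × α-1 * Y < H + H))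

        module _ (wrapped₁ : H ≤ suc α * Y) where
          -- For σ ≥ 2 both `low₁` and `low₂` are 0, so one and two wraps give the same value. The
          -- same applies to `V₁`.
          V₀ : T₃.L (suc (suc α)) ≈ 0# ⊕ (A₀.T ⊕ ⟦ 1 ⟧) ⊛ φ 3 (⟦ 6 ⟧ ⊝ ⟦ 3 ⟧)
          V₀ = wrapped-value (suc (suc α)) (A₀.value₁ (ℕₚ.≤-trans (ℕₚ.m≤n+m 3 4) 7≤A) (up (ℕₚ.n≤1+n (suc α)) wrapped₁)) (λ ge → A₀.value₂ ge (bound (suc (suc α)) ℕₚ.≤-refl))
          V₁ : T₃.L (suc α) ≈ 0# ⊕ (A₁.T ⊕ ⟦ 1 ⟧) ⊛ φ 3 (⟦ 4 ⟧ ⊝ ⟦ 3 ⟧)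
          V₁ = wrapped-value (suc α) (A₁.value₁ (ℕₚ.≤-trans (ℕₚ.m≤n+m 5 2) 7≤A) wrapped₁) (λ ge → A₁.value₂ ge (bound (suc α) (ℕₚ.n≤1+n (suc α))))
          V₄ : T₃.L 1 ≈ (⟦ 2 ⟧ ⊛ ȳ) ⊛ φ 3 (⟦ 5 ⟧ ⊝ ⟦ 2 ⟧)
          V₄ = T₃.even-value 1 (s≤s z≤n) ℕₚ.≤-refl (ℕₚ.≤-<-trans (ℕₚ.≤-reflexive (ℕₚ.*-identityˡ Y)) Y<H)

          -- The numbers 1, 15, 15, 1 are C(6, 2r) for r ≤ 3, and 2 · 6 is 2 C(6, 1), the
          -- coefficient belonging to t = 1.
          sumᴾ : ∀ {m} → Polynomial m → Polynomial m → Polynomial m → Polynomial m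
          sumᴾ y c d = (# 1 :* valueᴾ₁ 3 0 3 y :+ (# 15 :* valueᴾ₁ 3 1 2 y :+ (# 15 :* c :+ (# 1 :* d :+ # 0)))) :+ ((# 2 :* # 6) :* evenᴾ 3 1 y :+ # 0)

          wrap₂ : H + H ≤ α * Y → α * Y < H + H + H
          wrap₂ _ = bound α (ℕₚ.≤-trans (ℕₚ.n≤1+n _) (ℕₚ.n≤1+n _))
          α-1≤α : α-1 ≤ α
          α-1≤α = ℕₚ.m∸n≤m α 1

          216≉0 : ⟦ 216 ⟧ ≉ 0#
          216≉0 = ⟦*⟧-≉0 {4} {54} 4≉0 (⟦*⟧-≉0 {3} {18} 3≉0 (⟦*⟧-≉0 {3} {6} 3≉0 (⟦*⟧-≉0 {3} {2} 3≉0 2≉0)))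
          144≉0 : ⟦ 144 ⟧ ≉ 0#
          144≉0 = ⟦*⟧-≉0 {4} {36} 4≉0 (⟦*⟧-≉0 {4} {9} 4≉0 (⟦*⟧-≉0 {3} {3} 3≉0 3≉0))

          -- At y = 1 each pattern leaves a constant. The constants 180, 360, 900 and 1080 are
          -- products of 2, 3 and 5, hence non-zero; two wraps throughout leave 1512 = 216 · 7.
          one : ȳ ≈ ⟦ 1 ⟧ → Survivor
          one ȳ≈1 = by-cases (wraps α) (wraps α-1)
            where
            by-cases : α * Y < H ⊎ (H ≤ α * Y × α * Y < H + H) ⊎ H + H ≤ α * Y →
                       α-1 * Y < H ⊎ (H ≤ α-1 * Y × α-1 * Y < H + H) ⊎ H + H ≤ α-1 * Y → Survivor
            by-cases (inj₁ lt) (inj₁ lt′) = ⊥-elim (180≉0 (const≈0 108 1 180 ȳ≈1 (trans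
              (solve 1 (λ y → # 108 :* (y :- # 1) :+ # 180 := sumᴾ y (valueᴾ₀ 3 2 1 y) (valueᴾ₀ 3 3 0 y)) refl ȳ) (combine V₀ V₁ (A₂.value₀ lt) (A₃.value₀ lt′) V₄))))
            by-cases (inj₁ lt) (inj₂ (inj₁ (ge , _))) = ⊥-elim (ℕₚ.<⇒≱ (down α-1≤α lt) ge)
            by-cases (inj₁ lt) (inj₂ (inj₂ ge)) = ⊥-elim (ℕₚ.<⇒≱ (down α-1≤α lt) (ℕₚ.≤-trans H≤2H ge))
            by-cases (inj₂ (inj₁ (ge , lt))) (inj₁ lt′) = ⊥-elim (180≉0 (const≈0 378 1 180 ȳ≈1 (trans
              (solve 1 (λ y → # 378 :* (y :- # 1) :+ # 180 := sumᴾ y (valueᴾ₁ 3 2 1 y) (valueᴾ₀ 3 3 0 y)) refl ȳ) (combine V₀ V₁ (A₂.value₁ 7≤A ge lt) (A₃.value₀ lt′) V₄))))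
            by-cases (inj₂ (inj₁ (ge , lt))) (inj₂ (inj₁ (ge′ , lt′))) = ⊥-elim (⟦*⟧-≉0 {2} {180} 2≉0 180≉0 (const≈0 648 1 360 ȳ≈1 (trans
              (solve 1 (λ y → # 648 :* (y :- # 1) :+ # 360 := sumᴾ y (valueᴾ₁ 3 2 1 y) (valueᴾ₁ 3 3 0 y)) refl ȳ) (combine V₀ V₁ (A₂.value₁ 7≤A ge lt) (A₃.value₁ (9≤A ge′) ge′ lt′) V₄))))
            by-cases (inj₂ (inj₁ (_ , lt))) (inj₂ (inj₂ ge)) = ⊥-elim (ℕₚ.<⇒≱ (down α-1≤α lt) ge)
            by-cases (inj₂ (inj₂ ge)) (inj₁ lt′) = ⊥-elim (⟦*⟧-≉0 {5} {180} 5≉0 180≉0 (const≈0 1098 1 900 ȳ≈1 (trans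
              (solve 1 (λ y → # 1098 :* (y :- # 1) :+ # 900 := sumᴾ y (valueᴾ₂ 3 2 1 y) (valueᴾ₀ 3 3 0 y)) refl ȳ) (combine V₀ V₁ (A₂.value₂ ge (wrap₂ ge)) (A₃.value₀ lt′) V₄))))
            by-cases (inj₂ (inj₂ ge)) (inj₂ (inj₁ (ge′ , lt′))) = ⊥-elim (⟦*⟧-≉0 {3} {360} 3≉0 (⟦*⟧-≉0 {2} {180} 2≉0 180≉0) (const≈0 1368 1 1080 ȳ≈1 (trans
              (solve 1 (λ y → # 1368 :* (y :- # 1) :+ # 1080 := sumᴾ y (valueᴾ₂ 3 2 1 y) (valueᴾ₁ 3 3 0 y)) refl ȳ) (combine V₀ V₁ (A₂.value₂ ge (wrap₂ ge)) (A₃.value₁ (9≤A ge′) ge′ lt′) V₄))))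
            by-cases (inj₂ (inj₂ ge)) (inj₂ (inj₂ ge′)) = *-cancel-0 216≉0 (trans (sym (⟦⟧-* 216 7)) (const≈0 1800 1 1512 ȳ≈1 (trans
              (solve 1 (λ y → # 1800 :* (y :- # 1) :+ # 1512 := sumᴾ y (valueᴾ₂ 3 2 1 y) (valueᴾ₂ 3 3 0 y)) refl ȳ) (combine V₀ V₁ (A₂.value₂ ge (wrap₂ ge)) (A₃.value₂ ge′ (down α-1≤α (wrap₂ ge))) V₄))))
              , up (ℕₚ.n≤1+n α) ge , inj₁ (ȳ≈1 , ge′)

          -- As α + 1 ≤ 2 (α - 1), two wraps at α + 1 force a wrap at α - 1, so only one pattern is
          -- left. Its constant at y = 2 is 1008 = 144 · 7.
          two : ȳ ≈ ⟦ 2 ⟧ → H + H ≤ suc α * Y → α * Y < H + H → Survivor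
          two ȳ≈2 ge₁ lt = *-cancel-0 144≉0 (trans (sym (⟦⟧-* 144 7)) (const≈0 648 2 1008 ȳ≈2 (trans
              (solve 1 (λ y → # 648 :* (y :- # 2) :+ # 1008 := sumᴾ y (valueᴾ₁ 3 2 1 y) (valueᴾ₁ 3 3 0 y)) refl ȳ)
                (combine V₀ V₁ (A₂.value₁ 7≤A (up α-1≤α ge′) lt) (A₃.value₁ (9≤A ge′) ge′ lt′) V₄))))
            , ge₁ , inj₂ (ȳ≈2 , ge′ , lt′)
            where
            lt′ : α-1 * Y < H + H
            lt′ = down α-1≤α lt
            ge′ : H ≤ α-1 * Y
            ge′ = half-wrapped α-1 (ℕₚ.≤-trans (ℕₚ.≤-reflexive (≡.trans (≡.cong suc (≡.sym α-1+1≡α)) (≡.sym (ℕₚ.+-suc α-1 1)))) (ℕₚ.+-monoʳ-≤ α-1 (ℕₚ.∸-monoˡ-≤ 1 3≤α))) ge₁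

      private module Test₅ (⟦7⟧≈0 : ⟦ 7 ⟧ ≈ 0#) (wrapped₁ : H + H ≤ suc α * Y) where
        p≡7 : p ≡ 7
        p≡7 = ⟦7⟧≈0⇒p≡7 ⟦7⟧≈0

        -- For p = 7 and a = 1 one has α = 3, and then (α + 1) Y = 4Y < 2H contradicts the two wraps
        -- at α + 1. So a ≥ 2.
        6≤α : 6 ≤ α
        6≤α = by-exponent a ≡.refl
          where
          by-exponent : ∀ k → a ≡ k → 6 ≤ α
          by-exponent zero       a≡0 = ⊥-elim (ℕₚ.<-irrefl (≡.sym a≡0) 0<a)
          by-exponent (suc zero) a≡1 = ⊥-elim (ℕₚ.<⇒≱ (down {t = suc α} {2 + 2} (s≤s (ℕₚ.≤-reflexive α≡3)) (ℕₚ.≤-<-trans (ℕₚ.≤-reflexive (ℕₚ.*-distribʳ-+ Y 2 2)) (ℕₚ.+-mono-< 2Y<H 2Y<H))) wrapped₁)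
            where
            α≡3 : α ≡ 3
            α≡3 = halve (ℕₚ.suc-injective (≡.trans (≡.sym A≡) (≡.trans (≡.cong (p ^_) a≡1) (≡.trans (ℕₚ.*-identityʳ p) p≡7))))
          by-exponent (suc (suc k)) a≡ = ℕₚ.≰⇒> (λ α≤5 → ℕₚ.<⇒≱ (ℕₚ.≤-trans (ℕₚ.≤-trans (ℕₚ.m≤n+m 12 24) (ℕₚ.*-mono-≤ 5<p (≡.subst (6 ≤_) (≡.sym (ℕₚ.*-identityʳ p)) 5<p)))
              (ℕₚ.^-monoʳ-≤ p {{prime⇒nonZero pr}} {2} {a} (ℕₚ.≤-trans (s≤s (s≤s z≤n)) (ℕₚ.≤-reflexive (≡.sym a≡)))))
            (ℕₚ.≤-trans (ℕₚ.≤-reflexive A≡) (s≤s (ℕₚ.+-mono-≤ α≤5 α≤5))))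

        13≤A : 13 ≤ A
        13≤A = ℕₚ.≤-trans (s≤s (ℕₚ.+-mono-≤ 6≤α 6≤α)) (ℕₚ.≤-reflexive (≡.sym A≡))

        module T₅ = T 2 (ℕₚ.≤-trans (ℕₚ.n≤1+n 5) 6≤α)
        J : ℕ
        J = suc α + 2
        J≡₀ : suc (suc (suc α)) + 0 ≡ J
        J≡₀ = solve′ 1 (λ α → con′ 3 :+′ α :+′ con′ 0 :=′ con′ 1 :+′ α :+′ con′ 2) ≡.refl α
        J≡₁ : suc (suc α) + 1 ≡ J
        J≡₁ = solve′ 1 (λ α → con′ 2 :+′ α :+′ con′ 1 :=′ con′ 1 :+′ α :+′ con′ 2) ≡.refl α
        α+3≡J : α + 3 ≡ J
        α+3≡J = ℕₚ.+-suc α 2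
        J≡₄ : α-1 + 4 ≡ J
        J≡₄ = ≡.trans (≡.sym (ℕₚ.+-assoc α-1 1 3)) (≡.trans (≡.cong (_+ 3) α-1+1≡α) α+3≡J)
        J≡₅ : α-2 + 5 ≡ J
        J≡₅ = ≡.trans (≡.sym (ℕₚ.+-assoc α-2 2 3)) (≡.trans (≡.cong (_+ 3) α-2+2≡α) α+3≡J)
        module A₀ = T₅.At 0 5 (suc (suc (suc α))) ≡.refl J≡₀
        module A₁ = T₅.At 1 4 (suc (suc α)) ≡.refl J≡₁
        module A₄ = T₅.At 4 1 α-1 ≡.refl J≡₄
        module A₅ = T₅.At 5 0 α-2 ≡.refl J≡₅

        -- The relation for s = 5 reaches t = α + 3, one beyond `bound`. For p = 7 the top rung has
        -- 2J = 3B + 1, and 3 (3B + 1) = 9B + 3 is at least 7B + 5 = 2 (α + 3).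
        bound₅ : ∀ t → t ≤ suc (suc (suc α)) → t * Y < H + H + H
        bound₅ t t≤ = scale t {half b 1} (ℕₚ.≤-trans t≤ (double-cancel-≤ (ℕₚ.≤-trans (ℕₚ.≤-reflexive 2J≡) (ℕₚ.≤-trans (ℕₚ.+-monoʳ-≤ (7 * B) (ℕₚ.+-monoˡ-≤ 3 (ℕₚ.*-monoʳ-≤ 2 0<B))) (ℕₚ.≤-reflexive 6half≡)))))
            (ladder-top 1 5<p (ℕₚ.≤-trans (ℕₚ.≤-reflexive p≡7) (ℕₚ.m≤n+m 7 2)) a≡)
          where
          b = pred a
          B = p ^ b
          a≡ : suc b ≡ a
          a≡ = ℕₚ.suc-pred a {{>-nonZero 0<a}}
          0<B : 1 ≤ B
          0<B = ℕₚ.m^n>0 p {{prime⇒nonZero pr}} b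
          2J≡ : suc (suc (suc α)) + suc (suc (suc α)) ≡ 7 * B + 5
          2J≡ = ≡.trans (solve′ 1 (λ α → (con′ 3 :+′ α) :+′ (con′ 3 :+′ α) :=′ (con′ 1 :+′ (α :+′ α)) :+′ con′ 5) ≡.refl α)
            (≡.cong (_+ 5) (≡.trans (≡.sym A≡) (≡.trans (≡.cong (p ^_) (≡.sym a≡)) (≡.cong (_* B) p≡7))))
          6half≡ : 7 * B + (2 * B + 3) ≡ (half b 1 + half b 1 + half b 1) + (half b 1 + half b 1 + half b 1)
          6half≡ = ≡.trans (solve′ 1 (λ B → con′ 7 :*′ B :+′ (con′ 2 :*′ B :+′ con′ 3) :=′ (con′ 1 :+′ con′ 3 :*′ B) :+′ (con′ 1 :+′ con′ 3 :*′ B) :+′ (con′ 1 :+′ con′ 3 :*′ B)) ≡.refl B)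
            (≡.trans (≡.cong (λ w → w + w + w) (≡.sym (double-half b 1))) (solve′ 1 (λ J → (J :+′ J) :+′ (J :+′ J) :+′ (J :+′ J) :=′ (J :+′ J :+′ J) :+′ (J :+′ J :+′ J)) ≡.refl (half b 1)))

        7⊛≈0 : ∀ {x} → ⟦ 7 ⟧ ⊛ x ≈ 0#
        7⊛≈0 = trans (*-congʳ ⟦7⟧≈0) (zeroˡ _)

        -- Here and below: the product X (X - 2)(X - 4)(X - 6)(X - 8) modulo 7 at the arguments that
        -- occur.
        φ₇≈0 : φ 5 (⟦ 10 ⟧ ⊝ ⟦ 3 ⟧) ≈ 0#
        φ₇≈0 = trans (solve 0 (φᴾ 5 (# 10 :- # 3) := # 7 :* (:- # 15)) refl) 7⊛≈0
        φ₇′≈0 : φ 5 (⟦ 9 ⟧ ⊝ ⟦ 2 ⟧) ≈ 0#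
        φ₇′≈0 = trans (solve 0 (φᴾ 5 (# 9 :- # 2) := # 7 :* (:- # 15)) refl) 7⊛≈0
        φ₋₁≈0 : φ 5 (⟦ 2 ⟧ ⊝ ⟦ 3 ⟧) ≈ 0#
        φ₋₁≈0 = trans (solve 0 (φᴾ 5 (# 2 :- # 3) := # 7 :* (:- # 135)) refl) 7⊛≈0
        φ₋₃≈0 : φ 5 (⟦ 0 ⟧ ⊝ ⟦ 3 ⟧) ≈ 0#
        φ₋₃≈0 = trans (solve 0 (φᴾ 5 (# 0 :- # 3) := # 7 :* (:- (# 27 :* # 55))) refl) 7⊛≈0
        φ₅≈3 : φ 5 (⟦ 8 ⟧ ⊝ ⟦ 3 ⟧) ≈ ⟦ 3 ⟧
        φ₅≈3 = trans (solve 0 (φᴾ 5 (# 8 :- # 3) := # 3 :+ # 7 :* # 6) refl) (trans (+-congˡ 7⊛≈0) (+-identityʳ _))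
        φ₅′≈3 : φ 5 (⟦ 7 ⟧ ⊝ ⟦ 2 ⟧) ≈ ⟦ 3 ⟧
        φ₅′≈3 = trans (solve 0 (φᴾ 5 (# 7 :- # 2) := # 3 :+ # 7 :* # 6) refl) (trans (+-congˡ 7⊛≈0) (+-identityʳ _))
        φ₋₂≈3 : φ 5 (⟦ 0 ⟧ ⊝ ⟦ 2 ⟧) ≈ ⟦ 3 ⟧
        φ₋₂≈3 = trans (solve 0 (φᴾ 5 (# 0 :- # 2) := # 3 :+ # 7 :* (:- # 549)) refl) (trans (+-congˡ 7⊛≈0) (+-identityʳ _))
        φ₋₄≈4 : φ 5 (⟦ 0 ⟧ ⊝ ⟦ 4 ⟧) ≈ ⟦ 4 ⟧
        φ₋₄≈4 = trans (solve 0 (φᴾ 5 (# 0 :- # 4) := # 4 :+ # 7 :* (:- (# 4 :* # 823))) refl) (trans (+-congˡ 7⊛≈0) (+-identityʳ _))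

        0⊕≈ : ∀ {x z} → z ≈ 0# → 0# ⊕ x ⊛ z ≈ 0#
        0⊕≈ z≈0 = trans (+-identityˡ _) (trans (*-congˡ z≈0) (zeroʳ _))

        ⊕0≈ : ∀ {x z w} → z ≈ 0# → w ⊕ x ⊛ z ≈ w
        ⊕0≈ z≈0 = trans (+-congˡ (trans (*-congˡ z≈0) (zeroʳ _))) (+-identityʳ _)

        V₀ : T₅.L (suc (suc (suc α))) ≈ 0#
        V₀ = trans (wrapped-value {X = T₅.L (suc (suc (suc α))) ≈ 0# ⊕ (A₀.T ⊕ ⟦ 1 ⟧) ⊛ φ 5 (⟦ 10 ⟧ ⊝ ⟦ 3 ⟧)} (suc (suc (suc α)))
            (A₀.value₁ (ℕₚ.≤-trans (ℕₚ.m≤n+m 3 10) 13≤A) (ℕₚ.≤-trans H≤2H (up (ℕₚ.m≤n+m (suc α) 2) wrapped₁)))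
            (λ ge → A₀.value₂ ge (bound₅ (suc (suc (suc α))) ℕₚ.≤-refl))) (0⊕≈ φ₇≈0)

        V₁ : T₅.L (suc (suc α)) ≈ (A₁.T ⊕ ⟦ 1 ⟧) ⊛ ⟦ 3 ⟧
        V₁ = trans (wrapped-value {X = T₅.L (suc (suc α)) ≈ 0# ⊕ (A₁.T ⊕ ⟦ 1 ⟧) ⊛ φ 5 (⟦ 8 ⟧ ⊝ ⟦ 3 ⟧)} (suc (suc α))
            (A₁.value₁ (ℕₚ.≤-trans (ℕₚ.m≤n+m 5 8) 13≤A) (ℕₚ.≤-trans H≤2H (up (ℕₚ.n≤1+n (suc α)) wrapped₁)))
            (λ ge → A₁.value₂ ge (bound₅ (suc (suc α)) (ℕₚ.n≤1+n _)))) (trans (+-identityˡ _) (*-congˡ φ₅≈3))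

        M₂ : T₅.L 2 ≈ 0#
        M₂ = trans (T₅.even-value 2 (s≤s z≤n) ℕₚ.≤-refl 2Y<H) (trans (*-congˡ φ₇′≈0) (zeroʳ _))

        M₁ : T₅.L 1 ≈ (⟦ 2 ⟧ ⊛ ȳ) ⊛ ⟦ 3 ⟧
        M₁ = trans (T₅.even-value 1 (s≤s z≤n) (s≤s z≤n) (ℕₚ.≤-<-trans (ℕₚ.≤-reflexive (ℕₚ.*-identityˡ Y)) Y<H)) (*-congˡ φ₅′≈3)

        -- The coefficients are C(10, 2r) = 1, 45, 210, 210, 45, 1 together with 2 C(10, 1) = 20 and
        -- 2 C(10, 3) = 240. The terms with 210 vanish modulo 7, and L(α + 3) and L(2) are 0, so
        -- four terms remain.
        combine : ∀ {E₄ E₅} → T₅.L α-1 ≈ E₄ → T₅.L α-2 ≈ E₅ →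
          ⟦ 45 ⟧ ⊛ ((A₁.T ⊕ ⟦ 1 ⟧) ⊛ ⟦ 3 ⟧) ⊕ ⟦ 45 ⟧ ⊛ E₄ ⊕ E₅ ⊕ (⟦ 2 ⟧ ⊛ ⟦ 120 ⟧) ⊛ ((⟦ 2 ⟧ ⊛ ȳ) ⊛ ⟦ 3 ⟧) ≈ 0#
        combine {E₄} {E₅} e₄ e₅ = begin
          ⟦ 45 ⟧ ⊛ ((A₁.T ⊕ ⟦ 1 ⟧) ⊛ ⟦ 3 ⟧) ⊕ ⟦ 45 ⟧ ⊛ E₄ ⊕ E₅ ⊕ (⟦ 2 ⟧ ⊛ ⟦ 120 ⟧) ⊛ ((⟦ 2 ⟧ ⊛ ȳ) ⊛ ⟦ 3 ⟧)
            ≈⟨ +-cong (+-cong (+-cong (*-congˡ (at 1 {suc (suc α)} J≡₁ V₁)) (*-congˡ (at 4 {α-1} J≡₄ e₄))) (at 5 {α-2} J≡₅ e₅)) (*-congˡ (sym M₁)) ⟩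
          ⟦ 45 ⟧ ⊛ ℒ 1 ⊕ ⟦ 45 ⟧ ⊛ ℒ 4 ⊕ ℒ 5 ⊕ (⟦ 2 ⟧ ⊛ ⟦ 120 ⟧) ⊛ T₅.L 1
            ≈⟨ solve 8 (λ l₀ l₁ l₂ l₃ l₄ l₅ m₂ m₁ → # 45 :* l₁ :+ # 45 :* l₄ :+ l₅ :+ (# 2 :* # 120) :* m₁ :=
                 ((# 1 :* l₀ :+ (# 45 :* l₁ :+ (# 210 :* l₂ :+ (# 210 :* l₃ :+ (# 45 :* l₄ :+ (# 1 :* l₅ :+ # 0)))))) :+ ((# 2 :* # 10) :* m₂ :+ ((# 2 :* # 120) :* m₁ :+ # 0)))
                   :- (l₀ :+ # 7 :* (# 30 :* (l₂ :+ l₃)) :+ # 20 :* m₂)) refl (ℒ 0) (ℒ 1) (ℒ 2) (ℒ 3) (ℒ 4) (ℒ 5) (T₅.L 2) (T₅.L 1) ⟩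
          _ ⊝ (ℒ 0 ⊕ ⟦ 7 ⟧ ⊛ (⟦ 30 ⟧ ⊛ (ℒ 2 ⊕ ℒ 3)) ⊕ ⟦ 20 ⟧ ⊛ T₅.L 2)
            ≈⟨ +-cong T₅.balance (-‿cong (+-cong (+-cong (sym (at 0 {suc (suc (suc α))} J≡₀ V₀)) 7⊛≈0) (trans (*-congˡ M₂) (zeroʳ _)))) ⟩
          0# ⊝ (0# ⊕ 0# ⊕ 0#)
            ≈⟨ solve 0 (# 0 :- (# 0 :+ # 0 :+ # 0) := # 0) refl ⟩
          0# ∎
          where
          ℒ : ℕ → Carrier
          ℒ r = T₅.L (J ∸ r)
          at : ∀ r {t E} → t + r ≡ J → T₅.L t ≈ E → E ≈ ℒ r
          at r {t} eq e = trans (sym e) (reflexive (≡.cong T₅.L (≡.sym (∸-≡ {t} {r} eq))))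

        sumᴾ : ∀ {m} → Polynomial m → Polynomial m → Polynomial m → Polynomial m
        sumᴾ y e₄ e₅ = # 45 :* ((Tᴾ 5 1 y :+ # 1) :* # 3) :+ # 45 :* e₄ :+ e₅ :+ (# 2 :* # 120) :* ((# 2 :* y) :* # 3)

        wrapped₋₅ : H ≤ α-2 * Y
        wrapped₋₅ = half-wrapped α-2 (ℕₚ.≤-trans (ℕₚ.≤-reflexive (≡.trans (≡.cong suc (≡.sym α-2+2≡α)) (≡.sym (ℕₚ.+-suc α-2 2)))) (ℕₚ.+-monoʳ-≤ α-2 (ℕₚ.≤-trans (ℕₚ.n≤1+n 3) (ℕₚ.∸-monoˡ-≤ 2 6≤α)))) wrapped₁

        11≤A : 11 ≤ A
        11≤A = ℕₚ.≤-trans (ℕₚ.m≤n+m 11 2) 13≤A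

        α-1≤ : α-1 ≤ suc (suc (suc α))
        α-1≤ = ℕₚ.≤-trans (ℕₚ.m∸n≤m α 1) (ℕₚ.m≤n+m α 3)

        V₅₁ : α-2 * Y < H + H → T₅.L α-2 ≈ A₅.T ⊛ ⟦ 3 ⟧
        V₅₁ lt = trans (A₅.value₁ 13≤A wrapped₋₅ lt) (trans (⊕0≈ φ₋₃≈0) (*-congˡ φ₋₂≈3))

        final : ∀ k m c d → ȳ ≈ ⟦ m ⟧ → ⟦ d ⟧ ≉ 0# → ⟦ k ⟧ ⊛ (ȳ ⊝ ⟦ m ⟧) ⊕ (⟦ 7 ⟧ ⊛ ⟦ c ⟧ ⊕ ⟦ d ⟧) ≈ 0# → ⊥
        final k m c d ȳ≈m d≉0 eq = d≉0 (trans (sym (trans (+-cong (trans (*-congˡ (trans (+-congʳ ȳ≈m) (-‿inverseʳ _))) (zeroʳ _)) (trans (+-congʳ 7⊛≈0) (+-identityˡ _))) (+-identityˡ _))) eq)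

        1≉0 : ⟦ 1 ⟧ ≉ 0#
        1≉0 = ⟦⟧-pos (s≤s z≤n) (ℕₚ.≤-trans (s≤s (s≤s z≤n)) 5<p)

        6≉0 : ⟦ 6 ⟧ ≉ 0#
        6≉0 = ⟦*⟧-≉0 {3} {2} 3≉0 2≉0

        case₂ : ȳ ≈ ⟦ 2 ⟧ → H ≤ α-1 * Y → α-1 * Y < H + H → ⊥
        case₂ ȳ≈2 ge lt = final 1830 2 542 1 ȳ≈2 1≉0 (trans
          (solve 1 (λ y → # 1830 :* (y :- # 2) :+ (# 7 :* # 542 :+ # 1) := sumᴾ y (# 0) (Tᴾ 5 5 y :* # 3)) refl ȳ)
          (combine (trans (A₄.value₁ 11≤A ge lt) (0⊕≈ φ₋₁≈0)) (V₅₁ (down (ℕₚ.∸-monoʳ-≤ α (ℕₚ.n≤1+n 1)) lt))))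

        case₁ : ȳ ≈ ⟦ 1 ⟧ → H + H ≤ α-1 * Y → ⊥
        case₁ ȳ≈1 ge = wrapped-value α-2
          (λ lt → final 1425 1 222 6 ȳ≈1 6≉0 (trans
            (solve 1 (λ y → # 1425 :* (y :- # 1) :+ (# 7 :* # 222 :+ # 6) := sumᴾ y (Tᴾ 5 4 y :* # 3) (Tᴾ 5 5 y :* # 3)) refl ȳ)
            (combine V₄₂ (V₅₁ lt))))
          (λ ge′ → final 1420 1 222 1 ȳ≈1 1≉0 (trans
            (solve 1 (λ y → # 1420 :* (y :- # 1) :+ (# 7 :* # 222 :+ # 1) := sumᴾ y (Tᴾ 5 4 y :* # 3) (Tᴾ 5 5 y :* # 4)) refl ȳ)
            (combine V₄₂ (trans (A₅.value₂ ge′ (bound₅ α-2 (ℕₚ.≤-trans (ℕₚ.m∸n≤m α 2) (ℕₚ.m≤n+m α 3)))) (trans (⊕0≈ φ₋₃≈0) (*-congˡ φ₋₄≈4))))))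
          where
          V₄₂ : T₅.L α-1 ≈ A₄.T ⊛ ⟦ 3 ⟧
          V₄₂ = trans (A₄.value₂ ge (bound₅ α-1 α-1≤)) (trans (⊕0≈ φ₋₁≈0) (*-congˡ φ₋₂≈3))

      no-multiple : ⊥
      no-multiple = by-residue Test₁.test
        where
        finish : Test₃.Survivor → ⊥
        finish (7≈0 , ge₁ , inj₁ (ȳ≈1 , ge)) = Test₅.case₁ 7≈0 ge₁ ȳ≈1 ge
        finish (7≈0 , ge₁ , inj₂ (ȳ≈2 , ge , lt)) = Test₅.case₂ 7≈0 ge₁ ȳ≈2 ge lt
        by-residue : H ≤ suc α * Y × (ȳ ≈ ⟦ 1 ⟧ ⊎ (ȳ ≈ ⟦ 2 ⟧ × H + H ≤ suc α * Y × α * Y < H + H)) → ⊥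
        by-residue (ge , inj₁ ȳ≈1) = finish (Test₃.one ge ȳ≈1)
        by-residue (ge , inj₂ (ȳ≈2 , ge₁ , lt)) = finish (Test₃.two ge ȳ≈2 ge₁ lt)

    -- From the exponent e back to d modulo Q² - 1

    -- Otherwise e - 1 = y p^a with a > 0 and p not dividing y, and e - 1 < H ≤ Q forces a < h, so
    -- that `no-multiple` applies.
    exponent≡1 : ∀ {e} → Key e → Key 1 → 0 < e → e < H → ⟦ e ⟧ ≈ ⟦ 1 ⟧ → e ≡ 1
    exponent≡1 {suc zero}    _   _    _ _   _   = ≡.refl
    exponent≡1 {suc (suc Y)} key key₁ _ e<H e≈1 = ⊥-elim (excluded (p-part pr (suc Y) (s≤s z≤n) (⟦⟧≈0⇒p∣ ⟦Y⟧≈0)))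
      where
      ⟦Y⟧≈0 : ⟦ suc Y ⟧ ≈ 0#
      ⟦Y⟧≈0 = begin
        ⟦ suc Y ⟧                         ≈⟨ solve 2 (λ o y → y := (o :+ y) :- o) refl ⟦ 1 ⟧ ⟦ suc Y ⟧ ⟩
        (⟦ 1 ⟧ ⊕ ⟦ suc Y ⟧) ⊝ ⟦ 1 ⟧       ≈⟨ +-congʳ (trans (sym (⟦⟧-+ 1 (suc Y))) e≈1) ⟩
        ⟦ 1 ⟧ ⊝ ⟦ 1 ⟧                     ≈⟨ -‿inverseʳ _ ⟩
        0#                                ∎
      excluded : (∃ λ a → ∃ λ y → 0 < a × ¬ p ∣ y × suc Y ≡ y * p ^ a) → ⊥
      excluded (a , y , 0<a , p∤y , Y≡) = no-multiple 0<a a<h {y} (p∤⇒⟦⟧≉0 p∤y) (≡.subst (λ v → Key (suc v)) Y≡ key) key₁ (≡.subst (_< H) Y≡ Y<H)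
        where
        Y<H : suc Y < H
        Y<H = ℕₚ.<-trans (ℕₚ.n<1+n _) e<H
        H≤Q : H ≤ Q
        H≤Q = ℕₚ.≤-trans (ℕₚ.m≤m+n H H′) (ℕₚ.≤-reflexive (≡.sym Q≡H+H′))
        a<h : a < h
        a<h = ℕₚ.≰⇒> (λ h≤a → ℕₚ.<⇒≱ Y<H (ℕₚ.≤-trans H≤Q (ℕₚ.≤-trans (ℕₚ.≤-reflexive u+1≡pʰ)
          (ℕₚ.≤-trans (ℕₚ.^-monoʳ-≤ p {{prime⇒nonZero pr}} h≤a) (∣.∣⇒≤ (divides y Y≡))))))

    exponent-dichotomy : ∀ {e} → Key e → Key (H ∸ e) → Key 1 → 0 < e → e < H → e ≡ 1 ⊎ suc e ≡ H
    exponent-dichotomy {e} key key′ key₁ 0<e e<H = by-size (ℕₚ.m≤n⇒m<n∨m≡n 0<e)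
      where
      by-factor : Dec (⟦ e ⟧ ⊝ ⟦ 1 ⟧ ≈ 0#) → 2 ≤ e → e ≡ 1 ⊎ suc e ≡ H
      by-factor (yes e-1≈0) _   = inj₁ (exponent≡1 key key₁ 0<e e<H (x-y≈0⇒x≈y e-1≈0))
      by-factor (no e-1≉0)  2≤e = inj₂ (≡.trans (≡.cong (_+ e) (≡.sym (exponent≡1 key′ key₁ (ℕₚ.m<n⇒0<n∸m e<H) (ℕₚ.∸-monoʳ-< 0<e (ℕₚ.<⇒≤ e<H)) H-e≈1))) (ℕₚ.m∸n+n≡m (ℕₚ.<⇒≤ e<H)))
        where
        2e+1≈0 : ⟦ 2 ⟧ ⊛ ⟦ e ⟧ ⊕ ⟦ 1 ⟧ ≈ 0#
        2e+1≈0 = *-cancel-0 e-1≉0 (quadratic-test key 2≤e e<H)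
        H-e≈1 : ⟦ H ∸ e ⟧ ≈ ⟦ 1 ⟧
        H-e≈1 = *-cancelˡ 2≉0 (begin
          ⟦ 2 ⟧ ⊛ ⟦ H ∸ e ⟧
            ≈⟨ solve 2 (λ x e → con (ℤ.+ 2) :* x := ((x :+ e) :+ (x :+ e) :+ con (ℤ.+ 1)) :- (con (ℤ.+ 2) :* e :+ con (ℤ.+ 1))) refl ⟦ H ∸ e ⟧ ⟦ e ⟧ ⟩
          ((⟦ H ∸ e ⟧ ⊕ ⟦ e ⟧) ⊕ (⟦ H ∸ e ⟧ ⊕ ⟦ e ⟧) ⊕ ⟦ 1 ⟧) ⊝ (⟦ 2 ⟧ ⊛ ⟦ e ⟧ ⊕ ⟦ 1 ⟧)
            ≈⟨ +-cong (+-congʳ (trans (+-cong ⟦H⟧ ⟦H⟧) H+H≈1)) (-‿cong 2e+1≈0) ⟩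
          (⟦ 1 ⟧ ⊕ ⟦ 1 ⟧) ⊝ 0#
            ≈⟨ solve 0 ((con (ℤ.+ 1) :+ con (ℤ.+ 1)) :- con (ℤ.+ 0) := con (ℤ.+ 2) :* con (ℤ.+ 1)) refl ⟩
          ⟦ 2 ⟧ ⊛ ⟦ 1 ⟧ ∎)
          where
          ⟦H⟧ : ⟦ H ∸ e ⟧ ⊕ ⟦ e ⟧ ≈ ⟦ H ⟧
          ⟦H⟧ = trans (sym (⟦⟧-+ (H ∸ e) e)) (⟦⟧-cong (ℕₚ.m∸n+n≡m (ℕₚ.<⇒≤ e<H)))
      by-size : 1 < e ⊎ 1 ≡ e → e ≡ 1 ⊎ suc e ≡ H
      by-size (inj₂ 1≡e) = inj₁ (≡.sym 1≡e)
      by-size (inj₁ 1<e) = by-factor ((⟦ e ⟧ ⊝ ⟦ 1 ⟧) ≟ᴷ 0#) 1<e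

    -- For even d the difference map at α also vanishes at - α / 2.
    Planar⇒±1 : ∀ {m ζ} → Planar (m + m) → ζ ↑ (m + m) ≈ 1# → ζ ⊛ ζ ≈ 1#
    Planar⇒±1 {m} {ζ} planar ζᵈ≈1 = by-cases ((ζ ⊝ 1#) ≟ᴷ 0#)
      where
      half-1 : ∃ λ t → ⟦ 2 ⟧ ⊛ t ≈ 1#
      half-1 = inverse ⟦ 2 ⟧ 2≉0
      by-cases : Dec (ζ ⊝ 1# ≈ 0#) → ζ ⊛ ζ ≈ 1#
      by-cases (yes ζ-1≈0) = trans (*-cong ζ≈1 ζ≈1) (*-identityˡ 1#)
        where
        ζ≈1 : ζ ≈ 1#
        ζ≈1 = x-y≈0⇒x≈y ζ-1≈0
      by-cases (no α≉0) = trans (*-cong ζ≈-1 ζ≈-1) (trans (solve 1 (λ o → (:- o) :* (:- o) := o :* o) refl 1#) (*-identityˡ 1#))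
        where
        α t x₀ : Carrier
        α = ζ ⊝ 1#
        t = proj₁ half-1
        x₀ = ⊖ (t ⊛ α)
        2x₀≈-α : x₀ ⊕ x₀ ≈ ⊖ α
        2x₀≈-α = begin
          x₀ ⊕ x₀                  ≈⟨ solve 2 (λ t a → (:- (t :* a)) :+ (:- (t :* a)) := :- ((con (ℤ.+ 2) :* t) :* a)) refl t α ⟩
          ⊖ ((⟦ 2 ⟧ ⊛ t) ⊛ α)      ≈⟨ -‿cong (trans (*-congʳ (proj₂ half-1)) (*-identityˡ α)) ⟩
          ⊖ α                      ∎
        at-x₀ : (x₀ ⊕ α) ↑ (m + m) ⊝ x₀ ↑ (m + m) ≈ 0#
        at-x₀ = begin
          (x₀ ⊕ α) ↑ (m + m) ⊝ x₀ ↑ (m + m)      ≈⟨ +-congʳ (^-congˡ (m + m) (trans (solve 2 (λ x a → x :+ a := (:- x) :+ ((x :+ x) :+ a)) refl x₀ α) (trans (+-congˡ (trans (+-congʳ 2x₀≈-α) (-‿inverseˡ α))) (+-identityʳ _)))) ⟩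
          (⊖ x₀) ↑ (m + m) ⊝ x₀ ↑ (m + m)        ≈⟨ +-congʳ (trans (neg-^ x₀ (m + m)) (trans (*-congʳ (sgn-even m)) (*-identityˡ _))) ⟩
          x₀ ↑ (m + m) ⊝ x₀ ↑ (m + m)            ≈⟨ -‿inverseʳ _ ⟩
          0#                                     ∎
        at-1 : (1# ⊕ α) ↑ (m + m) ⊝ 1# ↑ (m + m) ≈ 0#
        at-1 = trans (+-cong (trans (^-congˡ (m + m) (solve 2 (λ o z → o :+ (z :- o) := z) refl 1# ζ)) ζᵈ≈1) (-‿cong (1^ (m + m)))) (-‿inverseʳ 1#)
        1≈x₀ : 1# ≈ x₀
        1≈x₀ = proj₁ (planar α α≉0) (trans at-1 (sym at-x₀))
        ζ≈-1 : ζ ≈ ⊖ 1#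
        ζ≈-1 = begin
          ζ                                    ≈⟨ solve 2 (λ z o → z := (:- (:- (z :- o))) :+ o) refl ζ 1# ⟩
          ⊖ (⊖ α) ⊕ 1#                         ≈⟨ +-congʳ (-‿cong (trans (sym 2x₀≈-α) (+-cong (sym 1≈x₀) (sym 1≈x₀)))) ⟩
          ⊖ (1# ⊕ 1#) ⊕ 1#                     ≈⟨ solve 1 (λ o → (:- (o :+ o)) :+ o := :- o) refl 1# ⟩
          ⊖ 1#                                 ∎

    1<H : 1 < H
    1<H = double-cancel-< (ℕₚ.<-≤-trans (ℕₚ.≤-trans (s≤s (s≤s (s≤s z≤n))) (ℕₚ.≤-trans 5<p p≤Q)) (ℕₚ.≤-trans (ℕₚ.n≤1+n Q) (ℕₚ.≤-reflexive Q+1≡2H)))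

    u≡2H′ : u ≡ H′ + H′
    u≡2H′ = ℕₚ.suc-injective (≡.trans Q≡H+H′ (≡.cong (_+ H′) (≡.sym suc-H′)))

    -- A common divisor g of μ and H divides d/2 = μ H′ + H. With m = (q - 1)/(2g), every ζ = x^m
    -- with x ≠ 0 satisfies ζ^d = 1 and hence ζ² = 1; but for g > 1 some x has x^(2m) ≠ 1.
    μ-coprime : ∀ {d μ} → Planar d → d ≡ 2 + suc μ * u → Coprime μ H
    μ-coprime {d} {μ} planar d≡ {zero} (_ , 0∣H) = ⊥-elim (ℕₚ.<-irrefl (≡.sym (∣.0∣⇒≡0 0∣H)) 0<H)
    μ-coprime {d} {μ} planar d≡ {suc zero} _ = ≡.refl
    μ-coprime {d} {μ} planar d≡ {suc (suc g₂)} (divides μ₀ μ≡ , divides H₀ H≡) = ⊥-elim (absurd u[u+2]∣q-1)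
      where
      g = suc (suc g₂)
      w = μ₀ * H′ + H₀
      d≡2gw : d ≡ g * w + g * w
      d≡2gw = ≡.trans d≡ (≡.trans (≡.cong (λ v → 2 + suc μ * v) u≡2H′) (≡.trans (solve′ 2 (λ μ K → con′ 2 :+′ (con′ 1 :+′ μ) :*′ (K :+′ K) :=′ (μ :*′ K :+′ (con′ 1 :+′ K)) :+′ (μ :*′ K :+′ (con′ 1 :+′ K))) ≡.refl μ H′)
        (≡.cong (λ v → v + v) (≡.trans (≡.cong₂ (λ a b → a * H′ + b) μ≡ (≡.trans suc-H′ H≡)) (solve′ 4 (λ m g K H → m :*′ g :*′ K :+′ H :*′ g :=′ g :*′ (m :*′ K :+′ H)) ≡.refl μ₀ g H′ H₀)))))
      absurd : u * (u + 2) ∣ q ∸ 1 → ⊥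
      absurd (divides k q-1≡) = contradict (∃-nonroot (m + m) 0<2m 2m+1<q)
        where
        m = k * u * H₀
        q-1≡2gm : q ∸ 1 ≡ (m + m) * g
        q-1≡2gm = ≡.trans q-1≡ (≡.trans (≡.cong (λ v → k * (u * v)) (≡.trans u+2≡2H (≡.cong (λ v → v + v) H≡))) (solve′ 4 (λ k u H g → k :*′ (u :*′ (H :*′ g :+′ H :*′ g)) :=′ (k :*′ u :*′ H :+′ k :*′ u :*′ H) :*′ g) ≡.refl k u H₀ g))
        0<q-1 : 0 < q ∸ 1
        0<q-1 = ℕₚ.m<n⇒0<n∸m 1<q
        0<2m : 0 < m + m
        0<2m = ℕₚ.n≢0⇒n>0 (λ 2m≡0 → ℕₚ.<-irrefl (≡.sym (≡.trans q-1≡2gm (≡.cong (_* g) 2m≡0))) 0<q-1)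
        2m+1<q : suc (m + m) < q
        2m+1<q = ℕₚ.≤-trans (s≤s (ℕₚ.≤-trans (ℕₚ.m<m*n (m + m) g {{>-nonZero 0<2m}} (s≤s (s≤s z≤n))) (ℕₚ.≤-reflexive (≡.sym q-1≡2gm)))) (ℕₚ.≤-reflexive suc[q∸1]≡q)
        contradict : (∃ λ x → x ≉ 0# × x ↑ (m + m) ≉ 1#) → ⊥
        contradict (x , x≉0 , x²ᵐ≉1) = x²ᵐ≉1 (trans (^-homo-* x m m) (Planar⇒±1 {g * w} {x ↑ m} (≡.subst Planar d≡2gw planar) (begin
          (x ↑ m) ↑ (g * w + g * w)   ≈⟨ ^-assocʳ x m (g * w + g * w) ⟩
          x ↑ (m * (g * w + g * w))   ≈⟨ ^-≡ x (≡.trans (solve′ 3 (λ m g w → m :*′ (g :*′ w :+′ g :*′ w) :=′ ((m :+′ m) :*′ g) :*′ w) ≡.refl m g w) (≡.cong (_* w) (≡.sym q-1≡2gm))) ⟩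
          x ↑ ((q ∸ 1) * w)           ≈⟨ ^-assocʳ x (q ∸ 1) w ⟨
          (x ↑ (q ∸ 1)) ↑ w           ≈⟨ trans (^-congˡ w (fermat x≉0)) (1^ w) ⟩
          1#                          ∎)))

    r₂ : ℕ
    r₂ = u * (u + 2)

    r₂≡2Hu : r₂ ≡ H * u + H * u
    r₂≡2Hu = ≡.trans (≡.cong (u *_) u+2≡2H) (solve′ 2 (λ u H → u :*′ (H :+′ H) :=′ H :*′ u :+′ H :*′ u) ≡.refl u H)

    r₂+1≡Q*Q : suc r₂ ≡ Q * Q
    r₂+1≡Q*Q = solve′ 1 (λ u → con′ 1 :+′ u :*′ (u :+′ con′ 2) :=′ (con′ 1 :+′ u) :*′ (con′ 1 :+′ u)) ≡.refl u

    4<r₂ : 4 < r₂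
    4<r₂ = ℕₚ.≤-trans (ℕₚ.≤-trans (s≤s⁻¹ (ℕₚ.≤-trans 5<p p≤Q)) (ℕₚ.m≤m+n u 2)) (ℕₚ.m≤n*m (u + 2) u {{>-nonZero 0<u}})

    -- Hermite's second-power criterion over the field of Q² elements excludes the quadratic twist of x².
    no-half-twist : ∀ {d} → Planar d → ¬ d ≡ 2 + H * u mod r₂
    no-half-twist {d} planar d≡ = 3≉0 (begin
      ⟦ 3 ⟧
        ≈⟨ solve 1 (λ x → con (ℤ.+ 3) := con (ℤ.+ 4) :* ((con (ℤ.+ 2) :+ x) :* ((con (ℤ.+ 2) :+ x) :- con (ℤ.+ 1))) :- ((x :+ x) :+ con (ℤ.+ 1)) :* ((x :+ x) :+ con (ℤ.+ 5))) refl ⟦ k ⟧ ⟩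
      ⟦ 4 ⟧ ⊛ ((⟦ 2 ⟧ ⊕ ⟦ k ⟧) ⊛ ((⟦ 2 ⟧ ⊕ ⟦ k ⟧) ⊝ ⟦ 1 ⟧)) ⊝ ((⟦ k ⟧ ⊕ ⟦ k ⟧) ⊕ ⟦ 1 ⟧) ⊛ ((⟦ k ⟧ ⊕ ⟦ k ⟧) ⊕ ⟦ 5 ⟧)
        ≈⟨ +-cong (trans (*-congˡ binomial≈0) (zeroʳ _)) (-‿cong (trans (*-congʳ 2k+1≈0) (zeroˡ _))) ⟩
      0# ⊝ 0#   ≈⟨ -‿inverseʳ 0# ⟩
      0#        ∎)
      where
      k = H * u
      r₂+1≡p²ʰ : suc r₂ ≡ p ^ (h + h)
      r₂+1≡p²ʰ = ≡.trans r₂+1≡Q*Q (≡.trans (≡.cong₂ _*_ u+1≡pʰ u+1≡pʰ) (≡.sym (ℕₚ.^-distribˡ-+-* p h h)))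
      open Moments F pr n q≡pⁿ (h + h) r₂ r₂+1≡p²ʰ (ℕₚ.≤-trans (s≤s z≤n) 4<r₂) u[u+2]∣q-1 using (hermite₂)
      2<k : 2 < k
      2<k = double-cancel-< (ℕₚ.<-≤-trans 4<r₂ (ℕₚ.≤-reflexive r₂≡2Hu))
      r₂∤2e : ¬ r₂ ∣ (2 + k) + (2 + k)
      r₂∤2e r₂∣ = ∣.>⇒∤ 4<r₂ (∣.∣m+n∣m⇒∣n {r₂} {r₂} {4} (≡.subst (r₂ ∣_) (≡.trans (solve′ 1 (λ k → (con′ 2 :+′ k) :+′ (con′ 2 :+′ k) :=′ (k :+′ k) :+′ con′ 4) ≡.refl k) (≡.cong (_+ 4) (≡.sym r₂≡2Hu))) r₂∣) ∣.∣-refl)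
      C≈0 : ⟦ (2 + k) C k ⟧ ≈ 0#
      C≈0 = hermite₂ {d} {2 + k} planar (Planar⇒0< d planar) (s≤s z≤n) d≡ r₂≡2Hu (ℕₚ.m≤n+m k 2) (ℕₚ.<-≤-trans (ℕₚ.+-monoˡ-< k 2<k) (ℕₚ.≤-reflexive (≡.sym r₂≡2Hu)))
        r₂∤2e (∣.>⇒∤ (ℕₚ.≤-trans (s≤s (s≤s (s≤s z≤n))) 4<r₂)) 2≉0
      binomial≈0 : (⟦ 2 ⟧ ⊕ ⟦ k ⟧) ⊛ ((⟦ 2 ⟧ ⊕ ⟦ k ⟧) ⊝ ⟦ 1 ⟧) ≈ 0#
      binomial≈0 = begin
        (⟦ 2 ⟧ ⊕ ⟦ k ⟧) ⊛ ((⟦ 2 ⟧ ⊕ ⟦ k ⟧) ⊝ ⟦ 1 ⟧)   ≈⟨ *-cong (⟦⟧-+ 2 k) (+-congʳ (⟦⟧-+ 2 k)) ⟨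
        ⟦ 2 + k ⟧ ⊛ (⟦ 2 + k ⟧ ⊝ ⟦ 1 ⟧)               ≈⟨ 2C2 (2 + k) ⟨
        ⟦ 2 ⟧ ⊛ ⟦ (2 + k) C 2 ⟧                       ≈⟨ *-congˡ (trans (⟦⟧-cong (nCk≡nC[n∸k] {2} {2 + k} (s≤s (s≤s z≤n)))) C≈0) ⟩
        ⟦ 2 ⟧ ⊛ 0#                                    ≈⟨ zeroʳ _ ⟩
        0#                                            ∎
      2k+1≈0 : (⟦ k ⟧ ⊕ ⟦ k ⟧) ⊕ ⟦ 1 ⟧ ≈ 0#
      2k+1≈0 = begin
        (⟦ k ⟧ ⊕ ⟦ k ⟧) ⊕ ⟦ 1 ⟧     ≈⟨ trans (+-congʳ (sym (⟦⟧-+ k k))) (sym (⟦⟧-+ (k + k) 1)) ⟩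
        ⟦ (k + k) + 1 ⟧             ≡⟨ ≡.cong ⟦_⟧ (≡.trans (ℕₚ.+-comm (k + k) 1) (≡.trans (≡.cong suc (≡.sym r₂≡2Hu)) r₂+1≡Q*Q)) ⟩
        ⟦ Q * Q ⟧                   ≈⟨ p∣⇒⟦⟧≈0 (∣.∣m⇒∣m*n Q p∣Q) ⟩
        0#                          ∎

    -- Here d = 2 + j H u while r₂ = 2 H u, so only the parity of j matters.
    untwisted : ∀ {d μ} → Planar d → d ≡ 2 + suc μ * u → H ∣ suc μ → d ≡ 2 mod r₂
    untwisted {d} {μ} planar d≡ (divides j sucμ≡) = by-parity (even⊎odd j)
      where
      d≡jHu : d ≡ 2 + j * (H * u)
      d≡jHu = ≡.trans d≡ (≡.cong (2 +_) (≡.trans (≡.cong (_* u) sucμ≡) (ℕₚ.*-assoc j H u)))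
      by-parity : (∃ λ i → j ≡ 2 * i ⊎ j ≡ suc (2 * i)) → d ≡ 2 mod r₂
      by-parity (i , inj₁ j≡) = 0 , i , ≡.trans (ℕₚ.+-identityʳ d) (≡.trans d≡jHu (≡.cong (2 +_)
        (≡.trans (≡.cong (_* (H * u)) j≡) (≡.trans (solve′ 2 (λ i k → con′ 2 :*′ i :*′ k :=′ i :*′ (k :+′ k)) ≡.refl i (H * u)) (≡.cong (i *_) (≡.sym r₂≡2Hu))))))
      by-parity (i , inj₂ j≡) = ⊥-elim (no-half-twist {d} planar (0 , i , ≡.trans (ℕₚ.+-identityʳ d) (≡.trans d≡jHu
        (≡.trans (≡.cong (λ v → 2 + v * (H * u)) j≡) (≡.trans (solve′ 2 (λ i k → con′ 2 :+′ (con′ 1 :+′ con′ 2 :*′ i) :*′ k :=′ (con′ 2 :+′ k) :+′ i :*′ (k :+′ k)) ≡.refl i (H * u)) (≡.cong (λ v → (2 + H * u) + i * v) (≡.sym r₂≡2Hu)))))))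

    Q²≡1 : Q * Q ≡ 1 mod r₂
    Q²≡1 = 0 , 1 , ≡.trans (ℕₚ.+-identityʳ _) (≡.trans (≡.sym r₂+1≡Q*Q) (≡.cong suc (≡.sym (ℕₚ.+-identityʳ r₂))))

    Q+1≡0 : suc Q ≡ 0 mod H
    Q+1≡0 = ∣⇒mod (divides 2 (≡.trans Q+1≡2H (≡.cong (H +_) (≡.sym (ℕₚ.+-identityʳ H)))))

    module _ {d μ : ℕ} (planar : Planar d) (d≡ : d ≡ 2 + suc μ * u) where
      private
        dQ : ℕ
        dQ = d * Q
        planarQ : Planar dQ
        planarQ = ≡.subst (λ v → Planar (d * v)) (≡.sym u+1≡pʰ) (Planar-frobenius {d} h planar)
        -- The parameter of the conjugate exponent d Q. As Q ≡ -1 (mod H), μ′ ≡ -μ, which is why its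
        -- inverse is H - e.
        μ′ : ℕ
        μ′ = suc (suc μ * Q)
        dQ≡ : dQ ≡ 2 + suc μ′ * u
        dQ≡ = ≡.trans (≡.cong (_* Q) d≡) (solve′ 2 (λ m u → (con′ 2 :+′ m :*′ u) :*′ (con′ 1 :+′ u) :=′ con′ 2 :+′ (con′ 2 :+′ m :*′ (con′ 1 :+′ u)) :*′ u) ≡.refl (suc μ) u)

        inverse-μ : ∃ λ e → 0 < e × e < H × e * μ ≡ 1 mod H
        inverse-μ = inverse-mod 1<H (μ-coprime {d} {μ} planar d≡)

      twisted-or-not : d ≡ 2 mod r₂ ⊎ d ≡ 2 * Q mod r₂
      twisted-or-not = conclude inverse-μ
        where
        conclude : (∃ λ e → 0 < e × e < H × e * μ ≡ 1 mod H) → d ≡ 2 mod r₂ ⊎ d ≡ 2 * Q mod r₂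
        conclude (e , 0<e , e<H , eμ≡1) = by-exponent (exponent-dichotomy (planar⇒Key {d} {μ} {e} planar d≡ eμ≡1) (planar⇒Key {dQ} {μ′} {H ∸ e} planarQ dQ≡ [H-e]μ′≡1) key₁ 0<e e<H)
          where
          [H-e]μ′≡1 : (H ∸ e) * μ′ ≡ 1 mod H
          [H-e]μ′≡1 = mod-+-cancelˡ (e * μ′) (mod-trans (∣⇒mod (divides μ′ (≡.trans (≡.sym (ℕₚ.*-distribʳ-+ μ′ e (H ∸ e))) (≡.trans (≡.cong (_* μ′) (ℕₚ.m+[n∸m]≡n (ℕₚ.<⇒≤ e<H))) (ℕₚ.*-comm H μ′)))))
            (mod-sym (mod-trans (mod-reflexive (solve′ 3 (λ e μ Q → e :*′ (con′ 1 :+′ (con′ 1 :+′ μ) :*′ Q) :+′ con′ 1 :=′ e :*′ (con′ 1 :+′ Q) :+′ ((e :*′ μ) :*′ Q :+′ con′ 1)) ≡.refl e μ Q))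
              (mod-trans (mod-+ (mod-*ˡ e Q+1≡0) (mod-+ (mod-*ʳ Q eμ≡1) (mod-reflexive {a = 1} ≡.refl)))
                (mod-trans (mod-reflexive (solve′ 2 (λ e Q → e :*′ con′ 0 :+′ (con′ 1 :*′ Q :+′ con′ 1) :=′ con′ 1 :+′ Q) ≡.refl e Q)) Q+1≡0)))))
          key₁ : Key 1
          key₁ = planar⇒Key {2 * p ^ h} {1} {1} (Planar-frobenius {2} h (Planar-2 2≉0)) (≡.trans (≡.cong (2 *_) (≡.sym u+1≡pʰ)) (solve′ 1 (λ u → con′ 2 :*′ (con′ 1 :+′ u) :=′ con′ 2 :+′ con′ 2 :*′ u) ≡.refl u)) (mod-reflexive ≡.refl)
          by-exponent : e ≡ 1 ⊎ suc e ≡ H → d ≡ 2 mod r₂ ⊎ d ≡ 2 * Q mod r₂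
          -- If e ≡ -1, then μ ≡ -1 and H divides μ + 1. If e = 1, the same holds for μ′, so d Q ≡
          -- 2, and multiplying by Q recovers d because Q² ≡ 1.
          by-exponent (inj₂ e+1≡H) = inj₁ (untwisted {d} {μ} planar d≡ (mod⇒∣ (mod-+-cancelˡ (e * suc μ) (mod-trans
            (∣⇒mod (divides (suc μ) (≡.trans (ℕₚ.+-comm (e * suc μ) (suc μ)) (≡.trans (≡.cong (_* suc μ) e+1≡H) (ℕₚ.*-comm H (suc μ))))))
            (mod-sym (mod-trans (mod-reflexive (solve′ 2 (λ e μ → e :*′ (con′ 1 :+′ μ) :+′ con′ 0 :=′ e :*′ μ :+′ e) ≡.refl e μ))
              (mod-trans (mod-+ eμ≡1 (mod-reflexive {a = e} ≡.refl)) (∣⇒mod (∣.∣-reflexive (≡.sym e+1≡H))))))))))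
          by-exponent (inj₁ e≡1) = inj₂ (mod-trans (mod-sym (mod-trans (mod-reflexive (ℕₚ.*-assoc d Q Q)) (mod-trans (mod-*ˡ d Q²≡1) (mod-reflexive (ℕₚ.*-identityʳ d)))))
              (mod-*ʳ Q (untwisted {dQ} {μ′} planarQ dQ≡ (mod⇒∣ (mod-trans (mod-+ (mod-reflexive {a = 2} ≡.refl) (mod-*ʳ Q (mod-+ (mod-reflexive {a = 1} ≡.refl) μ≡1)))
                (mod-trans (mod-reflexive (solve′ 1 (λ Q → con′ 2 :+′ con′ 2 :*′ Q :=′ con′ 2 :*′ (con′ 1 :+′ Q)) ≡.refl Q)) (mod-*ˡ 2 Q+1≡0)))))))
            where
            μ≡1 : μ ≡ 1 mod H
            μ≡1 = mod-trans (mod-reflexive (≡.sym (ℕₚ.*-identityˡ μ))) (≡.subst (λ v → v * μ ≡ 1 mod H) e≡1 eμ≡1)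

    level-up : ∀ {d} → Planar d → d ≡ 2 mod u → d ≡ 2 mod r₂ ⊎ d ≡ 2 * Q mod r₂
    level-up {d} planar d≡2 = from-representative quotient
      where
      -- Adding q - 1 makes the quotient of d⁺ - 2 by u positive, so that it has the form μ + 1.
      d⁺ = d + (q ∸ 1)
      d≡d⁺ : ∀ {m} → m ∣ q ∸ 1 → d ≡ d⁺ mod m
      d≡d⁺ (divides k q-1≡) = mod-sym (mod-trans (mod-reflexive (≡.cong (d +_) q-1≡)) (mod-multiple d k))
      r₂≤q-1 : r₂ ≤ q ∸ 1
      r₂≤q-1 = ∣.∣⇒≤ {{>-nonZero (ℕₚ.m<n⇒0<n∸m 1<q)}} u[u+2]∣q-1
      u+2≤d⁺ : u + 2 ≤ d⁺
      u+2≤d⁺ = ℕₚ.≤-trans (ℕₚ.≤-trans (ℕₚ.m≤n*m (u + 2) u {{>-nonZero 0<u}}) r₂≤q-1) (ℕₚ.m≤n+m (q ∸ 1) d)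
      2+[d⁺-2]≡d⁺ : 2 + (d⁺ ∸ 2) ≡ d⁺
      2+[d⁺-2]≡d⁺ = ℕₚ.m+[n∸m]≡n (ℕₚ.≤-trans (ℕₚ.m≤n+m 2 u) u+2≤d⁺)
      planar⁺ : Planar d⁺
      planar⁺ = Planar-periodic {d} {d⁺} planar (ℕₚ.≤-trans (Planar⇒0< d planar) (ℕₚ.m≤m+n d _)) (d≡d⁺ ∣.∣-refl)
      quotient : u ∣ d⁺ ∸ 2
      quotient = mod⇒∣ (mod-+-cancelˡ 2 (mod-trans (mod-reflexive 2+[d⁺-2]≡d⁺) (mod-trans (mod-sym (d≡d⁺ (∣-trans (∣.m∣m*n (u + 2)) u[u+2]∣q-1))) d≡2)))
      from-representative : u ∣ d⁺ ∸ 2 → d ≡ 2 mod r₂ ⊎ d ≡ 2 * Q mod r₂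
      from-representative (divides zero eq) = ⊥-elim (ℕₚ.<⇒≱ (ℕₚ.+-monoˡ-< 2 0<u) (ℕₚ.≤-trans u+2≤d⁺ (ℕₚ.≤-reflexive (≡.trans (≡.sym 2+[d⁺-2]≡d⁺) (≡.cong (2 +_) eq)))))
      from-representative (divides (suc μ) eq) = transfer (twisted-or-not {d⁺} {μ} planar⁺ (≡.trans (≡.sym 2+[d⁺-2]≡d⁺) (≡.cong (2 +_) eq)))
        where
        transfer : d⁺ ≡ 2 mod r₂ ⊎ d⁺ ≡ 2 * Q mod r₂ → d ≡ 2 mod r₂ ⊎ d ≡ 2 * Q mod r₂
        transfer (inj₁ ≡2)  = inj₁ (mod-trans (d≡d⁺ u[u+2]∣q-1) ≡2)
        transfer (inj₂ ≡2Q) = inj₂ (mod-trans (d≡d⁺ u[u+2]∣q-1) ≡2Q)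

-- Induction along the tower and the classification

module Classify where
  open Congruence
  open PlanarPowerSums
  open QuadraticTower
  open import Data.Nat
  import Data.Nat.Properties as ℕₚ
  open import Data.Nat.Divisibility as ∣ using (_∣_; divides)
  open import Data.Nat.Primality using (Prime; prime⇒nonZero)
  open import Data.Nat.Solver using (module +-*-Solver)
  open +-*-Solver using () renaming (solve to solve′; con to con′; _:+_ to _:+′_; _:*_ to _:*′_; _:=_ to _:=′_)
  open import Data.Integer using (+_; _-_)
  import Data.Integer as ℤ
  import Data.Integer.Properties as ℤₚ
  import Data.Integer.Divisibility as ℤ∣
  import Data.Integer.Solver as ℤSolver
  open import Data.Product using (∃; _,_; proj₁; proj₂)
  open import Data.Sum using (_⊎_; inj₁; inj₂)
  import Relation.Binary.PropositionalEquality as ≡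
  open ≡ using (_≡_; _≢_)

  mod⇒ℤ∣ : ∀ {a b m} → a ≡ b mod m → (+ m) ℤ∣.∣ ((+ a) - (+ b))
  mod⇒ℤ∣ {a} {b} {m} (i , j , eq) = divides ℤ.∣ (+ j) - (+ i) ∣ (≡.trans (≡.cong ℤ.∣_∣ difference) (ℤₚ.abs-* ((+ j) - (+ i)) (+ m)))
    where
    open ℤSolver.+-*-Solver
    eqℤ : (+ a) ℤ.+ (+ i) ℤ.* (+ m) ≡ (+ b) ℤ.+ (+ j) ℤ.* (+ m)
    eqℤ = ≡.trans (≡.cong (λ v → (+ a) ℤ.+ v) (≡.sym (ℤₚ.pos-* i m))) (≡.trans (≡.cong +_ eq) (≡.cong (λ v → (+ b) ℤ.+ v) (ℤₚ.pos-* j m)))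
    difference : (+ a) - (+ b) ≡ ((+ j) - (+ i)) ℤ.* (+ m)
    difference = ≡.trans (solve 4 (λ a b i m → a :- b := (a :+ i :* m) :- b :- i :* m) ≡.refl (+ a) (+ b) (+ i) (+ m))
      (≡.trans (≡.cong (λ v → v - (+ b) - (+ i) ℤ.* (+ m)) eqℤ)
        (solve 4 (λ b i j m → (b :+ j :* m) :- b :- i :* m := (j :- i) :* m) ≡.refl (+ b) (+ i) (+ j) (+ m)))

  ℤ∣⇒mod : ∀ {a b m} → (+ m) ℤ∣.∣ ((+ a) - (+ b)) → a ≡ b mod m
  ℤ∣⇒mod {a} {b} {m} m∣ = by-order (ℕₚ.≤-total a b)
    where
    m∣∣a⊖b∣ : m ∣ ℤ.∣ a ℤ.⊖ b ∣
    m∣∣a⊖b∣ = ≡.subst (λ v → m ∣ ℤ.∣ v ∣) (ℤₚ.m-n≡m⊖n a b) m∣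
    above : ∀ {x y} → x ≤ y → m ∣ y ∸ x → y ≡ x mod m
    above {x} {y} x≤y (divides k eq) = 0 , k , ≡.trans (ℕₚ.+-identityʳ y) (≡.trans (≡.sym (ℕₚ.m+[n∸m]≡n x≤y)) (≡.cong (_+_ x) eq))
    by-order : a ≤ b ⊎ b ≤ a → a ≡ b mod m
    by-order (inj₁ a≤b) = mod-sym (above a≤b (≡.subst (m ∣_) (ℤₚ.∣⊖∣-≤ a≤b) m∣∣a⊖b∣))
    by-order (inj₂ b≤a) = above b≤a (≡.subst (m ∣_) (≡.trans (ℤₚ.∣m⊖n∣≡∣n⊖m∣ a b) (ℤₚ.∣⊖∣-≤ b≤a)) m∣∣a⊖b∣)

  ≡1-mod-pred : ∀ {x} → 0 < x → x ≡ 1 mod (x ∸ 1)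
  ≡1-mod-pred {suc x} _ = 0 , 1 , ≡.trans (ℕₚ.+-identityʳ _) (≡.cong suc (≡.sym (ℕₚ.+-identityʳ x)))

  ≡1⇒∣pred : ∀ {x m} → 0 < x → x ≡ 1 mod m → m ∣ x ∸ 1
  ≡1⇒∣pred {suc x} _ eq = mod⇒∣ (mod-+-cancelˡ 1 eq)

  1^-mod : ∀ {x m} j → x ≡ 1 mod m → x ^ j ≡ 1 mod m
  1^-mod j eq = mod-trans (mod-^ j eq) (mod-reflexive (ℕₚ.^-zeroˡ j))

  module Classification {c ℓ : Level} (k p : ℕ) (pr : Prime p) (5<p : 5 < p) (F : FiniteField c ℓ (p ^ (2 ^ k))) where
    open CharP F pr (2 ^ k) ≡.refl using (Planar; Planar-frobenius; Planar-2; p∤⇒⟦⟧≉0)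
    open Sums F pr (2 ^ k) ≡.refl using (Planar-periodic)

    private
      instance
        p≢0 : NonZero p
        p≢0 = prime⇒nonZero pr

      0<p^ : ∀ m → 0 < p ^ m
      0<p^ = ℕₚ.m^n>0 p

    p^-≡1 : ∀ m j → p ^ (m * j) ≡ 1 mod (p ^ m ∸ 1)
    p^-≡1 m j = mod-trans (mod-reflexive (≡.sym (ℕₚ.^-*-assoc p m j))) (1^-mod j (≡1-mod-pred (0<p^ m)))

    p^-∣ : ∀ {m l} → m ∣ l → p ^ m ∸ 1 ∣ p ^ l ∸ 1
    p^-∣ {m} (divides j ≡.refl) = ≡1⇒∣pred (0<p^ (j * m)) (mod-trans (mod-reflexive (≡.cong (p ^_) (ℕₚ.*-comm j m))) (p^-≡1 m j))

    2^-∣ : ∀ {i} → i ≤ k → 2 ^ i ∣ 2 ^ k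
    2^-∣ {i} i≤k = ≡.subst (2 ^ i ∣_) (≡.trans (≡.sym (ℕₚ.^-distribˡ-+-* 2 i (k ∸ i))) (≡.cong (2 ^_) (ℕₚ.m+[n∸m]≡n i≤k))) (∣.m∣m*n _)

    -- Since p^m ≡ 1, the inverse of p^a is p^(a (m - 1)).
    untwist : ∀ m a → 0 < m → ∃ λ b → p ^ a * p ^ b ≡ 1 mod (p ^ m ∸ 1)
    untwist m a 0<m = a * pred m , mod-trans (mod-reflexive (≡.trans (≡.sym (ℕₚ.^-distribˡ-+-* p a (a * pred m)))
      (≡.cong (p ^_) (≡.trans (≡.sym (ℕₚ.*-suc a (pred m))) (≡.trans (≡.cong (a *_) (ℕₚ.suc-pred m {{>-nonZero 0<m}})) (ℕₚ.*-comm a m)))))) (p^-≡1 m a)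

    -- A Frobenius twist by p^b normalises the residue modulo Q - 1 to 2, which is the form
    -- `level-up` expects. The twist is undone afterwards by p^b′, an inverse of p^b for the larger
    -- modulus Q² - 1.
    ascend : ∀ {d} i → suc i ≤ k → Planar d → (∃ λ a → d ≡ 2 * p ^ a mod (p ^ (2 ^ i) ∸ 1)) →
             ∃ λ a → d ≡ 2 * p ^ a mod (p ^ (2 ^ suc i) ∸ 1)
    ascend {d} i i<k planar (a , d≡2pᵃ) = conclude (level-up {d * p ^ b} (Planar-frobenius {d} b planar) twisted≡2)
      where
      h = 2 ^ i
      u = p ^ h ∸ 1
      0<h : 0 < h
      0<h = ℕₚ.m^n>0 2 i
      u+1≡pʰ : suc u ≡ p ^ h
      u+1≡pʰ = ℕₚ.m+[n∸m]≡n (0<p^ h)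
      p≤pʰ : p ≤ p ^ h
      p≤pʰ = ∣.∣⇒≤ {{>-nonZero (0<p^ h)}} (p∣p^ 0<h)
      0<u : 0 < u
      0<u = s≤s⁻¹ (ℕₚ.≤-trans (ℕₚ.≤-trans (s≤s (s≤s z≤n)) 5<p) (ℕₚ.≤-trans p≤pʰ (ℕₚ.≤-reflexive (≡.sym u+1≡pʰ))))
      odd : ∃ λ g → p ^ h ≡ suc (2 * g)
      odd = odd-^ {p} {proj₁ p-odd} (proj₂ p-odd) h
        where p-odd = odd-prime pr (ℕₚ.≤-trans (s≤s (s≤s (s≤s z≤n))) 5<p)
      H = suc (proj₁ odd)
      u+2≡2H : u + 2 ≡ H + H
      u+2≡2H = ≡.trans (ℕₚ.+-comm u 2) (≡.trans (≡.cong suc (≡.trans u+1≡pʰ (proj₂ odd))) (solve′ 1 (λ g → con′ 1 :+′ (con′ 1 :+′ con′ 2 :*′ g) :=′ (con′ 1 :+′ g) :+′ (con′ 1 :+′ g)) ≡.refl (proj₁ odd)))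
      r₂≡ : u * (u + 2) ≡ p ^ (2 ^ suc i) ∸ 1
      r₂≡ = ≡.cong (_∸ 1) (≡.trans (solve′ 1 (λ u → con′ 1 :+′ u :*′ (u :+′ con′ 2) :=′ (con′ 1 :+′ u) :*′ (con′ 1 :+′ u)) ≡.refl u)
        (≡.trans (≡.cong₂ _*_ u+1≡pʰ u+1≡pʰ) (≡.trans (≡.sym (ℕₚ.^-distribˡ-+-* p h h)) (≡.cong (λ v → p ^ (h + v)) (≡.sym (ℕₚ.+-identityʳ h))))))
      open Tower F pr (2 ^ k) ≡.refl h u u+1≡pʰ 0<u H u+2≡2H (≡.subst (_∣ p ^ (2 ^ k) ∸ 1) (≡.sym r₂≡) (p^-∣ (2^-∣ i<k))) 5<p using (level-up)

      b = proj₁ (untwist h a 0<h)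
      b′ = proj₁ (untwist (2 ^ suc i) b (ℕₚ.m^n>0 2 (suc i)))
      R = p ^ (2 ^ suc i) ∸ 1

      twisted≡2 : d * p ^ b ≡ 2 mod u
      twisted≡2 = mod-trans (mod-*ʳ (p ^ b) d≡2pᵃ) (mod-trans (mod-reflexive (ℕₚ.*-assoc 2 (p ^ a) (p ^ b))) (mod-*ˡ 2 (proj₂ (untwist h a 0<h))))

      back : ∀ x → d * p ^ b ≡ x mod (u * (u + 2)) → d ≡ x * p ^ b′ mod R
      back x eq = mod-trans (mod-sym (mod-trans (mod-reflexive (ℕₚ.*-assoc d (p ^ b) (p ^ b′))) (mod-trans (mod-*ˡ d (proj₂ (untwist (2 ^ suc i) b (ℕₚ.m^n>0 2 (suc i))))) (mod-reflexive (ℕₚ.*-identityʳ d)))))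
        (mod-*ʳ (p ^ b′) (≡.subst (d * p ^ b ≡ x mod_) r₂≡ eq))

      conclude : d * p ^ b ≡ 2 mod (u * (u + 2)) ⊎ d * p ^ b ≡ 2 * suc u mod (u * (u + 2)) → ∃ λ a → d ≡ 2 * p ^ a mod R
      conclude (inj₁ ≡2)  = b′ , back 2 ≡2
      conclude (inj₂ ≡2Q) = h + b′ , mod-trans (back (2 * suc u) ≡2Q) (mod-reflexive
        (≡.trans (ℕₚ.*-assoc 2 (suc u) (p ^ b′)) (≡.cong (2 *_) (≡.trans (≡.cong (_* p ^ b′) u+1≡pʰ) (≡.sym (ℕₚ.^-distribˡ-+-* p h b′))))))

    planar⇒≡2pᵃ : ∀ {d} → Planar d → ∀ i → i ≤ k → ∃ λ a → d ≡ 2 * p ^ a mod (p ^ (2 ^ i) ∸ 1)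
    planar⇒≡2pᵃ {d} planar zero    _   = 0 , ≡.subst (d ≡ 2 mod_) (≡.cong (_∸ 1) (≡.sym (ℕₚ.*-identityʳ p))) (PrimeSubfield.planar⇒d≡2 F pr (2 ^ k) ≡.refl (p ∸ 1) (ℕₚ.m+[n∸m]≡n (ℕₚ.≤-trans (s≤s z≤n) 5<p)) 5<p
      (≡.subst (λ v → v ∸ 1 ∣ p ^ (2 ^ k) ∸ 1) (ℕₚ.*-identityʳ p) (p^-∣ (∣.1∣ (2 ^ k)))) planar)
    planar⇒≡2pᵃ {d} planar (suc i) i<k = ascend {d} i i<k planar (planar⇒≡2pᵃ {d} planar i (ℕₚ.<⇒≤ i<k))

    ≡2pᵃ⇒planar : ∀ {d} a → d ≡ 2 * p ^ a mod (p ^ (2 ^ k) ∸ 1) → Planar d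
    ≡2pᵃ⇒planar {d} a d≡ = Planar-periodic {2 * p ^ a} {d} (Planar-frobenius {2} a (Planar-2 (p∤⇒⟦⟧≉0 (∣.>⇒∤ (ℕₚ.≤-trans (s≤s (s≤s (s≤s z≤n))) 5<p))))) (ℕₚ.n≢0⇒n>0 d≢0) (mod-sym d≡)
      where
      n = 2 ^ k
      0<n : 0 < n
      0<n = ℕₚ.m^n>0 2 k
      b = proj₁ (untwist n a 0<n)
      2<q-1 : 2 < p ^ n ∸ 1
      2<q-1 = s≤s⁻¹ (ℕₚ.≤-trans (ℕₚ.≤-trans (s≤s (s≤s (s≤s (s≤s z≤n)))) (ℕₚ.≤-trans 5<p (∣.∣⇒≤ {{>-nonZero (0<p^ n)}} (p∣p^ 0<n)))) (ℕₚ.≤-reflexive (≡.sym (ℕₚ.m+[n∸m]≡n (0<p^ n)))))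
      -- `Planar-periodic` asks for a positive exponent. If d were 0, multiplying 2 p^a ≡ 0 by the
      -- inverse of p^a would give 2 ≡ 0 modulo q - 1 > 2.
      d≢0 : d ≢ 0
      d≢0 ≡.refl = ∣.>⇒∤ 2<q-1 (mod⇒∣ (mod-trans (mod-sym (mod-*ˡ 2 (proj₂ (untwist n a 0<n))))
        (mod-trans (mod-reflexive (≡.sym (ℕₚ.*-assoc 2 (p ^ a) (p ^ b)))) (mod-*ʳ (p ^ b) (mod-sym d≡)))))

open import Data.Nat using (ℕ; _<_; _^_; _*_; _∸_)
open import Data.Nat.Properties using (≤-refl)
open import Data.Nat.Primality using (Prime)
open import Data.Integer using (+_; _-_)
open import Data.Integer.Divisibility using (_∣_)
open import Data.Product using (∃; _,_)
open import Function.Bundles using (_⇔_; mk⇔)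
open import Relation.Binary.PropositionalEquality using (refl)
open PlanarPowerSums using (module CharP)
open Classify

theorem2 : ∀ {c ℓ : Level} (k p : ℕ) → Prime p → 5 < p →
    (F : FiniteField c ℓ (p ^ (2 ^ k))) → (d : ℕ) →
    IsPlanar F (monomial F d) ⇔
    (∃ λ (i : ℕ) → (+ (p ^ (2 ^ k) ∸ 1)) ∣ ((+ d) - (+ (2 * p ^ i))))
theorem2 k p pr 5<p F d = mk⇔
  (λ planar → let a , d≡ = planar⇒≡2pᵃ {d} (IsPlanar⇒Planar d planar) k ≤-refl in a , mod⇒ℤ∣ d≡)
  (λ (a , divisible) → Planar⇒IsPlanar d (≡2pᵃ⇒planar {d} a (ℤ∣⇒mod divisible)))
  where
  open Classification k p pr 5<p F
  open CharP F pr (2 ^ k) refl using (IsPlanar⇒Planar; Planar⇒IsPlanar)
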